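{- Let $\vartheta_{\mathcal{L}}^{(2)}$ be the degree 2 theta series of the Leech lattice. Then $\vartheta_{\mathcal{L}}^{(2)}\equiv 1\pmod{13}$, i.e. $a(\vartheta_{\mathcal{L}}^{(2)};0_2)=1$ and $a(\vartheta_{\mathcal{L}}^{(2)};T)\equiv 0\pmod{13}$ for every positive semidefinite $T\in Sym_2^*(\mathbb{Z})$ with $T\neq 0_2$.
   Context: The Leech lattice $\mathcal{L}$ is the (unique up to isometry) even unimodular positive definite lattice of rank 24 containing no vectors of norm 2; identify it with a Gram matrix $L\in M_{24}(\mathbb{Z})$. Its degree 2 theta series is $\vartheta_{\mathcal{L}}^{(2)}(Z)=\sum_{X\in M_{24,2}(\mathbb{Z})}\exp(\pi i\,\operatorname{tr}({}^tXLX\,Z))$ for $Z$ in the Siegel upper half space $\mathbb{H}_2$, with Fourier expansion $\sum_{0\le T\in Sym_2^*(\mathbb{Z})}a(\vartheta_{\mathcal{L}}^{(2)};T)\exp(2\pi i\,\operatorname{tr}(TZ))$, where $Sym_2^*(\mathbb{Z})=\{T=(t_{lj})\in Sym_2(\mathbb{Q}) : t_{ll}\in\mathbb{Z},\ 2t_{lj}\in\mathbb{Z}\}$. -}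

module Defs where

open import Data.Nat using (ℕ; zero; suc)
open import Data.Integer using (ℤ; +_; _+_; _*_; -_; _-_; _≤_; _<_)
open import Data.Integer.Divisibility using (_∣_)
open import Data.Fin using (Fin; zero; suc; toℕ; punchIn)
open import Data.Vec using (Vec; lookup)
open import Data.List using (List; length)
open import Data.List.Membership.Propositional using (_∈_)
open import Data.List.Relation.Unary.Unique.Propositional using (Unique)
open import Data.Product using (_×_; Σ; _,_)
open import Relation.Binary.PropositionalEquality using (_≡_; _≢_)
open import Relation.Nullary using (¬_)

sumFin : ∀ n → (Fin n → ℤ) → ℤ
sumFin zero    f = + 0
sumFin (suc n) f = f zero + sumFin n (λ i → f (suc i))

Mat : ℕ → Set
Mat n = Fin n → Fin n → ℤ

sgn : ℕ → ℤ
sgn zero          = + 1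
sgn (suc zero)    = - (+ 1)
sgn (suc (suc k)) = sgn k

det : ∀ n → Mat n → ℤ
det zero    M = + 1
det (suc n) M =
  sumFin (suc n) (λ j → sgn (toℕ j) * (M zero j * det n (λ i k → M (suc i) (punchIn j k))))

bil : ∀ {n} → Mat n → Vec ℤ n → Vec ℤ n → ℤ
bil {n} L x y = sumFin n (λ i → sumFin n (λ j → lookup x i * (L i j * lookup y j)))

zeroVec : ∀ n → Vec ℤ n
zeroVec n = Data.Vec.replicate n (+ 0)

-- Gram matrix of an even unimodular positive definite lattice of rank 24
-- without vectors of norm 2 (i.e. of the Leech lattice)
IsLeechGram : Mat 24 → Set
IsLeechGram L =
  (∀ i j → L i j ≡ L j i) ×
  (∀ i → (+ 2) ∣ L i i) ×
  (∀ (x : Vec ℤ 24) → x ≢ zeroVec 24 → + 0 < bil L x x) ×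
  -- unimodular (det = 1, as the form is positive definite)
  (det 24 L ≡ + 1) ×
  (∀ (x : Vec ℤ 24) → bil L x x ≢ + 2)

-- A half-integral symmetric matrix T = (t11, t12; t12, t22) ∈ Sym_2^*(ℤ) is
-- encoded by (t11, t22, b) with b = 2 t12 ∈ ℤ.
record Sym2* : Set where
  constructor sym2
  field
    t11 : ℤ
    t22 : ℤ
    b   : ℤ
open Sym2* public

zeroSym : Sym2*
zeroSym = sym2 (+ 0) (+ 0) (+ 0)

-- T ≥ 0 (positive semidefinite): t11 ≥ 0, t22 ≥ 0, det T = t11 t22 - t12² ≥ 0
-- (the last one multiplied by 4).
PSD : Sym2* → Set
PSD T = (+ 0 ≤ t11 T) × (+ 0 ≤ t22 T) × (b T * b T ≤ (+ 4) * (t11 T * t22 T))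

-- X = (x y) ∈ M_{24,2}(ℤ) represents T:  ᵗX L X = 2T  (i.e. ½ ᵗXLX = T)
Represents : Mat 24 → Sym2* → Vec ℤ 24 × Vec ℤ 24 → Set
Represents L T (x , y) =
  (bil L x x ≡ (+ 2) * t11 T) × (bil L y y ≡ (+ 2) * t22 T) × (bil L x y ≡ b T)

-- a(ϑ_L^{(2)}; T) = n : the set of X ∈ M_{24,2}(ℤ) with ½ ᵗXLX = T is finite
-- with exactly n elements (listed without repetition by some list).
FourierCoeff : Mat 24 → Sym2* → ℕ → Set
FourierCoeff L T n =
  Σ (List (Vec ℤ 24 × Vec ℤ 24)) λ xs →
    Unique xs × (∀ X → (X ∈ xs → Represents L T X) × (Represents L T X → X ∈ xs))
    × length xs ≡ n

{-# OPTIONS --safe #-}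
module Submission where

-- Averaging over random walks on a grid that orthogonalises the lattice gives, without
-- any analysis, a linear programming bound: there are so many vectors of norm at most 8
-- that some class modulo 2L contains 48 of norm 8, an orthogonal frame. In frame
-- coordinates L is built from a binary self-dual code of minimum weight 8, which is the
-- Golay code; hence L is the standard Leech lattice and has an automorphism of order 13
-- without nonzero fixed vectors, under which the pairs representing T ≠ 0 fall into orbits of size 13.

import Data.Integer as ℤ
import Data.Integer.Properties as ZP
import Data.Nat.Properties as NP
import Data.Vec.Properties as VP
import Data.Fin.Properties as FP
import Data.Vec as Vec
import Data.List.Relation.Unary.Unique.Propositional.Properties as UP
import Data.List.Membership.DecPropositional as DecMembership
import Data.Bool.Properties as BP
import Data.List.Relation.Unary.All as Allₗ
import Data.Vec.Relation.Unary.All.Properties as AP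
import Data.Vec.Functional as F
import Data.Vec.Functional.Properties as FF
import Data.Integer.Divisibility.Signed as Signedᵈ
open import Relation.Binary.PropositionalEquality hiding (J; resp)
open import Data.Sum using (_⊎_; inj₁; inj₂)
open import Relation.Nullary using (Dec; _×-dec_; contradiction; does; no; yes; ¬?; ¬_)
open import Data.Product using (_,_; _×_; proj₁; proj₂; Σ; ∃; ∃₂)
open import Data.Unit using (tt; ⊤)
open import Relation.Nullary.Decidable using (decidable-stable; map′; toWitness)
open import Relation.Binary.PropositionalEquality using () renaming (trans to tr; cong to cg; cong₂ to cg2; subst to sb; subst₂ to sb2; sym to sy)
open import Data.Product using () renaming (proj₁ to p1; proj₂ to p2)
open import Data.Sum using () renaming (inj₁ to n1; inj₂ to n2)
open import Relation.Nullary using () renaming (contradiction to cx)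
open import Data.Vec using () renaming (lookup to lk)

-- No theta series is evaluated: all that is shown is a lower bound for a weighted count of short
-- vectors. Norms 4 and 6 get weight 23, norm 8 gets weight 1. A class modulo 2L with a vector of
-- norm 4 or 6 contains only one pair of short vectors, so it weighs at most 46; a total above 46 *
-- 2^24 therefore forces a class of norm 8 vectors with more than 46 members. In the Leech lattice
-- the mean weight of a class is about 46.99, so the linear programming bound may lose two percent.
-- A walk of time `j` gives a lattice vector of norm 2k nearly exp(-36k/j) times its value at the
-- origin. The certificate is a polynomial in one unit of time X, squares times 1480 - 1000 X, and
-- is positive because a walk is a contraction. Gaussians, 1/e and 1/pi enter only through
-- inequalities between integers, sharpened by a mesh that is chosen after the basis. Membership in
-- the binary code is decided only under a double negation; divisibility by 13 is decidable, so this
-- does no harm.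

module Z where

 -- Sealed integer arithmetic and finite sums.

 open import Defs using (sumFin)
 open import Data.Nat as ℕ using (ℕ; zero; suc)
 open import Data.Integer using (ℤ; +_; -[1+_]; 0ℤ; 1ℤ; _≤_; _<_; +≤+)
 open import Data.Fin using (Fin; zero; suc)
 open import Data.Maybe using (just; nothing)
 open import Algebra.Structures using (IsCommutativeRing)
 open import Level using (0ℓ)
 open import Tactic.RingSolver using () renaming (solve-∀ to sv)
 open import Tactic.RingSolver.Core.AlmostCommutativeRing using (AlmostCommutativeRing; fromCommutativeRing)
 infixl 6 _+_ _-_
 infixl 7 _*_
 infix 8 -_
 opaque
  -- Sealed copies of the integer operations: terms with enormous literals stay symbolic, and
  -- `unfolding` reopens them only for ring identities and finite checks.
  _+_ : ℤ -> ℤ -> ℤ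
  a + b = a ℤ.+ b
  _*_ : ℤ -> ℤ -> ℤ
  a * b = a ℤ.* b
  -_ : ℤ -> ℤ
  - a = ℤ.- a
 _-_ : ℤ -> ℤ -> ℤ
 a - b = a + (- b)
 opaque
  unfolding _+_ _*_ -_
  isRing : IsCommutativeRing _≡_ _+_ _*_ -_ 0ℤ 1ℤ
  isRing = ZP.+-*-isCommutativeRing
 open IsCommutativeRing isRing public
  using (+-assoc; +-comm; *-assoc; *-comm)
 ring : AlmostCommutativeRing 0ℓ 0ℓ
 ring = fromCommutativeRing (record { isCommutativeRing = isRing }) \ { (+ 0) -> just refl; _ -> nothing }
 opaque
  unfolding _+_ _*_ -_
  +d : ∀ a b -> a ℤ.+ b ≡ a + b
  +d a b = refl
  *d : ∀ a b -> a ℤ.* b ≡ a * b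
  *d a b = refl
  nede : ∀ a -> ℤ.- a ≡ - a
  nede a = refl
  +-identityˡ : ∀ a -> 0ℤ + a ≡ a
  +-identityˡ = ZP.+-identityˡ
  +-identityʳ : ∀ a -> a + 0ℤ ≡ a
  +-identityʳ = ZP.+-identityʳ
  *-identityˡ : ∀ a -> 1ℤ * a ≡ a
  *-identityˡ = ZP.*-identityˡ
  *-identityʳ : ∀ a -> a * 1ℤ ≡ a
  *-identityʳ = ZP.*-identityʳ
  *-zeroˡ : ∀ a -> 0ℤ * a ≡ 0ℤ
  *-zeroˡ = ZP.*-zeroˡ
  *-zeroʳ : ∀ a -> a * 0ℤ ≡ 0ℤ
  *-zeroʳ = ZP.*-zeroʳ
  *-distribˡ-+ : ∀ a b c -> a * (b + c) ≡ a * b + a * c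
  *-distribˡ-+ = ZP.*-distribˡ-+
  +-inverse : ∀ a -> a - a ≡ 0ℤ
  +-inverse = ZP.+-inverseʳ
  pos-+ : ∀ m n -> + (m ℕ.+ n) ≡ + m + + n
  pos-+ = ZP.pos-+
  pos-* : ∀ m n -> + (m ℕ.* n) ≡ + m * + n
  pos-* = ZP.pos-*
  *≡0 : ∀ a b -> a * b ≡ 0ℤ -> a ≡ 0ℤ ⊎ b ≡ 0ℤ
  *≡0 a b = ZP.i*j≡0⇒i≡0∨j≡0 a
  *-cancelˡ-≡ : ∀ c {a b} -> c ≢ 0ℤ -> c * a ≡ c * b -> a ≡ b
  *-cancelˡ-≡ c {a} {b} c≢0 = ZP.*-cancelˡ-≡ c a b {{ℤ.≢-nonZero c≢0}}
  +-mono-≤ : ∀ {a b c d} -> a ≤ b -> c ≤ d -> a + c ≤ b + d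
  +-mono-≤ = ZP.+-mono-≤
  +-mono-<-≤ : ∀ {a b c d} -> a < b -> c ≤ d -> a + c < b + d
  +-mono-<-≤ = ZP.+-mono-<-≤
  neg-mono-≤ : ∀ {a b} -> a ≤ b -> - b ≤ - a
  neg-mono-≤ = ZP.neg-mono-≤
  *-monoˡ-≤ : ∀ {a b c} -> 0ℤ ≤ c -> a ≤ b -> c * a ≤ c * b
  *-monoˡ-≤ {c = c} p q = ZP.*-monoˡ-≤-nonNeg c {{ℤ.nonNegative p}} q
  *-monoˡ-< : ∀ {a b c} -> 0ℤ < c -> a < b -> c * a < c * b
  *-monoˡ-< {c = c} p q = ZP.*-monoˡ-<-pos c {{ℤ.positive p}} q
  *-cancelˡ-≤ : ∀ {a b c} -> 0ℤ < c -> c * a ≤ c * b -> a ≤ b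
  *-cancelˡ-≤ {a} {b} {c} p = ZP.*-cancelˡ-≤-pos a b c {{ℤ.positive p}}
  sqno : ∀ a -> 0ℤ ≤ a * a
  sqno (+ n) = sb (0ℤ ≤_) (ZP.pos-* n n) (+≤+ ℕ.z≤n)
  sqno -[1+ n ] = +≤+ ℕ.z≤n
  dino : ∀ {a b} -> a ≤ b -> 0ℤ ≤ b - a
  dino = ZP.i≤j⇒0≤j-i
  dn : ∀ {a b} -> 0ℤ ≤ b - a -> a ≤ b
  dn = ZP.0≤i-j⇒j≤i
  dize : ∀ a b -> a - b ≡ 0ℤ -> a ≡ b
  dize = ZP.i-j≡0⇒i≡j
 *n : ∀ {a b} -> 0ℤ ≤ a -> 0ℤ ≤ b -> 0ℤ ≤ a * b
 *n {a} {b} p q = sb (_≤ a * b) (*-zeroʳ a) (*-monoˡ-≤ p q)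
 *p : ∀ {a b} -> 0ℤ < a -> 0ℤ < b -> 0ℤ < a * b
 *p {a} {b} p q = sb (_< a * b) (*-zeroʳ a) (*-monoˡ-< p q)
 +no : ∀ {a b} -> 0ℤ ≤ a -> 0ℤ ≤ b -> 0ℤ ≤ a + b
 +no {a} {b} p q = sb (_≤ a + b) (+-identityˡ 0ℤ) (+-mono-≤ p q)
 sqpo : ∀ a -> a ≢ 0ℤ -> 0ℤ < a * a
 sqpo a a≢ = ZP.≤∧≢⇒< (sqno a) \ e -> a≢ (zesq (*≡0 a a (sy e)))
  where
  zesq : a ≡ 0ℤ ⊎ a ≡ 0ℤ -> a ≡ 0ℤ
  zesq (n1 p) = p
  zesq (n2 p) = p
 infix 4 _≤-by_
 _≤-by_ : ∀ {a b c} -> 0ℤ ≤ c -> b ≡ a + c -> a ≤ b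
 _≤-by_ {a} {c = c} p refl = sb (_≤ a + c) (+-identityʳ a) (+-mono-≤ (ZP.≤-refl {a}) p)
 opaque
  sum : ∀ n -> (Fin n -> ℤ) -> ℤ
  sum = sumFin
 opaque
  unfolding sum _+_
  sude : ∀ n f -> sumFin n f ≡ sum n f
  sude n f = refl
  se : ∀ f -> sum 0 f ≡ 0ℤ
  se f = refl
  susu : ∀ n f -> sum (suc n) f ≡ f zero + sum n (\ i -> f (suc i))
  susu n f = refl
 opaque
  unfolding _+_ _*_ -_
  interchange : ∀ a b c d -> (a + b) + (c + d) ≡ (a + c) + (b + d)
  interchange = sv ring
  *s : ∀ a b c -> a * (b * c) ≡ b * (a * c)
  *s = sv ring
 ac : ∀ {a b c} -> b ≡ c -> a + b ≡ a + c
 ac {a} = cg (\ z -> a + z)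
 mc : ∀ {a b c} -> b ≡ c -> a * b ≡ a * c
 mc {a} = cg (\ z -> a * z)
 mr : ∀ {a b c} -> a ≡ b -> a * c ≡ b * c
 mr {c = c} = cg (\ z -> z * c)
 private variable n : ℕ
 Sc : ∀ {n} {f g : Fin n -> ℤ} -> (∀ i -> f i ≡ g i) -> sum n f ≡ sum n g
 Sc {zero} e = tr (se _) (sy (se _))
 Sc {suc n} e = tr (susu n _) (tr (cg2 _+_ (e zero) (Sc (\ i -> e (suc i)))) (sy (susu n _)))
 Σz : {f : Fin n -> ℤ} -> (∀ i -> f i ≡ 0ℤ) -> sum n f ≡ 0ℤ
 Σz {zero} e = se _
 Σz {suc n} e = tr (susu n _) (tr (cg2 _+_ (e zero) (Σz (\ i -> e (suc i)))) (+-identityˡ 0ℤ))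
 Σ-+ : ∀ n (f g : Fin n -> ℤ) -> sum n (\ i -> f i + g i) ≡ sum n f + sum n g
 Σ-+ zero f g = tr (se _) (sy (tr (cg2 _+_ (se f) (se g)) (+-identityˡ 0ℤ)))
 Σ-+ (suc n) f g = tr (susu n _) (tr (ac (Σ-+ n (\ i -> f (suc i)) (\ i -> g (suc i))))
  (tr (interchange _ _ _ _) (sy (cg2 _+_ (susu n f) (susu n g)))))
 Σ* : ∀ n c (f : Fin n -> ℤ) -> sum n (\ i -> c * f i) ≡ c * sum n f
 Σ* zero c f = tr (se _) (sy (tr (cg (c *_) (se f)) (*-zeroʳ c)))
 Σ* (suc n) c f = tr (susu n _) (tr (ac (Σ* n c (\ i -> f (suc i))))
  (tr (sy (*-distribˡ-+ c _ _)) (cg (c *_) (sy (susu n f)))))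
 Σ*ʳ : ∀ n c (f : Fin n -> ℤ) -> sum n (\ i -> f i * c) ≡ sum n f * c
 Σ*ʳ n c f = tr (Sc (\ i -> *-comm (f i) c)) (tr (Σ* n c f) (*-comm c _))
 Σs : ∀ m n (f : Fin m -> Fin n -> ℤ) ->
  sum m (\ i -> sum n (f i)) ≡ sum n (\ j -> sum m (\ i -> f i j))
 Σs zero n f = tr (se _) (sy (Σz (\ j -> se _)))
 Σs (suc m) n f = tr (susu m _) (tr (ac (Σs m n (\ i -> f (suc i))))
  (tr (sy (Σ-+ n _ _)) (Sc \ j -> sy (susu m _))))
 Σm : {f g : Fin n -> ℤ} -> (∀ i -> f i ≤ g i) -> sum n f ≤ sum n g
 Σm {zero} {f} {g} e = ZP.≤-reflexive (tr (se f) (sy (se g)))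
 Σm {suc n} {f} {g} e = sb2 _≤_ (sy (susu n f)) (sy (susu n g)) (+-mono-≤ (e zero) (Σm (\ i -> e (suc i))))
 Σn : {f : Fin n -> ℤ} -> (∀ i -> 0ℤ ≤ f i) -> 0ℤ ≤ sum n f
 Σn {n} {f} e = sb (_≤ sum n f) (Σz {f = \ _ -> 0ℤ} (\ _ -> refl)) (Σm e)
 δ : Fin n -> Fin n -> ℤ
 δ zero zero = 1ℤ
 δ zero (suc j) = 0ℤ
 δ (suc i) zero = 0ℤ
 δ (suc i) (suc j) = δ i j
 δr : (i : Fin n) -> δ i i ≡ 1ℤ
 δr zero = refl
 δr (suc i) = δr i
 δ≢ : (i j : Fin n) -> i ≢ j -> δ i j ≡ 0ℤ
 δ≢ zero zero ne = cx refl ne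
 δ≢ zero (suc j) ne = refl
 δ≢ (suc i) zero ne = refl
 δ≢ (suc i) (suc j) ne = δ≢ i j (\ e -> ne (cg suc e))
 δs : (i j : Fin n) -> δ i j ≡ δ j i
 δs zero zero = refl
 δs zero (suc j) = refl
 δs (suc i) zero = refl
 δs (suc i) (suc j) = δs i j
 Σδ : ∀ n (i : Fin n) (f : Fin n -> ℤ) -> sum n (\ j -> δ i j * f j) ≡ f i
 Σδ (suc n) zero f = tr (susu n _) (tr (cg2 _+_ (*-identityˡ _) (Σz (\ i -> *-zeroˡ _))) (+-identityʳ _))
 Σδ (suc n) (suc i) f = tr (susu n _) (tr (cg2 _+_ (*-zeroˡ _) (Σδ n i (\ j -> f (suc j)))) (+-identityˡ _))
 Σδʳ : ∀ n (i : Fin n) (f : Fin n -> ℤ) -> sum n (\ j -> f j * δ j i) ≡ f i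
 Σδʳ n i f = tr (Sc (\ j -> tr (*-comm (f j) _) (cg (_* f j) (δs j i)))) (Σδ n i f)

-- Determinants over the integers: alternation, cofactors, Schur complements.

module Determinants where
 open import Defs using (Mat; sgn)
 import Defs
 open Z
 open import Data.Nat as ℕ using (ℕ; zero; suc)
 open import Data.Integer using (ℤ; +_; 0ℤ; 1ℤ)
 open import Data.Fin using (Fin; zero; suc; toℕ; punchIn)
 import Data.Fin as Fin
 import Data.Fin.Properties as Fin
 open import Data.Bool using (if_then_else_; true; false)
 open import Tactic.RingSolver using () renaming (solve-∀ to sv)
 open ≡-Reasoning
 infixr 8 _^_
 _^_ : ℤ -> ℕ -> ℤ
 a ^ zero = 1ℤ
 a ^ suc n = a * a ^ n
 opaque
  unfolding _+_ _*_ -_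
  sgsu : ∀ n -> sgn (suc n) ≡ - sgn n
  sgsu zero = refl
  sgsu (suc zero) = refl
  sgsu (suc (suc n)) = sgsu n
  lf : ∀ s a b c x y -> s * ((x * a + y * b) * c) ≡ x * (s * (a * c)) + y * (s * (b * c))
  lf = sv ring
  liot : ∀ s a x y p q -> s * (a * (x * p + y * q)) ≡ x * (s * (a * p)) + y * (s * (a * q))
  liot = sv ring
  capa : ∀ s a b d -> 1ℤ * s * (a * b) * d + (- s) * 1ℤ * (b * a) * d ≡ 0ℤ
  capa = sv ring
  nn* : ∀ a b -> (- a) * (- b) ≡ a * b
  nn* = sv ring
  adsu : ∀ a b -> a ≡ a + b - b
  adsu = sv ring
  reg : ∀ s t a b d -> s * (a * (t * (b * d))) ≡ s * t * (a * b) * d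
  reg = sv ring
  paze : ∀ x y -> x + y ≡ (0ℤ + x) + (y + 0ℤ)
  paze = sv ring
  zc : ∀ a -> 0ℤ * a + 0ℤ * a ≡ 0ℤ
  zc = sv ring
  abpo : ∀ a p d c -> a * (p * d) + c * 0ℤ ≡ (a * p) * d
  abpo = sv ring
  mipr : ∀ x c m -> x - c * m ≡ x + (- c) * m
  mipr = sv ring
  commutator : ∀ a b -> a * b - b * a ≡ 0ℤ
  commutator = sv ring
 opaque
  det : ∀ n -> Mat n -> ℤ
  mite : ∀ n -> Mat (suc n) -> Fin (suc n) -> ℤ
  det zero M = 1ℤ
  det (suc n) M = sum (suc n) (mite n M)
  mite n M j = sgn (toℕ j) * (M zero j * det n (\ i k -> M (suc i) (punchIn j k)))
 opaque
  unfolding det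
  deze : ∀ (M : Mat 0) -> det 0 M ≡ 1ℤ
  deze M = refl
  desu : ∀ n (M : Mat (suc n)) -> det (suc n) M ≡
   sum (suc n) (\ j -> sgn (toℕ j) * (M zero j * det n (\ i k -> M (suc i) (punchIn j k))))
  desu n M = refl
 dede : ∀ n (M : Mat n) -> Defs.det n M ≡ det n M
 dede zero M = sy (deze M)
 dede (suc n) M = tr (sude (suc n) _) (tr
  (Sc \ j -> tr (*d _ _) (mc (tr (*d _ _) (mc (dede n _)))))
  (sy (desu n M)))
 dc : ∀ n {M N : Mat n} -> (∀ i j -> M i j ≡ N i j) -> det n M ≡ det n N
 dc zero e = tr (deze _) (sy (deze _))
 dc (suc n) e = tr (desu n _) (tr (Sc \ j -> mc
  (cg2 _*_ (e zero j) (dc n (\ i k -> e (suc i) (punchIn j k))))) (sy (desu n _)))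
 dl : ∀ n (r : Fin n) (M A B : Mat n) (α β : ℤ) ->
  (∀ j -> M r j ≡ α * A r j + β * B r j) ->
  (∀ i -> i ≢ r -> ∀ j -> M i j ≡ A i j) -> (∀ i -> i ≢ r -> ∀ j -> M i j ≡ B i j) ->
  det n M ≡ α * det n A + β * det n B
 dl (suc n) r M A B α β er eA eB = tr (desu n M) (tr (Sc (term r er eA eB))
   (tr (Σ-+ (suc n) _ _) (cg2 _+_ (tr (Σ* (suc n) α _) (mc (sy (desu n A))))
          (tr (Σ* (suc n) β _) (mc (sy (desu n B)))))))
  where
  mino : Mat (suc n) -> Fin (suc n) -> Mat n
  mino X j i k = X (suc i) (punchIn j k)
  term : ∀ r -> (∀ j -> M r j ≡ α * A r j + β * B r j) ->
   (∀ i -> i ≢ r -> ∀ j -> M i j ≡ A i j) -> (∀ i -> i ≢ r -> ∀ j -> M i j ≡ B i j) -> ∀ j ->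
   sgn (toℕ j) * (M zero j * det n (mino M j)) ≡
   α * (sgn (toℕ j) * (A zero j * det n (mino A j))) + β * (sgn (toℕ j) * (B zero j * det n (mino B j)))
  term zero er eA eB j
   rewrite er j
      | dc n {mino A j} {mino M j} (\ i k -> sy (eA (suc i) (\ ()) (punchIn j k)))
      | dc n {mino B j} {mino M j} (\ i k -> sy (eB (suc i) (\ ()) (punchIn j k)))
   = lf (sgn (toℕ j)) (A zero j) (B zero j) (det n (mino M j)) α β
  term (suc r) er eA eB j
   rewrite sy (eA zero (\ ()) j) | sy (eB zero (\ ()) j)
      | dl n r (mino M j) (mino A j) (mino B j) α β (\ k -> er (punchIn j k))
        (\ i ne k -> eA (suc i) (\ e -> ne (Fin.suc-injective e)) (punchIn j k))
        (\ i ne k -> eB (suc i) (\ e -> ne (Fin.suc-injective e)) (punchIn j k))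
   = liot (sgn (toℕ j)) (M zero j) α β (det n (mino A j)) (det n (mino B j))
 -- This double sum arises from expanding along two equal rows. Exchanging the two deleted columns
 -- flips the sign and keeps the remaining minor: the terms that involve column zero cancel in
 -- pairs, and what is left is the same sum with one column fewer.
 trc : ∀ m (x : Fin (suc (suc m)) -> ℤ) (D : (Fin m -> Fin (suc (suc m))) -> ℤ) ->
  (∀ {f g} -> (∀ i -> f i ≡ g i) -> D f ≡ D g) ->
  sum (suc (suc m)) (\ j -> sum (suc m) (\ k ->
   sgn (toℕ j) * sgn (toℕ k) * (x j * x (punchIn j k)) * D (\ i -> punchIn j (punchIn k i)))) ≡ 0ℤ
 trc m x D D-cong = begin
  sum (suc (suc m)) (\ j -> sum (suc m) (t j)) ≡⟨ susu (suc m) _ ⟩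
  sum (suc m) (t zero) + sum (suc m) (\ j -> sum (suc m) (t (suc j)))
   ≡⟨ ac (tr (Sc (\ j -> susu m _)) (Σ-+ (suc m) (\ j -> t (suc j) zero) _)) ⟩
  sum (suc m) (t zero) + (sum (suc m) (\ j -> t (suc j) zero) + rest)
   ≡⟨ +-assoc _ _ rest ⟨
  sum (suc m) (t zero) + sum (suc m) (\ j -> t (suc j) zero) + rest
   ≡⟨ cg (\ z -> z + rest) (tr (sy (Σ-+ (suc m) _ _)) (Σz cancel)) ⟩
  0ℤ + rest ≡⟨ tr (+-identityˡ rest) (rest≡0 m x D D-cong) ⟩
  0ℤ ∎
  where
  t : Fin (suc (suc m)) -> Fin (suc m) -> ℤ
  t j k = sgn (toℕ j) * sgn (toℕ k) * (x j * x (punchIn j k)) * D (\ i -> punchIn j (punchIn k i))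
  rest : ℤ
  rest = sum (suc m) (\ j -> sum m (\ k -> t (suc j) (suc k)))
  cancel : ∀ j -> t zero j + t (suc j) zero ≡ 0ℤ
  cancel j rewrite sgsu (toℕ j) = capa (sgn (toℕ j)) (x zero) (x (suc j)) (D (\ i -> suc (punchIn j i)))
  rest≡0 : ∀ m (x : Fin (suc (suc m)) -> ℤ) (D : (Fin m -> Fin (suc (suc m))) -> ℤ) ->
   (∀ {f g} -> (∀ i -> f i ≡ g i) -> D f ≡ D g) ->
   sum (suc m) (\ j -> sum m (\ k ->
    sgn (suc (toℕ j)) * sgn (suc (toℕ k)) * (x (suc j) * x (suc (punchIn j k)))
     * D (\ i -> punchIn (suc j) (punchIn (suc k) i)))) ≡ 0ℤ
  rest≡0 zero x D D-cong = Σz (\ j -> se _)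
  rest≡0 (suc m) x D D-cong = tr
   (Sc \ j -> Sc \ k -> cg2 _*_
    (cg (_* (x (suc j) * x (suc (punchIn j k)))) (signs j k))
    (D-cong {g = lift (\ i -> punchIn j (punchIn k i))} \ { zero -> refl ; (suc i) -> refl }))
   (trc m (\ i -> x (suc i)) (\ f -> D (lift f)) \ e -> D-cong \ { zero -> refl ; (suc i) -> cg suc (e i) })
   where
   lift : (Fin m -> Fin (suc (suc m))) -> Fin (suc m) -> Fin (suc (suc (suc m)))
   lift f zero = zero
   lift f (suc i) = suc (f i)
   signs : (j : Fin (suc (suc m))) (k : Fin (suc m)) -> sgn (suc (toℕ j)) * sgn (suc (toℕ k)) ≡ sgn (toℕ j) * sgn (toℕ k)
   signs j k rewrite sgsu (toℕ j) | sgsu (toℕ k) = nn* (sgn (toℕ j)) (sgn (toℕ k))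
 update : ∀ {n} -> Mat n -> Fin n -> (Fin n -> ℤ) -> Mat n
 update M r u i = if does (i Fin.≟ r) then u else M i
 upsa : ∀ {n} (M : Mat n) r u j -> update M r u r j ≡ u j
 upsa M r u j with r Fin.≟ r
 ... | yes _ = refl
 ... | no ne = cx refl ne
 uo : ∀ {n} (M : Mat n) r u i -> i ≢ r -> ∀ j -> update M r u i j ≡ M i j
 uo M r u i ne j with i Fin.≟ r
 ... | yes e = cx e ne
 ... | no _ = refl
 Al : ℕ -> Set
 Al n = ∀ (M : Mat n) r s -> r ≢ s -> (∀ j -> M r j ≡ M s j) -> det n M ≡ 0ℤ
 alfi : ∀ {m} (M : Mat (suc (suc m))) -> (∀ j -> M zero j ≡ M (suc zero) j) -> det (suc (suc m)) M ≡ 0ℤ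
 alfi {m} M e =
  tr (desu (suc m) M) (tr
   (Sc \ j -> tr (mc (tr (mc (desu m _)) (sy (Σ* (suc m) (M zero j) _))))
      (tr (sy (Σ* (suc m) (sgn (toℕ j)) _)) (Sc \ k -> tr
       (reg (sgn (toℕ j)) (sgn (toℕ k)) (M zero j) (M (suc zero) (punchIn j k)) _)
       (cg (\ z -> sgn (toℕ j) * sgn (toℕ k) * (M zero j * z) * det m (\ i l -> M (suc (suc i)) (punchIn j (punchIn k l)))) (sy (e (punchIn j k)))))))
   (trc m (M zero) (\ f -> det m (\ i k -> M (suc (suc i)) (f k)))
    (\ e -> dc m (\ i k -> cg (M (suc (suc i))) (e k)))))
 allo : ∀ {n} -> Al n -> ∀ (M : Mat (suc n)) r s -> r ≢ s -> (∀ j -> M (suc r) j ≡ M (suc s) j) -> det (suc n) M ≡ 0ℤ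
 allo {n} IH M r s ne e = tr (desu n M) (Σz \ j -> tr (cg (\ z -> sgn (toℕ j) * (M zero j * z))
  (IH (\ i k -> M (suc i) (punchIn j k)) r s ne (\ k -> e (punchIn j k))))
  (tr (mc (*-zeroʳ (M zero j))) (*-zeroʳ (sgn (toℕ j)))))
 -- Polarisation. Let `f a b` be the determinant with `a` and `b` written into rows one and `q`. By
 -- induction `f` vanishes on the diagonal, hence is antisymmetric; `f u w` is the determinant of
 -- `M`, while `f w u` has its first two rows equal.
 az : ∀ {m} -> Al (suc m) -> ∀ (M : Mat (suc (suc m))) s -> (∀ j -> M zero j ≡ M (suc s) j) -> det (suc (suc m)) M ≡ 0ℤ
 az {m} IH M zero e = alfi M e
 az {m} IH M (suc s) e = begin
  det N M ≡⟨ adsu (det N M) (f w u) ⟩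
  det N M + f w u - f w u ≡⟨ tr (cg2 _-_ sum≡0 fw) (+-inverse 0ℤ) ⟩
  0ℤ ∎
  where
  N = suc (suc m)
  one : Fin N
  one = suc zero
  q : Fin N
  q = suc (suc s)
  w u : Fin N -> ℤ
  w = M zero
  u = M one
  f : (Fin N -> ℤ) -> (Fin N -> ℤ) -> ℤ
  f a b = det N (update (update M one a) q b)
  q≢1 : q ≢ one
  q≢1 ()
  at-q : ∀ a b j -> update (update M one a) q b q j ≡ b j
  at-q a b = upsa (update M one a) q b
  at-1 : ∀ a b j -> update (update M one a) q b one j ≡ a j
  at-1 a b j = tr (uo (update M one a) q b one (\ ()) j) (upsa M one a j)
  at-0 : ∀ a b j -> update (update M one a) q b zero j ≡ w j
  at-0 a b j = refl
  debo : ∀ a -> f a a ≡ 0ℤ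
  debo a = allo IH (update (update M one a) q a) zero (suc s) (\ ()) (\ j -> tr (at-1 a a j) (sy (at-q a a j)))
  fli : ∀ a b c -> f (\ j -> a j + b j) c ≡ f a c + f b c
  fli a b c = tr (dl N one _ (update (update M one a) q c) (update (update M one b) q c) 1ℤ 1ℤ
   (\ j -> tr (at-1 (\ j -> a j + b j) c j) (cg2 _+_ (tr (sy (at-1 a c j)) (sy (*-identityˡ _))) (tr (sy (at-1 b c j)) (sy (*-identityˡ _)))))
   (other a) (other b)) (cg2 _+_ (*-identityˡ _) (*-identityˡ _))
   where
   other : ∀ a′ i -> i ≢ one -> ∀ j -> update (update M one (\ j -> a j + b j)) q c i j ≡ update (update M one a′) q c i j
   other a′ i ne j with i Fin.≟ q
   ... | yes _ = refl
   ... | no _ = tr (uo M one _ i ne j) (sy (uo M one a′ i ne j))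
  fl : ∀ a b c -> f c (\ j -> a j + b j) ≡ f c a + f c b
  fl a b c = tr (dl N q _ (update (update M one c) q a) (update (update M one c) q b) 1ℤ 1ℤ
   (\ j -> tr (at-q c _ j) (cg2 _+_ (tr (sy (at-q c a j)) (sy (*-identityˡ _))) (tr (sy (at-q c b j)) (sy (*-identityˡ _)))))
   (other a) (other b)) (cg2 _+_ (*-identityˡ _) (*-identityˡ _))
   where
   other : ∀ a′ i -> i ≢ q -> ∀ j -> update (update M one c) q (\ j -> a j + b j) i j ≡ update (update M one c) q a′ i j
   other a′ i ne j = tr (uo (update M one c) q _ i ne j) (sy (uo (update M one c) q a′ i ne j))
  fw : f w u ≡ 0ℤ
  fw = alfi (update (update M one w) q u) (\ j -> tr (at-0 w u j) (sy (at-1 w u j)))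
  f-uw : det N M ≡ f u w
  f-uw = dc N same
   where
   same : ∀ i j -> M i j ≡ update (update M one u) q w i j
   same zero j = refl
   same (suc zero) j = refl
   same (suc (suc i)) j with i Fin.≟ s
   ... | yes refl = sy (e j)
   ... | no _ = refl
  sum≡0 : det N M + f w u ≡ 0ℤ
  sum≡0 = begin
   det N M + f w u ≡⟨ cg (_+ f w u) f-uw ⟩
   f u w + f w u ≡⟨ paze _ _ ⟩
   (0ℤ + f u w) + (f w u + 0ℤ) ≡⟨ cg2 (\ x y -> (x + f u w) + (f w u + y)) (sy (debo u)) (sy (debo w)) ⟩
   (f u u + f u w) + (f w u + f w w) ≡⟨ cg2 _+_ (fl u w u) (fl u w w) ⟨
   f u (\ j -> u j + w j) + f w (\ j -> u j + w j) ≡⟨ fli u w (\ j -> u j + w j) ⟨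
   f (\ j -> u j + w j) (\ j -> u j + w j) ≡⟨ debo (\ j -> u j + w j) ⟩
   0ℤ ∎
 detalt : ∀ n -> Al n
 detalt (suc n) M zero zero ne e = cx refl ne
 detalt (suc (suc m)) M zero (suc s) ne e = az (detalt (suc m)) M s e
 detalt (suc (suc m)) M (suc r) zero ne e = az (detalt (suc m)) M r (\ j -> sy (e j))
 detalt (suc n) M (suc r) (suc s) ne e = allo (detalt n) M r s (\ p -> ne (cg suc p)) e
 dus : ∀ n m (M : Mat n) r (a : Fin m -> ℤ) (w : Fin m -> Fin n -> ℤ) ->
  det n (update M r (\ j -> sum m (\ k -> a k * w k j))) ≡ sum m (\ k -> a k * det n (update M r (w k)))
 dus n zero M r a w = tr (dl n r _ M M 0ℤ 0ℤ
   (\ j -> tr (upsa M r _ j) (tr (se _) (sy (zc (M r j)))))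
   (uo M r _) (uo M r _)) (tr (zc (det n M)) (sy (se _)))
 dus n (suc m) M r a w = tr
  (dl n r _ (update M r (w zero)) (update M r rest) (a zero) 1ℤ
   (\ j -> tr (upsa M r _ j) (tr (susu m _) (cg2 _+_
    (mc (sy (upsa M r (w zero) j)))
    (tr (sy (upsa M r rest j)) (sy (*-identityˡ _))))))
   (other (w zero)) (other rest))
  (tr (ac (tr (*-identityˡ _) (dus n m M r (\ k -> a (suc k)) (\ k -> w (suc k)))))
   (sy (susu m _)))
  where
  rest : Fin n -> ℤ
  rest j = sum m (\ k -> a (suc k) * w (suc k) j)
  other : ∀ u i -> i ≢ r -> ∀ j -> update M r (\ j -> sum (suc m) (\ k -> a k * w k j)) i j ≡ update M r u i j
  other u i ne j = tr (uo M r _ i ne j) (sy (uo M r u i ne j))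
 cof : ∀ {n} -> Mat n -> Mat n
 cof {n} M i j = det n (update M i (δ j))
 -- A cofactor is the determinant with one row replaced by a basis vector, so linearity in that row
 -- reassembles row `k` there: a repeated row unless `k` is `i`.
 coin : ∀ n (M : Mat n) k i -> sum n (\ j -> M k j * cof M i j) ≡ δ k i * det n M
 coin n M k i = begin
  sum n (\ j -> M k j * cof M i j) ≡⟨ dus n n M i (M k) δ ⟨
  det n (update M i (\ j -> sum n (\ l -> M k l * δ l j))) ≡⟨ dc n (\ a b -> same a b) ⟩
  det n (update M i (M k)) ≡⟨ value ⟩
  δ k i * det n M ∎
  where
  same : ∀ a b -> update M i (\ j -> sum n (\ l -> M k l * δ l j)) a b ≡ update M i (M k) a b
  same a b with a Fin.≟ i
  ... | yes _ = Σδʳ n b (M k)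
  ... | no _ = refl
  value : det n (update M i (M k)) ≡ δ k i * det n M
  value with k Fin.≟ i
  ... | yes refl = tr (dc n unch) (tr (sy (*-identityˡ _)) (cg (\ z -> z * det n M) (sy (δr k))))
   where
   unch : ∀ a b -> update M k (M k) a b ≡ M a b
   unch a b with a Fin.≟ k
   ... | yes refl = refl
   ... | no _ = refl
  ... | no ne = tr (detalt n _ i k (\ e -> ne (sy e)) (\ j -> tr (upsa M i (M k) j) (sy (uo M i (M k) k ne j))))
         (tr (sy (*-zeroˡ (det n M))) (cg (\ z -> z * det n M) (sy (δ≢ k i ne))))
 -- Cramer's rule with denominator 1. It is the source of self-duality: every integral functional is
 -- an inner product.
 unso : ∀ n (M : Mat n) -> det n M ≡ 1ℤ -> (u : Fin n -> ℤ) ->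
  Σ (Fin n -> ℤ) \ y -> ∀ k -> sum n (\ j -> M k j * y j) ≡ u k
 unso n M e u = (\ j -> sum n (\ i -> u i * cof M i j)) , \ k -> begin
  sum n (\ j -> M k j * sum n (\ i -> u i * cof M i j))
   ≡⟨ Sc (\ j -> tr (sy (Σ* n (M k j) _)) (Sc \ i -> *s (M k j) (u i) (cof M i j))) ⟩
  sum n (\ j -> sum n (\ i -> u i * (M k j * cof M i j))) ≡⟨ Σs n n _ ⟩
  sum n (\ i -> sum n (\ j -> u i * (M k j * cof M i j)))
   ≡⟨ Sc (\ i -> tr (Σ* n (u i) _) (cg (\ z -> u i * z) (tr (coin n M k i) (tr (cg (\ z -> δ k i * z) e) (*-identityʳ _))))) ⟩
  sum n (\ i -> u i * δ k i) ≡⟨ Sc (\ i -> *-comm (u i) (δ k i)) ⟩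
  sum n (\ i -> δ k i * u i) ≡⟨ Σδ n k u ⟩
  u k ∎
 dzc : ∀ n (M : Mat (suc n)) -> (∀ i -> M i zero ≡ 0ℤ) -> det (suc n) M ≡ 0ℤ
 dzc n M e = tr (desu n M) (Σz (term n M e))
  where
  term : ∀ n (M : Mat (suc n)) -> (∀ i -> M i zero ≡ 0ℤ) -> ∀ j ->
   sgn (toℕ j) * (M zero j * det n (\ i k -> M (suc i) (punchIn j k))) ≡ 0ℤ
  term n M e zero = tr (*-identityˡ _) (tr (cg (\ z -> z * det n (\ i k -> M (suc i) (suc k))) (e zero)) (*-zeroˡ (det n (\ i k -> M (suc i) (suc k)))))
  term (suc n) M e (suc j) = tr (cg (\ z -> sgn (toℕ (suc j)) * (M zero (suc j) * z))
   (dzc n (\ i k -> M (suc i) (punchIn (suc j) k)) (\ i -> e (suc i))))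
   (tr (cg (\ z -> sgn (toℕ (suc j)) * z) (*-zeroʳ (M zero (suc j)))) (*-zeroʳ (sgn (toℕ (suc j)))))
 -- Only the first `k` rows below the top one are reduced, so that `ro` can treat one row at a time,
 -- each costing a factor `α`.
 rero : ∀ {n} -> Mat (suc n) -> ℤ -> (Fin n -> ℤ) -> ℕ -> Mat (suc n)
 rero M α c k zero = M zero
 rero M α c k (suc i) j = if toℕ i ℕ.<ᵇ k then α * M (suc i) j - c i * M zero j else M (suc i) j
 ro : ∀ n (M : Mat (suc n)) α (c : Fin n -> ℤ) k -> k ℕ.≤ n ->
  det (suc n) (rero M α c k) ≡ α ^ k * det (suc n) M
 ro n M α c zero _ = tr (dc (suc n) (\ { zero j -> refl ; (suc i) j -> refl })) (sy (*-identityˡ _))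
 ro n M α c (suc k) k<n = begin
  det (suc n) (N (suc k)) ≡⟨ dl (suc n) r (N (suc k)) (N k) (update (N k) r (M zero)) α (- c k′) at-r ofr ofr′ ⟩
  α * det (suc n) (N k) + (- c k′) * det (suc n) (update (N k) r (M zero))
   ≡⟨ cg2 (\ x y -> α * x + (- c k′) * y) (ro n M α c k (NP.<⇒≤ k<n)) repeated ⟩
  α * (α ^ k * det (suc n) M) + (- c k′) * 0ℤ ≡⟨ abpo α (α ^ k) (det (suc n) M) (- c k′) ⟩
  α ^ suc k * det (suc n) M ∎
  where
  N : ℕ -> Mat (suc n)
  N = rero M α c
  k′ : Fin n
  k′ = Fin.fromℕ< k<n
  r : Fin (suc n)
  r = suc k′
  <ᵇsu : ∀ k -> (k ℕ.<ᵇ suc k) ≡ true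
  <ᵇsu zero = refl
  <ᵇsu (suc k) = <ᵇsu k
  <i : ∀ k -> (k ℕ.<ᵇ k) ≡ false
  <i zero = refl
  <i (suc k) = <i k
  <s : ∀ i k -> i ≢ k -> (i ℕ.<ᵇ suc k) ≡ (i ℕ.<ᵇ k)
  <s zero zero ne = cx refl ne
  <s zero (suc k) ne = refl
  <s (suc i) zero ne = <z i
   where
   <z : ∀ i -> (i ℕ.<ᵇ 0) ≡ false
   <z zero = refl
   <z (suc i) = refl
  <s (suc i) (suc k) ne = <s i k (\ e -> ne (cg suc e))
  at-r : ∀ j -> N (suc k) r j ≡ α * N k r j + (- c k′) * update (N k) r (M zero) r j
  at-r j = tr pro (tr (mipr (α * M r j) (c k′) (M zero j))
   (cg2 (\ x y -> α * x + (- c k′) * y) (sy unp) (sy (upsa (N k) r (M zero) j))))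
   where
   pro : N (suc k) r j ≡ α * M r j - c k′ * M zero j
   pro = cg (\ b -> if b then α * M r j - c k′ * M zero j else M r j)
    (tr (cg (\ i -> i ℕ.<ᵇ suc k) (Fin.toℕ-fromℕ< k<n)) (<ᵇsu k))
   unp : N k r j ≡ M r j
   unp = cg (\ b -> if b then α * M r j - c k′ * M zero j else M r j)
    (tr (cg (\ i -> i ℕ.<ᵇ k) (Fin.toℕ-fromℕ< k<n)) (<i k))
  ofr : ∀ i -> i ≢ r -> ∀ j -> N (suc k) i j ≡ N k i j
  ofr zero ne j = refl
  ofr (suc i) ne j = cg (\ b -> if b then α * M (suc i) j - c i * M zero j else M (suc i) j)
   (<s (toℕ i) k (\ e -> ne (cg suc (Fin.toℕ-injective (tr e (sy (Fin.toℕ-fromℕ< k<n)))))))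
  ofr′ : ∀ i -> i ≢ r -> ∀ j -> N (suc k) i j ≡ update (N k) r (M zero) i j
  ofr′ i ne j = tr (ofr i ne j) (sy (uo (N k) r (M zero) i ne j))
  repeated : det (suc n) (update (N k) r (M zero)) ≡ 0ℤ
  repeated = detalt (suc n) _ zero r (\ ()) (\ j -> sy (upsa (N k) r (M zero) j))
 -- Fraction-free elimination: scaling the `n` lower rows costs `α ^ n`, and by symmetry the first
 -- column is cleared below the corner. Nothing is divided, because the pivots later serve as side
 -- lengths of a box in the integer grid.
 desc : ∀ n (M : Mat (suc n)) -> (∀ i j -> M i j ≡ M j i) ->
  M zero zero ^ n * det (suc n) M ≡
  M zero zero * det n (\ i j -> M zero zero * M (suc i) (suc j) - M zero (suc i) * M zero (suc j))
 desc n M symmetric = begin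
  α ^ n * det (suc n) M ≡⟨ ro n M α (\ i -> M zero (suc i)) n NP.≤-refl ⟨
  det (suc n) N ≡⟨ tr (desu n N) (susu n _) ⟩
  1ℤ * (α * det n (\ i k -> N (suc i) (suc k))) + tail
   ≡⟨ cg2 _+_ (tr (*-identityˡ _) (cg (\ z -> α * z) (dc n (\ i k -> pro i (suc k))))) (Σz ta) ⟩
  α * det n _ + 0ℤ ≡⟨ +-identityʳ _ ⟩
  α * det n (\ i j -> α * M (suc i) (suc j) - M zero (suc i) * M zero (suc j)) ∎
  where
  α = M zero zero
  N : Mat (suc n)
  N = rero M α (\ i -> M zero (suc i)) n
  tail = sum n (\ j -> sgn (toℕ (suc j)) * (M zero (suc j) * det n (\ i k -> N (suc i) (punchIn (suc j) k))))
  toℕ< : ∀ {n} (i : Fin n) -> (toℕ i ℕ.<ᵇ n) ≡ true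
  toℕ< zero = refl
  toℕ< (suc i) = toℕ< i
  pro : ∀ i j -> N (suc i) j ≡ α * M (suc i) j - M zero (suc i) * M zero j
  pro i j rewrite toℕ< i = refl
  ta : ∀ j -> sgn (toℕ (suc j)) * (M zero (suc j) * det n (\ i k -> N (suc i) (punchIn (suc j) k))) ≡ 0ℤ
  ta j = tr (cg (\ z -> sgn (toℕ (suc j)) * (M zero (suc j) * z)) (minor≡0 n j (\ i k -> N (suc i) k) column))
   (tr (cg (\ z -> sgn (toℕ (suc j)) * z) (*-zeroʳ (M zero (suc j)))) (*-zeroʳ (sgn (toℕ (suc j)))))
   where
   column : ∀ i -> N (suc i) zero ≡ 0ℤ
   column i = tr (pro i zero) (tr (cg (\ z -> α * z - M zero (suc i) * α) (symmetric (suc i) zero)) (commutator α (M zero (suc i))))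
   minor≡0 : ∀ n (j : Fin n) (X : Fin n -> Fin (suc n) -> ℤ) -> (∀ i -> X i zero ≡ 0ℤ) ->
    det n (\ i k -> X i (punchIn (suc j) k)) ≡ 0ℤ
   minor≡0 (suc n) j X e = dzc n _ e

-- Fraction-free completion of squares for a positive definite form.

module Forms where
 open import Defs using (Mat; bil)
 open Z
 open Determinants
 open import Data.Nat as ℕ using (ℕ; zero; suc)
 open import Data.Integer using (ℤ; +_; 0ℤ; 1ℤ; _≤_; _<_; +<+)
 open import Data.Fin using (Fin; zero; suc)
 open import Data.Vec using (Vec; []; _∷_; lookup; tabulate; replicate)
 open import Tactic.RingSolver using () renaming (solve-∀ to sv)
 open ≡-Reasoning
 private variable n : ℕ
 opaque
  unfolding _+_ _*_ -_
  pusc : ∀ c a m y -> (c * a) * (m * y) ≡ c * (a * (m * y))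
  pusc = sv ring
  difi : ∀ a b m y -> (a + b) * (m * y) ≡ a * (m * y) + b * (m * y)
  difi = sv ring
  trte : ∀ a m b -> a * (m * b) ≡ b * (m * a)
  trte = sv ring
  cosq : ∀ α x β f -> α * (x * (α * x) + x * β + (x * β + f)) ≡ (α * x + β) * (α * x + β) + (α * f - β * β)
  cosq = sv ring
  scte : ∀ α x m y b c -> x * ((α * m - b * c) * y) ≡ α * (x * (m * y)) + (- (b * x)) * (c * y)
  scte = sv ring
  n* : ∀ a b -> (- a) * b ≡ - (a * b)
  n* = sv ring
  el : ∀ α β -> α * (- β) + α * β ≡ 0ℤ
  el = sv ring
 opaque
  form : Mat n -> (Fin n -> ℤ) -> (Fin n -> ℤ) -> ℤ
  form {n} M x y = sum n (\ i -> sum n (\ j -> x i * (M i j * y j)))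
 opaque
  unfolding form
  fu : (M : Mat n) (x y : Fin n -> ℤ) -> form M x y ≡ sum n (\ i -> sum n (\ j -> x i * (M i j * y j)))
  fu M x y = refl
  bide : (M : Mat n) (x y : Vec ℤ n) -> bil M x y ≡ form M (lk x) (lk y)
  bide {n} M x y = tr (sude n _) (Sc \ i -> tr (sude n _) (Sc \ j ->
   tr (*d _ _) (mc (*d _ _))))
  fc : {M N : Mat n} {x x′ y y′ : Fin n -> ℤ} -> (∀ i j -> M i j ≡ N i j) ->
   (∀ i -> x i ≡ x′ i) -> (∀ i -> y i ≡ y′ i) -> form M x y ≡ form N x′ y′
  fc eM ex ey = Sc \ i -> Sc \ j -> cg2 _*_ (ex i) (cg2 _*_ (eM i j) (ey j))
  f+ : (M : Mat n) (x x′ y : Fin n -> ℤ) -> form M (\ i -> x i + x′ i) y ≡ form M x y + form M x′ y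
  f+ {n} M x x′ y = tr (Sc \ i -> tr (Sc \ j -> difi (x i) (x′ i) (M i j) (y j)) (Σ-+ n _ _)) (Σ-+ n _ _)
  f* : (M : Mat n) (c : ℤ) (x y : Fin n -> ℤ) -> form M (\ i -> c * x i) y ≡ c * form M x y
  f* {n} M c x y = tr (Sc \ i -> tr (Sc \ j -> pusc c (x i) (M i j) (y j)) (Σ* n c _)) (Σ* n c _)
  fosy : (M : Mat n) -> (∀ i j -> M i j ≡ M j i) -> ∀ x y -> form M x y ≡ form M y x
  fosy {n} M symmetric x y = tr (Σs n n _) (Sc \ j -> Sc \ i ->
   tr (cg (\ m -> x i * (m * y j)) (symmetric i j)) (trte (x i) (M j i) (y j)))
  foap : (M : Mat n) (x y : Fin n -> ℤ) -> form M x y ≡ sum n (\ i -> x i * sum n (\ j -> M i j * y j))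
  foap {n} M x y = Sc \ i -> Σ* n (x i) _
 fo+ʳ : (M : Mat n) -> (∀ i j -> M i j ≡ M j i) -> (x y y′ : Fin n -> ℤ) -> form M x (\ i -> y i + y′ i) ≡ form M x y + form M x y′
 fo+ʳ M s x y y′ = tr (fosy M s x _) (tr (f+ M y y′ x) (cg2 _+_ (fosy M s y x) (fosy M s y′ x)))
 fo*ʳ : (M : Mat n) -> (∀ i j -> M i j ≡ M j i) -> (c : ℤ) (x y : Fin n -> ℤ) -> form M x (\ i -> c * y i) ≡ c * form M x y
 fo*ʳ M s c x y = tr (fosy M s x _) (tr (f* M c y x) (mc (fosy M s y x)))
 dot : (Fin n -> ℤ) -> (Fin n -> ℤ) -> ℤ
 dot {n} b x = sum n (\ i -> b i * x i)
 sch : Mat (suc n) -> Mat n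
 sch M i j = M zero zero * M (suc i) (suc j) - M zero (suc i) * M zero (suc j)
 lead : Mat (suc n) -> (Fin (suc n) -> ℤ) -> ℤ
 lead M x = M zero zero * x zero + dot (\ i -> M zero (suc i)) (\ i -> x (suc i))
 fosc : (M : Mat (suc n)) -> (∀ i j -> M i j ≡ M j i) -> ∀ x ->
  M zero zero * form M x x ≡ lead M x * lead M x + form (sch M) (\ i -> x (suc i)) (\ i -> x (suc i))
 fosc {n} M symmetric x = begin
  α * form M x x ≡⟨ mc expand ⟩
  α * (x zero * (α * x zero) + x zero * β + (x zero * β + f)) ≡⟨ cosq α (x zero) β f ⟩
  lead M x * lead M x + (α * f - β * β) ≡⟨ ac (sy tafo) ⟩
  lead M x * lead M x + form (sch M) x′ x′ ∎
  module Expansion where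
  α = M zero zero
  b x′ : Fin n -> ℤ
  b i = M zero (suc i)
  x′ i = x (suc i)
  β = dot b x′
  N : Mat n
  N i j = M (suc i) (suc j)
  f = form N x′ x′
  expand : form M x x ≡ x zero * (α * x zero) + x zero * β + (x zero * β + f)
  expand = tr (fu M x x) (tr (susu n _) (cg2 _+_
   (tr (susu n _) (ac (Σ* n (x zero) _)))
   (tr (Sc \ i -> susu n _) (tr (Σ-+ n _ _) (cg2 _+_
    (tr (Sc \ i -> tr (cg (\ m -> x′ i * (m * x zero)) (symmetric (suc i) zero)) (trte (x′ i) (b i) (x zero))) (Σ* n (x zero) _))
    (sy (fu N x′ x′)))))))
  tafo : form (sch M) x′ x′ ≡ α * f - β * β
  tafo = begin
   form (sch M) x′ x′ ≡⟨ fu (sch M) x′ x′ ⟩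
   sum n (\ i -> sum n (\ j -> x′ i * (sch M i j * x′ j)))
    ≡⟨ (Sc \ i -> tr (Sc \ j -> scte α (x′ i) (N i j) (x′ j) (b i) (b j)) (tr (Σ-+ n _ _)
      (cg2 _+_ (Σ* n α _) (Σ* n _ _)))) ⟩
   sum n (\ i -> α * sum n (\ j -> x′ i * (N i j * x′ j)) + (- (b i * x′ i)) * β)
    ≡⟨ tr (Σ-+ n _ _) (cg2 _+_ (Σ* n α _) (Σne β)) ⟩
   α * sum n (\ i -> sum n (\ j -> x′ i * (N i j * x′ j))) + (- (β * β)) ≡⟨ cg2 _+_ (mc (sy (fu N x′ x′))) refl ⟩
   α * f - β * β ∎
   where
   Σne : ∀ c -> sum n (\ i -> (- (b i * x′ i)) * c) ≡ - (β * c)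
   Σne c = tr (Sc \ i -> flip (b i * x′ i) c) (tr (Σ* n (- c) _) (tr (n* c β) (cg -_ (*-comm c β))))
    where
    flip : ∀ a c -> (- a) * c ≡ (- c) * a
    flip a c = tr (n* a c) (tr (cg -_ (*-comm a c)) (sy (n* c a)))
 -- The record of a Lagrange reduction: the pivot `suc p` and the rest of its row, then the
 -- reduction of the integral Schur complement.
 data Ch : ℕ -> Set where
  done : Ch 0
  step : (p : ℕ) (b : Fin n -> ℤ) -> Ch n -> Ch (suc n)
 piv : Ch n -> ℕ
 piv done = 1
 piv (step p b c) = suc p ℕ.* piv c
 -- The linear forms whose squares occur in the reduction, stretched by the mesh factor `N`. The
 -- image is a triangular sublattice of the grid whose diagonal entries are `N` times the pivots.
 lattice : ℤ -> Ch n -> Vec ℤ n -> Vec ℤ n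
 lattice N done [] = []
 lattice N (step p b c) (x ∷ xs) = N * (+ suc p * x + dot b (lk xs)) ∷ lattice N c xs
 wei : Ch n -> Vec ℤ n -> ℤ
 wei done [] = 0ℤ
 wei (step p b c) (v ∷ vs) = + piv c * (v * v) + wei c vs
 -- The product of all partial products of the pivots. When the determinant is 1, `depi` makes it
 -- the square of `piv`, and this frees the final volume estimate from the choice of basis.
 pipr : Ch n -> ℕ
 pipr done = 1
 pipr {suc n} (step p b c) = suc p ℕ.^ suc n ℕ.* pipr c
 Pos : Mat n -> Set
 Pos {n} M = ∀ (x : Vec ℤ n) -> x ≢ replicate n 0ℤ -> 0ℤ < form M (lk x) (lk x)
 opaque
  unfolding _+_ _*_ -_
  west : ∀ P N l r -> P * ((N * l) * (N * l)) + (N * N) * (P * r) ≡ (N * N) * (P * (l * l + r))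
  west = sv ring
  reo : ∀ α P f -> P * (α * f) ≡ (α * P) * f
  reo = sv ring
  sqpi : ∀ α q -> α * (α * (q * q)) ≡ (α * q) * (α * q)
  sqpi = sv ring
 p^ : ∀ a n -> + (a ℕ.^ n) ≡ (+ a) ^ n
 p^ a zero = refl
 p^ a (suc n) = tr (pos-* a _) (mc (p^ a n))
 record Completion (M : Mat n) : Set where
  field
   chain : Ch n
   wl : ∀ N x -> wei chain (lattice N chain x) ≡ (N * N) * (+ piv chain * form M (lk x) (lk x))
   depi : + pipr chain * det n M ≡ + piv chain * + piv chain
 com : ∀ n (M : Mat n) -> (∀ i j -> M i j ≡ M j i) -> Pos M -> Completion M
 com zero M symmetric positive = record
  { chain = done
  ; wl = \ { N [] -> sy (tr (mc (tr (mc (tr (fu M _ _) (se _))) (*-zeroʳ _))) (*-zeroʳ _)) }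
  ; depi = mc (deze M) }
 com (suc n) M symmetric positive = build (M zero zero) refl αp
  where
  α = M zero zero
  e₀ : Vec ℤ (suc n)
  e₀ = 1ℤ ∷ replicate n 0ℤ
  e₀fo : form M (lk e₀) (lk e₀) ≡ α
  e₀fo = tr (foap M _ _) (tr (susu n _) (tr (cg2 _+_
   (tr (*-identityˡ _) (tr (susu n _) (tr (cg2 _+_ (*-identityʳ _)
    (Σz \ j -> tr (mc (VP.lookup-replicate j 0ℤ)) (*-zeroʳ _))) (+-identityʳ _))))
   (Σz \ i -> tr (mr (VP.lookup-replicate i 0ℤ)) (*-zeroˡ _))) (+-identityʳ α)))
  αp : 0ℤ < α
  αp = sb (0ℤ <_) e₀fo (positive e₀ \ ())
  scsy : ∀ i j -> sch M i j ≡ sch M j i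
  scsy i j = cg2 _-_ (mc (symmetric (suc i) (suc j))) (*-comm (M zero (suc i)) (M zero (suc j)))
  scpo : Pos (sch M)
  scpo x x≢0 = ZP.≰⇒> \ le -> ZP.<⇒≱ (*p αp (positive y y≢0)) (sb (_≤ 0ℤ) (sy value)
    (sb (α * (α * form (sch M) (lk x) (lk x)) ≤_) (tr (mc (*-zeroʳ α)) (*-zeroʳ α))
     (*-monoˡ-≤ (ZP.<⇒≤ αp) (*-monoˡ-≤ (ZP.<⇒≤ αp) le))))
   where
   b : Fin n -> ℤ
   b i = M zero (suc i)
   -- A lift of `α x` on which the leading linear form vanishes, so that only the Schur complement
   -- contributes to its norm.
   y : Vec ℤ (suc n)
   y = - dot b (lk x) ∷ tabulate (\ i -> α * lk x i)
   yt : ∀ i -> lk y (suc i) ≡ α * lk x i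
   yt i = VP.lookup∘tabulate _ i
   α≢ : α ≢ 0ℤ
   α≢ e = ZP.<-irrefl (sy e) αp
   y≢0 : y ≢ replicate (suc n) 0ℤ
   y≢0 e = x≢0 (loex \ i -> tr (*-cancelˡ-≡ α α≢ (tr (sy (yt i))
     (tr (cg (\ v -> lk v (suc i)) e) (tr (VP.lookup-replicate i 0ℤ) (sy (*-zeroʳ α)))))) (sy (VP.lookup-replicate i 0ℤ)))
    where
    loex : ∀ {n} {u v : Vec ℤ n} -> (∀ i -> lk u i ≡ lk v i) -> u ≡ v
    loex {u = []} {[]} e = refl
    loex {u = a ∷ u} {b ∷ v} e = cg2 _∷_ (e zero) (loex (\ i -> e (suc i)))
   lz : lead M (lk y) ≡ 0ℤ
   lz = tr (ac (tr (Sc \ i -> tr (mc (yt i)) (*s (b i) α (lk x i))) (Σ* n α _))) (el α _)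
   value : α * form M (lk y) (lk y) ≡ α * (α * form (sch M) (lk x) (lk x))
   value = tr (fosc M symmetric (lk y)) (tr (cg2 _+_
    (tr (cg (\ l -> l * lead M (lk y)) lz) (*-zeroˡ _))
    (tr (fc (\ _ _ -> refl) yt yt) (tr (f* (sch M) α _ _) (mc (fo*ʳ (sch M) scsy α _ _)))))
    (+-identityˡ _))
  build : ∀ a -> α ≡ a -> 0ℤ < a -> Completion M
  build (+ zero) e (+<+ ())
  build (+ suc p) e _ = record { chain = c ; wl = weeq ; depi = deeq }
   where
   open Completion (com n (sch M) scsy scpo) renaming (chain to c′; wl to IH; depi to IH-det)
   c : Ch (suc n)
   c = step p (\ i -> M zero (suc i)) c′
   weeq : ∀ N x -> wei c (lattice N c x) ≡ (N * N) * (+ piv c * form M (lk x) (lk x))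
   weeq N (x ∷ xs) = begin
    + piv c′ * ((N * l) * (N * l)) + wei c′ (lattice N c′ xs) ≡⟨ ac (IH N xs) ⟩
    + piv c′ * ((N * l) * (N * l)) + (N * N) * (+ piv c′ * r) ≡⟨ west _ N l r ⟩
    (N * N) * (+ piv c′ * (l * l + r)) ≡⟨ mc (mc (sy square)) ⟩
    (N * N) * (+ piv c′ * (+ suc p * f)) ≡⟨ mc (tr (reo (+ suc p) (+ piv c′) f) (cg (\ z -> z * f) (sy (pos-* (suc p) (piv c′))))) ⟩
    (N * N) * (+ piv c * f) ∎
    where
    f = form M (lk (x ∷ xs)) (lk (x ∷ xs))
    l = + suc p * x + dot (\ i -> M zero (suc i)) (lk xs)
    r = form (sch M) (lk xs) (lk xs)
    square : + suc p * f ≡ l * l + r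
    square = tr (cg (\ z -> z * f) (sy e)) (tr (fosc M symmetric (lk (x ∷ xs)))
     (cg (\ z -> (z * x + dot (\ i -> M zero (suc i)) (lk xs)) * (z * x + dot (\ i -> M zero (suc i)) (lk xs)) + r) e))
   deeq : + pipr c * det (suc n) M ≡ + piv c * + piv c
   deeq = begin
    + (suc p ℕ.* suc p ℕ.^ n ℕ.* pipr c′) * det (suc n) M
     ≡⟨ cg (\ z -> z * det (suc n) M) (tr (pos-* _ _) (mr (tr (pos-* (suc p) _) (mc (p^ (suc p) n))))) ⟩
    (+ suc p * (+ suc p) ^ n) * + pipr c′ * det (suc n) M ≡⟨ regr (+ suc p) ((+ suc p) ^ n) (+ pipr c′) (det (suc n) M) ⟩
    + suc p * (+ pipr c′ * ((+ suc p) ^ n * det (suc n) M))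
     ≡⟨ mc (mc (tr (cg (\ z -> z ^ n * det (suc n) M) (sy e)) (tr (desc n M symmetric) (mr {c = det n (sch M)} e)))) ⟩
    + suc p * (+ pipr c′ * (+ suc p * det n (sch M))) ≡⟨ mc (*s _ (+ suc p) _) ⟩
    + suc p * (+ suc p * (+ pipr c′ * det n (sch M))) ≡⟨ mc (mc IH-det) ⟩
    + suc p * (+ suc p * (+ piv c′ * + piv c′)) ≡⟨ sqpi (+ suc p) (+ piv c′) ⟩
    (+ suc p * + piv c′) * (+ suc p * + piv c′) ≡⟨ cg2 _*_ (pos-* (suc p) _) (pos-* (suc p) _) ⟨
    + piv c * + piv c ∎
    where
    opaque
     unfolding _+_ _*_ -_
     regr : ∀ α p P d -> (α * p) * P * d ≡ α * (P * (p * d))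
     regr = sv ring

-- The quotient of the grid by the orthogonalised lattice.

module Walks where
 open Z
 open Forms using (Ch; done; step; piv; lattice; dot)
 open import Data.Nat as ℕ using (ℕ; zero; suc)
 open import Data.Integer using (ℤ; +_; -[1+_]; 0ℤ; 1ℤ; _≤_)
 open import Data.Fin using (Fin; zero; suc; toℕ)
 open import Data.Vec using (Vec; []; _∷_; lookup; replicate; zipWith; map)
 open import Tactic.RingSolver using () renaming (solve-∀ to sv)
 open ≡-Reasoning
 private variable n : ℕ
 infixl 6 _⊕_
 _⊕_ : Vec ℤ n -> Vec ℤ n -> Vec ℤ n
 _⊕_ = zipWith _+_
 neg : Vec ℤ n -> Vec ℤ n
 neg = map (\ x -> - x)
 𝟎 : Vec ℤ n
 𝟎 = replicate _ 0ℤ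
 ⊕-assoc : (u v w : Vec ℤ n) -> (u ⊕ v) ⊕ w ≡ u ⊕ (v ⊕ w)
 ⊕-assoc = VP.zipWith-assoc +-assoc
 ⊕-comm : (u v : Vec ℤ n) -> u ⊕ v ≡ v ⊕ u
 ⊕-comm = VP.zipWith-comm +-comm
 ⊕-identityˡ : (u : Vec ℤ n) -> 𝟎 ⊕ u ≡ u
 ⊕-identityˡ = VP.zipWith-identityˡ +-identityˡ
 ⊕-identityʳ : (u : Vec ℤ n) -> u ⊕ 𝟎 ≡ u
 ⊕-identityʳ = VP.zipWith-identityʳ +-identityʳ
 ⊕-inverse : (u : Vec ℤ n) -> u ⊕ neg u ≡ 𝟎
 ⊕-inverse [] = refl
 ⊕-inverse (x ∷ u) = cg2 _∷_ (+-inverse x) (⊕-inverse u)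
 opaque
  unfolding _+_ _*_ -_
  neg-involutive : ∀ x -> - (- x) ≡ x
  neg-involutive = sv ring
  ll+ : ∀ N a x y s t -> N * (a * (x + y) + (s + t)) ≡ N * (a * x + s) + N * (a * y + t)
  ll+ = sv ring
  lln : ∀ N a x s -> N * (a * (- x) + (- s)) ≡ - (N * (a * x + s))
  lln = sv ring
  *ne : ∀ a b -> a * (- b) ≡ - (a * b)
  *ne = sv ring
  neg-zero : - 0ℤ ≡ 0ℤ
  neg-zero = refl
  n+ : ∀ a b -> - (a + b) ≡ - a + - b
  n+ = sv ring
  +cn : ∀ a b -> a + b + - b ≡ a
  +cn = sv ring
  +cane : ∀ a b -> a + - b + b ≡ a
  +cane = sv ring
  rosu : ∀ a b c -> a + (b + c) ≡ (b + a) + c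
  rosu = sv ring
  sqex : ∀ G h m -> (G * h - m) * (G * h - m) ≡ G * G * (h * h) + ((- (G * m) - G * m) * h + m * m)
  sqex = sv ring
  sqto : ∀ G s m -> G * G * s + ((- (G * m) - G * m) * m + m * m * G) ≡ G * (G * s - m * m)
  sqto = sv ring
  agi : ∀ a b -> a * a + b * b ≡ (a * b + a * b) + (a - b) * (a - b)
  agi = sv ring
  double : ∀ a -> a + a ≡ (1ℤ + 1ℤ) * a
  double = sv ring
 nene : (u : Vec ℤ n) -> neg (neg u) ≡ u
 nene [] = refl
 nene (x ∷ u) = cg2 _∷_ (neg-involutive x) (nene u)
 d⊕ : (b : Fin n -> ℤ) (u v : Vec ℤ n) -> dot b (lk (u ⊕ v)) ≡ dot b (lk u) + dot b (lk v)
 d⊕ b u v = tr (Sc \ i -> tr (mc (VP.lookup-zipWith _+_ i u v)) (*-distribˡ-+ (b i) _ _)) (Σ-+ _ _ _)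
 dotneg : (b : Fin n -> ℤ) (u : Vec ℤ n) -> dot b (lk (neg u)) ≡ - dot b (lk u)
 dotneg {n} b u = tr (Sc \ i -> tr (mc (VP.lookup-map i (\ x -> - x) u)) (tr (*ne (b i) (lk u i)) (ne1 (b i * lk u i)))) (tr (Σ* n (- 1ℤ) _) (sy (ne1 _)))
  where
  opaque
   unfolding _+_ _*_ -_
   ne1 : ∀ a -> - a ≡ - 1ℤ * a
   ne1 = sv ring
 la⊕ : ∀ N (c : Ch n) u v -> lattice N c (u ⊕ v) ≡ lattice N c u ⊕ lattice N c v
 la⊕ N done [] [] = refl
 la⊕ N (step p b c) (x ∷ u) (y ∷ v) = cg2 _∷_
  (tr (cg (\ z -> N * (+ suc p * (x + y) + z)) (d⊕ b u v)) (ll+ N (+ suc p) x y _ _)) (la⊕ N c u v)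
 lane : ∀ N (c : Ch n) u -> lattice N c (neg u) ≡ neg (lattice N c u)
 lane N done [] = refl
 lane N (step p b c) (x ∷ u) = cg2 _∷_
  (tr (cg (\ z -> N * (+ suc p * (- x) + z)) (dotneg b u)) (lln N (+ suc p) x _)) (lane N c u)
 la𝟎 : ∀ N (c : Ch n) -> lattice N c 𝟎 ≡ 𝟎
 la𝟎 N c = begin
  lattice N c 𝟎 ≡⟨ cg (lattice N c) (⊕-inverse 𝟎) ⟨
  lattice N c (𝟎 ⊕ neg 𝟎) ≡⟨ tr (la⊕ N c 𝟎 (neg 𝟎)) (cg (lattice N c 𝟎 ⊕_) (lane N c 𝟎)) ⟩
  lattice N c 𝟎 ⊕ neg (lattice N c 𝟎) ≡⟨ ⊕-inverse _ ⟩
  𝟎 ∎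
 Functional : ℕ -> Set
 Functional n = (Vec ℤ n -> ℤ) -> ℤ
 -- The common laws of sums over boxes, walks and ranges. Linearity allows two such sums to be
 -- interchanged; `monotone` is the positivity on which every inequality below rests.
 record Additive {A : Set} (Φ : (A -> ℤ) -> ℤ) : Set where
  field
   congruent : ∀ {f g} -> (∀ a -> f a ≡ g a) -> Φ f ≡ Φ g
   additive : ∀ f g -> Φ (\ a -> f a + g a) ≡ Φ f + Φ g
   homogeneous : ∀ k f -> Φ (\ a -> k * f a) ≡ k * Φ f
   monotone : ∀ {f g} -> (∀ a -> f a ≤ g a) -> Φ f ≤ Φ g
  suco : ∀ m (f : Fin m -> A -> ℤ) -> Φ (\ a -> sum m (\ i -> f i a)) ≡ sum m (\ i -> Φ (f i))
  suco zero f = tr (congruent (\ a -> tr (se _) (sy (*-zeroˡ 0ℤ)))) (tr (homogeneous 0ℤ (\ _ -> 0ℤ)) (tr (*-zeroˡ _) (sy (se _))))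
  suco (suc m) f = tr (congruent (\ a -> susu m _)) (tr (additive _ _) (tr (ac (suco m (\ i -> f (suc i)))) (sy (susu m _))))
 -- A fundamental domain: since the lattice is triangular, the side in each direction is the
 -- diagonal entry `N * suc p`.
 box : ℕ -> Ch n -> Functional n
 box N done g = g []
 box N (step p b c) g = box N c (\ ys -> sum (N ℕ.* suc p) (\ k -> g (+ toℕ k ∷ ys)))
 boad : ∀ N (c : Ch n) -> Additive (box N c)
 boad N done = record { congruent = \ e -> e [] ; additive = \ f g -> refl ; homogeneous = \ k f -> refl ; monotone = \ e -> e [] }
 boad N (step p b c) = record
  { congruent = \ e -> congruent (\ ys -> Sc \ k -> e _)
  ; additive = \ f g -> tr (congruent (\ ys -> Σ-+ _ _ _)) (additive _ _)
  ; homogeneous = \ k f -> tr (congruent (\ ys -> Σ* _ k _)) (homogeneous k _)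
  ; monotone = \ e -> monotone (\ ys -> Σm \ k -> e _) }
  where open Additive (boad N c)
 Per : ℕ -> Ch n -> (Vec ℤ n -> ℤ) -> Set
 Per N c g = ∀ x y -> g (y ⊕ lattice (+ N) c x) ≡ g y
 suro : ∀ m (f : ℤ -> ℤ) -> sum m (\ k -> f (+ toℕ k + 1ℤ)) + f 0ℤ ≡ sum m (\ k -> f (+ toℕ k)) + f (+ m)
 suro zero f = cg2 _+_ (tr (se _) (sy (se _))) refl
 suro (suc m) f = begin
  sum (suc m) (\ k -> f (+ toℕ k + 1ℤ)) + f 0ℤ ≡⟨ cg2 _+_ (tr (susu m _) (cg2 _+_ (cg f (+-identityˡ 1ℤ)) (Sc \ k -> cg (\ z -> f (z + 1ℤ)) (posu (toℕ k))))) refl ⟩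
  f 1ℤ + sum m (\ k -> g (+ toℕ k + 1ℤ)) + f 0ℤ ≡⟨ cg2 _+_ (tr (+-comm _ _) (ac (cg f (sy (+-identityˡ 1ℤ))))) refl ⟩
  sum m (\ k -> g (+ toℕ k + 1ℤ)) + g 0ℤ + f 0ℤ ≡⟨ cg2 _+_ (suro m g) refl ⟩
  sum m (\ k -> g (+ toℕ k)) + g (+ m) + f 0ℤ ≡⟨ tr (+-comm _ _) (sy (+-assoc _ _ _)) ⟩
  f 0ℤ + sum m (\ k -> g (+ toℕ k)) + g (+ m) ≡⟨ cg2 _+_ (tr (ac (Sc \ k -> cg f (sy (posu (toℕ k))))) (sy (susu m _))) (cg f (sy (posu m))) ⟩
  sum (suc m) (\ k -> f (+ toℕ k)) + f (+ suc m) ∎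
  where
  g : ℤ -> ℤ
  g z = f (z + 1ℤ)
  posu : ∀ k -> + suc k ≡ + k + 1ℤ
  posu k = tr (cg +_ (NP.+-comm 1 k)) (pos-+ k 1)
 sush : ∀ m (f : ℤ -> ℤ) -> (∀ z -> f (z + + m) ≡ f z) -> ∀ a -> sum m (\ k -> f (+ toℕ k + a)) ≡ sum m (\ k -> f (+ toℕ k))
 sush m f periodic a = go a f periodic
  where
  one : ∀ f -> (∀ z -> f (z + + m) ≡ f z) -> sum m (\ k -> f (+ toℕ k + 1ℤ)) ≡ sum m (\ k -> f (+ toℕ k))
  one f periodic = +-cancelʳ (tr (suro m f) (ac (tr (cg f (sy (+-identityˡ (+ m)))) (periodic 0ℤ))))
   where
   +-cancelʳ : ∀ {x y z} -> x + z ≡ y + z -> x ≡ y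
   +-cancelʳ {x} {y} {z} e = tr (sy (+cn x z)) (tr (cg (\ t -> t + - z) e) (+cn y z))
  sl : ∀ x y z -> x + y + z ≡ x + z + y
  sl x y z = tr (+-assoc x y z) (tr (ac (+-comm y z)) (sy (+-assoc x z y)))
  go : ∀ a f -> (∀ z -> f (z + + m) ≡ f z) -> sum m (\ k -> f (+ toℕ k + a)) ≡ sum m (\ k -> f (+ toℕ k))
  go (+ zero) f periodic = Sc \ k -> cg f (+-identityʳ _)
  go (+ suc a) f periodic = tr (Sc \ k -> cg f (tr (ac (tr (cg +_ (NP.+-comm 1 a)) (pos-+ a 1))) (sy (+-assoc _ _ _))))
   (tr (go (+ a) (\ z -> f (z + 1ℤ)) (\ z -> tr (cg f (sl z (+ m) 1ℤ)) (periodic _))) (one f periodic))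
  go (-[1+ a ]) f periodic = tr (sy (one (\ z -> f (z + -[1+ a ])) (\ z -> tr (cg f (sl z (+ m) _)) (periodic _))))
   (tr (Sc \ k -> cg f (tr (+-assoc _ _ _) (ac (stne a)))) (rest a))
   where
   opaque
    unfolding _+_ -_
    stne : ∀ a -> 1ℤ + -[1+ a ] ≡ - (+ a)
    stne zero = refl
    stne (suc a) = refl
   rest : ∀ a -> sum m (\ k -> f (+ toℕ k + - (+ a))) ≡ sum m (\ k -> f (+ toℕ k))
   rest zero = tr (Sc \ k -> cg (\ z -> f (+ toℕ k + z)) neg-zero) (go (+ 0) f periodic)
   rest (suc a) = tr (Sc \ k -> cg (\ z -> f (+ toℕ k + z)) (neg-suc a)) (go -[1+ a ] f periodic)
    where
    opaque
     unfolding -_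
     neg-suc : ∀ a -> - (+ suc a) ≡ -[1+ a ]
     neg-suc a = refl
 fipe : ∀ N p (b : Fin n -> ℤ) (c : Ch n) -> lattice (+ N) (step p b c) (1ℤ ∷ 𝟎) ≡ + (N ℕ.* suc p) ∷ 𝟎
 fipe N p b c = cg2 _∷_ (tr (mc (tr (cg2 _+_ (*-identityʳ _) (Σz \ i -> tr (mc (VP.lookup-replicate i 0ℤ)) (*-zeroʳ _))) (+-identityʳ _))) (sy (pos-* N (suc p)))) (la𝟎 (+ N) c)
 module _ (N : ℕ) (p : ℕ) (b : Fin n -> ℤ) (c : Ch n) (g : Vec ℤ (suc n) -> ℤ) (periodic : Per N (step p b c) g) where
  pefi : ∀ ys z -> g ((z + + (N ℕ.* suc p)) ∷ ys) ≡ g (z ∷ ys)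
  pefi ys z = tr (cg g (cg2 _∷_ refl (sy (⊕-identityʳ ys)))) (tr (cg (\ l -> g ((z ∷ ys) ⊕ l)) (sy (fipe N p b c))) (periodic (1ℤ ∷ 𝟎) (z ∷ ys)))
  mar : Vec ℤ n -> ℤ
  mar ys = sum (N ℕ.* suc p) (\ k -> g (+ toℕ k ∷ ys))
  mash : ∀ a ys -> sum (N ℕ.* suc p) (\ k -> g ((+ toℕ k + a) ∷ ys)) ≡ mar ys
  mash a ys = sush (N ℕ.* suc p) (\ z -> g (z ∷ ys)) (pefi ys) a
  mape : Per N c mar
  mape x ys = begin
   mar (ys ⊕ lattice (+ N) c x) ≡⟨ mash a _ ⟨
   sum (N ℕ.* suc p) (\ k -> g ((+ toℕ k + a) ∷ (ys ⊕ lattice (+ N) c x))) ≡⟨ Sc (\ k -> periodic (0ℤ ∷ x) (+ toℕ k ∷ ys)) ⟩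
   mar ys ∎
   where
   a = + N * (+ suc p * 0ℤ + dot b (lk x))
 -- The box sum is an invariant sum over the quotient group. One coordinate is shifted at a time:
 -- summing it out over a full period leaves, by `mape`, a function periodic under the remaining
 -- lattice.
 bosh : ∀ N (c : Ch n) g -> Per N c g -> ∀ z -> box N c (\ y -> g (y ⊕ z)) ≡ box N c g
 bosh N done g periodic [] = refl
 bosh N (step p b c) g periodic (z ∷ zs) = tr
  (Additive.congruent (boad N c) (\ ys -> mash N p b c g periodic z (ys ⊕ zs)))
  (bosh N c (mar N p b c g periodic) (mape N p b c g periodic) zs)
 boco : ∀ N (c : Ch n) k -> box N c (\ _ -> k) ≡ k * + (N ℕ.^ n ℕ.* piv c)
 boco N done k = sy (*-identityʳ k)
 boco {suc n} N (step p b c) k = tr (Additive.congruent (boad N c) (\ ys -> sumcon (N ℕ.* suc p)))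
  (tr (boco N c _) (tr (*-assoc k _ _) (mc (tr (sy (pos-* _ _)) (cg +_ ar)))))
  where
  sumcon : ∀ m -> sum m (\ _ -> k) ≡ k * + m
  sumcon zero = tr (se _) (sy (*-zeroʳ k))
  sumcon (suc m) = tr (susu m _) (tr (ac (sumcon m)) (tr (cg2 _+_ (sy (*-identityʳ k)) refl) (tr (sy (*-distribˡ-+ k _ _)) (mc (sy (pos-+ 1 m))))))
  ar : N ℕ.* suc p ℕ.* (N ℕ.^ n ℕ.* piv c) ≡ N ℕ.^ suc n ℕ.* piv (step p b c)
  ar = NP.[m*n]*[o*p]≡[m*o]*[n*p] N (suc p) (N ℕ.^ n) (piv c)

-- Binomial walks, their correlations and quadratic inequalities.

module Positivity where
 open Z
 open Forms using (Ch; done; step; piv; lattice; dot)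
 open Walks
 open import Data.Nat as ℕ using (ℕ; zero; suc)
 open import Data.Integer using (ℤ; +_; -[1+_]; 0ℤ; 1ℤ; _≤_; _<_; +<+)
 open import Data.Integer.Divisibility.Signed using (_∣?_; divides)
 open import Data.Fin using (Fin; zero; suc; toℕ)
 open import Data.Vec using (Vec; []; _∷_; lookup; zipWith)
 open import Algebra.Properties.CommutativeSemigroup NP.+-commutativeSemigroup using () renaming (interchange to +-interchange)
 open import Tactic.RingSolver using () renaming (solve-∀ to sv)
 open ≡-Reasoning
 private variable n : ℕ
 opaque
  unfolding _+_ _*_ -_
  isol : ∀ y N β -> y ≡ (y - N * β) + N * β
  isol = sv ring
  lequ : ∀ q N a β -> q * (N * a) + N * β ≡ N * (a * q + β)
  lequ = sv ring
  lq : ∀ x N a β -> N * (a * x + β) - N * β ≡ x * (N * a)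
  lq = sv ring
 +-cancelʳ-≡ : ∀ a b c -> a + c ≡ b + c -> a ≡ b
 +-cancelʳ-≡ a b c e = tr (sy (+cn a c)) (tr (cg (\ t -> t + - c) e) (+cn b c))
 module _ (N p : ℕ) where
  lm : ∀ (y β : ℤ) -> Dec (∃ \ x -> y ≡ + suc N * (+ suc p * x + β))
  lm y β with + (suc N ℕ.* suc p) ∣? (y - + suc N * β)
  ... | yes (divides q e) = yes (q , tr (isol y (+ suc N) β) (tr (cg (\ t -> t + + suc N * β) (tr e (tr (*d q _) (mc (pos-* (suc N) (suc p)))))) (lequ q (+ suc N) (+ suc p) β)))
  ... | no ¬d = no \ { (x , e) -> ¬d (divides x (tr (cg (\ t -> t - + suc N * β) e)
   (tr (lq x (+ suc N) (+ suc p) β) (tr (mc (sy (pos-* (suc N) (suc p)))) (sy (*d x _))))) ) }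
 li : ∀ N (c : Ch n) x x′ -> lattice (+ suc N) c x ≡ lattice (+ suc N) c x′ -> x ≡ x′
 li N done [] [] e = refl
 li N (step p b c) (x ∷ xs) (x′ ∷ xs′) e with li N c xs xs′ (VP.∷-injectiveʳ e)
 ... | refl = cg (_∷ xs) (*-cancelˡ-≡ (+ suc p) (\ ()) (+-cancelʳ-≡ _ _ _ (*-cancelˡ-≡ (+ suc N) (\ ()) (VP.∷-injectiveˡ e))))
 Me : ℕ -> Ch n -> Vec ℤ n -> Set
 Me N c y = ∃ \ x -> y ≡ lattice (+ suc N) c x
 me : ∀ N (c : Ch n) y -> Dec (Me N c y)
 me N done [] = yes ([] , refl)
 me N (step p b c) (y ∷ ys) with me N c ys
 ... | no ¬m = no \ { (x ∷ xs , e) -> ¬m (xs , VP.∷-injectiveʳ e) }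
 ... | yes (xs , e) with lm N p y (dot b (lk xs))
 ...   | yes (x , e′) = yes (x ∷ xs , cg2 _∷_ e′ e)
 ...   | no ¬m = no \ { (x ∷ xs′ , e′) -> ¬m (x , tr (VP.∷-injectiveˡ e′)
      (cg (\ u -> + suc N * (+ suc p * x + dot b (lk u))) (li N c xs′ xs (tr (sy (VP.∷-injectiveʳ e′)) e)))) }
 opaque
  indi : {A : Set} -> Dec A -> ℤ
  indi (yes _) = 1ℤ
  indi (no _) = 0ℤ
  inye : {A : Set} (d : Dec A) -> A -> indi d ≡ 1ℤ
  inye (yes _) a = refl
  inye (no ¬a) a = cx a ¬a
  inno : {A : Set} (d : Dec A) -> ¬ A -> indi d ≡ 0ℤ
  inno (yes a) ¬a = cx a ¬a
  inno (no _) ¬a = refl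
 i⇔ : {A B : Set} (d : Dec A) (e : Dec B) -> (A -> B) -> (B -> A) -> indi d ≡ indi e
 i⇔ (yes a) e f g = tr (inye (yes a) a) (sy (inye e (f a)))
 i⇔ (no ¬a) e f g = tr (inno (no ¬a) ¬a) (sy (inno e (\ b -> ¬a (g b))))
 D : ∀ N (c : Ch n) -> Vec ℤ n -> ℤ
 D N c y = indi (me N c y)
 m⊕ : ∀ N (c : Ch n) x {y} -> Me N c y -> Me N c (y ⊕ lattice (+ suc N) c x)
 m⊕ N c x (x′ , refl) = x′ ⊕ x , sy (la⊕ (+ suc N) c x′ x)
 Dp : ∀ N (c : Ch n) -> Per (suc N) c (D N c)
 Dp N c x y = i⇔ _ _ back (m⊕ N c x)
  where
  back : Me N c (y ⊕ lattice (+ suc N) c x) -> Me N c y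
  back m = sb (Me N c) (tr (⊕-assoc _ _ _) (tr (cg (y ⊕_) (tr (cg (lattice (+ suc N) c x ⊕_) (lane (+ suc N) c x)) (⊕-inverse _))) (⊕-identityʳ y))) (m⊕ N c (neg x) m)
 Dn : ∀ N (c : Ch n) y -> D N c (neg y) ≡ D N c y
 Dn N c y = i⇔ _ _ (\ m -> sb (Me N c) (nene y) (flip m)) flip
  where
  flip : ∀ {y} -> Me N c y -> Me N c (neg y)
  flip (x , refl) = neg x , sy (lane (+ suc N) c x)
 -- The origin is the only lattice point of the box. If the later coordinates lie in the lattice of
 -- the tail, periodicity moves them to zero; then the first coordinate is a multiple of the side of
 -- the box, hence zero.
 bD : ∀ N (c : Ch n) g -> Per (suc N) c g -> box (suc N) c (\ y -> D N c y * g y) ≡ g 𝟎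
 bD N done g periodic = tr (mr (inye (me N done []) ([] , refl))) (*-identityˡ _)
 bD {suc n} N (step p b c) g periodic = begin
  box (suc N) c (marg h) ≡⟨ Additive.congruent (boad (suc N) c) split ⟩
  box (suc N) c (\ ys -> D N c ys * marg h 𝟎) ≡⟨ tr (bD N c (\ _ -> marg h 𝟎) (\ _ _ -> refl)) refl ⟩
  marg h 𝟎 ≡⟨ atze ⟩
  g 𝟎 ∎
  where
  c′ = step p b c
  h : Vec ℤ (suc n) -> ℤ
  h y = D N c′ y * g y
  hpe : Per (suc N) c′ h
  hpe x y = cg2 _*_ (Dp N c′ x y) (periodic x y)
  marg : (Vec ℤ (suc n) -> ℤ) -> Vec ℤ n -> ℤ
  marg f ys = sum (suc N ℕ.* suc p) (\ k -> f (+ toℕ k ∷ ys))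
  split : ∀ ys -> marg h ys ≡ D N c ys * marg h 𝟎
  split ys = bc (me N c ys)
   where
   bc : Dec (Me N c ys) -> marg h ys ≡ D N c ys * marg h 𝟎
   bc (yes (x , e)) = tr (tr (cg (marg h) (tr e (sy (⊕-identityˡ _)))) (mape (suc N) p b c h hpe x 𝟎))
    (sy (tr (mr (inye (me N c ys) (x , e))) (*-identityˡ _)))
   bc (no ¬m) = tr (Σz \ k -> tr (mr (inno (me N c′ (+ toℕ k ∷ ys)) \ { (x ∷ xs , e) -> ¬m (xs , VP.∷-injectiveʳ e) })) (*-zeroˡ _))
    (sy (tr (mr (inno (me N c ys) ¬m)) (*-zeroˡ _)))
  atze : marg h 𝟎 ≡ g 𝟎
  atze = tr (susu _ _) (tr (cg2 _+_
   (tr (mr (inye (me N c′ 𝟎) (𝟎 , sy (la𝟎 (+ suc N) c′)))) (*-identityˡ _))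
   (Σz \ k -> tr (mr (inno (me N c′ _) (nomul k))) (*-zeroˡ _))) (+-identityʳ _))
   where
   nomul : ∀ (k : Fin (p ℕ.+ N ℕ.* suc p)) -> ¬ Me N c′ (+ suc (toℕ k) ∷ 𝟎)
   nomul k (x ∷ xs , e) = impossible x multiple
    where
    xs≡𝟎 : xs ≡ 𝟎
    xs≡𝟎 = li N c xs 𝟎 (tr (sy (VP.∷-injectiveʳ e)) (sy (la𝟎 (+ suc N) c)))
    multiple : + suc (toℕ k) ≡ x * (+ suc N * + suc p)
    multiple = tr (VP.∷-injectiveˡ e) (tr (mc (tr (cg (\ u -> + suc p * x + dot b (lk u)) xs≡𝟎)
     (tr (ac (Σz \ i -> tr (mc (VP.lookup-replicate i 0ℤ)) (*-zeroʳ _))) (+-identityʳ _)))) (ar (+ suc N) (+ suc p) x))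
     where
     opaque
      unfolding _+_ _*_ -_
      ar : ∀ N p x -> N * (p * x) ≡ x * (N * p)
      ar = sv ring
    bound : suc (toℕ k) ℕ.< suc N ℕ.* suc p
    bound = ℕ.s≤s (toℕ<n k)
     where open import Data.Fin.Properties using (toℕ<n)
    opaque
     unfolding _*_
     impossible : ∀ x -> ¬ (+ suc (toℕ k) ≡ x * (+ suc N * + suc p))
     impossible (+ zero) ()
     impossible (+ suc x) e = NP.<-irrefl (ZP.+-injective e) (NP.<-≤-trans bound (NP.m≤m+n _ _))
     impossible -[1+ x ] ()
 -- Summation against the binomial coefficients of order `n`, kept free of the denominator 2^n.
 half : ℕ -> (ℤ -> ℤ) -> ℤ
 half zero φ = φ 0ℤ
 half (suc n) φ = half n φ + half n (\ k -> φ (k + 1ℤ))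
 ha : ∀ n -> Additive (half n)
 ha zero = record { congruent = \ e -> e 0ℤ ; additive = \ f g -> refl ; homogeneous = \ k f -> refl ; monotone = \ e -> e 0ℤ }
 ha (suc n) = record
  { congruent = \ e -> cg2 _+_ (congruent e) (congruent (\ a -> e _))
  ; additive = \ f g -> tr (cg2 _+_ (additive f g) (additive _ _)) (interchange _ _ _ _)
  ; homogeneous = \ k f -> tr (cg2 _+_ (homogeneous k f) (homogeneous k _)) (sy (*-distribˡ-+ k _ _))
  ; monotone = \ e -> +-mono-≤ (monotone e) (monotone (\ a -> e _)) }
  where open Additive (ha n)
 haco : ∀ m n φ -> half m (\ k -> half n (\ l -> φ (k + l))) ≡ half (m ℕ.+ n) φ
 haco zero n φ = Additive.congruent (ha n) (\ l -> cg φ (+-identityˡ l))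
 haco (suc m) n φ = cg2 _+_ (haco m n φ) (tr
  (Additive.congruent (ha m) (\ k -> Additive.congruent (ha n) (\ l -> cg φ (sl k 1ℤ l))))
  (haco m n (\ k -> φ (k + 1ℤ))))
  where
  sl : ∀ x y z -> x + y + z ≡ x + z + y
  sl x y z = tr (+-assoc x y z) (tr (ac (+-comm y z)) (sy (+-assoc x z y)))
 hr : ∀ n φ -> half n (\ k -> φ (+ n - k)) ≡ half n φ
 hr zero φ = cg φ (tr (+-identityˡ _) neg-zero)
 hr (suc n) φ = tr (+-comm _ _) (cg2 _+_
  (tr (Additive.congruent (ha n) (\ k -> cg φ (step₁ k))) (hr n φ))
  (tr (Additive.congruent (ha n) (\ k -> cg φ (step₂ k))) (hr n (\ k -> φ (k + 1ℤ)))))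
  where
  opaque
   unfolding _+_ _*_ -_
   cancel₁ : ∀ n k -> (n + 1ℤ) - (k + 1ℤ) ≡ n - k
   cancel₁ = sv ring
   canc : ∀ n k -> (n + 1ℤ) - k ≡ n - k + 1ℤ
   canc = sv ring
  posu : + suc n ≡ + n + 1ℤ
  posu = tr (cg +_ (NP.+-comm 1 n)) (pos-+ n 1)
  step₁ : ∀ k -> + suc n - (k + 1ℤ) ≡ + n - k
  step₁ k = tr (cg (\ z -> z - (k + 1ℤ)) posu) (cancel₁ (+ n) k)
  step₂ : ∀ k -> + suc n - k ≡ + n - k + 1ℤ
  step₂ k = tr (cg (\ z -> z - k) posu) (canc (+ n) k)
 -- A walk of `2t` steps recentred at the origin. Its weight at `k` is the binomial coefficient (2t
 -- choose t+k), which falls off roughly like exp(-k^2/t).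
 cent : ℕ -> (ℤ -> ℤ) -> ℤ
 cent t φ = half (t ℕ.+ t) (\ k -> φ (k - + t))
 cead : ∀ t -> Additive (cent t)
 cead t = record { congruent = \ e -> congruent (\ k -> e _) ; additive = \ f g -> additive _ _ ; homogeneous = \ k f -> homogeneous k _ ; monotone = \ e -> monotone (\ k -> e _) }
  where open Additive (ha (t ℕ.+ t))
 -- Vandermonde's convolution: times add. This semigroup law does the work of multiplying Gaussian
 -- transforms.
 ceco : ∀ s t φ -> cent s (\ k -> cent t (\ l -> φ (k + l))) ≡ cent (s ℕ.+ t) φ
 ceco s t φ = tr (Additive.congruent (ha (s ℕ.+ s)) \ k -> Additive.congruent (ha (t ℕ.+ t)) \ l -> cg φ (tr (ar k l (+ s) (+ t)) (cg (\ z -> k + l - z) (sy (pos-+ s t)))))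
  (tr (haco (s ℕ.+ s) (t ℕ.+ t) (\ k -> φ (k - + (s ℕ.+ t)))) (cg (\ m -> half m (\ k -> φ (k - + (s ℕ.+ t)))) (dousum s t)))
  where
  opaque
   unfolding _+_ _*_ -_
   ar : ∀ k l s t -> (k - s) + (l - t) ≡ k + l - (s + t)
   ar = sv ring
  dousum : ∀ s t -> s ℕ.+ s ℕ.+ (t ℕ.+ t) ≡ s ℕ.+ t ℕ.+ (s ℕ.+ t)
  dousum s t = +-interchange s s t t
 cere : ∀ t φ -> cent t (\ k -> φ (- k)) ≡ cent t φ
 cere t φ = tr (Additive.congruent (ha (t ℕ.+ t)) (\ k -> cg φ (tr (ar k (+ t)) (cg (\ z -> z - k - + t) (sy (pos-+ t t)))))) (hr (t ℕ.+ t) (\ k -> φ (k - + t)))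
  where
  opaque
   unfolding _+_ _*_ -_
   ar : ∀ k t -> - (k - t) ≡ t + t - k - t
   ar = sv ring
 walk : Vec ℕ n -> Functional n
 walk [] g = g []
 walk (t ∷ ts) g = cent t (\ k -> walk ts (\ ks -> g (k ∷ ks)))
 wa : (ts : Vec ℕ n) -> Additive (walk ts)
 wa [] = record { congruent = \ e -> e [] ; additive = \ f g -> refl ; homogeneous = \ k f -> refl ; monotone = \ e -> e [] }
 wa (t ∷ ts) = record
  { congruent = \ {f} {g} e -> A.congruent {slice f} {slice g} (\ k -> congruent (\ ks -> e (k ∷ ks)))
  ; additive = \ f g -> tr (A.congruent {slice (\ v -> f v + g v)} {\ k -> slice f k + slice g k} (\ k -> additive (\ ks -> f (k ∷ ks)) (\ ks -> g (k ∷ ks)))) (A.additive (slice f) (slice g))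
  ; homogeneous = \ r f -> tr (A.congruent {slice (\ v -> r * f v)} {\ k -> r * slice f k} (\ k -> homogeneous r (\ ks -> f (k ∷ ks)))) (A.homogeneous r (slice f))
  ; monotone = \ {f} {g} e -> A.monotone {slice f} {slice g} (\ k -> monotone (\ ks -> e (k ∷ ks))) }
  where
  slice : (Vec ℤ _ -> ℤ) -> ℤ -> ℤ
  slice f k = walk ts (\ ks -> f (k ∷ ks))
  open Additive (wa ts)
  module A = Additive (cead t)
 hc : ∀ {A : Set} {Φ : (A -> ℤ) -> ℤ} -> Additive Φ -> ∀ n (f : A -> ℤ -> ℤ) -> Φ (\ a -> half n (f a)) ≡ half n (\ k -> Φ (\ a -> f a k))
 hc add zero f = refl
 hc add (suc n) f = tr (Additive.additive add _ _) (cg2 _+_ (hc add n f) (hc add n (\ a k -> f a (k + 1ℤ))))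
 waco : ∀ {A : Set} {Φ : (A -> ℤ) -> ℤ} -> Additive Φ -> (ts : Vec ℕ n) (f : A -> Vec ℤ n -> ℤ) -> Φ (\ a -> walk ts (f a)) ≡ walk ts (\ z -> Φ (\ a -> f a z))
 waco add [] f = refl
 waco add (t ∷ ts) f = tr (hc add (t ℕ.+ t) _) (Additive.congruent (cead t) (\ k -> waco add ts (\ a ks -> f a (k ∷ ks))))
 walcon : (ss ts : Vec ℕ n) (g : Vec ℤ n -> ℤ) -> walk ss (\ z -> walk ts (\ w -> g (z ⊕ w))) ≡ walk (zipWith ℕ._+_ ss ts) g
 walcon [] [] g = refl
 walcon (s ∷ ss) (t ∷ ts) g = tr
  (Additive.congruent (cead s) (\ k -> tr (hc (wa ss) (t ℕ.+ t) _) (Additive.congruent (cead t) (\ l -> walcon ss ts (\ u -> g (k + l ∷ u))))))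
  (ceco s t (\ k -> walk (zipWith ℕ._+_ ss ts) (\ u -> g (k ∷ u))))
 wr : (ts : Vec ℕ n) (g : Vec ℤ n -> ℤ) -> walk ts (\ z -> g (neg z)) ≡ walk ts g
 wr [] g = refl
 wr (t ∷ ts) g = tr (Additive.congruent (cead t) (\ k -> wr ts (\ u -> g (- k ∷ u)))) (cere t (\ k -> walk ts (\ u -> g (k ∷ u))))
 -- Each coordinate walks for a time proportional to the product of the pivots met so far, which is
 -- inverse to its coefficient in `wei`. The joint kernel therefore depends, up to a small error,
 -- only on the norm of the lattice vector.
 times : ℕ -> Ch n -> Vec ℕ n
 times s done = []
 times s (step p b c) = s ℕ.* suc p ∷ times (s ℕ.* suc p) c
 t+ : ∀ s t (c : Ch n) -> zipWith ℕ._+_ (times s c) (times t c) ≡ times (s ℕ.+ t) c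
 t+ s t done = refl
 t+ s t (step p b c) rewrite NP.*-distribʳ-+ (suc p) s t = cg (_ ∷_) (t+ (s ℕ.* suc p) (t ℕ.* suc p) c)
 module WalkOn (N : ℕ) (c : Ch n) (T : ℕ) where
  I : Functional n
  I = box (suc N) c
  module I = Additive (boad (suc N) c)
  P : ℕ -> Functional n
  P i = walk (times (i ℕ.* T) c)
  module P i = Additive (wa (times (i ℕ.* T) c))
  Δ : Vec ℤ n -> ℤ
  Δ = D N c
  Pc : ∀ i j g -> P i (\ z -> P j (\ w -> g (z ⊕ w))) ≡ P (i ℕ.+ j) g
  Pc i j g = tr (walcon (times (i ℕ.* T) c) _ g) (cg (\ ts -> walk ts g)
   (tr (t+ (i ℕ.* T) (j ℕ.* T) c) (cg (\ s -> times s c) (sy (NP.*-distribʳ-+ T i j)))))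
  return : ℕ -> ℤ
  return i = P i Δ
  mass : ℤ
  mass = P 1 (\ _ -> 1ℤ)
  infixr 8 _^_
  _^_ : ℤ -> ℕ -> ℤ
  a ^ zero = 1ℤ
  a ^ suc k = a * a ^ k
  Pm : ∀ i -> P i (\ _ -> 1ℤ) ≡ mass ^ i
  Pm zero = zw c
   where
   zw : ∀ {m} (c : Ch m) -> walk (times 0 c) (\ _ -> 1ℤ) ≡ 1ℤ
   zw done = refl
   zw (step p b c) = zw c
  Pm (suc i) = tr (sy (Pc 1 i (\ _ -> 1ℤ))) (tr (P.congruent 1 (\ z -> tr (Pm i) (sy (*-identityʳ _)))) (tr (P.homogeneous 1 (mass ^ i) (\ _ -> 1ℤ)) (*-comm _ _)))
  -- The walk kernel periodised over the lattice: the discrete counterpart of a theta function on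
  -- the torus.
  spr : ℕ -> Vec ℤ n -> ℤ
  spr i y = P i (\ z -> Δ (y ⊕ z))
  pesh : ∀ g z -> Per (suc N) c g -> Per (suc N) c (\ y -> g (y ⊕ z))
  pesh g z per x y = tr (cg g (tr (⊕-assoc y _ z) (tr (cg (y ⊕_) (⊕-comm _ z)) (sy (⊕-assoc y z _))))) (per x (y ⊕ z))
  sppe : ∀ i -> Per (suc N) c (spr i)
  sppe i x y = P.congruent i (\ z -> pesh Δ z (Dp N c) x y)
  I-D : ∀ g -> Per (suc N) c g -> I (\ y -> Δ y * g y) ≡ g 𝟎
  I-D = bD N c
  Ispr : ∀ i -> I (spr i) ≡ mass ^ i
  Ispr i = tr (waco (boad (suc N) c) (times (i ℕ.* T) c) (\ y z -> Δ (y ⊕ z)))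
   (tr (P.congruent i (\ z -> tr (bosh (suc N) c Δ (Dp N c) z)
    (tr (I.congruent (\ y -> sy (*-identityʳ _))) (I-D (\ _ -> 1ℤ) (\ _ _ -> refl))))) (Pm i))
  Ic : ∀ z w -> I (\ y -> Δ (y ⊕ z) * Δ (y ⊕ w)) ≡ Δ (neg z ⊕ w)
  Ic z w = begin
   I (\ y -> Δ (y ⊕ z) * Δ (y ⊕ w)) ≡⟨ I.congruent (\ y -> mc (cg Δ (shift y))) ⟩
   I (\ y -> h (y ⊕ z)) ≡⟨ bosh (suc N) c h hpe z ⟩
   I h ≡⟨ I-D _ (pesh Δ (neg z ⊕ w) (Dp N c)) ⟩
   Δ (𝟎 ⊕ (neg z ⊕ w)) ≡⟨ cg Δ (⊕-identityˡ _) ⟩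
   Δ (neg z ⊕ w) ∎
   where
   h : Vec ℤ n -> ℤ
   h y = Δ y * Δ (y ⊕ (neg z ⊕ w))
   hpe : Per (suc N) c h
   hpe x y = cg2 _*_ (Dp N c x y) (pesh Δ (neg z ⊕ w) (Dp N c) x y)
   shift : ∀ y -> y ⊕ w ≡ y ⊕ z ⊕ (neg z ⊕ w)
   shift y = sy (tr (⊕-assoc y z _) (cg (y ⊕_) (tr (sy (⊕-assoc z (neg z) w)) (tr (cg (_⊕ w) (⊕-inverse z)) (⊕-identityˡ w)))))
  -- Correlating two periodised kernels leaves the difference of two independent walks. Walks are
  -- symmetric under reflection, so this is one walk of time `i + j` returning to the lattice.
  Isp : ∀ i j -> I (\ y -> spr i y * spr j y) ≡ return (i ℕ.+ j)
  Isp i j = begin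
   I (\ y -> spr i y * spr j y)
    ≡⟨ I.congruent (\ y -> tr (*-comm _ _) (tr (sy (P.homogeneous i (spr j y) _)) (P.congruent i (\ z -> tr (*-comm _ _) (sy (P.homogeneous j (Δ (y ⊕ z)) _)))))) ⟩
   I (\ y -> P i (\ z -> P j (\ w -> Δ (y ⊕ z) * Δ (y ⊕ w))))
    ≡⟨ waco (boad (suc N) c) (times (i ℕ.* T) c) _ ⟩
   P i (\ z -> I (\ y -> P j (\ w -> Δ (y ⊕ z) * Δ (y ⊕ w))))
    ≡⟨ P.congruent i (\ z -> tr (waco (boad (suc N) c) (times (j ℕ.* T) c) (\ y w -> Δ (y ⊕ z) * Δ (y ⊕ w))) (P.congruent j (\ w -> Ic z w))) ⟩
   P i (\ z -> P j (\ w -> Δ (neg z ⊕ w))) ≡⟨ wr (times (i ℕ.* T) c) (\ z -> P j (\ w -> Δ (z ⊕ w))) ⟩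
   P i (\ z -> P j (\ w -> Δ (z ⊕ w))) ≡⟨ Pc i j Δ ⟩
   return (i ℕ.+ j) ∎
  index : ℤ
  index = + (suc N ℕ.^ n ℕ.* piv c)
  Io : I (\ _ -> 1ℤ) ≡ index
  Io = tr (boco (suc N) c 1ℤ) (*-identityˡ _)
  -- Cauchy-Schwarz against the constant function, from summing the squares of `index * h - I h`. It
  -- isolates the trivial frequency without any Fourier analysis.
  casc : 0ℤ < index -> ∀ h -> I h * I h ≤ index * I (\ y -> h y * h y)
  casc positive h = dn (*-cancelˡ-≤ positive (sb2 _≤_ (sy (*-zeroʳ index)) total
    (sb (_≤ I (\ y -> (index * h y - m) * (index * h y - m))) Iz (I.monotone (\ y -> sqno (index * h y - m))))))
   where
   m = I h
   Iz : I (\ _ -> 0ℤ) ≡ 0ℤ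
   Iz = tr (boco (suc N) c 0ℤ) (*-zeroˡ _)
   total : I (\ y -> (index * h y - m) * (index * h y - m)) ≡ index * (index * I (\ y -> h y * h y) - m * m)
   total = begin
    I (\ y -> (index * h y - m) * (index * h y - m)) ≡⟨ I.congruent (\ y -> sqex index (h y) m) ⟩
    I (\ y -> index * index * (h y * h y) + ((- (index * m) - index * m) * h y + m * m))
     ≡⟨ tr (I.additive _ _) (cg2 _+_ (I.homogeneous _ _) (tr (I.additive _ _) (cg2 _+_ (I.homogeneous _ h)
       (tr (I.congruent (\ _ -> sy (*-identityʳ _))) (tr (I.homogeneous (m * m) (\ _ -> 1ℤ)) (mc Io)))))) ⟩
    index * index * I (\ y -> h y * h y) + ((- (index * m) - index * m) * m + m * m * index) ≡⟨ sqto index _ m ⟩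
    index * (index * I (\ y -> h y * h y) - m * m) ∎
  -- Sum the square of `h y - h (y ⊕ w)` and use that the sum of squares of `h` is shift-invariant.
  shpr : ∀ h -> Per (suc N) c h -> ∀ w -> I (\ y -> h y * h (y ⊕ w)) ≤ I (\ y -> h y * h y)
  shpr h periodic w = *-cancelˡ-≤ twpo (sb2 _≤_ (tr (I.additive _ _) (double _)) (tr (I.additive _ _)
    (tr (ac (bosh (suc N) c (\ y -> h y * h y) (\ x y -> cg2 _*_ (periodic x y) (periodic x y)) w)) (double _)))
    (I.monotone (\ y -> sqno (h y - h (y ⊕ w)) ≤-by agi (h y) (h (y ⊕ w)))))
   where
   opaque
    unfolding _+_
    twpo : 0ℤ < 1ℤ + 1ℤ
    twpo = +<+ (ℕ.s≤s ℕ.z≤n)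
  module Combination (m : ℕ) (a : Fin m -> ℤ) where
   h : Vec ℤ n -> ℤ
   h y = sum m (\ i -> a i * spr (toℕ i) y)
   hsh : ℕ -> Vec ℤ n -> ℤ
   hsh s y = sum m (\ j -> a j * spr (s ℕ.+ toℕ j) y)
   hpe : Per (suc N) c h
   hpe x y = Sc \ i -> mc (sppe (toℕ i) x y)
   I-h : I h ≡ sum m (\ i -> a i * mass ^ toℕ i)
   I-h = tr (Additive.suco (boad (suc N) c) m _) (Sc \ i -> tr (I.homogeneous (a i) _) (mc (Ispr (toℕ i))))
   qu : ℕ -> ℤ
   qu s = sum m (\ i -> sum m (\ j -> a i * a j * return (s ℕ.+ (toℕ i ℕ.+ toℕ j))))
   Ihs : ∀ s -> I (\ y -> h y * hsh s y) ≡ qu s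
   Ihs s = tr (I.congruent (\ y -> tr (sy (Σ*ʳ m _ _)) (Sc \ i -> sy (Σ* m _ _))))
    (tr (Additive.suco (boad (suc N) c) m _) (Sc \ i -> tr (Additive.suco (boad (suc N) c) m _) (Sc \ j ->
     tr (I.congruent (\ y -> ar (a i) _ (a j) _)) (tr (I.homogeneous (a i * a j) _) (mc
      (tr (Isp (toℕ i) (s ℕ.+ toℕ j)) (cg return (reo (toℕ i) s (toℕ j)))))))))
    where
    opaque
     unfolding _+_ _*_ -_
     ar : ∀ a x b y -> (a * x) * (b * y) ≡ a * b * (x * y)
     ar = sv ring
    reo : ∀ i s j -> i ℕ.+ (s ℕ.+ j) ≡ s ℕ.+ (i ℕ.+ j)
    reo i s j = tr (sy (NP.+-assoc i s j)) (tr (cg (ℕ._+ j) (NP.+-comm i s)) (NP.+-assoc s i j))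
   hst : ∀ y -> hsh 1 y ≡ P 1 (\ w -> h (y ⊕ w))
   hst y = sy (tr (Additive.suco (wa (times (1 ℕ.* T) c)) m _) (Sc \ j -> tr (P.homogeneous 1 (a j) _) (mc
    (tr (P.congruent 1 (\ w -> P.congruent (toℕ j) (\ z -> cg Δ (⊕-assoc y w z)))) (Pc 1 (toℕ j) (\ z -> Δ (y ⊕ z)))))))
   qubo : 0ℤ < index -> I h * I h ≤ index * qu 0
   qubo positive = sb (\ q -> I h * I h ≤ index * q) (Ihs 0) (casc positive h)
   -- One more unit of walking averages shifted copies of `h`, so it cannot raise the correlation
   -- with `h`. This plays the role of the fact that the transform of the walk is at most 1.
   qc : qu 1 ≤ mass * qu 0
   qc = sb2 _≤_ left right (P.monotone 1 (\ w -> shpr h hpe w))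
    where
    left : P 1 (\ w -> I (\ y -> h y * h (y ⊕ w))) ≡ qu 1
    left = tr (sy (waco (boad (suc N) c) (times (1 ℕ.* T) c) (\ y w -> h y * h (y ⊕ w))))
     (tr (I.congruent (\ y -> tr (P.homogeneous 1 (h y) _) (mc (sy (hst y))))) (Ihs 1))
    right : P 1 (\ w -> I (\ y -> h y * h y)) ≡ mass * qu 0
    right = tr (P.congruent 1 (\ w -> sy (*-identityʳ _))) (tr (P.homogeneous 1 _ (\ _ -> 1ℤ)) (tr (*-comm _ _) (mc (Ihs 0))))

-- Walks written as sums with binomial kernels.

module Kernel where
 open Z
 open Walks
 open Positivity
 open import Data.Nat as ℕ using (ℕ; zero; suc; z≤n)
 open import Data.Nat.Tactic.RingSolver renaming (solve-∀ to ℕ-solve-∀)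
 open import Data.Integer using (ℤ; +_; 0ℤ; 1ℤ; _≤_; _<_; +≤+; ∣_∣)
 open import Data.Fin using (Fin; zero; suc; toℕ)
 open import Data.Vec using (Vec; []; _∷_)
 open import Data.Vec.Relation.Unary.All using (All; []; _∷_)
 open ≡-Reasoning
 private variable n : ℕ
 cho : ℕ -> ℕ -> ℕ
 cho n zero = 1
 cho zero (suc k) = 0
 cho (suc n) (suc k) = cho n k ℕ.+ cho n (suc k)
 cz : ∀ n d -> cho n (suc n ℕ.+ d) ≡ 0
 cz zero d = refl
 cz (suc n) d = cg2 ℕ._+_ (cz n d) (tr (cg (cho n) (sy (NP.+-suc (suc n) d))) (cz n (suc d)))
 chfu : ∀ n -> cho n n ≡ 1
 chfu zero = refl
 chfu (suc n) = cg2 ℕ._+_ (chfu n) (tr (cg (cho n) (sy (NP.+-identityʳ (suc n)))) (cz n 0))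
 chsy : ∀ a b -> cho (a ℕ.+ b) a ≡ cho (a ℕ.+ b) b
 chsy zero b = sy (chfu b)
 chsy (suc a) zero = tr (cg (\ m -> cho m (suc a)) (NP.+-identityʳ (suc a))) (chfu (suc a))
 chsy (suc a) (suc b) = tr (cg2 ℕ._+_ (chsy a (suc b))
   (tr (cg (\ m -> cho m (suc a)) (NP.+-suc a b)) (tr (chsy (suc a) b) (cg (\ m -> cho m b) (sy (NP.+-suc a b))))))
  (NP.+-comm (cho (a ℕ.+ suc b) (suc b)) _)
 absorption : ∀ n k -> suc k ℕ.* cho (suc n) (suc k) ≡ suc n ℕ.* cho n k
 absorption n zero = tr (NP.*-identityˡ _) (oc n)
  where
  oc : ∀ n -> cho (suc n) 1 ≡ suc n ℕ.* 1
  oc zero = refl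
  oc (suc n) = cg suc (oc n)
 absorption zero (suc k) = NP.*-zeroʳ (suc (suc k))
 absorption (suc n) (suc k) = begin
  suc (suc k) ℕ.* (cho (suc n) (suc k) ℕ.+ cho (suc n) (suc (suc k)))
   ≡⟨ expand (suc k) (cho (suc n) (suc k)) (cho (suc n) (suc (suc k))) ⟩
  cho (suc n) (suc k) ℕ.+ (suc k ℕ.* cho (suc n) (suc k) ℕ.+ suc (suc k) ℕ.* cho (suc n) (suc (suc k)))
   ≡⟨ cg (cho (suc n) (suc k) ℕ.+_) (cg2 ℕ._+_ (absorption n k) (absorption n (suc k))) ⟩
  cho (suc n) (suc k) ℕ.+ (suc n ℕ.* cho n k ℕ.+ suc n ℕ.* cho n (suc k)) ≡⟨ cg (cho (suc n) (suc k) ℕ.+_) (NP.*-distribˡ-+ (suc n) (cho n k) _) ⟨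
  suc (suc n) ℕ.* cho (suc n) (suc k) ∎
  where
  expand : ∀ k a b -> suc k ℕ.* (a ℕ.+ b) ≡ a ℕ.+ (k ℕ.* a ℕ.+ suc k ℕ.* b)
  expand = ℕ-solve-∀
 chra : ∀ k l -> suc k ℕ.* cho (k ℕ.+ l) (suc k) ≡ l ℕ.* cho (k ℕ.+ l) k
 chra k l = NP.+-cancelˡ-≡ (suc k ℕ.* cho (k ℕ.+ l) k) _ _ (tr (sy (NP.*-distribˡ-+ (suc k) (cho (k ℕ.+ l) k) (cho (k ℕ.+ l) (suc k))))
  (tr (absorption (k ℕ.+ l) k) (NP.*-distribʳ-+ (cho (k ℕ.+ l) k) (suc k) l)))
 sumspl : ∀ a b (f : ℕ -> ℤ) -> sum (a ℕ.+ b) (\ i -> f (toℕ i)) ≡ sum a (\ i -> f (toℕ i)) + sum b (\ i -> f (a ℕ.+ toℕ i))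
 sumspl zero b f = tr (sy (+-identityˡ _)) (cg2 _+_ (sy (se _)) refl)
 sumspl (suc a) b f = tr (susu (a ℕ.+ b) _) (tr (ac (sumspl a b (\ i -> f (suc i)))) (tr (sy (+-assoc _ _ _)) (cg2 _+_ (sy (susu a _)) refl)))
 hach : ∀ n φ -> half n φ ≡ sum (suc n) (\ m -> + cho n (toℕ m) * φ (+ toℕ m))
 hach zero φ = sy (tr (susu 0 _) (tr (cg2 _+_ (*-identityˡ _) (se _)) (+-identityʳ _)))
 hach (suc n) φ = begin
  half n φ + half n (\ k -> φ (k + 1ℤ)) ≡⟨ cg2 _+_ (hach n φ) (hach n _) ⟩
  sum (suc n) (\ m -> + cho n (toℕ m) * φ (+ toℕ m)) + sum (suc n) (\ m -> + cho n (toℕ m) * φ (+ toℕ m + 1ℤ))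
   ≡⟨ cg2 _+_ extend (Sc \ m -> mc (cg φ (posu (toℕ m)))) ⟩
  1ℤ * φ 0ℤ + upper + lower ≡⟨ tr (+-assoc _ _ _) (ac (tr (+-comm upper lower) (tr (sy (Σ-+ (suc n) _ _)) (Sc \ m -> pasc (toℕ m))))) ⟩
  1ℤ * φ 0ℤ + sum (suc n) (\ m -> + cho (suc n) (suc (toℕ m)) * φ (+ suc (toℕ m))) ≡⟨ susu (suc n) _ ⟨
  sum (suc (suc n)) (\ m -> + cho (suc n) (toℕ m) * φ (+ toℕ m)) ∎
  where
  upper lower : ℤ
  upper = sum (suc n) (\ m -> + cho n (suc (toℕ m)) * φ (+ suc (toℕ m)))
  lower = sum (suc n) (\ m -> + cho n (toℕ m) * φ (+ suc (toℕ m)))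
  posu : ∀ k -> + k + 1ℤ ≡ + suc k
  posu k = tr (sy (pos-+ k 1)) (cg +_ (NP.+-comm k 1))
  pasc : ∀ m -> + cho n m * φ (+ suc m) + + cho n (suc m) * φ (+ suc m) ≡ + cho (suc n) (suc m) * φ (+ suc m)
  pasc m = tr (cg2 _+_ (*-comm _ _) (*-comm _ _)) (tr (sy (*-distribˡ-+ (φ (+ suc m)) _ _)) (tr (*-comm _ _) (mr (sy (pos-+ _ _)))))
  f : ℕ -> ℤ
  f m = + cho n m * φ (+ m)
  extend : sum (suc n) (\ m -> f (toℕ m)) ≡ 1ℤ * φ 0ℤ + upper
  extend = begin
   sum (suc n) (\ m -> f (toℕ m)) ≡⟨ susu n _ ⟩
   1ℤ * φ 0ℤ + sum n (\ m -> f (suc (toℕ m))) ≡⟨ ac (sy (tr (cg (\ k -> sum k (\ m -> f (suc (toℕ m)))) (NP.+-comm 1 n))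
     (tr (sumspl n 1 (\ m -> f (suc m))) (tr (ac (Σz last)) (+-identityʳ _))))) ⟩
   1ℤ * φ 0ℤ + upper ∎
   where
   last : ∀ (i : Fin 1) -> f (suc (n ℕ.+ toℕ i)) ≡ 0ℤ
   last i = tr (mr (cg +_ (cz n (toℕ i)))) (*-zeroˡ _)
 range : ℕ -> (ℤ -> ℤ) -> ℤ
 range M φ = sum (suc (M ℕ.+ M)) (\ i -> φ (+ toℕ i - + M))
 raad : ∀ M -> Additive (range M)
 raad M = record { congruent = \ e -> Sc (\ i -> e _) ; additive = \ f g -> Σ-+ _ _ _ ; homogeneous = \ k f -> Σ* _ k _ ; monotone = \ e -> Σm (\ i -> e _) }
 ker : ℕ -> ℤ -> ℕ
 ker t k = cho (t ℕ.+ t) (t ℕ.+ ∣ k ∣)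
 -- The margin `d` lets walks of different lengths be summed over one common range, where the
 -- coefficients beyond reach are zero. Symmetry of the binomial coefficients accounts for the
 -- absolute value in `ker`.
 ck : ∀ t d φ -> cent t φ ≡ range (t ℕ.+ d) (\ k -> + ker t k * φ k)
 ck t d φ = begin
  half (t ℕ.+ t) (\ k -> φ (k - + t)) ≡⟨ hach (t ℕ.+ t) _ ⟩
  sum (suc (t ℕ.+ t)) (\ m -> + cho (t ℕ.+ t) (toℕ m) * φ (+ toℕ m - + t)) ≡⟨ Sc (\ m -> sy (middle (toℕ m) (NP.≤-pred (FP.toℕ<n m)))) ⟩
  sum (suc (t ℕ.+ t)) (\ m -> g (d ℕ.+ toℕ m)) ≡⟨ tr (sy (+-identityˡ _)) (cg2 _+_ (sy (Σz low)) (tr (sy (+-identityʳ _)) (ac (sy (Σz (\ i -> high (toℕ i) (FP.toℕ<n i))))))) ⟩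
  sum d (\ i -> g (toℕ i)) + (sum (suc (t ℕ.+ t)) (\ m -> g (d ℕ.+ toℕ m)) + sum d (\ i -> g (d ℕ.+ (suc (t ℕ.+ t) ℕ.+ toℕ i))))
   ≡⟨ sy (tr (sumspl d (suc (t ℕ.+ t) ℕ.+ d) g) (ac (sumspl (suc (t ℕ.+ t)) d (\ i -> g (d ℕ.+ i))))) ⟩
  sum (d ℕ.+ (suc (t ℕ.+ t) ℕ.+ d)) (\ i -> g (toℕ i)) ≡⟨ cg (\ m -> sum m (\ i -> g (toℕ i))) (leeq d t) ⟩
  range (t ℕ.+ d) (\ k -> + ker t k * φ k) ∎
  where
  g : ℕ -> ℤ
  g i = + ker t (+ i - + (t ℕ.+ d)) * φ (+ i - + (t ℕ.+ d))
  leeq : ∀ d t -> d ℕ.+ (suc (t ℕ.+ t) ℕ.+ d) ≡ suc (t ℕ.+ d ℕ.+ (t ℕ.+ d))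
  leeq = ℕ-solve-∀
  opaque
   unfolding _+_ -_
   offs : ∀ i m -> + i - + m ≡ i ℤ.⊖ m
   offs i m = ZP.m-n≡m⊖n i m
  low : ∀ (i : Fin d) -> g (toℕ i) ≡ 0ℤ
  low i = tr (mr (cg +_ (tr (cg (cho (t ℕ.+ t)) index) (cz (t ℕ.+ t) e)))) (*-zeroˡ _)
   where
   k = toℕ i
   k<d = FP.toℕ<n i
   e = d ℕ.∸ suc k
   abs : ∣ + k - + (t ℕ.+ d) ∣ ≡ t ℕ.+ suc e
   abs = tr (cg ∣_∣ (offs k (t ℕ.+ d))) (tr (ZP.∣⊖∣-≤ (NP.≤-trans (NP.<⇒≤ k<d) (NP.m≤n+m d t)))
    (tr (NP.+-∸-assoc t (NP.<⇒≤ k<d)) (cg (t ℕ.+_) (NP.+-∸-assoc 1 k<d))))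
   index : t ℕ.+ ∣ + k - + (t ℕ.+ d) ∣ ≡ suc (t ℕ.+ t) ℕ.+ e
   index = tr (cg (t ℕ.+_) abs) (arr t e)
    where
    arr : ∀ t e -> t ℕ.+ (t ℕ.+ suc e) ≡ suc (t ℕ.+ t) ℕ.+ e
    arr = ℕ-solve-∀
  high : ∀ i -> i ℕ.< d -> g (d ℕ.+ (suc (t ℕ.+ t) ℕ.+ i)) ≡ 0ℤ
  high i i<d = tr (mr (cg +_ (tr (cg (cho (t ℕ.+ t)) index) (cz (t ℕ.+ t) i)))) (*-zeroˡ _)
   where
   arr₁ : ∀ d t i -> d ℕ.+ (suc (t ℕ.+ t) ℕ.+ i) ≡ t ℕ.+ d ℕ.+ suc (t ℕ.+ i)
   arr₁ = ℕ-solve-∀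
   abs : ∣ + (d ℕ.+ (suc (t ℕ.+ t) ℕ.+ i)) - + (t ℕ.+ d) ∣ ≡ suc (t ℕ.+ i)
   abs = tr (cg (\ z -> ∣ + z - + (t ℕ.+ d) ∣) (arr₁ d t i)) (tr (cg ∣_∣ (offs _ (t ℕ.+ d)))
    (tr (cg ∣_∣ (ZP.⊖-≥ (NP.m≤m+n (t ℕ.+ d) (suc (t ℕ.+ i))))) (NP.m+n∸m≡n (t ℕ.+ d) _)))
   index : t ℕ.+ ∣ + (d ℕ.+ (suc (t ℕ.+ t) ℕ.+ i)) - + (t ℕ.+ d) ∣ ≡ suc (t ℕ.+ t) ℕ.+ i
   index = tr (cg (t ℕ.+_) abs) (arr t i)
    where
    arr : ∀ t e -> t ℕ.+ suc (t ℕ.+ e) ≡ suc (t ℕ.+ t) ℕ.+ e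
    arr = ℕ-solve-∀
  shift : ∀ m -> + (d ℕ.+ m) - + (t ℕ.+ d) ≡ + m - + t
  shift m = tr (offs _ _) (tr (cg2 ℤ._⊖_ refl (NP.+-comm t d)) (tr (ZP.+-cancelˡ-⊖ d m t) (sy (offs m t))))
  middle : ∀ m -> m ℕ.≤ t ℕ.+ t -> g (d ℕ.+ m) ≡ + cho (t ℕ.+ t) m * φ (+ m - + t)
  middle m m≤2t = tr (cg (\ k -> + ker t k * φ k) (shift m)) (mr (cg +_ (coefficient (NP.≤-total t m))))
   where
   coefficient : _ -> ker t (+ m - + t) ≡ cho (t ℕ.+ t) m
   coefficient (n1 t≤m) = cg (cho (t ℕ.+ t)) (tr (cg (\ z -> t ℕ.+ ∣ z ∣) (tr (offs m t) (ZP.⊖-≥ t≤m))) (NP.m+[n∸m]≡n t≤m))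
   coefficient (n2 m≤t) = tr (cg (cho (t ℕ.+ t)) (tr (cg (\ z -> t ℕ.+ ∣ z ∣) (offs m t)) (cg (t ℕ.+_) (ZP.∣⊖∣-≤ m≤t))))
    (tr (cg (\ z -> cho z (t ℕ.+ (t ℕ.∸ m))) (sy total)) (tr (chsy (t ℕ.+ (t ℕ.∸ m)) m) (cg (\ z -> cho z m) total)))
    where
    total : t ℕ.+ (t ℕ.∸ m) ℕ.+ m ≡ t ℕ.+ t
    total = tr (NP.+-assoc t _ m) (cg (t ℕ.+_) (NP.m∸n+n≡m m≤t))
 ran : ℕ -> Functional n
 ran {zero} M g = g []
 ran {suc n} M g = range M (\ k -> ran M (\ ks -> g (k ∷ ks)))
 ra : ∀ n M -> Additive (ran {n} M)
 ra zero M = record { congruent = \ e -> e [] ; additive = \ f g -> refl ; homogeneous = \ k f -> refl ; monotone = \ e -> e [] }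
 ra (suc n) M = record
  { congruent = \ {f} {g} e -> A.congruent {slice f} {slice g} (\ k -> congruent (\ ks -> e (k ∷ ks)))
  ; additive = \ f g -> tr (A.congruent {slice (\ v -> f v + g v)} {\ k -> slice f k + slice g k} (\ k -> additive (\ ks -> f (k ∷ ks)) (\ ks -> g (k ∷ ks)))) (A.additive (slice f) (slice g))
  ; homogeneous = \ r f -> tr (A.congruent {slice (\ v -> r * f v)} {\ k -> r * slice f k} (\ k -> homogeneous r (\ ks -> f (k ∷ ks)))) (A.homogeneous r (slice f))
  ; monotone = \ {f} {g} e -> A.monotone {slice f} {slice g} (\ k -> monotone (\ ks -> e (k ∷ ks))) }
  where
  slice : (Vec ℤ (suc n) -> ℤ) -> ℤ -> ℤ
  slice f k = ran M (\ ks -> f (k ∷ ks))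
  open Additive (ra n M)
  module A = Additive (raad M)
 ke : Vec ℕ n -> Vec ℤ n -> ℕ
 ke [] [] = 1
 ke (t ∷ ts) (k ∷ ks) = ker t k ℕ.* ke ts ks
 wake : ∀ M (ts : Vec ℕ n) -> All (ℕ._≤ M) ts -> ∀ g -> walk ts g ≡ ran M (\ y -> + ke ts y * g y)
 wake M [] [] g = sy (*-identityˡ _)
 wake M (t ∷ ts) (t≤M ∷ ts≤M) g = begin
  cent t (\ k -> walk ts (\ ks -> g (k ∷ ks))) ≡⟨ Additive.congruent (cead t) (\ k -> wake M ts ts≤M (\ ks -> g (k ∷ ks))) ⟩
  cent t slice ≡⟨ ck t (M ℕ.∸ t) slice ⟩
  range (t ℕ.+ (M ℕ.∸ t)) (\ k -> + ker t k * slice k) ≡⟨ cg (\ m -> range m (\ k -> + ker t k * slice k)) (NP.m+[n∸m]≡n t≤M) ⟩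
  range M (\ k -> + ker t k * slice k)
   ≡⟨ Additive.congruent (raad M) {\ k -> + ker t k * slice k} {\ k -> ran M (\ ks -> + ke (t ∷ ts) (k ∷ ks) * g (k ∷ ks))}
      (\ k -> tr (sy (Additive.homogeneous (ra _ M) (+ ker t k) (\ ks -> + ke ts ks * g (k ∷ ks))))
      (Additive.congruent (ra _ M) (\ ks -> tr (sy (*-assoc _ _ _)) (mr (sy (pos-* (ker t k) (ke ts ks))))))) ⟩
  ran M (\ y -> + ke (t ∷ ts) y * g y) ∎
  where
  slice : ℤ -> ℤ
  slice k = ran M (\ ks -> + ke ts ks * g (k ∷ ks))
 opaque
  unfolding _+_ -_
  roi : ∀ {a b m} -> + a - + m ≡ + b - + m -> a ≡ b
  roi {a} {b} {m} e = ZP.+-injective (tr (sy (+cane (+ a) (+ m))) (tr (cg (\ z -> z + + m) e) (+cane (+ b) (+ m))))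
 suin≤1 : ∀ m (P : Fin m -> Set) (d : ∀ i -> Dec (P i)) -> (∀ i j -> P i -> P j -> i ≡ j) -> sum m (\ i -> indi (d i)) ≤ 1ℤ
 suin≤1 zero P d unique = sb (_≤ 1ℤ) (sy (se _)) (+≤+ z≤n)
 suin≤1 (suc m) P d unique = sb (_≤ 1ℤ) (sy (susu m _)) (bc (d zero))
  where
  bc : Dec (P zero) -> indi (d zero) + sum m (\ i -> indi (d (suc i))) ≤ 1ℤ
  bc (yes p) = ZP.≤-reflexive (tr (cg2 _+_ (inye (d zero) p) (Σz \ i -> inno (d (suc i)) \ q -> ze (unique zero (suc i) p q))) (+-identityʳ 1ℤ))
   where
   ze : ∀ {i : Fin m} -> zero ≢ suc i
   ze ()
  bc (no ¬p) = sb (_≤ 1ℤ) (sy (tr (cg2 _+_ (inno (d zero) ¬p) refl) (+-identityˡ _)))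
   (suin≤1 m (\ i -> P (suc i)) (\ i -> d (suc i)) \ i j p q -> FP.suc-injective (unique _ _ p q))
 _≟ᵥ_ : (u v : Vec ℤ n) -> Dec (u ≡ v)
 _≟ᵥ_ = VP.≡-dec ZP._≟_
 i* : {A B : Set} (a : Dec A) (b : Dec B) (c : Dec (Σ A \ _ -> B)) -> indi c ≡ indi a * indi b
 i* (yes a) (yes b) c = tr (inye c (a , b)) (sy (tr (cg2 _*_ (inye (yes a) a) (inye (yes b) b)) (*-identityˡ _)))
 i* (yes a) (no ¬b) c = tr (inno c \ p -> ¬b (Σ.proj₂ p)) (sy (tr (mc (inno (no ¬b) ¬b)) (*-zeroʳ _)))
 i* (no ¬a) b c = tr (inno c \ p -> ¬a (Σ.proj₁ p)) (sy (tr (mr (inno (no ¬a) ¬a)) (*-zeroˡ _)))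
 -- An inequality suffices, and it spares the check that the point lies inside the range.
 rapo : ∀ n M (v : Vec ℤ n) -> ran M (\ y -> indi (y ≟ᵥ v)) ≤ 1ℤ
 rapo zero M [] = ZP.≤-reflexive (inye ([] ≟ᵥ []) refl)
 rapo (suc n) M (v ∷ vs) = ZP.≤-trans
  (Additive.monotone (raad M) {\ k -> ran M (\ ks -> indi ((k ∷ ks) ≟ᵥ (v ∷ vs)))} {\ k -> indi (k ZP.≟ v)} (\ k -> sb (_≤ indi (k ZP.≟ v))
   (sy (tr (Additive.congruent (ra n M) (\ ks -> tr (i⇔ ((k ∷ ks) ≟ᵥ (v ∷ vs)) (pair k ks) (\ e -> VP.∷-injectiveˡ e , VP.∷-injectiveʳ e) (\ { (refl , refl) -> refl }))
     (i* (k ZP.≟ v) (ks ≟ᵥ vs) (pair k ks)))) (Additive.homogeneous (ra n M) _ _)))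
   (sb (indi (k ZP.≟ v) * ran M (\ ks -> indi (ks ≟ᵥ vs)) ≤_) (*-identityʳ _) (*-monoˡ-≤ (indnon (k ZP.≟ v)) (rapo n M vs)))))
  (suin≤1 _ _ (\ i -> (+ toℕ i - + M) ZP.≟ v) (\ i j p q -> FP.toℕ-injective (roi (tr p (sy q)))))
  where
  open import Relation.Nullary using (_×-dec_)
  pair : ∀ k ks -> Dec (Σ (k ≡ v) \ _ -> ks ≡ vs)
  pair k ks = (k ZP.≟ v) ×-dec (ks ≟ᵥ vs)
  indnon : {A : Set} (a : Dec A) -> 0ℤ ≤ indi a
  indnon (yes a) = sb (0ℤ ≤_) (sy (inye (yes a) a)) (+≤+ z≤n)
  indnon (no ¬a) = ZP.≤-reflexive (sy (inno (no ¬a) ¬a))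

-- Binomial coefficients against discrete Gaussians.

module Estimates where
 open Kernel using (cho; chra; cz; chsy; ker; ke)
 open import Data.Nat
 open import Data.Nat.Properties
 open import Data.Nat.Tactic.RingSolver using () renaming (solve-∀ to sv)
 open ≤-Reasoning
 *i : ∀ a b c d -> (a * b) * (c * d) ≡ (a * c) * (b * d)
 *i = sv
 ^-distrib-* : ∀ a b n -> (a * b) ^ n ≡ a ^ n * b ^ n
 ^-distrib-* a b zero = refl
 ^-distrib-* a b (suc n) = tr (cg (a * b *_) (^-distrib-* a b n)) (*i a b (a ^ n) (b ^ n))
 ^-cancel-≤ : ∀ {a b} n -> a ^ suc n ≤ b ^ suc n -> a ≤ b
 ^-cancel-≤ {a} {b} n le = ≮⇒≥ \ b<a -> <⇒≱ (^-monoˡ-< (suc n) b<a) le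
 square-cancel-≤ : ∀ {a b} -> a * a ≤ b * b -> a ≤ b
 square-cancel-≤ {a} {b} le = ≮⇒≥ \ b<a -> <⇒≱ (*-mono-< b<a b<a) le
 -- With m = a + 1 this says (m-e)/(m+e) is at most ((m-1)/(m+1))^e. In logarithms it is the
 -- superadditivity of artanh: artanh(e/m) is at least e artanh(1/m).
 arsu : ∀ e r a -> suc a ≡ r + e -> r * (2 + a) ^ e ≤ (suc a + e) * a ^ e
 arsu zero r a eq = ≤-reflexive (cg (_* 1) (tr (sy (tr eq (+-identityʳ r))) (sy (+-identityʳ (suc a)))))
 arsu (suc e) r a eq = *-cancelˡ-≤ (suc r) (begin
  suc r * (r * ((2 + a) * (2 + a) ^ e)) ≡⟨ shuf r (2 + a) ((2 + a) ^ e) ⟩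
  r * (2 + a) * (suc r * (2 + a) ^ e) ≤⟨ *-monoʳ-≤ (r * (2 + a)) (arsu e (suc r) a (tr eq (+-suc r e))) ⟩
  r * (2 + a) * ((suc a + e) * a ^ e) ≡⟨ shu (r * (2 + a)) (suc a + e) (a ^ e) ⟩
  (r * (2 + a)) * (suc a + e) * a ^ e ≤⟨ *-monoˡ-≤ (a ^ e) (polynomial a≡) ⟩
  suc r * ((suc a + suc e) * a) * a ^ e ≡⟨ shuffle₃ (suc r) (suc a + suc e) a (a ^ e) ⟩
  suc r * ((suc a + suc e) * (a * a ^ e)) ∎)
  where
  a≡ : a ≡ r + e
  a≡ = suc-injective (tr eq (+-suc r e))
  shuf : ∀ r b p -> suc r * (r * (b * p)) ≡ r * b * (suc r * p)
  shuf = sv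
  shu : ∀ x y p -> x * (y * p) ≡ x * y * p
  shu = sv
  shuffle₃ : ∀ x y a p -> x * (y * a) * p ≡ x * (y * (a * p))
  shuffle₃ = sv
  identity : ∀ r e -> (r * (2 + (r + e))) * (suc (r + e) + e) + 2 * (e * e + e) ≡ suc r * ((suc (r + e) + suc e) * (r + e))
  identity = sv
  polynomial : a ≡ r + e -> (r * (2 + a)) * (suc a + e) ≤ suc r * ((suc a + suc e) * a)
  polynomial refl = ≤-trans (m≤m+n _ (2 * (e * e + e))) (≤-reflexive (identity r e))
 -- Bernoulli's inequality for (1 + h/a)^e, cleared of denominators.
 ber : ∀ a h e -> a ^ e * (a + e * h) ≤ (a + h) ^ e * a
 ber a h zero = ≤-reflexive (cg (1 *_) (+-identityʳ a))
 ber a h (suc e) = begin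
  a * a ^ e * (a + suc e * h) ≡⟨ shuf a (a ^ e) (suc e * h) ⟩
  a ^ e * (a * (a + suc e * h)) ≤⟨ *-monoʳ-≤ (a ^ e) (≤-trans (m≤m+n _ (h * (e * h))) (≤-reflexive (shu a h e))) ⟩
  a ^ e * ((a + h) * (a + e * h)) ≡⟨ shuffle₃ (a ^ e) (a + h) (a + e * h) ⟩
  (a + h) * (a ^ e * (a + e * h)) ≤⟨ *-monoʳ-≤ (a + h) (ber a h e) ⟩
  (a + h) * ((a + h) ^ e * a) ≡⟨ *-assoc (a + h) _ a ⟨
  (a + h) ^ suc e * a ∎
  where
  shuf : ∀ a p x -> a * p * (a + x) ≡ p * (a * (a + x))
  shuf = sv
  shu : ∀ a h e -> a * (a + suc e * h) + h * (e * h) ≡ (a + h) * (a + e * h)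
  shu = sv
  shuffle₃ : ∀ p x y -> p * (x * y) ≡ x * (p * y)
  shuffle₃ = sv
 odd : ℕ -> ℕ
 odd v = suc (v + v)
 sqsu : ∀ e v -> e * (suc v * suc v) ≡ e * odd v + e * (v * v)
 sqsu e v = lemma e v
  where
  lemma : ∀ e v -> e * (suc v * suc v) ≡ e * suc (v + v) + e * (v * v)
  lemma = sv
 module Gaussian (a : ℕ) where
  b : ℕ
  b = 2 + a
  -- Consecutive binomial coefficients have ratio (t-v)/(t+v+1). Multiplied through by 2e this is
  -- (m-E)/(m+E) with m = a + 1 and E = e(2v+1), the exact shape of `arsu`; hence the demand that
  -- `odd t` divide `suc a`.
  stup : ∀ e t v d -> e * odd t ≡ suc a -> t ≡ v + d -> d * b ^ (e * odd v) ≤ suc (t + v) * a ^ (e * odd v)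
  stup zero t v d () _
  stup (suc e) t v d eq refl = *-cancelˡ-≤ (2 * suc e) (begin
   2 * suc e * (d * b ^ E) ≡⟨ *-assoc (2 * suc e) d _ ⟨
   2 * suc e * d * b ^ E ≤⟨ arsu E (2 * suc e * d) a (tr (sy eq) (split (suc e) v d)) ⟩
   (suc a + E) * a ^ E ≡⟨ cg (\ m -> (m + E) * a ^ E) eq ⟨
   (suc e * odd t + E) * a ^ E ≡⟨ cg (_* a ^ E) (total (suc e) v d) ⟩
   2 * suc e * suc (t + v) * a ^ E ≡⟨ *-assoc (2 * suc e) (suc (t + v)) (a ^ E) ⟩
   2 * suc e * (suc (t + v) * a ^ E) ∎)
   where
   E = suc e * odd v
   split : ∀ e v d -> e * suc (v + d + (v + d)) ≡ 2 * e * d + e * suc (v + v)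
   split = sv
   total : ∀ e v d -> e * suc (v + d + (v + d)) + e * suc (v + v) ≡ 2 * e * suc (v + d + v)
   total = sv
  chst : ∀ v d -> suc (v + d + v) * cho (v + d + (v + d)) (suc (v + d + v)) ≡ d * cho (v + d + (v + d)) (v + d + v)
  chst v d = sb (\ m -> suc (v + d + v) * cho m (suc (v + d + v)) ≡ d * cho m (v + d + v)) (lemma v d) (chra (v + d + v) d)
   where
   lemma : ∀ v d -> v + d + v + d ≡ v + d + (v + d)
   lemma = sv
  -- The exponents e(2v+1) of the single steps add up to e v^2, the Gaussian exponent.
  cu : ∀ e t v -> e * odd t ≡ suc a ->
   cho (t + t) (t + v) * b ^ (e * (v * v)) ≤ cho (t + t) t * a ^ (e * (v * v))
  cu e t zero eq rewrite *-zeroʳ e | +-identityʳ t = ≤-refl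
  cu e t (suc v) eq with ≤-total t v
  ... | n1 t≤v = sb (\ m -> cho (t + t) m * b ^ (e * (suc v * suc v)) ≤ cho (t + t) t * a ^ (e * (suc v * suc v))) (index t≤v) (sb (\ z -> z * b ^ (e * (suc v * suc v)) ≤ cho (t + t) t * a ^ (e * (suc v * suc v))) (sy (cz (t + t) (v ∸ t))) z≤n)
   where
   index : t ≤ v -> suc (t + t) + (v ∸ t) ≡ t + suc v
   index le = tr (cg suc (tr (+-assoc t t _) (cg (t +_) (m+[n∸m]≡n le)))) (sy (+-suc t v))
  ... | n2 v≤t = sb (\ t -> cho (t + t) (t + suc v) * b ^ (e * (suc v * suc v)) ≤ cho (t + t) t * a ^ (e * (suc v * suc v))) t≡ (main (t ∸ v) (sb (\ t -> e * odd t ≡ suc a) (sy t≡) eq))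
   where
   t≡ : v + (t ∸ v) ≡ t
   t≡ = m+[n∸m]≡n v≤t
   main : ∀ d -> e * odd (v + d) ≡ suc a -> cho (v + d + (v + d)) (v + d + suc v) * b ^ (e * (suc v * suc v)) ≤ cho (v + d + (v + d)) (v + d) * a ^ (e * (suc v * suc v))
   main d eq = *-cancelˡ-≤ (suc (t′ + v)) (begin
    suc (t′ + v) * (cho (t′ + t′) (t′ + suc v) * b ^ (e * (suc v * suc v)))
     ≡⟨ cg2 (\ k x -> suc (t′ + v) * (cho (t′ + t′) k * b ^ x)) (+-suc t′ v) (sqsu e v) ⟩
    suc (t′ + v) * (cho (t′ + t′) (suc (t′ + v)) * b ^ (E + S)) ≡⟨ sy (*-assoc (suc (t′ + v)) (cho (t′ + t′) (suc (t′ + v))) _) ⟩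
    suc (t′ + v) * cho (t′ + t′) (suc (t′ + v)) * b ^ (E + S) ≡⟨ cg2 _*_ (chst v d) (^-distribˡ-+-* b E S) ⟩
    d * cho (t′ + t′) (t′ + v) * (b ^ E * b ^ S) ≡⟨ *i d _ _ _ ⟩
    d * b ^ E * (cho (t′ + t′) (t′ + v) * b ^ S) ≤⟨ *-mono-≤ (stup e t′ v d eq refl) (cu e t′ v eq) ⟩
    suc (t′ + v) * a ^ E * (cho (t′ + t′) t′ * a ^ S) ≡⟨ reg (suc (t′ + v)) (a ^ E) (cho (t′ + t′) t′) (a ^ S) ⟩
    suc (t′ + v) * (cho (t′ + t′) t′ * (a ^ E * a ^ S)) ≡⟨ cg (\ x -> suc (t′ + v) * (cho (t′ + t′) t′ * x)) (tr (sy (^-distribˡ-+-* a E S)) (cg (a ^_) (sy (sqsu e v)))) ⟩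
    suc (t′ + v) * (cho (t′ + t′) t′ * a ^ (e * (suc v * suc v))) ∎)
    where
    t′ = v + d
    E = e * odd v
    S = e * (v * v)
    reg : ∀ x p c s -> x * p * (c * s) ≡ x * (c * (p * s))
    reg = sv
  -- The reverse estimate comes from Bernoulli: (b/a)^E is at least 1 + 2E/a, and the hypothesis on
  -- `a` makes this at least (t+v+1)/d. The rate `e` must be a little too large, which restricts
  -- `v`.
  stlo : ∀ e v d -> .{{_ : NonZero a}} -> a ≤ 2 * (e * d) -> suc (v + d + v) * a ^ (e * odd v) ≤ d * b ^ (e * odd v)
  stlo e v d le = *-cancelʳ-≤ _ _ a (begin
   suc (v + d + v) * a ^ E * a ≡⟨ shuffle (suc (v + d + v)) (a ^ E) a ⟩
   a ^ E * (suc (v + d + v) * a) ≤⟨ *-monoʳ-≤ (a ^ E) (begin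
    suc (v + d + v) * a ≡⟨ split v d a ⟩
    d * a + odd v * a ≤⟨ +-monoʳ-≤ (d * a) (*-monoʳ-≤ (odd v) le) ⟩
    d * a + odd v * (2 * (e * d)) ≡⟨ join d a (odd v) e ⟩
    d * (a + E * 2) ∎) ⟩
   a ^ E * (d * (a + E * 2)) ≡⟨ shu (a ^ E) d (a + E * 2) ⟩
   d * (a ^ E * (a + E * 2)) ≤⟨ *-monoʳ-≤ d (ber a 2 E) ⟩
   d * ((a + 2) ^ E * a) ≡⟨ cg (\ x -> d * (x ^ E * a)) (+-comm a 2) ⟩
   d * (b ^ E * a) ≡⟨ *-assoc d _ a ⟨
   d * b ^ E * a ∎)
   where
   E = e * odd v
   shuffle : ∀ x p a -> x * p * a ≡ p * (x * a)
   shuffle = sv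
   shu : ∀ p d x -> p * (d * x) ≡ d * (p * x)
   shu = sv
   split : ∀ v d a -> suc (v + d + v) * a ≡ d * a + suc (v + v) * a
   split = sv
   join : ∀ d a o e -> d * a + o * (2 * (e * d)) ≡ d * (a + e * o * 2)
   join = sv
  cl : ∀ e t v -> .{{_ : NonZero a}} -> v ≤ t -> a ≤ 2 * (e * (t ∸ v)) ->
   cho (t + t) t * a ^ (e * (v * v)) ≤ cho (t + t) (t + v) * b ^ (e * (v * v))
  cl e t zero _ _ rewrite *-zeroʳ e | +-identityʳ t = ≤-refl
  cl e t (suc v) v<t le = sb (\ t -> cho (t + t) t * a ^ (e * (suc v * suc v)) ≤ cho (t + t) (t + suc v) * b ^ (e * (suc v * suc v))) t≡ (main (t ∸ v)
    (≤-trans le (*-monoʳ-≤ 2 (*-monoʳ-≤ e (∸-monoʳ-≤ t (n≤1+n v)))))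
    (sb (\ t -> cho (t + t) t * a ^ (e * (v * v)) ≤ cho (t + t) (t + v) * b ^ (e * (v * v))) (sy t≡) (cl e t v (<⇒≤ v<t) (≤-trans le (*-monoʳ-≤ 2 (*-monoʳ-≤ e (∸-monoʳ-≤ t (n≤1+n v))))))))
   where
   t≡ : v + (t ∸ v) ≡ t
   t≡ = m+[n∸m]≡n (<⇒≤ v<t)
   main : ∀ d -> a ≤ 2 * (e * d) -> cho (v + d + (v + d)) (v + d) * a ^ (e * (v * v)) ≤ cho (v + d + (v + d)) (v + d + v) * b ^ (e * (v * v)) ->
    cho (v + d + (v + d)) (v + d) * a ^ (e * (suc v * suc v)) ≤ cho (v + d + (v + d)) (v + d + suc v) * b ^ (e * (suc v * suc v))
   main d le IH = *-cancelˡ-≤ (suc (t′ + v)) (begin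
    suc (t′ + v) * (cho (t′ + t′) t′ * a ^ (e * (suc v * suc v))) ≡⟨ cg (\ x -> suc (t′ + v) * (cho (t′ + t′) t′ * x)) (tr (cg (a ^_) (sqsu e v)) (^-distribˡ-+-* a E S)) ⟩
    suc (t′ + v) * (cho (t′ + t′) t′ * (a ^ E * a ^ S)) ≡⟨ reg (suc (t′ + v)) (a ^ E) (cho (t′ + t′) t′) (a ^ S) ⟨
    suc (t′ + v) * a ^ E * (cho (t′ + t′) t′ * a ^ S) ≤⟨ *-mono-≤ (stlo e v d le) IH ⟩
    d * b ^ E * (cho (t′ + t′) (t′ + v) * b ^ S) ≡⟨ *i d _ _ _ ⟩
    d * cho (t′ + t′) (t′ + v) * (b ^ E * b ^ S) ≡⟨ cg2 _*_ (chst v d) (^-distribˡ-+-* b E S) ⟨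
    suc (t′ + v) * cho (t′ + t′) (suc (t′ + v)) * b ^ (E + S) ≡⟨ *-assoc (suc (t′ + v)) (cho (t′ + t′) (suc (t′ + v))) _ ⟩
    suc (t′ + v) * (cho (t′ + t′) (suc (t′ + v)) * b ^ (E + S)) ≡⟨ cg2 (\ k x -> suc (t′ + v) * (cho (t′ + t′) k * b ^ x)) (+-suc t′ v) (sqsu e v) ⟨
    suc (t′ + v) * (cho (t′ + t′) (t′ + suc v) * b ^ (e * (suc v * suc v))) ∎)
    where
    t′ = v + d
    E = e * odd v
    S = e * (v * v)
    reg : ∀ x p c s -> x * p * (c * s) ≡ x * (c * (p * s))
    reg = sv
  -- Superadditivity of artanh again, now for the difference of two rates: `arsu` bounds the power
  -- of exponent `F`, and the remaining polynomial inequality has the manifest slack 2(β+F)βF.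
  stra : ∀ e e′ d δ t t′ v -> e ≡ e′ + δ -> e * odd t ≡ suc a -> e′ * odd t′ ≡ suc a -> t ≡ v + d -> ∀ d′ -> t′ ≡ v + d′ ->
   d * suc (t′ + v) * b ^ (δ * odd v) ≤ suc (t + v) * d′ * a ^ (δ * odd v)
  stra e zero d δ t t′ v _ _ () _ d′ _
  stra e (suc e″) d δ t t′ v refl eq eq′ refl d′ refl = *-cancelˡ-≤ (4 * (e * e′)) ⦃ _ ⦄ (*-cancelˡ-≤ (suc a + F) (begin
   (suc a + F) * (4 * (e * e′) * (d * suc (t′ + v) * b ^ F)) ≡⟨ shuf (suc a + F) e e′ d (suc (t′ + v)) (b ^ F) ⟩
   (2 * e * d) * (2 * e′ * suc (t′ + v)) * (suc a + F) * b ^ F ≤⟨ *-monoˡ-≤ (b ^ F) polynomial ⟩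
   (2 * e * suc (t + v)) * (2 * e′ * d′) * R * b ^ F ≡⟨ *-assoc ((2 * e * suc (t + v)) * (2 * e′ * d′)) R _ ⟩
   (2 * e * suc (t + v)) * (2 * e′ * d′) * (R * b ^ F) ≤⟨ *-monoʳ-≤ ((2 * e * suc (t + v)) * (2 * e′ * d′)) (arsu F R a m≡) ⟩
   (2 * e * suc (t + v)) * (2 * e′ * d′) * ((suc a + F) * a ^ F) ≡⟨ shu e e′ (suc (t + v)) d′ (suc a + F) (a ^ F) ⟩
   (suc a + F) * (4 * (e * e′) * (suc (t + v) * d′ * a ^ F)) ∎))
   where
   e′ = suc e″
   x = odd v
   F = δ * x
   A = 2 * e * d
   β = e′ * x
   R = A + β
   shuf : ∀ m e e′ d y p -> m * (4 * (e * e′) * (d * y * p)) ≡ (2 * e * d) * (2 * e′ * y) * m * p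
   shuf = sv
   shu : ∀ e e′ x d m p -> (2 * e * x) * (2 * e′ * d) * (m * p) ≡ m * (4 * (e * e′) * (x * d * p))
   shu = sv
   mfr : ∀ e v d -> e * suc (v + d + (v + d)) ≡ 2 * e * d + e * suc (v + v)
   mfr = sv
   m-to : ∀ e v d -> 2 * e * suc (v + d + v) ≡ e * suc (v + d + (v + d)) + e * suc (v + v)
   m-to = sv
   distr : ∀ e′ δ x -> (e′ + δ) * x ≡ e′ * x + δ * x
   distr = sv
   m≡′ : suc a ≡ A + (β + F)
   m≡′ = tr (sy eq) (tr (mfr e v d) (cg (A +_) (distr e′ δ x)))
   m≡ : suc a ≡ R + F
   m≡ = tr m≡′ (sy (+-assoc A β F))
   2e′d′ : 2 * e′ * d′ ≡ A + F
   2e′d′ = +-cancelʳ-≡ β (2 * e′ * d′) (A + F) (tr (sy (mfr e′ v d′)) (tr eq′ (tr m≡′ (perm A β F))))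
    where
    perm : ∀ A β F -> A + (β + F) ≡ A + F + β
    perm = sv
   2e′t′ : 2 * e′ * suc (t′ + v) ≡ A + (β + F) + β
   2e′t′ = tr (m-to e′ v d′) (cg (_+ β) (tr eq′ m≡′))
   2et : 2 * e * suc (t + v) ≡ A + (β + F) + (β + F)
   2et = tr (m-to e v d) (cg2 _+_ (tr eq m≡′) (distr e′ δ x))
   identity : ∀ A β F -> A * (A + (β + F) + β) * (A + (β + F) + F) + 2 * ((β + F) * β * F) ≡ (A + (β + F) + (β + F)) * (A + F) * (A + β)
   identity = sv
   polynomial : A * (2 * e′ * suc (t′ + v)) * (suc a + F) ≤ (2 * e * suc (t + v)) * (2 * e′ * d′) * R
   polynomial = begin
    A * (2 * e′ * suc (t′ + v)) * (suc a + F) ≡⟨ cg2 (\ y m -> A * y * (m + F)) 2e′t′ m≡′ ⟩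
    A * (A + (β + F) + β) * (A + (β + F) + F) ≤⟨ m≤m+n _ _ ⟩
    A * (A + (β + F) + β) * (A + (β + F) + F) + 2 * ((β + F) * β * F) ≡⟨ identity A β F ⟩
    (A + (β + F) + (β + F)) * (A + F) * (A + β) ≡⟨ cg2 (\ y z -> y * z * R) 2et 2e′d′ ⟨
    (2 * e * suc (t + v)) * (2 * e′ * d′) * R ∎
  -- Compares a shorter walk with a longer one directly. Unlike the lower estimate `cl` it holds for
  -- every `v`, which is what the far tail of the certificate requires.
  cr : ∀ e e′ δ t t′ v -> e ≡ e′ + δ -> e * odd t ≡ suc a -> e′ * odd t′ ≡ suc a -> t ≤ t′ ->
   cho (t + t) (t + v) * cho (t′ + t′) t′ * b ^ (δ * (v * v)) ≤ cho (t + t) t * cho (t′ + t′) (t′ + v) * a ^ (δ * (v * v))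
  cr e e′ δ t t′ zero _ _ _ _ rewrite *-zeroʳ δ | +-identityʳ t | +-identityʳ t′ = ≤-refl
  cr e e′ δ t t′ (suc v) e≡ eq eq′ t≤t′ with ≤-total t v
  ... | n1 t≤v = sb (\ c -> c * cho (t′ + t′) t′ * b ^ (δ * (suc v * suc v)) ≤ cho (t + t) t * cho (t′ + t′) (t′ + suc v) * a ^ (δ * (suc v * suc v)))
    (tr (sy (cz (t + t) (v ∸ t))) (cg (cho (t + t)) (index t≤v))) z≤n
   where
   index : t ≤ v -> suc (t + t) + (v ∸ t) ≡ t + suc v
   index le = tr (cg suc (tr (+-assoc t t _) (cg (t +_) (m+[n∸m]≡n le)))) (sy (+-suc t v))
  ... | n2 v≤t = main (t ∸ v) (sy (m+[n∸m]≡n v≤t)) (t′ ∸ v) (sy (m+[n∸m]≡n (≤-trans v≤t t≤t′)))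
   where
   E = δ * odd v
   S = δ * (v * v)
   main : ∀ d -> t ≡ v + d -> ∀ d′ -> t′ ≡ v + d′ ->
    cho (t + t) (t + suc v) * cho (t′ + t′) t′ * b ^ (δ * (suc v * suc v)) ≤ cho (t + t) t * cho (t′ + t′) (t′ + suc v) * a ^ (δ * (suc v * suc v))
   main zero refl d′ refl = sb (\ c -> c * cho (t′ + t′) t′ * b ^ (δ * (suc v * suc v)) ≤ cho (t + t) t * cho (t′ + t′) (t′ + suc v) * a ^ (δ * (suc v * suc v)))
    (tr (sy (cz (t + t) 0)) (cg (cho (t + t)) (index v))) z≤n
    where
    index : ∀ v -> suc (v + 0 + (v + 0)) + 0 ≡ v + 0 + suc v
    index = sv
   main (suc d₀) refl zero t′≡ with +-cancelˡ-≤ v (suc d₀) 0 (≤-trans t≤t′ (≤-reflexive t′≡))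
   ... | ()
   main d@(suc _) refl d′@(suc _) refl = *-cancelˡ-≤ (suc (t + v) * d′) (begin
    suc (t + v) * d′ * (cho (t + t) (t + suc v) * K′ * b ^ (δ * (suc v * suc v)))
     ≡⟨ cg2 (\ k x -> suc (t + v) * d′ * (cho (t + t) k * K′ * x)) (+-suc t v) (tr (cg (b ^_) (sqsu δ v)) (^-distribˡ-+-* b E S)) ⟩
    suc (t + v) * d′ * (cho (t + t) (suc (t + v)) * K′ * (b ^ E * b ^ S)) ≡⟨ shuf (suc (t + v)) d′ (cho (t + t) (suc (t + v))) K′ (b ^ E) (b ^ S) ⟩
    (suc (t + v) * cho (t + t) (suc (t + v))) * d′ * K′ * b ^ E * b ^ S ≡⟨ cg (\ z -> z * d′ * K′ * b ^ E * b ^ S) (chst v d) ⟩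
    (d * cho (t + t) (t + v)) * d′ * K′ * b ^ E * b ^ S ≡⟨ shu d (cho (t + t) (t + v)) d′ K′ (b ^ E) (b ^ S) ⟩
    d * b ^ E * d′ * (cho (t + t) (t + v) * K′ * b ^ S) ≤⟨ *-monoʳ-≤ (d * b ^ E * d′) (cr e e′ δ t t′ v e≡ eq eq′ t≤t′) ⟩
    d * b ^ E * d′ * (K * cho (t′ + t′) (t′ + v) * a ^ S) ≡⟨ shuffle₃ d (b ^ E) d′ K (cho (t′ + t′) (t′ + v)) (a ^ S) ⟩
    d * (d′ * cho (t′ + t′) (t′ + v)) * b ^ E * (K * a ^ S) ≡⟨ cg (\ z -> d * z * b ^ E * (K * a ^ S)) (chst v d′) ⟨
    d * (suc (t′ + v) * cho (t′ + t′) (suc (t′ + v))) * b ^ E * (K * a ^ S) ≡⟨ shuffle₄ d (suc (t′ + v)) (cho (t′ + t′) (suc (t′ + v))) (b ^ E) (K * a ^ S) ⟩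
    d * suc (t′ + v) * b ^ E * (cho (t′ + t′) (suc (t′ + v)) * (K * a ^ S)) ≤⟨ *-monoˡ-≤ _ (stra e e′ d δ t t′ v e≡ eq eq′ refl d′ refl) ⟩
    suc (t + v) * d′ * a ^ E * (cho (t′ + t′) (suc (t′ + v)) * (K * a ^ S)) ≡⟨ shuffle₅ (suc (t + v) * d′) (a ^ E) (cho (t′ + t′) (suc (t′ + v))) K (a ^ S) ⟩
    suc (t + v) * d′ * (K * cho (t′ + t′) (suc (t′ + v)) * (a ^ E * a ^ S))
     ≡⟨ cg2 (\ k x -> suc (t + v) * d′ * (K * cho (t′ + t′) k * x)) (+-suc t′ v) (tr (cg (a ^_) (sqsu δ v)) (^-distribˡ-+-* a E S)) ⟨
    suc (t + v) * d′ * (K * cho (t′ + t′) (t′ + suc v) * a ^ (δ * (suc v * suc v))) ∎)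
    where
    K = cho (t + t) t
    K′ = cho (t′ + t′) t′
    shuf : ∀ x d c K p s -> x * d * (c * K * (p * s)) ≡ (x * c) * d * K * p * s
    shuf = sv
    shu : ∀ d c d′ K p s -> (d * c) * d′ * K * p * s ≡ d * p * d′ * (c * K * s)
    shu = sv
    shuffle₃ : ∀ d p d′ K c s -> d * p * d′ * (K * c * s) ≡ d * (d′ * c) * p * (K * s)
    shuffle₃ = sv
    shuffle₄ : ∀ d x c p y -> d * (x * c) * p * y ≡ d * x * p * (c * y)
    shuffle₄ = sv
    shuffle₅ : ∀ x p c K s -> x * p * (c * (K * s)) ≡ x * (K * c * (p * s))
    shuffle₅ = sv

-- Fractions, and powers that approximate 1/e.

module Fractions where
 open Estimates using (arsu; ^-distrib-*; *i; ^-cancel-≤)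
 open import Data.Nat
 open import Data.Nat.Properties
 open import Data.Nat.Tactic.RingSolver using () renaming (solve-∀ to sv)
 open ≤-Reasoning
 infix 5 _∕_
 record Frac : Set where
  constructor _∕_
  field
   num den : ℕ
   .{{den≢0}} : NonZero den
 open Frac public
 frac-≡ : ∀ {p q} -> num p ≡ num q -> den p ≡ den q -> p ≡ q
 frac-≡ {_ ∕ _} {_ ∕ _} refl refl = refl
 infix 3 _≼_
 record _≼_ (p q : Frac) : Set where
  constructor cross
  field unc : num p * den q ≤ num q * den p
 open _≼_ public
 ≼r : ∀ {p} -> p ≼ p
 ≼r = cross ≤-refl
 ≼t : ∀ {p q r} -> p ≼ q -> q ≼ r -> p ≼ r
 ≼t {p} {q} {r} pq qr = cross (*-cancelʳ-≤ _ _ (den q) (begin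
  num p * den r * den q ≡⟨ sl (num p) (den r) (den q) ⟩
  num p * den q * den r ≤⟨ *-monoˡ-≤ (den r) (unc pq) ⟩
  num q * den p * den r ≡⟨ sl (num q) (den p) (den r) ⟩
  num q * den r * den p ≤⟨ *-monoˡ-≤ (den p) (unc qr) ⟩
  num r * den q * den p ≡⟨ sl (num r) (den q) (den p) ⟩
  num r * den p * den q ∎))
  where
  sl : ∀ x y z -> x * y * z ≡ x * z * y
  sl = sv
 infixl 7 _∙_
 _∙_ : Frac -> Frac -> Frac
 p ∙ q = _∕_ (num p * num q) (den p * den q) {{m*n≢0 (den p) (den q)}}
 infixr 8 _↑_
 _↑_ : Frac -> ℕ -> Frac
 p ↑ n = _∕_ (num p ^ n) (den p ^ n) {{m^n≢0 (den p) n}}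
 ∙m : ∀ {p q r s} -> p ≼ q -> r ≼ s -> p ∙ r ≼ q ∙ s
 ∙m {p} {q} {r} {s} pq rs = cross (sb2 _≤_ (*i (num p) (den q) (num r) (den s)) (*i (num q) (den p) (num s) (den r)) (*-mono-≤ (unc pq) (unc rs)))
 ↑m : ∀ {p q} n -> p ≼ q -> p ↑ n ≼ q ↑ n
 ↑m {p} {q} n le = cross (sb2 _≤_ (^-distrib-* (num p) (den q) n) (^-distrib-* (num q) (den p) n) (^-monoˡ-≤ n (unc le)))
 ↑c : ∀ {p q} n -> p ↑ suc n ≼ q ↑ suc n -> p ≼ q
 ↑c {p} {q} n le = cross (^-cancel-≤ n (sb2 _≤_ (sy (^-distrib-* (num p) (den q) (suc n))) (sy (^-distrib-* (num q) (den p) (suc n))) (unc le)))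
 ↑* : ∀ p m n -> (p ↑ m) ↑ n ≡ p ↑ (m * n)
 ↑* p m n = frac-≡ (^-*-assoc (num p) m n) (^-*-assoc (den p) m n)
 ↑co : ∀ p m n -> (p ↑ m) ↑ n ≡ (p ↑ n) ↑ m
 ↑co p m n = tr (↑* p m n) (tr (cg (p ↑_) (*-comm m n)) (sy (↑* p n m)))
 ↑a : ∀ p {m n} -> num p ≤ den p -> m ≤ n -> p ↑ n ≼ p ↑ m
 ↑a p {m} {n} p≤1 m≤n = sb (\ n -> p ↑ n ≼ p ↑ m) (m+[n∸m]≡n m≤n) (cross (begin
  num p ^ (m + k) * den p ^ m ≡⟨ cg (_* den p ^ m) (^-distribˡ-+-* (num p) m k) ⟩
  num p ^ m * num p ^ k * den p ^ m ≤⟨ *-monoˡ-≤ _ (*-monoʳ-≤ (num p ^ m) (^-monoˡ-≤ k p≤1)) ⟩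
  num p ^ m * den p ^ k * den p ^ m ≡⟨ ar (num p ^ m) (den p ^ k) (den p ^ m) ⟩
  num p ^ m * (den p ^ m * den p ^ k) ≡⟨ cg (num p ^ m *_) (^-distribˡ-+-* (den p) m k) ⟨
  num p ^ m * den p ^ (m + k) ∎))
  where
  k = n ∸ m
  ar : ∀ x y z -> x * y * z ≡ x * (z * y)
  ar = sv
 -- A fixed relative margin `g` pays for an exponent that is off by one, provided `M` is large
 -- enough for `g ↑ M` to outweigh the one surplus factor `y`.
 au : ∀ {x y g : Frac} M -> x ∙ g ≼ y -> 1 ∕ 1 ≼ g ↑ M ∙ y -> x ↑ M ≼ y ↑ suc M
 au {x} {y} {g} M xg≼y large = ≼t
  (sb (_≼ (g ↑ M ∙ y) ∙ x ↑ M) (unit (x ↑ M)) (∙m {1 ∕ 1} {g ↑ M ∙ y} {x ↑ M} {x ↑ M} large ≼r))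
  (sb (_≼ y ↑ suc M) (rearrange x g y M) (∙m {y} {y} {(x ∙ g) ↑ M} {y ↑ M} ≼r (↑m M xg≼y)))
  where
  unit : ∀ p -> (1 ∕ 1) ∙ p ≡ p
  unit p = frac-≡ (*-identityˡ _) (*-identityˡ _)
  lemma : ∀ x g y M -> y * (x * g) ^ M ≡ g ^ M * y * x ^ M
  lemma x g y M = tr (cg (y *_) (^-distrib-* x g M)) (reo y (x ^ M) (g ^ M))
   where
   reo : ∀ y p q -> y * (p * q) ≡ q * y * p
   reo = sv
  rearrange : ∀ x g y M -> y ∙ (x ∙ g) ↑ M ≡ (g ↑ M ∙ y) ∙ x ↑ M
  rearrange x g y M = frac-≡ (lemma (num x) (num g) (num y) M) (lemma (den x) (den g) (den y) M)
 -- In closed form 2l(l-1): the quadratic coefficient of (1 - 2/b)^l times b^2.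
 tria : ℕ -> ℕ
 tria zero = 0
 tria (suc l) = tria l + 4 * l
 bo : ∀ a l -> let b = 2 + a in a ^ l * (b * b) + 2 * l * (b * b ^ l) ≤ b ^ l * (b * b + tria l)
 bo a zero = ≤-reflexive (lemma a)
  where
  lemma : ∀ a -> 1 * ((2 + a) * (2 + a)) + 0 ≡ 1 * ((2 + a) * (2 + a) + 0)
  lemma = sv
 bo a (suc l) = begin
  a * X * (b * b) + 2 * suc l * (b * (b * Y)) ≡⟨ split a X Y l ⟩
  a * (X * (b * b) + 2 * l * (b * Y)) + (4 * l * b + 2 * (b * b)) * Y ≤⟨ +-monoˡ-≤ _ (*-monoʳ-≤ a (bo a l)) ⟩
  a * (Y * (b * b + τ)) + (4 * l * b + 2 * (b * b)) * Y ≤⟨ m≤m+n _ (2 * τ * Y) ⟩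
  a * (Y * (b * b + τ)) + (4 * l * b + 2 * (b * b)) * Y + 2 * τ * Y ≡⟨ join a Y l τ ⟩
  b * Y * (b * b + (τ + 4 * l)) ∎
  where
  b = 2 + a
  X = a ^ l
  Y = b ^ l
  τ = tria l
  split : ∀ a X Y l -> a * X * ((2 + a) * (2 + a)) + 2 * suc l * ((2 + a) * ((2 + a) * Y)) ≡
   a * (X * ((2 + a) * (2 + a)) + 2 * l * ((2 + a) * Y)) + (4 * l * (2 + a) + 2 * ((2 + a) * (2 + a))) * Y
  split = sv
  join : ∀ a Y l τ -> a * (Y * ((2 + a) * (2 + a) + τ)) + (4 * l * (2 + a) + 2 * ((2 + a) * (2 + a))) * Y + 2 * τ * Y ≡
   (2 + a) * Y * ((2 + a) * (2 + a) + (τ + 4 * l))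
  join = sv
 tv : ∀ l -> tria (suc l) ≡ 2 * (suc l * l)
 tv zero = refl
 tv (suc l) = tr (cg (_+ 4 * suc l) (tv l)) (lemma l)
  where
  lemma : ∀ l -> 2 * (suc l * l) + 4 * suc l ≡ 2 * (suc (suc l) * suc l)
  lemma = sv
 -- By the second-order bound `bo`, base^L is at most 1 - 1/M + 1/(2M^2), where L = l + 1, M = m + 1
 -- and a + 1 = 2LM. Its M-th power exceeds 1/e only by a relative error of order 1/M^2.
 eu : ∀ a l m -> suc a ≡ 2 * (suc l * suc m) ->
  a ^ suc l * (2 * (suc m * suc m)) + 2 * suc m * (2 + a) ^ suc l ≤ (2 + a) ^ suc l * (2 * (suc m * suc m) + 1)
 eu a l m a≡ = *-cancelʳ-≤ _ _ (b * b) (+-cancelʳ-≤ (4 * (M * M) * L * b * Y + 2 * (M * M) * τ * Y) _ _ (begin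
  (X * (2 * (M * M)) + 2 * M * Y) * (b * b) + (4 * (M * M) * L * b * Y + 2 * (M * M) * τ * Y) ≡⟨ split X Y M L b τ ⟩
  2 * (M * M) * (X * (b * b) + 2 * L * (b * Y)) + (2 * (M * M) * τ + 2 * M * (b * b)) * Y
   ≤⟨ +-mono-≤ (*-monoʳ-≤ (2 * (M * M)) (bo a L)) (*-monoˡ-≤ Y polynomial) ⟩
  2 * (M * M) * (Y * (b * b + τ)) + (4 * (M * M) * L * b + b * b) * Y ≡⟨ join Y M L b τ ⟩
  Y * (2 * (M * M) + 1) * (b * b) + (4 * (M * M) * L * b * Y + 2 * (M * M) * τ * Y) ∎))
  where
  b = 2 + a
  L = suc l
  M = suc m
  X = a ^ L
  Y = b ^ L
  τ = tria L
  split : ∀ X Y M L b τ -> (X * (2 * (M * M)) + 2 * M * Y) * (b * b) + (4 * (M * M) * L * b * Y + 2 * (M * M) * τ * Y) ≡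
   2 * (M * M) * (X * (b * b) + 2 * L * (b * Y)) + (2 * (M * M) * τ + 2 * M * (b * b)) * Y
  split = sv
  join : ∀ Y M L b τ -> 2 * (M * M) * (Y * (b * b + τ)) + (4 * (M * M) * L * b + b * b) * Y ≡
   Y * (2 * (M * M) + 1) * (b * b) + (4 * (M * M) * L * b * Y + 2 * (M * M) * τ * Y)
  join = sv
  b≡ : b ≡ suc (2 * (L * M))
  b≡ = cg suc a≡
  expand : ∀ l m -> let L = suc l; M = suc m; b = suc (2 * (L * M)) in
   2 * (M * M) * (2 * (L * l)) + 2 * M * (b * b) + (4 * (l * M) + 2 * M + 1) ≡ 4 * (M * M) * L * b + b * b
  expand = sv
  polynomial : 2 * (M * M) * τ + 2 * M * (b * b) ≤ 4 * (M * M) * L * b + b * b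
  polynomial = sb2 (\ b τ -> 2 * (M * M) * τ + 2 * M * (b * b) ≤ 4 * (M * M) * L * b + b * b) (sy b≡) (sy (tv l))
   (≤-trans (m≤m+n _ (4 * (l * M) + 2 * M + 1)) (≤-reflexive (expand l m)))
 module _ (a : ℕ) where
  base : Frac
  base = a ∕ (2 + a)
  baup : ∀ l m -> suc a ≡ 2 * (suc l * suc m) -> base ↑ (suc l * suc m) ≼ ((2 * (suc m * suc m) + 1 ∸ 2 * suc m) ∕ (2 * (suc m * suc m))) ↑ suc m
  baup l m a≡ = sb (_≼ ((2 * (suc m * suc m) + 1 ∸ 2 * suc m) ∕ (2 * (suc m * suc m))) ↑ suc m) (↑* base (suc l) (suc m)) (↑m {base ↑ suc l} {(2 * (suc m * suc m) + 1 ∸ 2 * suc m) ∕ (2 * (suc m * suc m))} (suc m) (cross (begin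
   a ^ suc l * (2 * (suc m * suc m)) ≡⟨ m+n∸n≡m _ (2 * suc m * (2 + a) ^ suc l) ⟨
   a ^ suc l * (2 * (suc m * suc m)) + 2 * suc m * (2 + a) ^ suc l ∸ 2 * suc m * (2 + a) ^ suc l ≤⟨ ∸-monoˡ-≤ (2 * suc m * (2 + a) ^ suc l) (eu a l m a≡) ⟩
   (2 + a) ^ suc l * (2 * (suc m * suc m) + 1) ∸ 2 * suc m * (2 + a) ^ suc l ≡⟨ cg (_∸ 2 * suc m * (2 + a) ^ suc l) (*-comm ((2 + a) ^ suc l) _) ⟩
   (2 * (suc m * suc m) + 1) * (2 + a) ^ suc l ∸ 2 * suc m * (2 + a) ^ suc l ≡⟨ *-distribʳ-∸ ((2 + a) ^ suc l) (2 * (suc m * suc m) + 1) (2 * suc m) ⟨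
   (2 * (suc m * suc m) + 1 ∸ 2 * suc m) * (2 + a) ^ suc l ∎)))
  -- The matching lower bound: (2M-1)/(2M+1) with M = p + 1 is the first Padé approximant of
  -- exp(-1/M), and `arsu` puts it below base^(l+1).
  bl : ∀ l p -> suc a ≡ 2 * (suc l * suc p) -> (suc (2 * p) ∕ (3 + 2 * p)) ↑ suc p ≼ base ↑ (suc l * suc p)
  bl l p a≡ = sb ((suc (2 * p) ∕ (3 + 2 * p)) ↑ suc p ≼_) (↑* base (suc l) (suc p)) (↑m {suc (2 * p) ∕ (3 + 2 * p)} {base ↑ suc l} (suc p)
   (cross (*-cancelˡ-≤ (suc l) (begin
    suc l * (suc (2 * p) * (2 + a) ^ suc l) ≡⟨ *-assoc (suc l) (suc (2 * p)) _ ⟨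
    suc l * suc (2 * p) * (2 + a) ^ suc l ≤⟨ arsu (suc l) (suc l * suc (2 * p)) a (tr a≡ (split l p)) ⟩
    (suc a + suc l) * a ^ suc l ≡⟨ cg (\ z -> (z + suc l) * a ^ suc l) a≡ ⟩
    (2 * (suc l * suc p) + suc l) * a ^ suc l ≡⟨ join l p (a ^ suc l) ⟩
    suc l * (a ^ suc l * (3 + 2 * p)) ∎))))
   where
   split : ∀ l p -> 2 * (suc l * suc p) ≡ suc l * suc (2 * p) + suc l
   split = sv
   join : ∀ l p x -> (2 * (suc l * suc p) + suc l) * x ≡ suc l * (x * (3 + 2 * p))
   join = sv

-- Products of kernels along a reduction, and central binomial coefficients.

module ChainBounds where
 open Estimates
 open Kernel using (cho; chra; chsy; absorption; ker; ke)
 open Forms using (Ch; done; step; piv; pipr)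
 open Walks using (𝟎)
 open Positivity using (times)
 open import Data.Nat
 open import Data.Nat.Properties
 open import Data.Nat.DivMod using (m/n*n≡m; /-monoʳ-≤)
 open import Data.Nat.Divisibility using (_∣_)
 open import Data.Nat.Tactic.RingSolver using () renaming (solve-∀ to sv)
 open import Data.Integer using (ℤ; ∣_∣; 0ℤ)
 open import Data.Vec using (Vec; []; _∷_; map)
 open import Data.Vec.Relation.Unary.All using (All; []; _∷_)
 open ≤-Reasoning
 private variable n : ℕ
 norm² : ℤ -> ℕ
 norm² v = ∣ v ∣ * ∣ v ∣
 weig : (ℕ -> ℕ) -> Vec ℕ n -> Vec ℤ n -> ℕ
 weig r [] [] = 0
 weig r (s ∷ ss) (v ∷ vs) = r s * norm² v + weig r ss vs
 weightℕ : Ch n -> Vec ℤ n -> ℕ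
 weightℕ done [] = 0
 weightℕ (step p b c) (v ∷ vs) = piv c * norm² v + weightℕ c vs
 sc : ℕ -> Vec ℕ n -> Vec ℕ n
 sc j = map (j *_)
 tisc : ∀ j s (c : Ch n) -> times (j * s) c ≡ sc j (times s c)
 tisc j s done = refl
 tisc j s (step p b c) = cg2 _∷_ (*-assoc j s (suc p)) (tr (cg (\ z -> times z c) (*-assoc j s (suc p))) (tisc j (s * suc p) c))
 kaz : ∀ t -> ker t 0ℤ ≡ cho (t + t) t
 kaz t = cg (cho (t + t)) (+-identityʳ t)
 posp : ∀ x y k l p -> x * y * p ^ (k + l) ≡ (x * p ^ k) * (y * p ^ l)
 posp x y k l p = tr (cg (x * y *_) (^-distribˡ-+-* p k l)) (*i x y _ _)
 module Products (a : ℕ) where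
  open Gaussian a
  -- An exact quotient wherever it is used: `a` is chosen so that `suc a` is divisible by all the
  -- odd numbers that occur.
  rate : ℕ -> ℕ -> ℕ
  rate j s = suc a / odd (j * s)
  raeq : ∀ j s -> odd (j * s) ∣ suc a -> rate j s * odd (j * s) ≡ suc a
  raeq j s = m/n*n≡m
  keup : ∀ j (ss : Vec ℕ n) -> All (\ s -> odd (j * s) ∣ suc a) ss -> ∀ v ->
   ke (sc j ss) v * b ^ weig (rate j) ss v ≤ ke (sc j ss) 𝟎 * a ^ weig (rate j) ss v
  keup j [] [] [] = ≤-refl
  keup j (s ∷ ss) (d ∷ ds) (v ∷ vs) = begin
   ker (j * s) v * ke (sc j ss) vs * b ^ (e + f) ≡⟨ posp (ker (j * s) v) _ e f b ⟩
   (ker (j * s) v * b ^ e) * (ke (sc j ss) vs * b ^ f) ≤⟨ *-mono-≤ (≤-trans (cu (rate j s) (j * s) ∣ v ∣ (raeq j s d)) (≤-reflexive (cg (_* a ^ e) (sy (kaz (j * s)))))) (keup j ss ds vs) ⟩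
   (ker (j * s) 0ℤ * a ^ e) * (ke (sc j ss) 𝟎 * a ^ f) ≡⟨ posp (ker (j * s) 0ℤ) _ e f a ⟨
   ker (j * s) 0ℤ * ke (sc j ss) 𝟎 * a ^ (e + f) ∎
   where
   e = rate j s * norm² v
   f = weig (rate j) ss vs
  gap : ℕ -> ℕ -> ℕ -> ℕ
  gap j J s = rate j s ∸ rate J s
  kr : ∀ j J -> j ≤ J -> (ss : Vec ℕ n) -> All (\ s -> odd (j * s) ∣ suc a) ss -> All (\ s -> odd (J * s) ∣ suc a) ss -> ∀ v ->
   ke (sc j ss) v * ke (sc J ss) 𝟎 * b ^ weig (gap j J) ss v ≤
   ke (sc j ss) 𝟎 * ke (sc J ss) v * a ^ weig (gap j J) ss v
  kr j J le [] [] [] [] = ≤-refl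
  kr j J le (s ∷ ss) (d ∷ ds) (d′ ∷ ds′) (v ∷ vs) = begin
   ker (j * s) v * ke (sc j ss) vs * (ker (J * s) 0ℤ * ke (sc J ss) 𝟎) * b ^ (e + f)
    ≡⟨ tr (cg (_* b ^ (e + f)) (*i (ker (j * s) v) _ _ _)) (posp (ker (j * s) v * ker (J * s) 0ℤ) _ e f b) ⟩
   (ker (j * s) v * ker (J * s) 0ℤ * b ^ e) * (ke (sc j ss) vs * ke (sc J ss) 𝟎 * b ^ f)
    ≤⟨ *-mono-≤ first (kr j J le ss ds ds′ vs) ⟩
   (ker (j * s) 0ℤ * ker (J * s) v * a ^ e) * (ke (sc j ss) 𝟎 * ke (sc J ss) vs * a ^ f)
    ≡⟨ tr (cg (_* a ^ (e + f)) (*i (ker (j * s) 0ℤ) _ _ _)) (posp (ker (j * s) 0ℤ * ker (J * s) v) _ e f a) ⟨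
   ker (j * s) 0ℤ * ke (sc j ss) 𝟎 * (ker (J * s) v * ke (sc J ss) vs) * a ^ (e + f) ∎
   where
   e = gap j J s * norm² v
   f = weig (gap j J) ss vs
   js : j * s ≤ J * s
   js = *-monoˡ-≤ s le
   raan : rate J s ≤ rate j s
   raan = /-monoʳ-≤ (suc a) (s≤s (+-mono-≤ js js))
   first : ker (j * s) v * ker (J * s) 0ℤ * b ^ e ≤ ker (j * s) 0ℤ * ker (J * s) v * a ^ e
   first = sb2 (\ x y -> ker (j * s) v * x * b ^ e ≤ y * ker (J * s) v * a ^ e) (sy (kaz (J * s))) (sy (kaz (j * s)))
    (cr (rate j s) (rate J s) (gap j J s) (j * s) (J * s) ∣ v ∣ (sy (m+[n∸m]≡n raan)) (raeq j s d) (raeq J s d′) js)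
  kl : .{{_ : NonZero a}} -> ∀ j (r : ℕ -> ℕ) V (ss : Vec ℕ n) -> All (\ s -> V ≤ j * s × a ≤ 2 * (r s * (j * s ∸ V))) ss ->
   ∀ v -> All (\ v -> ∣ v ∣ ≤ V) v ->
   ke (sc j ss) 𝟎 * a ^ weig r ss v ≤ ke (sc j ss) v * b ^ weig r ss v
  kl j r V [] [] [] [] = ≤-refl
  kl j r V (s ∷ ss) ((V≤ , cond) ∷ conds) (v ∷ vs) (v≤ ∷ vs≤) = begin
   ker (j * s) 0ℤ * ke (sc j ss) 𝟎 * a ^ (e + f) ≡⟨ posp (ker (j * s) 0ℤ) _ e f a ⟩
   (ker (j * s) 0ℤ * a ^ e) * (ke (sc j ss) 𝟎 * a ^ f) ≤⟨ *-mono-≤ (≤-trans (≤-reflexive (cg (_* a ^ e) (kaz (j * s))))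
     (cl (r s) (j * s) ∣ v ∣ (≤-trans v≤ V≤) (≤-trans cond (*-monoʳ-≤ 2 (*-monoʳ-≤ (r s) (∸-monoʳ-≤ (j * s) v≤)))))) (kl j r V ss conds vs vs≤) ⟩
   (ker (j * s) v * b ^ e) * (ke (sc j ss) vs * b ^ f) ≡⟨ posp (ker (j * s) v) _ e f b ⟨
   ker (j * s) v * ke (sc j ss) vs * b ^ (e + f) ∎
   where
   e = r s * norm² v
   f = weig r ss vs
  pivo : ∀ {n} (c : Ch n) -> NonZero (piv c)
  pivo done = _
  pivo (step p b c) = m*n≢0 (suc p) (piv c) {{_}} {{pivo c}}
  module _ (T B K L : ℕ) (r : ℕ -> ℕ) where
   private
    bost : ∀ {n} p (c : Ch n) P -> P * (suc p * piv c) ≤ B -> P * suc p * piv c ≤ B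
    bost p c P = sb (_≤ B) (sy (*-assoc P (suc p) (piv c)))
    bf : ∀ {n} p (c : Ch n) P -> P * (suc p * piv c) ≤ B -> P * suc p ≤ B
    bf p c P le = ≤-trans (m≤m*n (P * suc p) (piv c) {{pivo c}}) (bost p c P le)
    co : ∀ L P s r q y w -> L * (P * s) * r * (q * y) + L * (P * s) * q * w ≡ L * P * (s * q) * (r * y + w)
    co = sv
   -- `P` is the product of the pivots already passed. A coordinate has coefficient piv/P in the
   -- norm and walks for time T P, so a bound on P times its rate, uniform in `P`, transfers to the
   -- whole sum.
   weicom : (∀ P -> .{{NonZero P}} -> P ≤ B -> K ≤ L * P * r (T * P)) ->
    ∀ (c : Ch n) P -> .{{NonZero P}} -> P * piv c ≤ B -> ∀ v -> K * weightℕ c v ≤ L * P * piv c * weig r (times (T * P) c) v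
   weicom cond done P _ [] = ≤-reflexive (tr (*-zeroʳ K) (sy (*-zeroʳ (L * P * 1))))
   weicom cond (step p b c) P le (v ∷ vs) = sb (\ S -> K * (piv c * norm² v + weightℕ c vs) ≤ L * P * (suc p * piv c) * (r S * norm² v + weig r (times S c) vs)) (sy (*-assoc T P (suc p))) (begin
    K * (piv c * norm² v + weightℕ c vs) ≡⟨ *-distribˡ-+ K (piv c * norm² v) (weightℕ c vs) ⟩
    K * (piv c * norm² v) + K * weightℕ c vs ≤⟨ +-mono-≤ (*-monoˡ-≤ (piv c * norm² v) (cond P′ {{m*n≢0 P (suc p)}} (bf p c P le))) (weicom cond c P′ {{m*n≢0 P (suc p)}} (bost p c P le) vs) ⟩
    L * P′ * r (T * P′) * (piv c * norm² v) + L * P′ * piv c * weig r (times (T * P′) c) vs ≡⟨ co L P (suc p) (r (T * P′)) (piv c) (norm² v) (weig r (times (T * P′) c) vs) ⟩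
    L * P * (suc p * piv c) * (r (T * P′) * norm² v + weig r (times (T * P′) c) vs) ∎)
    where
    P′ = P * suc p
   weco : (∀ P -> .{{NonZero P}} -> P ≤ B -> L * P * r (T * P) ≤ K) ->
    ∀ (c : Ch n) P -> .{{NonZero P}} -> P * piv c ≤ B -> ∀ v -> L * P * piv c * weig r (times (T * P) c) v ≤ K * weightℕ c v
   weco cond done P _ [] = ≤-reflexive (tr (*-zeroʳ (L * P * 1)) (sy (*-zeroʳ K)))
   weco cond (step p b c) P le (v ∷ vs) = sb (\ S -> L * P * (suc p * piv c) * (r S * norm² v + weig r (times S c) vs) ≤ K * (piv c * norm² v + weightℕ c vs)) (sy (*-assoc T P (suc p))) (begin
    L * P * (suc p * piv c) * (r (T * P′) * norm² v + weig r (times (T * P′) c) vs) ≡⟨ co L P (suc p) (r (T * P′)) (piv c) (norm² v) (weig r (times (T * P′) c) vs) ⟨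
    L * P′ * r (T * P′) * (piv c * norm² v) + L * P′ * piv c * weig r (times (T * P′) c) vs ≤⟨ +-mono-≤ (*-monoˡ-≤ (piv c * norm² v) (cond P′ {{m*n≢0 P (suc p)}} (bf p c P le))) (weco cond c P′ {{m*n≢0 P (suc p)}} (bost p c P le) vs) ⟩
    K * (piv c * norm² v) + K * weightℕ c vs ≡⟨ *-distribˡ-+ K (piv c * norm² v) (weightℕ c vs) ⟨
    K * (piv c * norm² v + weightℕ c vs) ∎)
    where
    P′ = P * suc p
   Alti : ∀ (G : ℕ -> Set) -> (∀ P -> .{{NonZero P}} -> P ≤ B -> G (T * P)) -> ∀ {n} (c : Ch n) P -> .{{NonZero P}} -> P * piv c ≤ B -> All G (times (T * P) c)
   Alti G good done P _ = []
   Alti G good (step p b c) P le = sb (\ S -> All G (S ∷ times S c)) (sy (*-assoc T P (suc p)))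
    (good (P * suc p) {{m*n≢0 P (suc p)}} (bf p c P le) ∷ Alti G good c (P * suc p) {{m*n≢0 P (suc p)}} (bost p c P le))
 ce : ℕ -> ℕ
 ce t = cho (t + t) t
 cesu : ∀ t -> suc t * ce (suc t) ≡ 2 * odd t * ce t
 cesu t = *-cancelˡ-≡ _ _ (suc t) (begin-equality
  suc t * (suc t * cho (suc t + suc t) (suc t)) ≡⟨ cg (\ m -> suc t * (suc t * cho m (suc t))) (cg suc (+-suc t t)) ⟩
  suc t * (suc t * cho (suc (suc (t + t))) (suc t)) ≡⟨ cg (suc t *_) (absorption (suc (t + t)) t) ⟩
  suc t * (suc (suc (t + t)) * cho (suc (t + t)) t) ≡⟨ swap (suc t) (suc (suc (t + t))) (cho (suc (t + t)) t) ⟩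
  suc (suc (t + t)) * (suc t * cho (suc (t + t)) t) ≡⟨ cg (\ z -> suc (suc (t + t)) * (suc t * z)) (chosym t) ⟩
  suc (suc (t + t)) * (suc t * cho (suc (t + t)) (suc t)) ≡⟨ cg (suc (suc (t + t)) *_) (absorption (t + t) t) ⟩
  suc (suc (t + t)) * (suc (t + t) * ce t) ≡⟨ final t (ce t) ⟩
  suc t * (2 * odd t * ce t) ∎)
  where
  swap : ∀ x y z -> x * (y * z) ≡ y * (x * z)
  swap = sv
  chosym : ∀ t -> cho (suc (t + t)) t ≡ cho (suc (t + t)) (suc t)
  chosym t = tr (cg (\ m -> cho m t) (sy (+-suc t t))) (tr (chsy t (suc t)) (cg (\ m -> cho m (suc t)) (+-suc t t)))
  final : ∀ t c -> suc (suc (t + t)) * (suc (t + t) * c) ≡ suc t * (2 * suc (t + t) * c)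
  final = sv
 private
  scst : ∀ t θ κ -> let X = ce (suc t) * ce (suc t); Y = ce t * ce t in
   X * (κ * suc t + θ) * (suc t * suc t) ≡ 4 * (odd t * odd t) * Y * (κ * suc t + θ)
  scst t θ κ = begin-equality
   X * (κ * suc t + θ) * (suc t * suc t) ≡⟨ shuffle (ce (suc t)) (κ * suc t + θ) (suc t) ⟩
   (suc t * ce (suc t)) * (suc t * ce (suc t)) * (κ * suc t + θ) ≡⟨ cg (\ z -> z * z * (κ * suc t + θ)) (cesu t) ⟩
   (2 * odd t * ce t) * (2 * odd t * ce t) * (κ * suc t + θ) ≡⟨ shuffle′ (odd t) (ce t) (κ * suc t + θ) ⟩
   4 * (odd t * odd t) * Y * (κ * suc t + θ) ∎
   where
   X = ce (suc t) * ce (suc t)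
   Y = ce t * ce t
   shuffle : ∀ c x s -> c * c * x * (s * s) ≡ (s * c) * (s * c) * x
   shuffle = sv
   shuffle′ : ∀ o c x -> (2 * o * c) * (2 * o * c) * x ≡ 4 * (o * o) * (c * c) * x
   shuffle′ = sv
 -- The sequence ce(t)^2 t / 16^t increases to 1/pi; one step is the recurrence `cesu` squared.
 ci : ∀ t d -> ce t * ce t * t * 16 ^ d ≤ ce (t + d) * ce (t + d) * (t + d)
 ci t zero rewrite +-identityʳ t = ≤-reflexive (*-identityʳ _)
 ci t (suc d) = begin
  ce t * ce t * t * (16 * 16 ^ d) ≡⟨ swap (ce t * ce t * t) 16 (16 ^ d) ⟩
  16 * (ce t * ce t * t * 16 ^ d) ≤⟨ *-monoʳ-≤ 16 (ci t d) ⟩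
  16 * (ce u * ce u * u) ≤⟨ onst u ⟩
  ce (suc u) * ce (suc u) * suc u ≡⟨ cg (\ z -> ce z * ce z * z) (+-suc t d) ⟨
  ce (t + suc d) * ce (t + suc d) * (t + suc d) ∎
  where
  u = t + d
  swap : ∀ x y z -> x * (y * z) ≡ y * (x * z)
  swap = sv
  onst : ∀ u -> 16 * (ce u * ce u * u) ≤ ce (suc u) * ce (suc u) * suc u
  onst u = *-cancelʳ-≤ _ _ (suc u * suc u) (begin
   16 * (ce u * ce u * u) * (suc u * suc u) ≤⟨ m≤m+n _ (4 * (ce u * ce u) * suc u) ⟩
   16 * (ce u * ce u * u) * (suc u * suc u) + 4 * (ce u * ce u) * suc u ≡⟨ identity (ce u * ce u) u ⟩
   4 * (odd u * odd u) * (ce u * ce u) * (1 * suc u + 0) ≡⟨ scst u 0 1 ⟨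
   ce (suc u) * ce (suc u) * (1 * suc u + 0) * (suc u * suc u) ≡⟨ cg (\ z -> ce (suc u) * ce (suc u) * z * (suc u * suc u)) (tr (+-identityʳ _) (*-identityˡ (suc u))) ⟩
   ce (suc u) * ce (suc u) * suc u * (suc u * suc u) ∎)
   where
   identity : ∀ Y u -> 16 * (Y * u) * (suc u * suc u) + 4 * Y * suc u ≡ 4 * (suc (u + u) * suc (u + u)) * Y * (1 * suc u + 0)
   identity = sv
 -- With t + 3/10 in place of t the sequence decreases instead. The asymptotic shift is 1/4; any
 -- slightly larger fraction turns the monotonicity around.
 cede : ∀ t d -> .{{_ : NonZero t}} -> ce (t + d) * ce (t + d) * (10 * (t + d) + 3) ≤ ce t * ce t * (10 * t + 3) * 16 ^ d
 cede t zero = ≤-reflexive (tr (cg (\ u -> ce u * ce u * (10 * u + 3)) (+-identityʳ t)) (sy (*-identityʳ _)))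
 cede t@(suc t₀) (suc d) = begin
  ce (t + suc d) * ce (t + suc d) * (10 * (t + suc d) + 3) ≡⟨ cg (\ z -> ce z * ce z * (10 * z + 3)) (+-suc t d) ⟩
  ce (suc (t + d)) * ce (suc (t + d)) * (10 * suc (t + d) + 3) ≤⟨ onst (t₀ + d) ⟩
  16 * (ce (t + d) * ce (t + d) * (10 * (t + d) + 3)) ≤⟨ *-monoʳ-≤ 16 (cede t d) ⟩
  16 * (ce t * ce t * (10 * t + 3) * 16 ^ d) ≡⟨ swap (ce t * ce t * (10 * t + 3)) 16 (16 ^ d) ⟨
  ce t * ce t * (10 * t + 3) * (16 * 16 ^ d) ∎
  where
  swap : ∀ x y z -> x * (y * z) ≡ y * (x * z)
  swap = sv
  onst : ∀ u₀ -> let u = suc u₀ in ce (suc u) * ce (suc u) * (10 * suc u + 3) ≤ 16 * (ce u * ce u * (10 * u + 3))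
  onst u₀ = *-cancelʳ-≤ _ _ (suc u * suc u) (begin
   ce (suc u) * ce (suc u) * (10 * suc u + 3) * (suc u * suc u) ≡⟨ scst u 3 10 ⟩
   4 * (odd u * odd u) * (ce u * ce u) * (10 * suc u + 3) ≤⟨ m≤m+n _ ((8 * u₀ + 4) * (ce u * ce u)) ⟩
   4 * (odd u * odd u) * (ce u * ce u) * (10 * suc u + 3) + (8 * u₀ + 4) * (ce u * ce u) ≡⟨ identity (ce u * ce u) u₀ ⟩
   16 * (ce u * ce u * (10 * u + 3)) * (suc u * suc u) ∎)
   where
   u = suc u₀
   identity : ∀ Y v -> let u = suc v in 4 * (suc (u + u) * suc (u + u)) * Y * (10 * suc u + 3) + (8 * v + 4) * Y ≡ 16 * (Y * (10 * u + 3)) * (suc u * suc u)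
   identity = sv
 vo : Vec ℕ n -> ℕ
 vo [] = 1
 vo (s ∷ ss) = 4 ^ s * vo ss
 module CentralProducts (j d : ℕ) where
  J : ℕ
  J = j + d
  cen : Vec ℕ n -> ℕ
  cen ss = vo ss ^ d * ke (sc j ss) 𝟎
  c∷ : ∀ s (ss : Vec ℕ n) -> cen (s ∷ ss) ≡ ((4 ^ s) ^ d * ce (j * s)) * cen ss
  c∷ s ss = tr (cg2 _*_ (^-distrib-* (4 ^ s) (vo ss) d) (cg (_* ke (sc j ss) 𝟎) (kaz (j * s)))) (*i ((4 ^ s) ^ d) (vo ss ^ d) (ce (j * s)) (ke (sc j ss) 𝟎))
  si : ∀ s -> (4 ^ s) ^ d * (4 ^ s) ^ d ≡ 16 ^ (d * s)
  si s = tr (sy (^-distrib-* (4 ^ s) (4 ^ s) d)) (tr (cg (_^ d) (sy (^-distrib-* 4 4 s))) (tr (^-*-assoc 16 s d) (cg (16 ^_) (*-comm s d))))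
  private
   reg : ∀ x c -> (x * c) * (x * c) ≡ (x * x) * (c * c)
   reg = sv
   products : ∀ A C j y -> (A * C) * (A * C) * (j * y) ≡ ((A * A) * j) * ((C * C) * y)
   products = sv
   J*s : ∀ s -> j * s + d * s ≡ J * s
   J*s s = sy (*-distribʳ-+ s j d)
  coup : ∀ s -> .{{NonZero s}} -> ((4 ^ s) ^ d * ce (j * s)) * ((4 ^ s) ^ d * ce (j * s)) * j ≤ ce (J * s) * ce (J * s) * J
  coup s = *-cancelʳ-≤ _ _ s (begin
   ((4 ^ s) ^ d * c) * ((4 ^ s) ^ d * c) * j * s ≡⟨ cg (\ z -> z * j * s) (tr (reg ((4 ^ s) ^ d) c) (cg (_* (c * c)) (si s))) ⟩
   16 ^ (d * s) * (c * c) * j * s ≡⟨ shuffle (16 ^ (d * s)) (c * c) j s ⟩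
   c * c * (j * s) * 16 ^ (d * s) ≤⟨ ci (j * s) (d * s) ⟩
   ce (j * s + d * s) * ce (j * s + d * s) * (j * s + d * s) ≡⟨ cg (\ z -> ce z * ce z * z) (J*s s) ⟩
   ce (J * s) * ce (J * s) * (J * s) ≡⟨ *-assoc (ce (J * s) * ce (J * s)) J s ⟨
   ce (J * s) * ce (J * s) * J * s ∎)
   where
   c = ce (j * s)
   shuffle : ∀ p c j s -> p * c * j * s ≡ c * (j * s) * p
   shuffle = sv
  -- `cen` pads the walk of time `j` with full mass for the missing time `d`. Relative to mass the
  -- square of the peak behaves like 1/j in each coordinate; working with squares avoids
  -- half-integral powers.
  ceup : ∀ {n} (ss : Vec ℕ n) -> All NonZero ss -> cen ss * cen ss * j ^ n ≤ ke (sc J ss) 𝟎 * ke (sc J ss) 𝟎 * J ^ n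
  ceup [] [] rewrite ^-zeroˡ d = ≤-refl
  ceup {suc n} (s ∷ ss) (s≢0 ∷ ss≢) = begin
   cen (s ∷ ss) * cen (s ∷ ss) * (j * j ^ n) ≡⟨ tr (cg (\ z -> z * z * (j * j ^ n)) (c∷ s ss)) (products A (cen ss) j (j ^ n)) ⟩
   (A * A * j) * (cen ss * cen ss * j ^ n) ≤⟨ *-mono-≤ (coup s {{s≢0}}) (ceup ss ss≢) ⟩
   (ce (J * s) * ce (J * s) * J) * (K * K * J ^ n) ≡⟨ products (ce (J * s)) K J (J ^ n) ⟨
   (ce (J * s) * K) * (ce (J * s) * K) * (J * J ^ n) ≡⟨ cg (\ z -> (z * K) * (z * K) * (J * J ^ n)) (kaz (J * s)) ⟨
   ke (sc J (s ∷ ss)) 𝟎 * ke (sc J (s ∷ ss)) 𝟎 * J ^ suc n ∎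
   where
   A = (4 ^ s) ^ d * ce (j * s)
   K = ke (sc J ss) 𝟎
  colo : ∀ T s -> .{{NonZero j}} -> .{{NonZero s}} -> T ≤ s -> ce (J * s) * ce (J * s) * (J * T) ≤ ((4 ^ s) ^ d * ce (j * s)) * ((4 ^ s) ^ d * ce (j * s)) * (j * suc T)
  colo T s T≤s = *-cancelʳ-≤ _ _ (10 * s) {{m*n≢0 10 s}} (begin
   ce (J * s) * ce (J * s) * (J * T) * (10 * s) ≡⟨ shuf (ce (J * s) * ce (J * s)) J T s ⟩
   ce (J * s) * ce (J * s) * (10 * (J * s)) * T ≤⟨ *-monoˡ-≤ T (*-monoʳ-≤ (ce (J * s) * ce (J * s)) (m≤m+n _ 3)) ⟩
   ce (J * s) * ce (J * s) * (10 * (J * s) + 3) * T ≡⟨ cg (\ z -> ce z * ce z * (10 * z + 3) * T) (sy (J*s s)) ⟩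
   ce (j * s + d * s) * ce (j * s + d * s) * (10 * (j * s + d * s) + 3) * T ≤⟨ *-monoˡ-≤ T (cede (j * s) (d * s) {{m*n≢0 j s}}) ⟩
   c * c * (10 * (j * s) + 3) * 16 ^ (d * s) * T ≡⟨ shu (c * c) (10 * (j * s) + 3) (16 ^ (d * s)) T ⟩
   16 ^ (d * s) * (c * c) * ((10 * (j * s) + 3) * T) ≤⟨ *-monoʳ-≤ (16 ^ (d * s) * (c * c)) (begin
    (10 * (j * s) + 3) * T ≡⟨ shuffle₄ (10 * (j * s)) T ⟩
    10 * (j * s) * T + 3 * T ≤⟨ +-monoʳ-≤ (10 * (j * s) * T) (≤-trans (*-monoʳ-≤ 3 T≤s) (*-mono-≤ {3} {10 * j} (≤-trans (m≤m+n 3 7) (m≤m*n 10 j)) (≤-refl {s}))) ⟩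
    10 * (j * s) * T + 10 * j * s ≡⟨ shuffle₅ j s T ⟩
    (j * suc T) * (10 * s) ∎) ⟩
   16 ^ (d * s) * (c * c) * ((j * suc T) * (10 * s)) ≡⟨ sy (*-assoc (16 ^ (d * s) * (c * c)) (j * suc T) (10 * s)) ⟩
   16 ^ (d * s) * (c * c) * (j * suc T) * (10 * s) ≡⟨ cg (\ z -> z * (j * suc T) * (10 * s)) (tr (reg ((4 ^ s) ^ d) c) (cg (_* (c * c)) (si s))) ⟨
   ((4 ^ s) ^ d * c) * ((4 ^ s) ^ d * c) * (j * suc T) * (10 * s) ∎)
   where
   c = ce (j * s)
   shuf : ∀ C J T s -> C * (J * T) * (10 * s) ≡ C * (10 * (J * s)) * T
   shuf = sv
   shu : ∀ c x p T -> c * x * p * T ≡ p * c * (x * T)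
   shu = sv
   shuffle₄ : ∀ x T -> (x + 3) * T ≡ x * T + 3 * T
   shuffle₄ = sv
   shuffle₅ : ∀ j s T -> 10 * (j * s) * T + 10 * j * s ≡ (j * suc T) * (10 * s)
   shuffle₅ = sv
  celo : ∀ T {n} (ss : Vec ℕ n) -> .{{NonZero j}} -> All NonZero ss -> All (T ≤_) ss ->
   ke (sc J ss) 𝟎 * ke (sc J ss) 𝟎 * (J * T) ^ n ≤ cen ss * cen ss * (j * suc T) ^ n
  celo T [] [] [] rewrite ^-zeroˡ d = ≤-refl
  celo T {suc n} (s ∷ ss) {{j≢0}} (s≢0 ∷ ss≢) (T≤s ∷ T≤ss) = begin
   ke (sc J (s ∷ ss)) 𝟎 * ke (sc J (s ∷ ss)) 𝟎 * (J * T) ^ suc n ≡⟨ cg (\ z -> (z * K) * (z * K) * ((J * T) * (J * T) ^ n)) (kaz (J * s)) ⟩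
   (ce (J * s) * K) * (ce (J * s) * K) * ((J * T) * (J * T) ^ n) ≡⟨ products (ce (J * s)) K (J * T) ((J * T) ^ n) ⟩
   (ce (J * s) * ce (J * s) * (J * T)) * (K * K * (J * T) ^ n) ≤⟨ *-mono-≤ (colo T s {{j≢0}} {{s≢0}} T≤s) (celo T ss ss≢ T≤ss) ⟩
   (A * A * (j * suc T)) * (cen ss * cen ss * (j * suc T) ^ n) ≡⟨ tr (cg (\ z -> z * z * ((j * suc T) * (j * suc T) ^ n)) (c∷ s ss)) (products A (cen ss) (j * suc T) ((j * suc T) ^ n)) ⟨
   cen (s ∷ ss) * cen (s ∷ ss) * (j * suc T) ^ suc n ∎
   where
   A = (4 ^ s) ^ d * ce (j * s)
   K = ke (sc J ss) 𝟎
 tipr : Vec ℕ n -> ℕ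
 tipr [] = 1
 tipr (s ∷ ss) = s * tipr ss
 tpc : ∀ {n} S (c : Ch n) -> tipr (times S c) ≡ S ^ n * pipr c
 tpc S done = refl
 tpc {suc n} S (step p b c) = begin-equality
  S * suc p * tipr (times (S * suc p) c) ≡⟨ cg (S * suc p *_) (tr (tpc (S * suc p) c) (cg (_* pipr c) (^-distrib-* S (suc p) n))) ⟩
  S * suc p * (S ^ n * suc p ^ n * pipr c) ≡⟨ shuffle S (suc p) (S ^ n) (suc p ^ n) (pipr c) ⟩
  S * S ^ n * (suc p * suc p ^ n * pipr c) ∎
  where
  shuffle : ∀ S p x y z -> S * p * (x * y * z) ≡ S * x * (p * y * z)
  shuffle = sv
 -- One numerical check at `t₀` bounds the decreasing sequence of `cede` for all later times, so
 -- that `wn / wd` serves as an upper bound for 1/pi.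
 module CentralLimit (t₀ wn wd : ℕ) (check : ce t₀ * ce t₀ * (10 * t₀ + 3) * wd ≤ wn * 10 * 16 ^ t₀) .{{_ : NonZero t₀}} where
  cenlim : ∀ t -> t₀ ≤ t -> ce t * ce t * t * wd ≤ wn * 16 ^ t
  cenlim t t₀≤t = *-cancelʳ-≤ _ _ 10 (begin
   ce t * ce t * t * wd * 10 ≡⟨ shuffle (ce t * ce t) t wd ⟩
   ce t * ce t * (10 * t) * wd ≤⟨ *-monoˡ-≤ wd (*-monoʳ-≤ (ce t * ce t) (m≤m+n (10 * t) 3)) ⟩
   ce t * ce t * (10 * t + 3) * wd ≤⟨ *-monoˡ-≤ wd (sb (\ u -> ce u * ce u * (10 * u + 3) ≤ ce t₀ * ce t₀ * (10 * t₀ + 3) * 16 ^ e) (m+[n∸m]≡n t₀≤t) (cede t₀ e)) ⟩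
   ce t₀ * ce t₀ * (10 * t₀ + 3) * 16 ^ e * wd ≡⟨ sl (ce t₀ * ce t₀ * (10 * t₀ + 3)) (16 ^ e) wd ⟩
   ce t₀ * ce t₀ * (10 * t₀ + 3) * wd * 16 ^ e ≤⟨ *-monoˡ-≤ (16 ^ e) check ⟩
   wn * 10 * 16 ^ t₀ * 16 ^ e ≡⟨ shuffle′ wn (16 ^ t₀) (16 ^ e) ⟩
   wn * (16 ^ t₀ * 16 ^ e) * 10 ≡⟨ cg (\ z -> wn * z * 10) (tr (sy (^-distribˡ-+-* 16 t₀ e)) (cg (16 ^_) (m+[n∸m]≡n t₀≤t))) ⟩
   wn * 16 ^ t * 10 ∎)
   where
   e = t ∸ t₀
   shuffle : ∀ C t w -> C * t * w * 10 ≡ C * (10 * t) * w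
   shuffle = sv
   sl : ∀ x y z -> x * y * z ≡ x * z * y
   sl = sv
   shuffle′ : ∀ w x y -> w * 10 * x * y ≡ w * (x * y) * 10
   shuffle′ = sv
  celi : ∀ J {n} (ss : Vec ℕ n) -> All (\ s -> t₀ ≤ J * s) ss ->
   ke (sc J ss) 𝟎 * ke (sc J ss) 𝟎 * (J ^ n * tipr ss) * wd ^ n ≤ wn ^ n * (vo ss ^ J * vo ss ^ J)
  celi J [] [] rewrite ^-zeroˡ J = ≤-refl
  celi J {suc n} (s ∷ ss) (le ∷ les) = begin
   ker (J * s) 0ℤ * K * (ker (J * s) 0ℤ * K) * (J * J ^ n * (s * tipr ss)) * (wd * wd ^ n) ≡⟨ cg (\ z -> z * K * (z * K) * (J * J ^ n * (s * tipr ss)) * (wd * wd ^ n)) (kaz (J * s)) ⟩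
   C * K * (C * K) * (J * J ^ n * (s * tipr ss)) * (wd * wd ^ n) ≡⟨ shuffle C K J (J ^ n) s (tipr ss) wd (wd ^ n) ⟩
   (C * C * (J * s) * wd) * (K * K * (J ^ n * tipr ss) * wd ^ n) ≤⟨ *-mono-≤ (cenlim (J * s) le) (celi J ss les) ⟩
   (wn * 16 ^ (J * s)) * (wn ^ n * (vo ss ^ J * vo ss ^ J)) ≡⟨ cg (\ z -> (wn * z) * (wn ^ n * (vo ss ^ J * vo ss ^ J))) (sy (CentralProducts.si 0 J s)) ⟩
   (wn * ((4 ^ s) ^ J * (4 ^ s) ^ J)) * (wn ^ n * (vo ss ^ J * vo ss ^ J)) ≡⟨ shuffle′ wn ((4 ^ s) ^ J) (wn ^ n) (vo ss ^ J) ⟩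
   (wn * wn ^ n) * (((4 ^ s) ^ J * vo ss ^ J) * ((4 ^ s) ^ J * vo ss ^ J)) ≡⟨ cg (\ z -> (wn * wn ^ n) * (z * z)) (^-distrib-* (4 ^ s) (vo ss) J) ⟨
   wn ^ suc n * (vo (s ∷ ss) ^ J * vo (s ∷ ss) ^ J) ∎
   where
   C = ce (J * s)
   K = ke (sc J ss) 𝟎
   shuffle : ∀ C K J y s t w z -> C * K * (C * K) * (J * y * (s * t)) * (w * z) ≡ (C * C * (J * s) * w) * (K * K * (y * t) * z)
   shuffle = sv
   shuffle′ : ∀ w x y z -> (w * (x * x)) * (y * (z * z)) ≡ (w * y) * ((x * z) * (x * z))
   shuffle′ = sv

-- Kernel values at lattice vectors of given norm.

module Limits where
 open Estimates
 open Fractions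
 open ChainBounds
 open Kernel using (ke)
 open Forms using (Ch; piv)
 open Walks using (𝟎)
 open Positivity using (times)
 open import Data.Nat hiding (compare)
 open import Data.Nat.Properties
 open import Data.Nat.DivMod using (m/n*n≡m)
 open import Data.Nat.Divisibility using (_∣_)
 open import Data.Nat.Tactic.RingSolver using () renaming (solve-∀ to sv)
 open import Data.Integer using (ℤ; ∣_∣)
 open import Data.Vec using (Vec)
 open import Data.Vec.Relation.Unary.All using (All)
 import Data.Vec.Relation.Unary.All as All
 open ≤-Reasoning
 private variable n : ℕ
 den^ : ∀ ν k -> NonZero (den ν ^ k)
 den^ (_ ∕ d) k = m^n≢0 d k
 canpow : ∀ (A B k₁ k₂ a b : ℕ) -> A * b ≤ B * a -> .{{NonZero b}} -> .{{NonZero k₂}} -> a * k₂ ≤ k₁ * b -> A * k₂ ≤ B * k₁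
 canpow A B k₁ k₂ a b le ratio = *-cancelʳ-≤ _ _ b (begin
  A * k₂ * b ≡⟨ sl A k₂ b ⟩
  A * b * k₂ ≤⟨ *-monoˡ-≤ k₂ le ⟩
  B * a * k₂ ≡⟨ *-assoc B a k₂ ⟩
  B * (a * k₂) ≤⟨ *-monoʳ-≤ B ratio ⟩
  B * (k₁ * b) ≡⟨ *-assoc B k₁ b ⟨
  B * k₁ * b ∎)
  where
  sl : ∀ x y z -> x * y * z ≡ x * z * y
  sl = sv
 module Context {n : ℕ} (c : Ch n) (a T N q : ℕ) (a≡ : suc a ≡ 2 * q) (N² : N * N ≡ 18 * T) .{{_ : NonZero T}} .{{_ : NonZero q}} where
  open Products a
  ss : Vec ℕ n
  ss = times T c
  -- The walk coordinates of a lattice vector of norm 2k, by the completed squares.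
  Ha : Vec ℤ n -> ℕ -> Set
  Ha v k = weightℕ c v ≡ N * N * (piv c * (2 * k))
  one≤ : 1 * piv c ≤ piv c
  one≤ = ≤-reflexive (*-identityˡ _)
  -- The constant 36 is 18 from the mesh `N * N ≡ 18 * T` times 2 from the norm 2k; the factor
  -- `piv c` cancels.
  compare : ∀ K L (r : ℕ -> ℕ) -> (∀ P -> .{{NonZero P}} -> P ≤ piv c -> K ≤ L * P * r (T * P)) -> ∀ v k -> Ha v k -> K * (36 * T * k) ≤ L * weig r ss v
  compare K L r cond v k norm = *-cancelʳ-≤ _ _ (piv c) {{pivo c}} (begin
   K * (36 * T * k) * piv c ≡⟨ shuffle K T k (piv c) ⟩
   K * (18 * T * (piv c * (2 * k))) ≡⟨ cg (K *_) (tr (cg (_* (piv c * (2 * k))) (sy N²)) (sy norm)) ⟩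
   K * weightℕ c v ≤⟨ sb (\ S -> K * weightℕ c v ≤ L * 1 * piv c * weig r (times S c) v) (*-identityʳ T) (weicom T (piv c) K L r cond c 1 one≤ v) ⟩
   L * 1 * piv c * weig r ss v ≡⟨ shu L (piv c) (weig r ss v) ⟩
   L * weig r ss v * piv c ∎)
   where
   shuffle : ∀ K T k p -> K * (36 * T * k) * p ≡ K * (18 * T * (p * (2 * k)))
   shuffle = sv
   shu : ∀ L p w -> L * 1 * p * w ≡ L * w * p
   shu = sv
  comp : ∀ K L (r : ℕ -> ℕ) -> (∀ P -> .{{NonZero P}} -> P ≤ piv c -> L * P * r (T * P) ≤ K) -> ∀ v k -> Ha v k -> L * weig r ss v ≤ K * (36 * T * k)
  comp K L r cond v k norm = *-cancelʳ-≤ _ _ (piv c) {{pivo c}} (begin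
   L * weig r ss v * piv c ≡⟨ shu L (piv c) (weig r ss v) ⟨
   L * 1 * piv c * weig r ss v ≤⟨ sb (\ S -> L * 1 * piv c * weig r (times S c) v ≤ K * weightℕ c v) (*-identityʳ T) (weco T (piv c) K L r cond c 1 one≤ v) ⟩
   K * weightℕ c v ≡⟨ cg (K *_) (tr (cg (_* (piv c * (2 * k))) (sy N²)) (sy norm)) ⟨
   K * (18 * T * (piv c * (2 * k))) ≡⟨ shuffle K T k (piv c) ⟨
   K * (36 * T * k) * piv c ∎)
   where
   shuffle : ∀ K T k p -> K * (36 * T * k) * p ≡ K * (18 * T * (p * (2 * k)))
   shuffle = sv
   shu : ∀ L p w -> L * 1 * p * w ≡ L * w * p
   shu = sv
  bas : num (base a) ≤ den (base a)
  bas = m≤n+m a 2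
  ob : ∀ j P -> .{{NonZero j}} -> .{{NonZero P}} -> odd (j * (T * P)) ≤ j * suc (2 * T) * P
  ob j P = begin
   suc (j * (T * P) + j * (T * P)) ≤⟨ +-monoˡ-≤ (j * (T * P) + j * (T * P)) (positive (j * P) {{m*n≢0 j P}}) ⟩
   j * P + (j * (T * P) + j * (T * P)) ≡⟨ shuffle j T P ⟩
   j * suc (2 * T) * P ∎
   where
   shuffle : ∀ j T P -> j * P + (j * (T * P) + j * (T * P)) ≡ j * suc (2 * T) * P
   shuffle = sv
   positive : ∀ m -> .{{NonZero m}} -> 1 ≤ m
   positive (suc m) = s≤s z≤n
  Od : ℕ -> Set
  Od j = ∀ P -> .{{NonZero P}} -> P ≤ piv c -> odd (j * (T * P)) ∣ suc a
  oddi : ∀ j -> Od j -> All (\ s -> odd (j * s) ∣ suc a) ss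
  oddi j od = sb (\ S -> All (\ s -> odd (j * s) ∣ suc a) (times S c)) (*-identityʳ T) (Alti T (piv c) 0 0 (\ _ -> 0) (\ s -> odd (j * s) ∣ suc a) od c 1 one≤)
  module _ (e₁ : Frac) (e-bound : base a ↑ q ≼ e₁) where
   -- Ideally the value at norm 2k is exp(-36k/j) times the peak. The rates involve 2jTP + 1 rather
   -- than 2jTP, so the exponent falls short by the factor 2T/(2T+1); `au` absorbs this into `g`.
   kebo : ∀ j -> .{{NonZero j}} -> Od j -> ∀ (ν g : Frac) -> e₁ ↑ 36 ∙ g ≼ ν ↑ j -> 1 ∕ 1 ≼ g ↑ (2 * T) ∙ ν ↑ j ->
    ∀ v k -> Ha v k -> ke (sc j ss) v * den ν ^ k ≤ ke (sc j ss) 𝟎 * num ν ^ k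
   kebo j od ν g margin large v k norm = canpow (ke (sc j ss) v) (ke (sc j ss) 𝟎) (num ν ^ k) (den ν ^ k) (a ^ E) ((2 + a) ^ E) (keup j ss (oddi j od) v) {{m^n≢0 (2 + a) E}} {{den^ ν k}} (unc final)
    where
    E = weig (rate j) ss v
    expo : q * (36 * (2 * T)) * k ≤ j * suc (2 * T) * E
    expo = ≤-trans (≤-reflexive (tr (shuffle q T k) (cg (_* (36 * T * k)) (sy a≡)))) (compare (suc a) (j * suc (2 * T)) (rate j) cond v k norm)
     where
     shuffle : ∀ q T k -> q * (36 * (2 * T)) * k ≡ 2 * q * (36 * T * k)
     shuffle = sv
     cond : ∀ P -> .{{NonZero P}} -> P ≤ piv c -> suc a ≤ j * suc (2 * T) * P * rate j (T * P)
     cond P le = begin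
      suc a ≡⟨ raeq j (T * P) (od P le) ⟨
      rate j (T * P) * odd (j * (T * P)) ≤⟨ *-monoʳ-≤ (rate j (T * P)) (ob j P) ⟩
      rate j (T * P) * (j * suc (2 * T) * P) ≡⟨ *-comm (rate j (T * P)) _ ⟩
      j * suc (2 * T) * P * rate j (T * P) ∎
    M = j * suc (2 * T)
    chof : (base a ↑ E) ↑ M ≼ (ν ↑ k) ↑ M
    chof = ≼t {(base a ↑ E) ↑ M} {(base a ↑ q) ↑ (36 * (2 * T) * k)} (sb2 _≼_ (tr (cg (base a ↑_) (*-comm M E)) (sy (↑* (base a) E M))) (tr (cg (base a ↑_) (*-assoc q (36 * (2 * T)) k)) (sy (↑* (base a) q (36 * (2 * T) * k)))) (↑a (base a) bas expo))
     (≼t {q = e₁ ↑ (36 * (2 * T) * k)} (↑m {base a ↑ q} {e₁} (36 * (2 * T) * k) e-bound)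
     (sb2 _≼_ (tr (cg (_↑ k) (↑* e₁ 36 (2 * T))) (↑* e₁ (36 * (2 * T)) k)) (tr (cg (_↑ k) (↑* ν j (suc (2 * T)))) (↑co ν M k))
      (↑m {(e₁ ↑ 36) ↑ (2 * T)} {(ν ↑ j) ↑ suc (2 * T)} k (au {e₁ ↑ 36} {ν ↑ j} {g} (2 * T) margin large))))
    final : base a ↑ E ≼ ν ↑ k
    final = root M chof {{m*n≢0 j (suc (2 * T))}}
     where
     root : ∀ M -> (base a ↑ E) ↑ M ≼ (ν ↑ k) ↑ M -> .{{NonZero M}} -> base a ↑ E ≼ ν ↑ k
     root (suc M) le = ↑c M le
   -- The ideal ratio of the two kernels is exp(-36k(J-j)/(jJ)). The numbers 100 and 101 cover the
   -- loss (2T/(2T+1))^2 from both rates.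
   kt : ∀ j J -> .{{NonZero j}} -> .{{NonZero J}} -> j ≤ J -> Od j -> Od J -> suc (2 * T) * suc (2 * T) * 100 ≤ 101 * (4 * (T * T)) ->
    ∀ (ν : Frac) -> e₁ ↑ (3600 * (J ∸ j)) ≼ ν ↑ (101 * (j * J)) -> ∀ v k -> Ha v k ->
    ke (sc j ss) v * ke (sc J ss) 𝟎 * den ν ^ k ≤ ke (sc j ss) 𝟎 * ke (sc J ss) v * num ν ^ k
   kt j J j≤J od od′ Tl ν margin v k norm = canpow (ke (sc j ss) v * ke (sc J ss) 𝟎) (ke (sc j ss) 𝟎 * ke (sc J ss) v) (num ν ^ k) (den ν ^ k) (a ^ F) ((2 + a) ^ F) (kr j J j≤J ss (oddi j od) (oddi J od′) v) {{m^n≢0 (2 + a) F}} {{den^ ν k}} (unc final)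
    where
    F = weig (gap j J) ss v
    M = 101 * (j * J)
    expo : q * (3600 * (J ∸ j)) * k ≤ M * F
    expo = *-cancelˡ-≤ (4 * (T * T)) {{m*n≢0 4 (T * T) {{_}} {{m*n≢0 T T}}}} (begin
     4 * (T * T) * (q * (3600 * (J ∸ j)) * k) ≡⟨ shuffle q T k (J ∸ j) ⟩
     100 * (2 * T * (J ∸ j) * (2 * q) * (36 * T * k)) ≡⟨ cg (\ z -> 100 * (2 * T * (J ∸ j) * z * (36 * T * k))) (sy a≡) ⟩
     100 * (2 * T * (J ∸ j) * suc a * (36 * T * k)) ≤⟨ *-monoʳ-≤ 100 (compare (2 * T * (J ∸ j) * suc a) (j * J * (suc (2 * T) * suc (2 * T))) (gap j J) cond v k norm) ⟩
     100 * (j * J * (suc (2 * T) * suc (2 * T)) * F) ≡⟨ shu (j * J) (suc (2 * T) * suc (2 * T)) F ⟩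
     suc (2 * T) * suc (2 * T) * 100 * (j * J * F) ≤⟨ *-monoˡ-≤ (j * J * F) Tl ⟩
     101 * (4 * (T * T)) * (j * J * F) ≡⟨ shuffle₃ (T * T) (j * J) F ⟩
     4 * (T * T) * (M * F) ∎)
     where
     shuffle : ∀ q T k d -> 4 * (T * T) * (q * (3600 * d) * k) ≡ 100 * (2 * T * d * (2 * q) * (36 * T * k))
     shuffle = sv
     shu : ∀ x y F -> 100 * (x * y * F) ≡ y * 100 * (x * F)
     shu = sv
     shuffle₃ : ∀ t x F -> 101 * (4 * t) * (x * F) ≡ 4 * t * (101 * x * F)
     shuffle₃ = sv
     cond : ∀ P -> .{{NonZero P}} -> P ≤ piv c -> 2 * T * (J ∸ j) * suc a ≤ j * J * (suc (2 * T) * suc (2 * T)) * P * gap j J (T * P)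
     cond P le = *-cancelˡ-≤ P (begin
      P * (2 * T * (J ∸ j) * suc a) ≡⟨ ar P T (J ∸ j) (suc a) ⟩
      (J ∸ j) * (T * P) * 2 * suc a ≡⟨ cg (_* suc a) (sy difference) ⟩
      (o′ ∸ o) * suc a ≡⟨ *-distribʳ-∸ (suc a) o′ o ⟩
      o′ * suc a ∸ o * suc a ≡⟨ cg2 _∸_ (tr (cg (o′ *_) (sy (raeq j s (od P le)))) (sh o′ (rate j s) o)) (tr (cg (o *_) (sy (raeq J s (od′ P le)))) (tr (sh o (rate J s) o′) (cg (rate J s *_) (*-comm o o′)))) ⟩
      rate j s * (o′ * o) ∸ rate J s * (o′ * o) ≡⟨ *-distribʳ-∸ (o′ * o) (rate j s) (rate J s) ⟨
      gap j J s * (o′ * o) ≤⟨ *-monoʳ-≤ (gap j J s) (*-mono-≤ (ob J P) (ob j P)) ⟩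
      gap j J s * (J * suc (2 * T) * P * (j * suc (2 * T) * P)) ≡⟨ arra (gap j J s) J (suc (2 * T)) P j ⟩
      P * (j * J * (suc (2 * T) * suc (2 * T)) * P * gap j J s) ∎)
      where
      s = T * P
      o = odd (j * s)
      o′ = odd (J * s)
      ar : ∀ P T d a -> P * (2 * T * d * a) ≡ d * (T * P) * 2 * a
      ar = sv
      arra : ∀ g J t P j -> g * (J * t * P * (j * t * P)) ≡ P * (j * J * (t * t) * P * g)
      arra = sv
      sh : ∀ x r y -> x * (r * y) ≡ r * (x * y)
      sh = sv
      difference : o′ ∸ o ≡ (J ∸ j) * s * 2
      difference = tr (cg (_∸ (j * s + j * s)) (cg2 _+_ (sy eq) (sy eq))) (tr (cg (_∸ (j * s + j * s)) (perm (j * s) ((J ∸ j) * s))) (m+n∸m≡n (j * s + j * s) _))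
       where
       eq : j * s + (J ∸ j) * s ≡ J * s
       eq = tr (sy (*-distribʳ-+ s j (J ∸ j))) (cg (_* s) (m+[n∸m]≡n j≤J))
       perm : ∀ x y -> x + y + (x + y) ≡ x + x + y * 2
       perm = sv
    chof : (base a ↑ F) ↑ M ≼ (ν ↑ k) ↑ M
    chof = ≼t {(base a ↑ F) ↑ M} {(base a ↑ q) ↑ (3600 * (J ∸ j) * k)} (sb2 _≼_ (tr (cg (base a ↑_) (*-comm M F)) (sy (↑* (base a) F M))) (tr (cg (base a ↑_) (*-assoc q (3600 * (J ∸ j)) k)) (sy (↑* (base a) q (3600 * (J ∸ j) * k)))) (↑a (base a) bas expo))
     (≼t {q = e₁ ↑ (3600 * (J ∸ j) * k)} (↑m {base a ↑ q} {e₁} (3600 * (J ∸ j) * k) e-bound)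
     (sb2 _≼_ (↑* e₁ (3600 * (J ∸ j)) k) (↑co ν M k) (↑m {e₁ ↑ (3600 * (J ∸ j))} {ν ↑ M} k margin)))
    final : base a ↑ F ≼ ν ↑ k
    final = root M chof {{m*n≢0 101 (j * J) {{_}} {{m*n≢0 j J}}}}
     where
     root : ∀ M -> (base a ↑ F) ↑ M ≼ (ν ↑ k) ↑ M -> .{{NonZero M}} -> base a ↑ F ≼ ν ↑ k
     root (suc M) le = ↑c M le
  module _ (e₀ : Frac) (e-bound : e₀ ≼ base a ↑ q) (R : ℕ) .{{_ : NonZero R}} where
   -- The ideal rate q/(js) inflated by 1 + 1/R. The inflation makes room for the displacement `V`
   -- in the Bernoulli estimate once (R+1)V is at most T.
   rat : ℕ -> ℕ -> ℕ
   rat j s = qura j s * suc R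
    where
    qura : ℕ -> ℕ -> ℕ
    qura j s = q / suc (pred (R * (j * s)))
   Ti : ℕ -> Set
   Ti j = ∀ P -> .{{NonZero P}} -> P ≤ piv c -> R * (j * (T * P)) ∣ q
   kb : ∀ j -> .{{NonZero j}} -> .{{NonZero a}} -> Ti j -> ∀ V -> suc R * V ≤ T -> ∀ (ν g : Frac) -> ν ↑ j ∙ g ≼ e₀ ↑ 36 -> 1 ∕ 1 ≼ g ↑ R ∙ e₀ ↑ 36 ->
    ∀ v k -> All (\ y -> ∣ y ∣ ≤ V) v -> Ha v k -> ke (sc j ss) 𝟎 * num ν ^ k ≤ ke (sc j ss) v * den ν ^ k
   kb j td V Vs ν g margin large v k bounded norm =
    capo (kl j (rat j) V ss conditions v bounded) (unc final)
    where
    E = weig (rat j) ss v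
    capo : ke (sc j ss) 𝟎 * a ^ E ≤ ke (sc j ss) v * (2 + a) ^ E -> num ν ^ k * (2 + a) ^ E ≤ a ^ E * den ν ^ k -> ke (sc j ss) 𝟎 * num ν ^ k ≤ ke (sc j ss) v * den ν ^ k
    capo le ratio = *-cancelʳ-≤ _ _ ((2 + a) ^ E) {{m^n≢0 (2 + a) E}} (begin
     K₀ * num ν ^ k * (2 + a) ^ E ≡⟨ *-assoc K₀ _ _ ⟩
     K₀ * (num ν ^ k * (2 + a) ^ E) ≤⟨ *-monoʳ-≤ K₀ ratio ⟩
     K₀ * (a ^ E * den ν ^ k) ≡⟨ *-assoc K₀ _ _ ⟨
     K₀ * a ^ E * den ν ^ k ≤⟨ *-monoˡ-≤ (den ν ^ k) le ⟩
     K * (2 + a) ^ E * den ν ^ k ≡⟨ sl K _ _ ⟩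
     K * den ν ^ k * (2 + a) ^ E ∎)
     where
     K₀ = ke (sc j ss) 𝟎
     K = ke (sc j ss) v
     sl : ∀ x y z -> x * y * z ≡ x * z * y
     sl = sv
    rateq₀ : ∀ P -> .{{NonZero P}} -> P ≤ piv c -> R * (j * (T * P)) * rat j (T * P) ≡ q * suc R
    rateq₀ P le = go (R * (j * (T * P))) {{ste P}} (td P le)
     where
     j* : ∀ m -> .{{NonZero m}} -> NonZero (j * m)
     j* m = m*n≢0 j m
     R* : ∀ m -> .{{NonZero m}} -> NonZero (R * m)
     R* m = m*n≢0 R m
     ste : ∀ P -> .{{NonZero P}} -> NonZero (R * (j * (T * P)))
     ste P = R* (j * (T * P)) {{j* (T * P) {{m*n≢0 T P}}}}
     go : ∀ m -> .{{NonZero m}} -> m ∣ q -> m * (q / suc (pred m) * suc R) ≡ q * suc R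
     go (suc m) d = tr (sh (suc m) (q / suc m) (suc R)) (cg (_* suc R) (m/n*n≡m d))
      where
      sh : ∀ m x y -> m * (x * y) ≡ x * m * y
      sh = sv
    conditions : All (\ s -> V ≤ j * s × a ≤ 2 * (rat j s * (j * s ∸ V))) ss
    conditions = sb (\ S -> All Good (times S c)) (*-identityʳ T) (Alti T (piv c) 0 0 (\ _ -> 0) Good good c 1 one≤)
     where
     Good : ℕ -> Set
     Good s = V ≤ j * s × a ≤ 2 * (rat j s * (j * s ∸ V))
     good : ∀ P -> .{{NonZero P}} -> P ≤ piv c -> Good (T * P)
     good P le = ≤-trans (m≤n*m V (suc R)) RV , (begin
      a ≤⟨ n≤1+n a ⟩
      suc a ≡⟨ a≡ ⟩
      2 * q ≤⟨ *-monoʳ-≤ 2 (*-cancelʳ-≤ q (rat j (T * P) * (t ∸ V)) (suc R) (begin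
       q * suc R ≡⟨ rateq₀ P le ⟨
       R * t * rat j (T * P) ≤⟨ *-monoˡ-≤ (rat j (T * P)) Rt ⟩
       suc R * (t ∸ V) * rat j (T * P) ≡⟨ sh (suc R) (t ∸ V) (rat j (T * P)) ⟩
       rat j (T * P) * (t ∸ V) * suc R ∎)) ⟩
      2 * (rat j (T * P) * (t ∸ V)) ∎)
      where
      t = j * (T * P)
      T≤t : T ≤ t
      T≤t = ≤-trans (m≤m*n T P) (m≤n*m (T * P) j)
      RV : suc R * V ≤ t
      RV = ≤-trans Vs T≤t
      sh : ∀ x y z -> x * y * z ≡ z * y * x
      sh = sv
      Rt : R * t ≤ suc R * (t ∸ V)
      Rt = begin
       R * t ≡⟨ m+n∸m≡n t (R * t) ⟨
       suc R * t ∸ t ≤⟨ ∸-monoʳ-≤ (suc R * t) RV ⟩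
       suc R * t ∸ suc R * V ≡⟨ *-distribˡ-∸ (suc R) t V ⟨
       suc R * (t ∸ V) ∎
    M = j * R
    expo : M * E ≤ q * (36 * suc R * k)
    expo = *-cancelˡ-≤ T (begin
     T * (M * E) ≡⟨ sh₁ T j R E ⟩
     R * j * T * E ≤⟨ comp (q * suc R) (R * j * T) (rat j) cond v k norm ⟩
     q * suc R * (36 * T * k) ≡⟨ sh₂ q (suc R) T k ⟩
     T * (q * (36 * suc R * k)) ∎)
     where
     sh₁ : ∀ T j R E -> T * (j * R * E) ≡ R * j * T * E
     sh₁ = sv
     sh₂ : ∀ q r T k -> q * r * (36 * T * k) ≡ T * (q * (36 * r * k))
     sh₂ = sv
     cond : ∀ P -> .{{NonZero P}} -> P ≤ piv c -> R * j * T * P * rat j (T * P) ≤ q * suc R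
     cond P le = ≤-reflexive (tr (cg (_* rat j (T * P)) (sh₃ R j T P)) (rateq₀ P le))
      where
      sh₃ : ∀ R j T P -> R * j * T * P ≡ R * (j * (T * P))
      sh₃ = sv
    chof : (ν ↑ k) ↑ M ≼ (base a ↑ E) ↑ M
    chof = ≼t {(ν ↑ k) ↑ M} {e₀ ↑ (36 * suc R * k)}
     (sb2 _≼_ (tr (cg (_↑ k) (↑* ν j R)) (↑co ν M k)) (tr (cg (_↑ k) (↑* e₀ 36 (suc R))) (↑* e₀ (36 * suc R) k)) (↑m {(ν ↑ j) ↑ R} {(e₀ ↑ 36) ↑ suc R} k (au {ν ↑ j} {e₀ ↑ 36} {g} R margin large)))
     (≼t {q = (base a ↑ q) ↑ (36 * suc R * k)} (↑m {e₀} {base a ↑ q} (36 * suc R * k) e-bound)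
     (sb2 _≼_ (sy (↑* (base a) q (36 * suc R * k))) (tr (cg (base a ↑_) (*-comm M E)) (sy (↑* (base a) E M))) (↑a (base a) bas expo)))
    final : ν ↑ k ≼ base a ↑ E
    final = root M chof {{m*n≢0 j R}}
     where
     root : ∀ M -> (ν ↑ k) ↑ M ≼ (base a ↑ E) ↑ M -> .{{NonZero M}} -> ν ↑ k ≼ base a ↑ E
     root (suc M) le = ↑c M le

-- Coefficient lists, and their separation by sign.

module Polynomials where
 open Z
 open import Data.Nat as ℕ using (ℕ; zero; suc)
 open import Data.Integer using (ℤ; +_; -[1+_]; 0ℤ; +[1+_])
 open import Data.Fin using (zero; suc; toℕ)
 open import Data.List using (List; []; _∷_)
 open import Data.Vec using (Vec; lookup; toList) renaming ([] to []ᵥ; _∷_ to _∷ᵥ_)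
 -- Umbral evaluation: `X i` stands for the i-th power of one unit of walking. `X` need not be
 -- multiplicative, so a product of polynomials becomes the iterated evaluation `evmu`.
 ev : List ℤ -> (ℕ -> ℤ) -> ℤ
 ev [] X = 0ℤ
 ev (u ∷ us) X = u * X 0 + ev us (\ i -> X (suc i))
 add : List ℤ -> List ℤ -> List ℤ
 add [] vs = vs
 add (u ∷ us) [] = u ∷ us
 add (u ∷ us) (v ∷ vs) = (u ℤ.+ v) ∷ add us vs
 sca : ℤ -> List ℤ -> List ℤ
 sca c [] = []
 sca c (v ∷ vs) = (c ℤ.* v) ∷ sca c vs
 mul : List ℤ -> List ℤ -> List ℤ
 mul [] vs = []
 mul (u ∷ us) vs = add (sca u vs) (0ℤ ∷ mul us vs)
 evco : ∀ us {X Y : ℕ -> ℤ} -> (∀ i -> X i ≡ Y i) -> ev us X ≡ ev us Y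
 evco [] e = refl
 evco (u ∷ us) e = cg2 _+_ (mc (e 0)) (evco us (\ i -> e (suc i)))
 ea : ∀ us vs X -> ev (add us vs) X ≡ ev us X + ev vs X
 ea [] vs X = sy (+-identityˡ _)
 ea (u ∷ us) [] X = sy (+-identityʳ _)
 ea (u ∷ us) (v ∷ vs) X = tr (cg2 _+_ (tr (mr (+d u v)) (tr (*-comm _ _) (tr (*-distribˡ-+ (X 0) u v) (cg2 _+_ (*-comm _ _) (*-comm _ _))))) (ea us vs _)) (interchange _ _ _ _)
 evsc : ∀ c vs X -> ev (sca c vs) X ≡ c * ev vs X
 evsc c [] X = sy (*-zeroʳ c)
 evsc c (v ∷ vs) X = tr (cg2 _+_ (tr (mr (*d c v)) (*-assoc c v _)) (evsc c vs _)) (sy (*-distribˡ-+ c _ _))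
 ev-* : ∀ us c X -> ev us (\ i -> c * X i) ≡ c * ev us X
 ev-* [] c X = sy (*-zeroʳ c)
 ev-* (u ∷ us) c X = tr (cg2 _+_ (*s u c _) (ev-* us c _)) (sy (*-distribˡ-+ c _ _))
 ev-+ : ∀ us X Y -> ev us (\ i -> X i + Y i) ≡ ev us X + ev us Y
 ev-+ [] X Y = sy (+-identityˡ 0ℤ)
 ev-+ (u ∷ us) X Y = tr (cg2 _+_ (*-distribˡ-+ u _ _) (ev-+ us _ _)) (interchange _ _ _ _)
 evsu : ∀ {n} (u : Vec ℤ n) X -> sum n (\ i -> lk u i * X (toℕ i)) ≡ ev (toList u) X
 evsu []ᵥ X = se _
 evsu (x ∷ᵥ u) X = tr (susu _ _) (ac (evsu u (\ i -> X (suc i))))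
 evmu : ∀ us vs X -> ev (mul us vs) X ≡ ev us (\ i -> ev vs (\ j -> X (i ℕ.+ j)))
 evmu [] vs X = refl
 evmu (u ∷ us) vs X = tr (ea (sca u vs) _ X) (cg2 _+_ (evsc u vs X)
  (tr (cg2 _+_ (*-zeroˡ _) (evmu us vs (\ i -> X (suc i)))) (+-identityˡ _)))
 sumu : ∀ {n} (u : Vec ℤ n) X -> sum n (\ i -> sum n (\ j -> lk u i * lk u j * X (toℕ i ℕ.+ toℕ j))) ≡ ev (mul (toList u) (toList u)) X
 sumu {n} u X = tr (Sc \ i -> tr (Sc \ j -> *-assoc _ _ _) (tr (Σ* n (lk u i) _) (mc (evsu u (\ j -> X (toℕ i ℕ.+ j))))))
  (tr (evsu u (\ i -> ev (toList u) (\ j -> X (i ℕ.+ j)))) (sy (evmu (toList u) (toList u) X)))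
 Terms : Set
 Terms = List (ℕ × ℕ)
 total : Terms -> (ℕ -> ℕ) -> ℕ
 total [] X = 0
 total ((j , c) ∷ ts) X = c ℕ.* X j ℕ.+ total ts X
 posi nega : ℕ -> List ℤ -> Terms
 posi j [] = []
 posi j (+ zero ∷ us) = posi (suc j) us
 posi j (+[1+ c ] ∷ us) = (j , suc c) ∷ posi (suc j) us
 posi j (-[1+ c ] ∷ us) = posi (suc j) us
 nega j [] = []
 nega j (+ c ∷ us) = nega (suc j) us
 nega j (-[1+ c ] ∷ us) = (j , suc c) ∷ nega (suc j) us
 spsi : ∀ j us (X : ℕ -> ℕ) -> ev us (\ i -> + X (j ℕ.+ i)) + + total (nega j us) X ≡ + total (posi j us) X
 spsi j [] X = +-identityʳ 0ℤ
 spsi j (u ∷ us) X = tr (cg (\ e -> u * + X (j ℕ.+ 0) + e + + total (nega j (u ∷ us)) X) (evco us (\ i -> cg (\ m -> + X m) (NP.+-suc j i))))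
   (tr (cg (\ m -> u * + X m + tail + + total (nega j (u ∷ us)) X) (NP.+-identityʳ j)) (bysig u))
  where
  tail = ev us (\ i -> + X (suc j ℕ.+ i))
  IH : tail + + total (nega (suc j) us) X ≡ + total (posi (suc j) us) X
  IH = spsi (suc j) us X
  bysig : ∀ u -> u * + X j + tail + + total (nega j (u ∷ us)) X ≡ + total (posi j (u ∷ us)) X
  bysig (+ zero) = tr (cg (\ z -> z + tail + N) (*-zeroˡ _)) (tr (cg (\ z -> z + N) (+-identityˡ tail)) IH)
   where
   N = + total (nega (suc j) us) X
  bysig +[1+ c ] = tr (+-assoc _ _ _) (tr (cg2 _+_ (sy (pos-* (suc c) (X j))) IH) (sy (pos-+ _ _)))
  bysig -[1+ c ] = tr (ac (pos-+ (suc c ℕ.* X j) _)) (tr (interchange _ _ _ _) (tr (cg2 _+_ cancel IH) (+-identityˡ _)))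
   where
   opaque
    unfolding _+_ _*_
    cancel : -[1+ c ] * + X j + + (suc c ℕ.* X j) ≡ 0ℤ
    cancel = tr (cg2 ℤ._+_ (sy (ZP.neg-distribˡ-* (+ suc c) (+ X j))) (ZP.pos-* (suc c) (X j))) (ZP.+-inverseˡ (+ suc c ℤ.* + X j))

-- The numerical certificate of the linear programming bound.

module Certificate where
 open Polynomials using (Terms; total; posi; nega; mul; add; sca)
 open Fractions
 open Estimates using (odd; ber)
 open ChainBounds using (ce; cesu)
 open Kernel using (cho)
 open import Data.Nat
 open import Data.Nat.Properties
 open import Data.Nat.Tactic.RingSolver using () renaming (solve-∀ to sv)
 open import Data.Bool using (T)
 open import Data.Integer using (ℤ; +_; -[1+_])
 open import Data.List using (List; []; _∷_; map)
 open import Data.List.Relation.Unary.All using (All; []; _∷_)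
 open import Data.List.Relation.Unary.Any using (here; there)
 open import Data.List.Membership.Propositional using (_∈_)
 import Data.List.Relation.Unary.All as All
 open import Data.Vec using (Vec) renaming ([] to []ᵥ; _∷_ to _∷ᵥ_)
 open ≤-Reasoning
 ≼be : ∀ (x y : Frac) -> T (num x * den y ≤ᵇ num y * den x) -> x ≼ y
 ≼be x y t = cross (≤ᵇ⇒≤ (num x * den y) (num y * den x) t)
 -- The two polynomials whose squares make up the auxiliary function. They start in degree 2, so
 -- that no time below 4 occurs, and the largest time is 15.
 u₁ u₂ : Vec ℤ 8
 u₁ = + 0 ∷ᵥ + 0 ∷ᵥ + 3638856 ∷ᵥ -[1+ 153755551 ] ∷ᵥ + 292652164 ∷ᵥ + 9637947860 ∷ᵥ -[1+ 18659589999 ] ∷ᵥ + 7230000000 ∷ᵥ []ᵥ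
 u₂ = + 0 ∷ᵥ + 0 ∷ᵥ -[1+ 18956547 ] ∷ᵥ + 961902000 ∷ᵥ -[1+ 9508427249 ] ∷ᵥ + 21645875000 ∷ᵥ -[1+ 12374999999 ] ∷ᵥ + 0 ∷ᵥ []ᵥ
 -- The multiplier 1480 - 1000 X keeps the value 480 at the trivial frequency X = 1 and is at least
 -- 480 wherever X is at most 1.
 wesq : Vec ℤ 8 -> List ℤ
 wesq u = add (sca (+ 1480) (mul v v)) (+ 0 ∷ sca (-[1+ 999 ]) (mul v v))
  where v = Vec.toList u
 R : List ℤ
 R = add (wesq u₁) (wesq u₂)
 pt nete : Terms
 pt =
  (4 , 551436137896259200) ∷ (6 , 1978637242899161042560) ∷ (8 , 210804488637507418110880) ∷
  (10 , 1583773305605459330128000) ∷ (12 , 1839398729011590800000000) ∷ (14 , 347181563400000000000000) ∷ []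
 nete =
  (5 , 56002345796849595520) ∷ (7 , 29628158841843527921280) ∷ (9 , 757045241942604154797600) ∷
  (11 , 2102574944962819963600000) ∷ (13 , 1040015803695700000000000) ∷ (15 , 52272900000000000000000) ∷ []
 pR : posi 0 R ≡ pt
 pR = refl
 nR : nega 0 R ≡ nete
 nR = refl
 opaque
  R[1] : ℕ
  R[1] = 1544223544830109626240
 opaque
  -- `ν j / D` approximates exp(-36/j), a little above it for even `j`, where the coefficient of the
  -- certificate is positive, and a little below it for odd `j`, where it is negative.
  ν : ℕ -> ℕ
  ν 4 = 12340980479
  ν 5 = 74658580663
  ν 6 = 247875218615
  ν 7 = 584097733328
  ν 8 = 1110899657040
  ν 9 = 1831563886415
  ν 10 = 2732372251111
  ν 11 = 3790291435865
  ν 12 = 4978706846559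
  ν 13 = 6271022476788
  ν 14 = 7642628712044
  ν 15 = 9071795321275
  ν _ = 0
 opaque
  -- In hundredths, an upper bound for exp(-36/j + 36/15), the decay of time `j` relative to time
  -- 15.
  τ : ℕ -> ℕ
  τ 4 = 1
  τ 6 = 3
  τ 8 = 13
  τ 10 = 31
  τ 12 = 56
  τ 14 = 85
  τ _ = 0
 opaque
  D H : ℕ
  D = 100000000000000
  H = 10000000000
 opaque
  -- 360360 is the least common multiple of 1 to 15. In dimension 24 the peak at time `j` is
  -- proportional to j^(-12), so `Λ/ j` clears these denominators.
  Λ : ℕ
  Λ = 360360 ^ 12
 opaque
  unfolding Λ
  Λ/ : ℕ -> ℕ
  Λ/ j = Λ / suc (pred (j ^ 12))
 opaque
  unfolding Λ/ D
  instance
   Λ≢ : NonZero Λ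
   Λ≢ = _
   D≢ : NonZero D
   D≢ = _
 upsu losu : ℕ -> ℕ
 upsu k = total pt (\ j -> Λ/ j * (ν j ^ k * suc H))
 losu k = total nete (\ j -> Λ/ j * (ν j ^ k * H))
 opaque
  -- Bounds for the auxiliary function: `S₀` at the origin, and `μ` per unit of weight at the short
  -- vectors, up to common normalisation.
  S₀ μ : ℕ
  S₀ = 1929573854380045635894689497315918346487252400527283707153211706340086179850153461188000
  μ = 73255717027665484289683410980580500463861357093473973597421204179060963142702828
 -- The argument is half the norm. A pair of vectors of norm 4 or 6 weighs 46, a full frame of norm
 -- 8 weighs 48, and the threshold 46 lies between.
 wo : ℕ -> ℕ
 wo 2 = 23
 wo 3 = 23
 wo 4 = 1
 wo _ = 0
 bu : ℕ -> ℕ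
 bu zero = S₀
 bu (suc k) = μ * wo (suc k)
 opaque
  Fits : ℕ -> Set
  Fits k = upsu k ≤ losu k + bu k * D ^ k
  fbe : ∀ k -> T (upsu k ≤ᵇ losu k + bu k * D ^ k) -> Fits k
  fbe k t = ≤ᵇ⇒≤ (upsu k) (losu k + bu k * D ^ k) t
  fit : ∀ k -> Fits k -> upsu k ≤ losu k + bu k * D ^ k
  fit k fits = fits
 opaque
  unfolding R[1] ν τ D Λ Λ/ S₀
  f0 : Fits 0
  f0 = fbe 0 tt
  -- Half norm 1 does not occur and from 17 on `tasu` takes over, so fifteen numerical checks
  -- remain. In each the positive side carries the factor `suc H` and the negative side `H`, which
  -- leaves a tolerance for the finite mesh.
  f2 : ∀ k -> k ≤ 14 -> Fits (2 + k)
  f2 0 _ = fbe 2 tt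
  f2 1 _ = fbe 3 tt
  f2 2 _ = fbe 4 tt
  f2 3 _ = fbe 5 tt
  f2 4 _ = fbe 6 tt
  f2 5 _ = fbe 7 tt
  f2 6 _ = fbe 8 tt
  f2 7 _ = fbe 9 tt
  f2 8 _ = fbe 10 tt
  f2 9 _ = fbe 11 tt
  f2 10 _ = fbe 12 tt
  f2 11 _ = fbe 13 tt
  f2 12 _ = fbe 14 tt
  f2 13 _ = fbe 15 tt
  f2 14 _ = fbe 16 tt
  f2 (suc (suc (suc (suc (suc (suc (suc (suc (suc (suc (suc (suc (suc (suc (suc k))))))))))))))) (s≤s (s≤s (s≤s (s≤s (s≤s (s≤s (s≤s (s≤s (s≤s (s≤s (s≤s (s≤s (s≤s (s≤s ()))))))))))))))
 tomo : ∀ ts {X Y : ℕ -> ℕ} -> All (\ t -> X (p1 t) ≤ Y (p1 t)) ts -> total ts X ≤ total ts Y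
 tomo [] [] = z≤n
 tomo ((j , c) ∷ ts) (p ∷ ps) = +-mono-≤ (*-monoʳ-≤ c p) (tomo ts ps)
 t∈ : ∀ {j c} ts (X : ℕ -> ℕ) -> (j , c) ∈ ts -> c * X j ≤ total ts X
 t∈ (t ∷ ts) X (here refl) = m≤m+n _ _
 t∈ (t ∷ ts) X (there j∈) = ≤-trans (t∈ ts X j∈) (m≤n+m _ _)
 t* : ∀ ts m (X : ℕ -> ℕ) -> total ts (\ j -> m * X j) ≡ m * total ts X
 t* [] m X = sy (*-zeroʳ m)
 t* ((j , c) ∷ ts) m X = tr (cg2 _+_ (swap c m (X j)) (t* ts m X)) (sy (*-distribˡ-+ m _ _))
  where
  swap : ∀ x y z -> x * (y * z) ≡ y * (x * z)
  swap = sv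
 -- Raising the exponent multiplies each term by at most `b`, so a single check at `k₀` settles the
 -- whole tail.
 tode : ∀ ts (Y τ : ℕ -> ℕ) b Z k₀ -> All (\ t -> τ (p1 t) ≤ b) ts ->
  total ts (\ j -> Y j * τ j ^ k₀) ≤ Z * b ^ k₀ -> ∀ k -> total ts (\ j -> Y j * τ j ^ (k + k₀)) ≤ Z * b ^ (k + k₀)
 tode ts Y τ b Z k₀ τ≤b start zero = start
 tode ts Y τ b Z k₀ τ≤b start (suc k) = begin
  total ts (\ j -> Y j * τ j ^ (suc k + k₀)) ≤⟨ tomo ts {\ j -> Y j * τ j ^ (suc k + k₀)} {\ j -> b * (Y j * τ j ^ (k + k₀))} (All.map (\ {t} -> step (p1 t)) τ≤b) ⟩
  total ts (\ j -> b * (Y j * τ j ^ (k + k₀))) ≡⟨ t* ts b (\ j -> Y j * τ j ^ (k + k₀)) ⟩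
  b * total ts (\ j -> Y j * τ j ^ (k + k₀)) ≤⟨ *-monoʳ-≤ b (tode ts Y τ b Z k₀ τ≤b start k) ⟩
  b * (Z * b ^ (k + k₀)) ≡⟨ swap Z b (b ^ (k + k₀)) ⟨
  Z * b ^ (suc k + k₀) ∎
  where
  swap : ∀ x y z -> x * (y * z) ≡ y * (x * z)
  swap = sv
  step : ∀ j -> τ j ≤ b -> Y j * (τ j * τ j ^ (k + k₀)) ≤ b * (Y j * τ j ^ (k + k₀))
  step j le = ≤-trans (*-monoʳ-≤ (Y j) (*-monoˡ-≤ (τ j ^ (k + k₀)) le)) (≤-reflexive (swap (Y j) b (τ j ^ (k + k₀))))
 opaque
  unfolding R[1] ν τ D Λ Λ/ S₀
  t1 : total pt (\ j -> Λ/ j * τ j ^ 17) ≤ 52272900000000000000000 * Λ/ 15 * 100 ^ 17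
  t1 = ≤ᵇ⇒≤ (total pt (\ j -> Λ/ j * τ j ^ 17)) (52272900000000000000000 * Λ/ 15 * 100 ^ 17) tt
  tasu : ∀ k e -> k ≡ e + 17 -> total pt (\ j -> Λ/ j * τ j ^ k) ≤ 52272900000000000000000 * Λ/ 15 * 100 ^ k
  tasu _ e refl = tode pt Λ/ τ 100 (52272900000000000000000 * Λ/ 15) 17
   (≤ᵇ⇒≤ (τ 4) 100 tt ∷ ≤ᵇ⇒≤ (τ 6) 100 tt ∷ ≤ᵇ⇒≤ (τ 8) 100 tt ∷ ≤ᵇ⇒≤ (τ 10) 100 tt ∷ ≤ᵇ⇒≤ (τ 12) 100 tt ∷ ≤ᵇ⇒≤ (τ 14) 100 tt ∷ []) t1 e
 -- Bounds for 1/e from above and below, and the relative margin 1 + 10^(-10) that pays for finite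
 -- `T` and `Q`.
 e₁ e₀ γ : Frac
 e₁ = 36787944139986239656 ∕ 100000000000000000000
 e₀ = 36787944105723751211 ∕ 100000000000000000000
 γ = 10000000001 ∕ 10000000000
 e₁ch : ((2 * (16384 * 16384) + 1 ∸ 2 * 16384) ∕ (2 * (16384 * 16384))) ↑ 16384 ≼ e₁
 e₁ch = ≼be (((2 * (16384 * 16384) + 1 ∸ 2 * 16384) ∕ (2 * (16384 * 16384))) ↑ 16384) e₁ tt
 e₀ch : e₀ ≼ (suc (2 * 16383) ∕ (3 + 2 * 16383)) ↑ 16384
 e₀ch = ≼be e₀ ((suc (2 * 16383) ∕ (3 + 2 * 16383)) ↑ 16384) tt
 Mar Ma : ℕ -> Set
 Mar j = (e₁ ↑ 36 ∙ γ ≼ (ν j ∕ D) ↑ j) × (D ^ j ≤ 10 ^ 16 * ν j ^ j)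
 Ma j = (ν j ∕ D) ↑ j ∙ γ ≼ e₀ ↑ 36
 record Marginᵗ (j : ℕ) : Set where
  constructor mar
  field
   margin : (37 ∕ 100) ↑ (3600 * (15 ∸ j)) ≼ (τ j ∕ 100) ↑ (101 * (j * 15))
 ec : e₁ ≼ 37 ∕ 100
 ec = ≼be e₁ (37 ∕ 100) tt
 mabyev : ∀ j -> T (num (e₁ ↑ 36 ∙ γ) * den ((ν j ∕ D) ↑ j) ≤ᵇ num ((ν j ∕ D) ↑ j) * den (e₁ ↑ 36 ∙ γ)) -> T (D ^ j ≤ᵇ 10 ^ 16 * ν j ^ j) -> Mar j
 mabyev j t t′ = ≼be (e₁ ↑ 36 ∙ γ) ((ν j ∕ D) ↑ j) t , ≤ᵇ⇒≤ (D ^ j) (10 ^ 16 * ν j ^ j) t′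
 mbe : ∀ j -> T (num ((ν j ∕ D) ↑ j ∙ γ) * den (e₀ ↑ 36) ≤ᵇ num (e₀ ↑ 36) * den ((ν j ∕ D) ↑ j ∙ γ)) -> Ma j
 mbe j t = ≼be ((ν j ∕ D) ↑ j ∙ γ) (e₀ ↑ 36) t
 marbyeva : ∀ j -> T (37 ^ (3600 * (15 ∸ j)) * 100 ^ (101 * (j * 15)) ≤ᵇ τ j ^ (101 * (j * 15)) * 100 ^ (3600 * (15 ∸ j))) -> Marginᵗ j
 marbyeva j t = mar (≼be ((37 ∕ 100) ↑ (3600 * (15 ∸ j))) ((τ j ∕ 100) ↑ (101 * (j * 15))) t)
 opaque
  unfolding R[1] ν τ D Λ Λ/ S₀
  margin⁺ : All (\ t -> Mar (p1 t)) pt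
  margin⁺ = mabyev 4 tt tt ∷ mabyev 6 tt tt ∷ mabyev 8 tt tt ∷
   mabyev 10 tt tt ∷ mabyev 12 tt tt ∷ mabyev 14 tt tt ∷ []
  margin⁻ : All (\ t -> Ma (p1 t)) nete
  margin⁻ = mbe 5 tt ∷ mbe 7 tt ∷ mbe 9 tt ∷
   mbe 11 tt ∷ mbe 13 tt ∷ mbe 15 tt ∷ []
  marginᵗ : All (\ t -> Marginᵗ (p1 t)) pt
  marginᵗ = marbyeva 4 tt ∷ marbyeva 6 tt ∷ marbyeva 8 tt ∷
   marbyeva 10 tt ∷ marbyeva 12 tt ∷ marbyeva 14 tt ∷ []
 Λd : ℕ -> Set
 Λd j = j ^ 12 * Λ/ j ≡ Λ
 opaque
  unfolding R[1] ν τ D Λ Λ/ S₀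
  Λp : All (\ t -> Λd (p1 t)) pt
  Λp = refl ∷ refl ∷ refl ∷ refl ∷ refl ∷ refl ∷ []
  Λn : All (\ t -> Λd (p1 t)) nete
  Λn = refl ∷ refl ∷ refl ∷ refl ∷ refl ∷ refl ∷ []
 opaque
  unfolding Λ/ D
  Λ1 : Λd 15
  Λ1 = refl
  Hm : 1000000000001 ^ 12 * H ≤ 1000000000000 ^ 12 * suc H
  Hm = ≤ᵇ⇒≤ (1000000000001 ^ 12 * H) (1000000000000 ^ 12 * suc H) tt
 e₀si : 100000000000000000000 ^ 36 ≤ 10 ^ 16 * 36787944105723751211 ^ 36
 e₀si = ≤ᵇ⇒≤ (100000000000000000000 ^ 36) (10 ^ 16 * 36787944105723751211 ^ 36) tt
 opaque
  vast : ℕ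
  vast = 10 ^ 16 * 10000000000
  vasp : vast ≡ 10 ^ 16 * 10000000000
  vasp = refl
  vas : 1000000000000 ≤ vast
  vas = ≤ᵇ⇒≤ 1000000000000 vast tt
 -- Bernoulli gives (1 + 1/A)^M at least M/A with A = 10^10. The factor 10^16 covers e^36, which is
 -- all that the fractions fed in here require.
 lapo : ∀ M -> vast ≤ M -> ∀ y -> den y ≤ 10 ^ 16 * num y -> 1 ∕ 1 ≼ γ ↑ M ∙ y
 lapo M M-large y size = cross (begin
  1 * (10000000000 ^ M * den y) ≡⟨ *-identityˡ _ ⟩
  10000000000 ^ M * den y ≤⟨ *-monoʳ-≤ (10000000000 ^ M) size ⟩
  10000000000 ^ M * (10 ^ 16 * num y) ≡⟨ *-assoc (10000000000 ^ M) (10 ^ 16) (num y) ⟨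
  10000000000 ^ M * 10 ^ 16 * num y ≤⟨ *-monoˡ-≤ (num y) power ⟩
  (10000000001) ^ M * num y ≡⟨ *-identityʳ _ ⟨
  (10000000001) ^ M * num y * 1 ∎)
  where
  generic : ∀ A C -> .{{_ : NonZero A}} -> C * A ≤ M -> A ^ M * C ≤ (A + 1) ^ M
  generic A C le = *-cancelʳ-≤ _ _ A (begin
   A ^ M * C * A ≡⟨ *-assoc (A ^ M) C A ⟩
   A ^ M * (C * A) ≤⟨ *-monoʳ-≤ (A ^ M) (≤-trans le (≤-trans (≤-reflexive (sy (*-identityʳ M))) (m≤n+m (M * 1) A))) ⟩
   A ^ M * (A + M * 1) ≤⟨ ber A 1 M ⟩
   (A + 1) ^ M * A ∎)
  power : 10000000000 ^ M * 10 ^ 16 ≤ 10000000001 ^ M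
  power = generic 10000000000 (10 ^ 16) (sb (_≤ M) vasp M-large)
 -- Together they evaluate the central coefficient at 100 by products; Pascal's recursion would
 -- branch exponentially.
 dood factorial : ℕ -> ℕ
 dood zero = 1
 dood (suc t) = 2 * odd t * dood t
 factorial zero = 1
 factorial (suc t) = suc t * factorial t
 cp : ∀ t -> factorial t * ce t ≡ dood t
 cp zero = refl
 cp (suc t) = begin-equality
  suc t * factorial t * ce (suc t) ≡⟨ swap (suc t) (factorial t) (ce (suc t)) ⟩
  factorial t * (suc t * ce (suc t)) ≡⟨ cg (factorial t *_) (cesu t) ⟩
  factorial t * (2 * odd t * ce t) ≡⟨ swa (factorial t) (2 * odd t) (ce t) ⟩
  2 * odd t * (factorial t * ce t) ≡⟨ cg (2 * odd t *_) (cp t) ⟩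
  2 * odd t * dood t ∎
  where
  swap : ∀ x y z -> x * y * z ≡ y * (x * z)
  swap = sv
  swa : ∀ x y z -> x * (y * z) ≡ y * (x * z)
  swa = sv
 opaque
  wn wd : ℕ
  wn = 31846766
  wd = 100000000
 cech : ∀ t -> .{{_ : NonZero (factorial t)}} -> dood t * dood t * (10 * t + 3) * wd ≤ wn * 10 * 16 ^ t * (factorial t * factorial t) ->
  ce t * ce t * (10 * t + 3) * wd ≤ wn * 10 * 16 ^ t
 cech t le = *-cancelʳ-≤ _ _ (factorial t * factorial t) {{m*n≢0 (factorial t) (factorial t)}} (begin
  ce t * ce t * (10 * t + 3) * wd * (factorial t * factorial t) ≡⟨ shuffle (ce t) (10 * t + 3) wd (factorial t) ⟩
  (factorial t * ce t) * (factorial t * ce t) * (10 * t + 3) * wd ≡⟨ cg (\ z -> z * z * (10 * t + 3) * wd) (cp t) ⟩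
  dood t * dood t * (10 * t + 3) * wd ≤⟨ le ⟩
  wn * 10 * 16 ^ t * (factorial t * factorial t) ∎)
  where
  shuffle : ∀ c x w f -> c * c * x * w * (f * f) ≡ (f * c) * (f * c) * x * w
  shuffle = sv
 opaque
  unfolding wn
  c1 : ce 100 * ce 100 * (10 * 100 + 3) * wd ≤ wn * 10 * 16 ^ 100
  c1 = cech 100 (≤ᵇ⇒≤ (dood 100 * dood 100 * (10 * 100 + 3) * wd) (wn * 10 * 16 ^ 100 * (factorial 100 * factorial 100)) tt)
 opaque
  unfolding wn R[1] ν τ D Λ Λ/ S₀
  -- The decisive comparison. The number of grid points in the box times the peak contributes
  -- (18/pi)^12, with `wn / wd` for 1/pi; a total weight of at most 46 * 2^24 would contradict the
  -- lower bound `R[1]`.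
  fich : (18 * wn) ^ 12 * (S₀ + μ * (46 * 2 ^ 24)) < Λ * suc H * R[1] * wd ^ 12
  fich = <ᵇ⇒< ((18 * wn) ^ 12 * (S₀ + μ * (46 * 2 ^ 24))) (Λ * suc H * R[1] * wd ^ 12) tt

-- The lattice as an inner product space over the integers.

module Leech where
 open import Defs using (Mat)
 open Z
 open Forms
 open Walks
 open Determinants using (det; unso)
 open import Data.Nat as ℕ using (ℕ; zero; suc)
 open import Data.Integer as ℤ using (ℤ; +_; 0ℤ; 1ℤ; _≤_; _<_)
 open import Data.Fin using (Fin; zero; suc)
 open import Data.List using (List)
 open import Data.List.Relation.Unary.Unique.Propositional using (Unique)
 open import Data.Vec using (Vec; lookup; tabulate; map)
 open import Tactic.RingSolver using () renaming (solve-∀ to sv)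
 private variable n : ℕ
 infixr 7 _·_
 _·_ : ℤ -> Vec ℤ n -> Vec ℤ n
 c · v = map (c *_) v
 l⊕ : (u v : Vec ℤ n) (i : Fin n) -> lk (u ⊕ v) i ≡ lk u i + lk v i
 l⊕ u v i = VP.lookup-zipWith _+_ i u v
 l· : (c : ℤ) (v : Vec ℤ n) (i : Fin n) -> lk (c · v) i ≡ c * lk v i
 l· c v i = VP.lookup-map i (c *_) v
 l𝟎 : (i : Fin n) -> lk 𝟎 i ≡ 0ℤ
 l𝟎 i = VP.lookup-replicate i 0ℤ
 lookup-injective : {u v : Vec ℤ n} -> (∀ i -> lk u i ≡ lk v i) -> u ≡ v
 lookup-injective {u = u} {v} e = tr (sy (VP.tabulate∘lookup u)) (tr (VP.tabulate-cong e) (VP.tabulate∘lookup v))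
 neg≡ : (v : Vec ℤ n) -> neg v ≡ (- 1ℤ) · v
 neg≡ v = VP.map-cong minu v
  where
  opaque
   unfolding _+_ _*_ -_
   minu : ∀ a -> - a ≡ - 1ℤ * a
   minu = sv ring
 opaque
  evfo : ∀ n (M : Mat n) -> (∀ i j -> M i j ≡ M j i) -> (∀ i -> Σ ℤ \ m -> M i i ≡ m + m) -> ∀ x -> Σ ℤ \ h -> form M x x ≡ h + h
  evfo zero M symmetric even x = 0ℤ , tr (fu M x x) (tr (se _) (sy (+-identityʳ 0ℤ)))
  evfo (suc n) M symmetric even x with even zero | evfo n (\ i j -> M (suc i) (suc j)) (\ i j -> symmetric (suc i) (suc j)) (\ i -> even (suc i)) (\ i -> x (suc i))
  ... | m , e | h , e′ = x zero * (m * x zero) + x zero * β + h , tr expand (tr (cg2 (\ a f -> x zero * (a * x zero) + x zero * β + (x zero * β + f)) e e′) (co (x zero) m β h))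
   where
   open Expansion M symmetric x
   opaque
    unfolding _+_ _*_ -_
    co : ∀ x m b h -> x * ((m + m) * x) + x * b + (x * b + (h + h)) ≡ (x * (m * x) + x * b + h) + (x * (m * x) + x * b + h)
    co = sv ring
 module Lattice (L : Mat n) (symmetric : ∀ i j -> L i j ≡ L j i) where
  opaque
   ⟨_,_⟩ : Vec ℤ n -> Vec ℤ n -> ℤ
   ⟨ x , y ⟩ = form L (lk x) (lk y)
   ⟨s : ∀ x y -> ⟨ x , y ⟩ ≡ ⟨ y , x ⟩
   ⟨s x y = fosy L symmetric (lk x) (lk y)
   ⟨⊕ : ∀ x x′ y -> ⟨ x ⊕ x′ , y ⟩ ≡ ⟨ x , y ⟩ + ⟨ x′ , y ⟩
   ⟨⊕ x x′ y = tr (fc (\ _ _ -> refl) (l⊕ x x′) (\ _ -> refl)) (f+ L (lk x) (lk x′) (lk y))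
   ⟨· : ∀ c x y -> ⟨ c · x , y ⟩ ≡ c * ⟨ x , y ⟩
   ⟨· c x y = tr (fc (\ _ _ -> refl) (l· c x) (\ _ -> refl)) (f* L c (lk x) (lk y))
   ⟨⟩de : ∀ x y -> ⟨ x , y ⟩ ≡ form L (lk x) (lk y)
   ⟨⟩de x y = refl
  ⟨⟩⊕ʳ : ∀ x y y′ -> ⟨ x , y ⊕ y′ ⟩ ≡ ⟨ x , y ⟩ + ⟨ x , y′ ⟩
  ⟨⟩⊕ʳ x y y′ = tr (⟨s x _) (tr (⟨⊕ y y′ x) (cg2 _+_ (⟨s y x) (⟨s y′ x)))
  ⟨⟩·ʳ : ∀ c x y -> ⟨ x , c · y ⟩ ≡ c * ⟨ x , y ⟩
  ⟨⟩·ʳ c x y = tr (⟨s x _) (tr (⟨· c y x) (mc (⟨s y x)))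
  ⟨𝟎 : ∀ y -> ⟨ 𝟎 , y ⟩ ≡ 0ℤ
  ⟨𝟎 y = tr (cg (\ v -> ⟨ v , y ⟩) (lookup-injective \ i -> tr (l𝟎 i) (sy (tr (l· 0ℤ 𝟎 i) (*-zeroˡ _))))) (tr (⟨· 0ℤ 𝟎 y) (*-zeroˡ _))
  ⟨⟩su : ∀ x y -> ⟨ x ⊕ y , x ⊕ y ⟩ ≡ (⟨ x , x ⟩ + ⟨ x , y ⟩) + (⟨ x , y ⟩ + ⟨ y , y ⟩)
  ⟨⟩su x y = tr (⟨⊕ x y (x ⊕ y)) (cg2 _+_ (⟨⟩⊕ʳ x x y) (tr (⟨⟩⊕ʳ y x y) (cg2 _+_ (⟨s y x) refl)))
  ⟨d : ∀ x y -> ⟨ x ⊕ neg y , x ⊕ neg y ⟩ ≡ (⟨ x , x ⟩ - ⟨ x , y ⟩) + (⟨ y , y ⟩ - ⟨ x , y ⟩)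
  ⟨d x y = tr (cg (\ z -> ⟨ x ⊕ z , x ⊕ z ⟩) (neg≡ y)) (tr (⟨⟩su x (- 1ℤ · y)) (tr
    (cg2 (\ p q -> (⟨ x , x ⟩ + p) + (p + q)) (⟨⟩·ʳ (- 1ℤ) x y) (tr (⟨· (- 1ℤ) y _) (mc (⟨⟩·ʳ (- 1ℤ) y y)))) (co _ _ _)))
   where
   opaque
    unfolding _+_ _*_ -_
    co : ∀ a c b -> (a + (- 1ℤ) * c) + ((- 1ℤ) * c + (- 1ℤ) * ((- 1ℤ) * b)) ≡ (a - c) + (b - c)
    co = sv ring
  module Definite (positive : ∀ x -> x ≢ 𝟎 -> 0ℤ < ⟨ x , x ⟩) where
   nonNeg : ∀ x -> 0ℤ ≤ ⟨ x , x ⟩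
   nonNeg x with VP.≡-dec ZP._≟_ x 𝟎
   ... | yes refl = ZP.≤-reflexive (sy (⟨𝟎 𝟎))
   ... | no ne = ZP.<⇒≤ (positive x ne)
   null : ∀ x -> ⟨ x , x ⟩ ≡ 0ℤ -> x ≡ 𝟎
   null x e with VP.≡-dec ZP._≟_ x 𝟎
   ... | yes x≡ = x≡
   ... | no ne = cx (sy e) (ZP.<⇒≢ (positive x ne))
   cau : ∀ x y -> ⟨ x , y ⟩ * ⟨ x , y ⟩ ≤ ⟨ x , x ⟩ * ⟨ y , y ⟩
   cau x y with VP.≡-dec ZP._≟_ y 𝟎
   ... | yes refl = ZP.≤-reflexive (tr (cg (\ z -> z * z) zepr) (tr (*-zeroˡ _) (sy (tr (mc (⟨𝟎 𝟎)) (*-zeroʳ _)))))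
    where
    zepr : ⟨ x , 𝟎 ⟩ ≡ 0ℤ
    zepr = tr (⟨s x 𝟎) (⟨𝟎 x)
   ... | no y≢0 = dn (*-cancelˡ-≤ (positive y y≢0) (sb2 _≤_ (sy (*-zeroʳ _)) expand (nonNeg z)))
    where
    q = ⟨ y , y ⟩
    p = ⟨ x , y ⟩
    -- Up to the factor `q`, the component of `x` orthogonal to `y`; its norm is `q` times the
    -- defect in Cauchy-Schwarz.
    z = q · x ⊕ neg (p · y)
    opaque
     unfolding _+_ _*_ -_
     co : ∀ q p a -> (q * (q * a) - q * (p * p)) + (p * (p * q) - q * (p * p)) ≡ q * (a * q - p * p)
     co = sv ring
    expand : ⟨ z , z ⟩ ≡ q * (⟨ x , x ⟩ * q - p * p)
    expand = tr (⟨d (q · x) (p · y)) (tr (cg2 _+_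
     (cg2 _-_ (tr (⟨· q x _) (mc (⟨⟩·ʳ q x x))) cross) (cg2 _-_ (tr (⟨· p y _) (mc (⟨⟩·ʳ p y y))) cross)) (co q p _))
     where
     cross : ⟨ q · x , p · y ⟩ ≡ q * (p * p)
     cross = tr (⟨· q x _) (mc (⟨⟩·ʳ p x y))
   module Unimodular (unimodular : det n L ≡ 1ℤ) where
    represent : (u : Fin n -> ℤ) -> Σ (Vec ℤ n) \ y -> ∀ x -> ⟨ x , y ⟩ ≡ sum n (\ i -> lk x i * u i)
    represent u with unso n L unimodular u
    ... | y , e = tabulate y , \ x -> tr (⟨⟩de x (tabulate y)) (tr (foap L (lk x) _) (Sc \ i -> mc (tr (Sc \ j -> mc (VP.lookup∘tabulate y j)) (e i))))
    coo : Fin n -> Vec ℤ n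
    coo i = p1 (represent (\ j -> δ j i))
    cosp : ∀ i x -> ⟨ x , coo i ⟩ ≡ lk x i
    cosp i x = tr (p2 (represent (\ j -> δ j i)) x) (Σδʳ n i (lk x))
    -- `coo i` is the dual basis vector, integral by unimodularity, so Cauchy-Schwarz bounds each
    -- coordinate by the norm. Hence balls are finite and can be listed.
    enbo : ∀ i x -> lk x i * lk x i ≤ ⟨ x , x ⟩ * ⟨ coo i , coo i ⟩
    enbo i x = sb (\ z -> z * z ≤ ⟨ x , x ⟩ * ⟨ coo i , coo i ⟩) (cosp i x) (cau x (coo i))

-- The lower bound from positivity of the certificate.

module LowerBound where
 open Z
 open Forms
 open Walks
 open Positivity
 open ChainBounds using (vo)
 open Polynomials
 open import Data.Nat as ℕ using (ℕ; zero; suc; z≤n; s≤s)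
 open import Data.Integer as ℤ using (ℤ; +_; 0ℤ; _≤_; _<_)
 open import Data.Fin using (Fin; zero; suc; toℕ)
 open import Data.List using (List; []; _∷_; length)
 open import Data.Vec using (Vec; lookup; toList)
 open import Tactic.RingSolver using () renaming (solve-∀ to sv)
 private variable n : ℕ
 ec< : ∀ us {X Y : ℕ -> ℤ} -> (∀ i -> i ℕ.< length us -> X i ≡ Y i) -> ev us X ≡ ev us Y
 ec< [] e = refl
 ec< (u ∷ us) e = cg2 _+_ (mc (e 0 (s≤s z≤n))) (ec< us (\ i i< -> e (suc i) (s≤s i<)))
 wesq : ℤ -> ℤ -> List ℤ -> List ℤ
 wesq p q u = add (sca p (mul u u)) (0ℤ ∷ sca q (mul u u))
 module _ (N : ℕ) (c : Ch n) (T : ℕ) where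
  open WalkOn N c T
  ^-+ : ∀ a i j -> a ^ (i ℕ.+ j) ≡ a ^ i * a ^ j
  ^-+ a zero j = sy (*-identityˡ _)
  ^-+ a (suc i) j = tr (mc (^-+ a i j)) (sy (*-assoc _ _ _))
  module Square (d : ℕ) (u : Vec ℤ (suc d)) where
   vs = toList u
   a : Fin (suc d) -> ℤ
   -- Walks are not normalised: time `i` carries mass to the power `i`. The extra power makes all
   -- terms homogeneous of degree `d`.
   a i = lk u i * mass ^ (d ℕ.∸ toℕ i)
   open Combination (suc d) a
   toℕ≤ : (i : Fin (suc d)) -> toℕ i ℕ.≤ d
   toℕ≤ i = NP.≤-pred (FP.toℕ<n i)
   toma : I h ≡ sum (suc d) (lk u) * mass ^ d
   toma = tr I-h (tr (Sc \ i -> tr (*-assoc _ _ _) (mc (tr (sy (^-+ mass (d ℕ.∸ toℕ i) (toℕ i))) (cg (\ e -> mass ^ e) (NP.m∸n+n≡m (toℕ≤ i)))))) (Σ*ʳ (suc d) (mass ^ d) (lk u)))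
   qe : ∀ s -> qu s ≡ ev (mul vs vs) (\ t -> mass ^ (d ℕ.+ d ℕ.∸ t) * return (s ℕ.+ t))
   qe s = tr (Sc \ i -> Sc \ j -> tr (mr (reg _ _ _ _)) (tr (*-assoc _ _ _) (mc (mr (exponents i j))))) (sumu u (\ t -> mass ^ (d ℕ.+ d ℕ.∸ t) * return (s ℕ.+ t)))
    where
    opaque
     unfolding _+_ _*_ -_
     reg : ∀ x y z w -> (x * y) * (z * w) ≡ (x * z) * (y * w)
     reg = sv ring
    exponents : ∀ i j -> mass ^ (d ℕ.∸ toℕ i) * mass ^ (d ℕ.∸ toℕ j) ≡ mass ^ (d ℕ.+ d ℕ.∸ (toℕ i ℕ.+ toℕ j))
    exponents i j = tr (sy (^-+ mass (d ℕ.∸ toℕ i) (d ℕ.∸ toℕ j))) (cg (\ e -> mass ^ e) (sy (difference (toℕ i) (toℕ j) (toℕ≤ i) (toℕ≤ j))))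
     where
     difference : ∀ x y -> x ℕ.≤ d -> y ℕ.≤ d -> d ℕ.+ d ℕ.∸ (x ℕ.+ y) ≡ (d ℕ.∸ x) ℕ.+ (d ℕ.∸ y)
     difference x y x≤ y≤ = tr (sy (NP.∸-+-assoc (d ℕ.+ d) x y)) (tr (cg (ℕ._∸ y) (tr (cg (ℕ._∸ x) (NP.+-comm d d)) (tr (NP.+-∸-assoc d x≤) (NP.+-comm d _)))) (NP.+-∸-assoc (d ℕ.∸ x) y≤))
   -- Write the multiplier q - (q-p) X as p + (q-p)(1 - X). The first part is bounded below by
   -- Cauchy-Schwarz against constants, and the second is nonnegative because walking is a
   -- contraction.
   lobo : ∀ p q -> 0ℤ < index -> 0ℤ ≤ mass -> 0ℤ ≤ p -> 0ℤ ≤ q - p -> length (mul vs vs) ≡ suc (d ℕ.+ d) ->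
    p * (sum (suc d) (lk u) * sum (suc d) (lk u) * mass ^ suc (d ℕ.+ d)) ≤ index * ev (wesq q (- (q - p)) vs) (\ t -> mass ^ (suc (d ℕ.+ d) ℕ.∸ t) * return t)
   lobo p q inde mass≥0 p≥0 r≥0 len = ZP.≤-trans
    (ZP.≤-trans (ZP.≤-reflexive (expand p S mass (mass ^ d) (mass ^ (d ℕ.+ d)) (^-+ mass d d)))
     (*-monoˡ-≤ p≥0 (*-monoˡ-≤ mass≥0 (sb (\ z -> z * z ≤ index * qu 0) toma (qubo inde)))))
    (sb (p * (mass * (index * qu 0)) ≤_) (cg (index *_) (sy evaluate))
     (*n (ZP.<⇒≤ inde) (*n r≥0 (dino qc)) ≤-by slac index p (q - p) q mass (qu 0) (qu 1) (restore p q)))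
    where
    S = sum (suc d) (lk u)
    E = suc (d ℕ.+ d)
    Y : ℕ -> ℤ
    Y t = mass ^ (E ℕ.∸ t) * return t
    opaque
     unfolding _+_ _*_ -_
     expa : ∀ p S m b -> p * (S * S * (m * (b * b))) ≡ p * (m * ((S * b) * (S * b)))
     expa = sv ring
     restore : ∀ p q -> p + (q - p) ≡ q
     restore = sv ring
     sla : ∀ i p r m x y -> i * ((p + r) * (m * x) + (- r) * y) ≡ p * (m * (i * x)) + i * (r * (m * x - y))
     sla = sv ring
    expand : ∀ p S m b bb -> bb ≡ b * b -> p * (S * S * (m * bb)) ≡ p * (m * ((S * b) * (S * b)))
    expand p S m b _ refl = expa p S m b
    slac : ∀ i p r q m x y -> p + r ≡ q -> i * (q * (m * x) + (- r) * y) ≡ p * (m * (i * x)) + i * (r * (m * x - y))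
    slac i p r _ m x y refl = sla i p r m x y
    evaluate : ev (wesq q (- (q - p)) vs) Y ≡ q * (mass * qu 0) + (- (q - p)) * qu 1
    evaluate = tr (ea (sca q (mul vs vs)) _ Y) (cg2 _+_
     (tr (evsc q (mul vs vs) Y) (mc (tr (ec< (mul vs vs) first) (tr (ev-* (mul vs vs) mass _) (mc (sy (qe 0)))))))
     (tr (cg2 _+_ (*-zeroˡ _) (tr (evsc (- (q - p)) (mul vs vs) (\ t -> Y (suc t))) (mc (sy (qe 1))))) (+-identityˡ _)))
     where
     first : ∀ t -> t ℕ.< length (mul vs vs) -> Y t ≡ mass * (mass ^ (d ℕ.+ d ℕ.∸ t) * return t)
     first t t< = tr (mr (cg (\ e -> mass ^ e) (NP.+-∸-assoc 1 (NP.≤-pred (sb (t ℕ.<_) len t<))))) (*-assoc _ _ _)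

-- Orbits of a map of period 13.

module Orbits where
 open import Data.Nat
 open import Data.Nat.Properties
 open import Data.Nat.Divisibility using (_∣_; _∣0; ∣m∣n⇒∣m+n; divides)
 open import Data.Nat.Tactic.RingSolver using () renaming (solve-∀ to sv)
 open import Data.List using (List; []; _∷_; length; filter; applyUpTo)
 open import Data.List.Properties using (length-applyUpTo)
 open import Data.List.Membership.Propositional using (_∈_)
 open import Data.List.Membership.Propositional.Properties using (∈-filter⁺; ∈-filter⁻; ∈-applyUpTo⁺; ∈-applyUpTo⁻)
 open import Data.List.Relation.Unary.Any using (here)
 open import Data.List.Relation.Unary.Unique.Propositional using (Unique)
 open import Data.List.Relation.Binary.Permutation.Propositional.Properties using (↭-length)
 open import Data.List.Membership.Propositional.Properties.WithK using (unique∧set⇒bag)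
 open import Data.List.Relation.Binary.BagAndSetEquality using (∼bag⇒↭)
 open import Function using (_∘_)
 open import Function.Bundles using (mk⇔)
 open import Relation.Binary using (DecidableEquality)
 open import Relation.Unary using (Decidable)
 lesp : ∀ {A : Set} {P : A -> Set} (P? : Decidable P) (xs : List A) -> length xs ≡ length (filter P? xs) + length (filter (¬? ∘ P?) xs)
 lesp P? [] = refl
 lesp P? (x ∷ xs) with P? x
 ... | yes _ = cg suc (lesp P? xs)
 ... | no _ = tr (cg suc (lesp P? xs)) (sy (+-suc _ _))
 iterate : ∀ {A : Set} -> (A -> A) -> ℕ -> A -> A
 iterate f zero x = x
 iterate f (suc k) x = f (iterate f k x)
 module _ {A : Set} (_≟ₐ_ : DecidableEquality A) (f : A -> A) (peri : ∀ x -> iterate f 13 x ≡ x) where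
  open DecMembership _≟ₐ_ using (_∈?_)
  i+ : ∀ i j x -> iterate f (i + j) x ≡ iterate f i (iterate f j x)
  i+ zero j x = refl
  i+ (suc i) j x = cg f (i+ i j x)
  itfi : ∀ e d x -> iterate f d x ≡ x -> iterate f (e * d) x ≡ x
  itfi zero d x fixed = refl
  itfi (suc e) d x fixed = tr (i+ d (e * d) x) (tr (cg (iterate f d) (itfi e d x fixed)) fixed)
  des : ∀ e d q x -> e * d ≡ suc (q * 13) -> iterate f d x ≡ x -> f x ≡ x
  des e d q x eq fixed = tr (cg f (sy (itfi q 13 x (peri x)))) (tr (cg (\ k -> iterate f k x) (sy eq)) (itfi e d x fixed))
  -- As 13 is prime, each shorter period is invertible modulo 13; the table holds e and q with e
  -- times the period equal to 13q + 1.
  nsp : ∀ d -> d < 12 -> ∀ x -> iterate f (suc d) x ≡ x -> f x ≡ x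
  nsp 0 _ x = des 1 1 0 x refl
  nsp 1 _ x = des 7 2 1 x refl
  nsp 2 _ x = des 9 3 2 x refl
  nsp 3 _ x = des 10 4 3 x refl
  nsp 4 _ x = des 8 5 3 x refl
  nsp 5 _ x = des 11 6 5 x refl
  nsp 6 _ x = des 2 7 1 x refl
  nsp 7 _ x = des 5 8 3 x refl
  nsp 8 _ x = des 3 9 2 x refl
  nsp 9 _ x = des 4 10 3 x refl
  nsp 10 _ x = des 6 11 5 x refl
  nsp 11 _ x = des 12 12 11 x refl
  nsp (suc (suc (suc (suc (suc (suc (suc (suc (suc (suc (suc (suc d)))))))))))) (s≤s (s≤s (s≤s (s≤s (s≤s (s≤s (s≤s (s≤s (s≤s (s≤s (s≤s (s≤s ()))))))))))))
  orb : A -> List A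
  orb x = applyUpTo (\ i -> iterate f i x) 13
  Closed : List A -> Set
  Closed xs = ∀ {x} -> x ∈ xs -> f x ∈ xs
  i∈ : ∀ {xs} -> Closed xs -> ∀ i {x} -> x ∈ xs -> iterate f i x ∈ xs
  i∈ closed zero x∈ = x∈
  i∈ closed (suc i) x∈ = closed (i∈ closed i x∈)
  orcl : ∀ x -> Closed (orb x)
  orcl x y∈ with ∈-applyUpTo⁻ (\ i -> iterate f i x) y∈
  ... | i , i< , refl with suc i ≟ 13
  ...   | yes e = sb (_∈ orb x) (sy (tr (cg (\ k -> iterate f k x) e) (peri x))) (∈-applyUpTo⁺ (\ i -> iterate f i x) (s≤s z≤n))
  ...   | no ne = ∈-applyUpTo⁺ (\ i -> iterate f i x) (≤∧≢⇒< i< ne)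
  opb : ∀ x y -> f y ∈ orb x -> y ∈ orb x
  opb x y fy∈ = sb (_∈ orb x) (tr (sy (i+ 12 1 y)) (peri y)) (i∈ (orcl x) 12 fy∈)
  ou : ∀ x -> (∀ i -> f (iterate f i x) ≢ iterate f i x) -> Unique (orb x)
  ou x mov = UP.applyUpTo⁺₁ (\ i -> iterate f i x) 13 \ {i} {j} i<j j<13 e ->
   mov i (nsp (j ∸ suc i) (≤-trans (≤-reflexive (sy (+-∸-assoc 1 i<j))) (≤-trans (m∸n≤m j i) (≤-pred j<13))) (iterate f i x)
    (tr (sy (i+ (suc (j ∸ suc i)) i x)) (tr (cg (\ k -> iterate f k x) (tr (+-comm (suc (j ∸ suc i)) i) (tr (+-suc i _) (m+[n∸m]≡n i<j)))) (sy e))))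
  -- Remove the orbit of the first element: it has exactly 13 members, the rest is again closed, and
  -- `n` bounds the recursion.
  13∣length : ∀ n xs -> length xs ≤ n -> Unique xs -> Closed xs -> (∀ {x} -> x ∈ xs -> f x ≢ x) -> 13 ∣ length xs
  13∣length n [] _ _ _ _ = 13 ∣0
  13∣length (suc n) xs@(x ∷ _) len unique closed mov = sb (13 ∣_) (sy (tr (lesp (_∈? orb x) xs) (cg (_+ length rest) inside)))
    (∣m∣n⇒∣m+n (divides 1 refl) (13∣length n rest shorter (UP.filter⁺ (¬? ∘ (_∈? orb x)) unique) recl (\ y∈ -> mov (p1 (∈-filter⁻ (¬? ∘ (_∈? orb x)) y∈)))))
   where
   rest : List A
   rest = filter (¬? ∘ (_∈? orb x)) xs
   orbi : ∀ {y} -> y ∈ orb x -> y ∈ xs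
   orbi y∈ with ∈-applyUpTo⁻ (\ i -> iterate f i x) y∈
   ... | i , _ , refl = i∈ closed i (here refl)
   inside : length (filter (_∈? orb x) xs) ≡ 13
   inside = tr (↭-length (∼bag⇒↭ (unique∧set⇒bag (UP.filter⁺ (_∈? orb x) unique) (ou x (\ i -> mov (i∈ closed i (here refl))))
    (mk⇔ (\ y∈ -> p2 (∈-filter⁻ (_∈? orb x) y∈)) (\ y∈ -> ∈-filter⁺ (_∈? orb x) (orbi y∈) y∈))))) (length-applyUpTo (\ i -> iterate f i x) 13)
   recl : Closed rest
   recl y∈ with ∈-filter⁻ (¬? ∘ (_∈? orb x)) y∈
   ... | y∈xs , y∉ = ∈-filter⁺ (¬? ∘ (_∈? orb x)) (closed y∈xs) (\ fy∈ -> y∉ (opb x _ fy∈))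
   shorter : length rest ≤ n
   shorter = ≤-pred (≤-trans (≤-trans (m<n+m (length rest) {13} (s≤s z≤n)) (≤-reflexive (sy (tr (lesp (_∈? orb x) xs) (cg (_+ length rest) inside))))) len)

-- Classes modulo 2L and the orthogonal frame.

module Frames where
 open import Defs using (Mat)
 open Z hiding (+-identityʳ; +-identityˡ; *-identityʳ; *-identityˡ)
 open Forms
 open Walks
 open Kernel using (_≟ᵥ_)
 open Leech
 open Orbits using (lesp)
 open Certificate using (wo)
 open import Data.Nat as ℕ using (ℕ; zero; suc; z≤n; s≤s)
 open import Data.Nat.Tactic.RingSolver using () renaming (solve-∀ to svN)
 open import Data.Bool using (Bool; true; false)
 open import Data.Integer as ℤ using (ℤ; +_; -[1+_]; 0ℤ; 1ℤ)
 open import Data.Fin using (Fin; zero; suc)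
 open import Data.List using (List; []; _∷_; length; filter)
 open import Data.List.Membership.Propositional using (_∈_)
 open import Data.List.Membership.Propositional.Properties using (∈-filter⁻)
 open import Data.List.Properties using (filter-all)
 open import Data.List.Relation.Unary.Any using (here; there)
 open import Data.List.Relation.Unary.All using (All; []; _∷_)
 import Data.List.Relation.Unary.All as All
 open import Data.List.Relation.Unary.AllPairs using ([]; _∷_)
 open import Data.List.Relation.Unary.Unique.Propositional using (Unique)
 open import Data.Vec using (Vec; []; _∷_; lookup; map)
 open import Tactic.RingSolver using () renaming (solve-∀ to sv)
 private variable
  n : ℕ
  A : Set
 su : List A -> (A -> ℕ) -> ℕ
 su [] f = 0
 su (x ∷ xs) f = f x ℕ.+ su xs f
 susp : (p : A -> Bool) (xs : List A) (w : A -> ℕ) ->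
  su xs w ≡ su (filter (\ x -> p x BP.≟ true) xs) w ℕ.+ su (filter (\ x -> p x BP.≟ false) xs) w
 susp p [] w = refl
 susp p (x ∷ xs) w with p x
 ... | true = tr (cg (w x ℕ.+_) (susp p xs w)) (sy (NP.+-assoc (w x) _ _))
 ... | false = tr (cg (w x ℕ.+_) (susp p xs w)) (swap (w x) (su (filter (\ x -> p x BP.≟ true) xs) w) _)
  where
  swap : ∀ a b c -> a ℕ.+ (b ℕ.+ c) ≡ b ℕ.+ (a ℕ.+ c)
  swap = svN
 subo : ∀ B (xs : List A) (w : A -> ℕ) -> (∀ x -> w x ℕ.≤ B) -> su xs w ℕ.≤ length xs ℕ.* B
 subo B [] w w≤ = z≤n
 subo B (x ∷ xs) w w≤ = NP.+-mono-≤ (w≤ x) (subo B xs w w≤)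
 record HeavyClass (n : ℕ) (xs : List A) (p : A -> Vec Bool n) (w : A -> ℕ) (B : ℕ) : Set where
  field
   members : List A
   listed : ∀ {x} -> x ∈ members -> x ∈ xs
   unique : Unique xs -> Unique members
   same : ∀ {x y} -> x ∈ members -> y ∈ members -> p x ≡ p y
   he : B ℕ.< su members w
 -- A weighted pigeonhole principle, halving by one parity bit at a time: if one half does not
 -- exceed its share, the other one does.
 hecl : ∀ n (xs : List A) (p : A -> Vec Bool n) w B -> B ℕ.* 2 ℕ.^ n ℕ.< su xs w -> HeavyClass n xs p w B
 hecl zero xs p w B lt = record { members = xs ; listed = \ x∈ -> x∈ ; unique = \ u -> u ; same = \ {x} {y} _ _ -> empty (p x) (p y) ; he = sb (ℕ._< su xs w) (NP.*-identityʳ B) lt }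
  where
  empty : (u v : Vec Bool 0) -> u ≡ v
  empty [] [] = refl
 hecl {A = A} (suc n) xs p w B lt = cho (NP.≤-<-connex (su (part true) w) (B ℕ.* 2 ℕ.^ n))
  where
  part : Bool -> List A
  part b = filter (\ x -> Data.Vec.head (p x) BP.≟ b) xs
  tacl : ∀ b -> HeavyClass n (part b) (\ x -> Data.Vec.tail (p x)) w B -> HeavyClass (suc n) xs p w B
  tacl b K = record
   { members = members
   ; listed = \ x∈ -> p1 (∈-filter⁻ (\ x -> Data.Vec.head (p x) BP.≟ b) (listed x∈))
   ; unique = \ u -> unique (UP.filter⁺ (\ x -> Data.Vec.head (p x) BP.≟ b) u)
   ; same = \ {x} {y} x∈ y∈ -> join (p x) (p y) (tr (p2 (∈-filter⁻ (\ x -> Data.Vec.head (p x) BP.≟ b) {xs = xs} (listed x∈))) (sy (p2 (∈-filter⁻ (\ x -> Data.Vec.head (p x) BP.≟ b) {xs = xs} (listed y∈))))) (same x∈ y∈)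
   ; he = he }
   where
   open HeavyClass K
   join : (u v : Vec Bool (suc n)) -> Data.Vec.head u ≡ Data.Vec.head v -> Data.Vec.tail u ≡ Data.Vec.tail v -> u ≡ v
   join (_ ∷ _) (_ ∷ _) refl refl = refl
  cho : su (part true) w ℕ.≤ B ℕ.* 2 ℕ.^ n ⊎ B ℕ.* 2 ℕ.^ n ℕ.< su (part true) w -> HeavyClass (suc n) xs p w B
  cho (n2 gt) = tacl true (hecl n (part true) _ w B gt)
  cho (n1 le) = tacl false (hecl n (part false) _ w B (NP.+-cancelˡ-< (B ℕ.* 2 ℕ.^ n) _ _
   (NP.<-≤-trans (sb2 ℕ._<_ (spdo B (2 ℕ.^ n)) (susp (\ x -> Data.Vec.head (p x)) xs w) lt) (NP.+-monoˡ-≤ _ le))))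
   where
   spdo : ∀ B t -> B ℕ.* (2 ℕ.* t) ≡ B ℕ.* t ℕ.+ B ℕ.* t
   spdo = svN
 evenℕ : ℕ -> Bool
 evenℕ zero = true
 evenℕ (suc zero) = false
 evenℕ (suc (suc n)) = evenℕ n
 parity : ℤ -> Bool
 parity (+ n) = evenℕ n
 parity -[1+ n ] = evenℕ (suc n)
 Hal : Bool -> ℤ -> Set
 Hal b a = Σ ℤ \ t -> (b ≡ true × a ≡ t + t) ⊎ (b ≡ false × a ≡ t + t + 1ℤ)
 opaque
  unfolding _+_ _*_ -_
  hal : ∀ n -> Hal (evenℕ n) (+ n)
  hal zero = 0ℤ , n1 (refl , refl)
  hal (suc zero) = 0ℤ , n2 (refl , refl)
  hal (suc (suc n)) with hal n
  ... | t , n1 (e , h) = t + 1ℤ , n1 (e , tr (cg (\ z -> (1ℤ + 1ℤ) + z) h) (shift₀ t))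
   where
   shift₀ : ∀ t -> (1ℤ + 1ℤ) + (t + t) ≡ (t + 1ℤ) + (t + 1ℤ)
   shift₀ = sv ring
  ... | t , n2 (e , h) = t + 1ℤ , n2 (e , tr (cg (\ z -> (1ℤ + 1ℤ) + z) h) (shif t))
   where
   shif : ∀ t -> (1ℤ + 1ℤ) + (t + t + 1ℤ) ≡ (t + 1ℤ) + (t + 1ℤ) + 1ℤ
   shif = sv ring
  paha : ∀ a -> Hal (parity a) a
  paha (+ n) = hal n
  paha -[1+ n ] with hal (suc n)
  ... | t , n1 (e , h) = - t , n1 (e , tr (cg -_ h) (negate t))
   where
   negate : ∀ t -> - (t + t) ≡ - t + - t
   negate = sv ring
  ... | t , n2 (e , h) = - t - 1ℤ , n2 (e , tr (cg -_ h) (negate t))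
   where
   negate : ∀ t -> - (t + t + 1ℤ) ≡ (- t - 1ℤ) + (- t - 1ℤ) + 1ℤ
   negate = sv ring
  halsum : ∀ a b -> parity a ≡ parity b -> Σ ℤ \ t -> a + b ≡ t + t
  halsum a b e with paha a | paha b
  ... | s , n1 (_ , refl) | t , n1 (_ , refl) = s + t , co s t
   where
   co : ∀ s t -> (s + s) + (t + t) ≡ (s + t) + (s + t)
   co = sv ring
  ... | s , n2 (_ , refl) | t , n2 (_ , refl) = s + t + 1ℤ , co s t
   where
   co : ∀ s t -> (s + s + 1ℤ) + (t + t + 1ℤ) ≡ (s + t + 1ℤ) + (s + t + 1ℤ)
   co = sv ring
  ... | s , n1 (p , _) | t , n2 (q , _) = cx (tr (sy p) (tr e q)) \ ()
  ... | s , n2 (p , _) | t , n1 (q , _) = cx (tr (sy q) (tr (sy e) p)) \ ()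
  haldif : ∀ a b -> parity a ≡ parity b -> Σ ℤ \ t -> a + - b ≡ t + t
  haldif a b e with halsum a b e
  ... | t , h = t - b , tr (reg a b) (tr (cg (\ z -> z - (b + b)) h) (co t b))
   where
   reg : ∀ a b -> a + - b ≡ (a + b) - (b + b)
   reg = sv ring
   co : ∀ t b -> (t + t) - (b + b) ≡ (t - b) + (t - b)
   co = sv ring
 parities : Vec ℤ n -> Vec Bool n
 parities = map parity
 hasu : (x y : Vec ℤ n) -> parities x ≡ parities y -> Σ (Vec ℤ n) \ p -> x ⊕ y ≡ p ⊕ p
 hasu [] [] e = [] , refl
 hasu (a ∷ x) (b ∷ y) e with halsum a b (VP.∷-injectiveˡ e) | hasu x y (VP.∷-injectiveʳ e)
 ... | t , h | p , hs = t ∷ p , cg2 _∷_ h hs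
 hadi : (x y : Vec ℤ n) -> parities x ≡ parities y -> Σ (Vec ℤ n) \ p -> x ⊕ neg y ≡ p ⊕ p
 hadi [] [] e = [] , refl
 hadi (a ∷ x) (b ∷ y) e with haldif a b (VP.∷-injectiveˡ e) | hadi x y (VP.∷-injectiveʳ e)
 ... | t , h | p , hs = t ∷ p , cg2 _∷_ h hs
 ⊕n𝟎 : (x y : Vec ℤ n) -> x ⊕ neg y ≡ 𝟎 -> x ≡ y
 ⊕n𝟎 x y e = tr (sy (⊕-identityʳ x)) (tr (cg (x ⊕_) (tr (sy (⊕-inverse y)) (⊕-comm y (neg y)))) (tr (sy (⊕-assoc x (neg y) y)) (tr (cg (_⊕ y) e) (⊕-identityˡ y))))
 ⊕𝟎n : (x y : Vec ℤ n) -> x ⊕ y ≡ 𝟎 -> x ≡ neg y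
 ⊕𝟎n x y e = ⊕n𝟎 x (neg y) (tr (cg (x ⊕_) (nene y)) e)
 remove : Vec ℤ n -> List (Vec ℤ n) -> List (Vec ℤ n)
 remove v = filter (\ z -> ¬? (z ≟ᵥ v))
 length-remove : ∀ (v : Vec ℤ n) xs -> Unique xs -> length xs ℕ.≤ suc (length (remove v xs))
 length-remove v [] _ = z≤n
 length-remove v (x ∷ xs) (x∉ ∷ u) with x ≟ᵥ v
 ... | yes refl = s≤s (NP.≤-reflexive (cg length (sy (filter-all (\ z -> ¬? (z ≟ᵥ x)) (All.map (\ ne e -> ne (sy e)) x∉)))))
 ... | no _ = s≤s (length-remove v xs u)
 module _ {n} (L : Mat n) (symmetric : ∀ i j -> L i j ≡ L j i)
  (hn : Vec ℤ n -> ℕ) (hns : ∀ x -> Lattice.⟨_,_⟩ L symmetric x x ≡ + (2 ℕ.* hn x))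
  (hnz : ∀ x -> hn x ≡ 0 -> x ≡ 𝟎) (nr : ∀ x -> hn x ≢ 1) where
  open Lattice L symmetric
  alt : ∀ x -> x ≢ 𝟎 -> 2 ℕ.≤ hn x
  alt x x≢0 with hn x in e
  ... | zero = cx (hnz x e) x≢0
  ... | suc zero = cx e (nr x)
  ... | suc (suc _) = s≤s (s≤s z≤n)
  dono : ∀ p -> ⟨ p ⊕ p , p ⊕ p ⟩ ≡ + (8 ℕ.* hn p)
  dono p = tr (⟨⟩su p p) (tr (cg (\ z -> (z + z) + (z + z)) (hns p)) (tr (sy (tr (pos-+ (a ℕ.+ a) (a ℕ.+ a)) (cg2 _+_ (pos-+ a a) (pos-+ a a)))) (cg +_ (ei (hn p)))))
   where
   a = 2 ℕ.* hn p
   ei : ∀ h -> 2 ℕ.* h ℕ.+ 2 ℕ.* h ℕ.+ (2 ℕ.* h ℕ.+ 2 ℕ.* h) ≡ 8 ℕ.* h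
   ei = svN
  opaque
   unfolding _+_ _*_ -_
   adup : ∀ a b c -> ((a + c) + (c + b)) + ((a - c) + (b - c)) ≡ (a + a) + (b + b)
   adup = sv ring
   crte : ∀ a b c -> ((a + c) + (c + b)) - ((a - c) + (b - c)) ≡ (1ℤ + 1ℤ + 1ℤ + 1ℤ) * c
   crte = sv ring
   fou : 1ℤ + 1ℤ + 1ℤ + 1ℤ ≢ 0ℤ
   fou ()
  -- (x+y)/2 and (x-y)/2 are nonzero lattice vectors, hence of norm at least 4. By the parallelogram
  -- law the norms of x and y add up to at least 16, so both are 8, both halves have norm 4, and the
  -- inner product vanishes.
  consho : ∀ x y -> hn x ℕ.≤ 4 -> hn y ℕ.≤ 4 -> parities x ≡ parities y -> x ≢ y -> x ≢ neg y ->
   hn x ≡ 4 × ⟨ x , y ⟩ ≡ 0ℤ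
  consho x y hx≤ hy≤ same x≢y x≢-y with hasu x y same | hadi x y same
  ... | p , ep | q , eq = hx≡4 , ort
   where
   open NP.≤-Reasoning
   hx = hn x
   hy = hn y
   hp = hn p
   hq = hn q
   𝟎⊕𝟎 : 𝟎 ⊕ 𝟎 ≡ 𝟎 {n}
   𝟎⊕𝟎 = ⊕-identityˡ 𝟎
   hp≥ : 2 ℕ.≤ hp
   hp≥ = alt p \ p≡ -> x≢-y (⊕𝟎n x y (tr ep (tr (cg (\ z -> z ⊕ z) p≡) 𝟎⊕𝟎)))
   hq≥ : 2 ℕ.≤ hq
   hq≥ = alt q \ q≡ -> x≢y (⊕n𝟎 x y (tr eq (tr (cg (\ z -> z ⊕ z) q≡) 𝟎⊕𝟎)))
   sueq : (⟨ x , x ⟩ + ⟨ x , y ⟩) + (⟨ x , y ⟩ + ⟨ y , y ⟩) ≡ + (8 ℕ.* hp)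
   sueq = tr (sy (⟨⟩su x y)) (tr (cg (\ z -> ⟨ z , z ⟩) ep) (dono p))
   dieq : (⟨ x , x ⟩ - ⟨ x , y ⟩) + (⟨ y , y ⟩ - ⟨ x , y ⟩) ≡ + (8 ℕ.* hq)
   dieq = tr (sy (⟨d x y)) (tr (cg (\ z -> ⟨ z , z ⟩) eq) (dono q))
   par : hx ℕ.+ hy ≡ 2 ℕ.* (hp ℕ.+ hq)
   par = NP.*-cancelˡ-≡ _ _ 4 (tr (left hx hy) (tr (ZP.+-injective (tr (tr (pos-+ (2 ℕ.* hx ℕ.+ 2 ℕ.* hx) _) (cg2 _+_ (pos-+ (2 ℕ.* hx) _) (pos-+ (2 ℕ.* hy) _))) (tr (sy (cg2 (\ a b -> (a + a) + (b + b)) (hns x) (hns y)))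
     (tr (sy (adup ⟨ x , x ⟩ ⟨ y , y ⟩ ⟨ x , y ⟩)) (tr (cg2 _+_ sueq dieq) (sy (pos-+ (8 ℕ.* hp) (8 ℕ.* hq)))))))) (right hp hq)))
    where
    left : ∀ x y -> 4 ℕ.* (x ℕ.+ y) ≡ 2 ℕ.* x ℕ.+ 2 ℕ.* x ℕ.+ (2 ℕ.* y ℕ.+ 2 ℕ.* y)
    left = svN
    right : ∀ x y -> 8 ℕ.* x ℕ.+ 8 ℕ.* y ≡ 4 ℕ.* (2 ℕ.* (x ℕ.+ y))
    right = svN
   big : 8 ℕ.≤ hx ℕ.+ hy
   big = sb (8 ℕ.≤_) (sy par) (NP.*-monoʳ-≤ 2 (NP.+-mono-≤ hp≥ hq≥))
   hx≡4 : hx ≡ 4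
   hx≡4 = NP.≤-antisym hx≤ (NP.+-cancelʳ-≤ 4 4 hx (NP.≤-trans big (NP.+-monoʳ-≤ hx hy≤)))
   small : hp ℕ.+ hq ℕ.≤ 4
   small = NP.*-cancelˡ-≤ 2 (sb (ℕ._≤ 8) par (NP.+-mono-≤ hx≤ hy≤))
   hp≡2 : hp ≡ 2
   hp≡2 = NP.≤-antisym (NP.+-cancelʳ-≤ 2 hp 2 (NP.≤-trans (NP.+-monoʳ-≤ hp hq≥) small)) hp≥
   hq≡2 : hq ≡ 2
   hq≡2 = NP.≤-antisym (NP.+-cancelˡ-≤ 2 hq 2 (NP.≤-trans (NP.+-monoˡ-≤ hq hp≥) small)) hq≥
   ort : ⟨ x , y ⟩ ≡ 0ℤ
   ort = *-cancelˡ-≡ (1ℤ + 1ℤ + 1ℤ + 1ℤ) fou (tr (sy (crte ⟨ x , x ⟩ ⟨ y , y ⟩ ⟨ x , y ⟩))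
    (tr (cg2 _-_ (tr sueq (cg (\ h -> + (8 ℕ.* h)) hp≡2)) (tr dieq (cg (\ h -> + (8 ℕ.* h)) hq≡2))) (tr (+-inverse _) (sy (*-zeroʳ _)))))
  Congruent : List (Vec ℤ n) -> Set
  Congruent xs = ∀ {x y} -> x ∈ xs -> y ∈ xs -> parities x ≡ parities y
  record Orthogonal (k : ℕ) (xs : List (Vec ℤ n)) : Set where
   field
    vector : Fin k -> Vec ℤ n
    listed : ∀ i -> vector i ∈ xs
    ort : ∀ i j -> i ≢ j -> ⟨ vector i , vector j ⟩ ≡ 0ℤ
  -- Each chosen vector rules out only itself and its negative. The `suc` allows the last vector to
  -- lack a partner, so 47 members already yield 24.
  extract : ∀ k xs -> Unique xs -> (∀ {x} -> x ∈ xs -> hn x ℕ.≤ 4) -> Congruent xs -> 2 ℕ.* k ℕ.≤ suc (length xs) -> Orthogonal k xs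
  extract zero xs _ _ _ _ = record { vector = \ () ; listed = \ () ; ort = \ () }
  extract (suc k) [] _ _ _ le with sb (ℕ._≤ 1) (NP.*-suc 2 k) le
  ... | s≤s ()
  extract (suc k) (x ∷ xs) (x∉ ∷ u) short congruent le = record { vector = vec ; listed = inli ; ort = orth }
   where
   module T = Orthogonal (extract k (remove (neg x) xs) (UP.filter⁺ _ u) (\ y∈ -> short (there (p1 (∈-filter⁻ (\ z -> ¬? (z ≟ᵥ neg x)) y∈))))
    (\ y∈ z∈ -> congruent (there (p1 (∈-filter⁻ (\ z -> ¬? (z ≟ᵥ neg x)) y∈))) (there (p1 (∈-filter⁻ (\ z -> ¬? (z ≟ᵥ neg x)) z∈))))
    (NP.≤-trans (NP.≤-pred (NP.≤-pred (sb (ℕ._≤ suc (suc (length xs))) (NP.*-suc 2 k) le))) (length-remove (neg x) xs u)))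
   vec : Fin (suc k) -> Vec ℤ n
   vec zero = x
   vec (suc i) = T.vector i
   inli : ∀ i -> vec i ∈ x ∷ xs
   inli zero = here refl
   inli (suc i) = there (p1 (∈-filter⁻ (\ z -> ¬? (z ≟ᵥ neg x)) (T.listed i)))
   heor : ∀ i -> ⟨ T.vector i , x ⟩ ≡ 0ℤ
   heor i = p2 (consho (T.vector i) x (short (inli (suc i))) (short (here refl)) (congruent (inli (suc i)) (here refl))
    (\ e -> All.lookup x∉ (p1 (∈-filter⁻ (\ z -> ¬? (z ≟ᵥ neg x)) (T.listed i))) (sy e)) (p2 (∈-filter⁻ (\ z -> ¬? (z ≟ᵥ neg x)) {xs = xs} (T.listed i))))
   orth : ∀ i j -> i ≢ j -> ⟨ vec i , vec j ⟩ ≡ 0ℤ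
   orth zero zero ne = cx refl ne
   orth zero (suc j) ne = tr (⟨s x _) (heor j)
   orth (suc i) zero ne = heor i
   orth (suc i) (suc j) ne = T.ort i j (\ e -> ne (cg suc e))
  weight≤ : ∀ k -> wo k ℕ.≤ 23
  weight≤ 0 = z≤n
  weight≤ 1 = z≤n
  weight≤ 2 = NP.≤-refl
  weight≤ 3 = NP.≤-refl
  weight≤ 4 = s≤s z≤n
  weight≤ (suc (suc (suc (suc (suc k))))) = z≤n
  -- A member not of norm 8 tolerates only its negative beside it; two members of weight at most 23
  -- do not exceed 46.
  an8 : ∀ xs -> Unique xs -> (∀ {x} -> x ∈ xs -> hn x ℕ.≤ 4) -> Congruent xs -> 46 ℕ.< su xs (\ x -> wo (hn x)) ->
   ∀ {x} -> x ∈ xs -> hn x ≡ 4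
  an8 xs u short congruent he {x} x∈ with hn x ℕ.≟ 4
  ... | yes e = e
  ... | no ne = cx (NP.<-≤-trans he (NP.≤-trans (subo 23 xs _ (\ z -> weight≤ (hn z))) (NP.*-monoˡ-≤ 23 two))) (NP.<-irrefl refl)
   where
   ys = remove (neg x) (remove x xs)
   nomo : ∀ {y} -> y ∈ ys -> x ≡ x -> y ≢ y
   nomo y∈ _ _ with ∈-filter⁻ (\ z -> ¬? (z ≟ᵥ neg x)) {xs = remove x xs} y∈
   ... | y∈′ , y≢-x with ∈-filter⁻ (\ z -> ¬? (z ≟ᵥ x)) {xs = xs} y∈′
   ...   | y∈xs , y≢x = ne (p1 (consho x _ (short x∈) (short y∈xs) (congruent x∈ y∈xs) (\ e -> y≢x (sy e)) (\ e -> y≢-x (tr (sy (nene _)) (cg neg (sy e))))))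
   empty : ∀ zs -> (∀ {y} -> y ∈ zs -> x ≡ x -> y ≢ y) -> length zs ≡ 0
   empty [] _ = refl
   empty (z ∷ zs) f = cx refl (f (here refl) refl)
   two : length xs ℕ.≤ 2
   two = NP.≤-trans (length-remove x xs u) (s≤s (NP.≤-trans (length-remove (neg x) (remove x xs) (UP.filter⁺ _ u)) (s≤s (NP.≤-reflexive (empty ys nomo)))))
  record OrthogonalFrame (k : ℕ) : Set where
   field
    vector : Fin k -> Vec ℤ n
    norm : ∀ i -> hn (vector i) ≡ 4
    ort : ∀ i j -> i ≢ j -> ⟨ vector i , vector j ⟩ ≡ 0ℤ
    congruent : ∀ i j -> parities (vector i) ≡ parities (vector j)
  fra : ∀ (short : List (Vec ℤ n)) -> Unique short -> (∀ {x} -> x ∈ short -> hn x ℕ.≤ 4) ->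
   46 ℕ.* 2 ℕ.^ n ℕ.< su short (\ x -> wo (hn x)) -> OrthogonalFrame 24
  fra short u norms many = record { vector = O.vector ; norm = \ i -> n8 (O.listed i) ; ort = O.ort ; congruent = \ i j -> same (O.listed i) (O.listed j) }
   where
   open HeavyClass (hecl n short parities (\ x -> wo (hn x)) 46 many)
   n8 : ∀ {x} -> x ∈ members -> hn x ≡ 4
   n8 = an8 members (unique u) (\ x∈ -> norms (listed x∈)) same he
   count : ∀ xs -> (∀ {x} -> x ∈ xs -> hn x ≡ 4) -> su xs (\ x -> wo (hn x)) ≡ length xs
   count [] f = refl
   count (x ∷ xs) f = cg2 ℕ._+_ (cg wo (f (here refl))) (count xs (\ x∈ -> f (there x∈)))
   module O = Orthogonal (extract 24 members (unique u) (\ x∈ -> norms (listed x∈)) same (NP.≤-trans (NP.≤-trans (NP.≤-reflexive refl) (s≤s (sb (46 ℕ.<_) (count members n8) he))) NP.≤-refl))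

-- Assembling the bound: there are many short vectors.

module ShortVectors where
 open import Defs using (Mat)
 open Z using (sum; susu; Sc; Σ*; pos-+; pos-*)
 open Forms
 open Determinants using (det)
 open Walks hiding (neg)
 open Positivity hiding (D)
 open Kernel
 open ChainBounds
 open Fractions hiding (num; den)
 open Limits
 open Polynomials
 open Certificate renaming (wesq to square-terms)
 open LowerBound using (ec<; wesq)
 open Frames using (su)
 open Estimates using (^-distrib-*; square-cancel-≤; *i; odd)
 open import Data.Nat
 open import Data.Nat.Properties
 open import Data.Nat.Divisibility using (_∣_; ∣-trans; m∣m*n; n∣m*n; *-monoʳ-∣)
 open import Data.Nat.Tactic.RingSolver using () renaming (solve-∀ to sv)
 open import Data.Integer as ℤ using (ℤ; +_; -[1+_]; 0ℤ; 1ℤ; ∣_∣)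
 open import Data.Fin using (Fin)
 open import Data.List using (List; []; _∷_)
 open import Data.List.Membership.Propositional using (_∈_)
 open import Data.List.Relation.Unary.Any using (here; there)
 open import Data.List.Relation.Unary.All using ([]; _∷_)
 open import Data.Vec using (Vec; lookup)
 open import Data.Vec.Relation.Unary.All using (All)
 import Data.Vec.Relation.Unary.All as All
 open ≤-Reasoning
 private variable n : ℕ
 nowe : ∀ (v : ℤ) -> v Z.* v ≡ + (norm² v)
 nowe v = tr (sy (Z.*d v v)) (square v)
  where
  square : ∀ v -> v ℤ.* v ≡ + (norm² v)
  square (+ m) = sy (ZP.pos-* m m)
  square -[1+ m ] = refl
 wewe : (c : Ch n) (v : Vec ℤ n) -> wei c v ≡ + weightℕ c v
 wewe done Vec.[] = refl
 wewe (step p b c) (v Vec.∷ vs) = tr (cg2 Z._+_ (tr (Z.mc (nowe v)) (sy (pos-* (piv c) (norm² v)))) (wewe c vs)) (sy (pos-+ _ _))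
 labo : ∀ N (c : Ch n) x V -> All (\ y -> ∣ y ∣ ≤ V) (lattice 1ℤ c x) -> All (\ y -> ∣ y ∣ ≤ N * V) (lattice (+ N) c x)
 labo N done Vec.[] V All.[] = All.[]
 labo N (step p b c) (x Vec.∷ xs) V (y≤ All.∷ ys≤) = scbo All.∷ labo N c xs V ys≤
  where
  z = + suc p Z.* x Z.+ dot b (lk xs)
  scbo : ∣ + N Z.* z ∣ ≤ N * V
  scbo = ≤-trans (≤-reflexive (tr (cg ∣_∣ (sy (Z.*d (+ N) z))) (ZP.abs-* (+ N) z))) (*-monoʳ-≤ N (≤-trans (≤-reflexive (cg ∣_∣ (sy (Z.*-identityˡ z)))) y≤))
 ef : ∀ {A : Set} {Φ : (A -> ℤ) -> ℤ} -> Additive Φ -> ∀ us (G : ℕ -> A -> ℤ) -> ev us (\ i -> Φ (G i)) ≡ Φ (\ a -> ev us (\ i -> G i a))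
 ef add [] G = sy (tr (congruent (\ _ -> sy (Z.*-zeroˡ 0ℤ))) (tr (homogeneous 0ℤ (\ _ -> 0ℤ)) (Z.*-zeroˡ _)))
  where open Additive add
 ef add (u ∷ us) G = sy (tr (additive _ _) (cg2 Z._+_ (homogeneous u (G 0)) (sy (ef add us (\ i -> G (suc i))))))
  where open Additive add
 -- A factorial-like product: a common multiple of the first `n` values, used to make all rates
 -- exact.
 prto : (ℕ -> ℕ) -> ℕ -> ℕ
 prto f zero = 1
 prto f (suc n) = f (suc n) * prto f n
 pt∣ : ∀ f n P -> .{{NonZero P}} -> P ≤ n -> f P ∣ prto f n
 pt∣ f zero (suc P) ()
 pt∣ f (suc n) P le with P ≟ suc n
 ... | yes refl = m∣m*n _
 ... | no ne = ∣-trans (pt∣ f n P (≤-pred (≤∧≢⇒< le ne))) (n∣m*n (f (suc n)))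
 pt≢ : ∀ f n -> (∀ P -> NonZero (f (suc P))) -> NonZero (prto f n)
 pt≢ f zero nz = _
 pt≢ f (suc n) nz = m*n≢0 (f (suc n)) (prto f n) {{nz n}} {{pt≢ f n nz}}
 k𝟎p : ∀ j (ss : Vec ℕ n) -> NonZero (ke (sc j ss) 𝟎)
 k𝟎p j Vec.[] = _
 k𝟎p j (s Vec.∷ ss) = m*n≢0 (ker (j * s) 0ℤ) (ke (sc j ss) 𝟎) {{sb NonZero (sy (kaz (j * s))) (central≢0 (j * s))}} {{k𝟎p j ss}}
  where
  choo : ∀ n d -> NonZero (cho (n + d) n)
  choo zero zero = _
  choo zero (suc d) = _
  choo (suc n) d with cho (n + d) n | choo n d
  ... | suc k | _ = _
  central≢0 : ∀ t -> NonZero (ce t)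
  central≢0 t = choo t t
 haon : ∀ n -> half n (\ _ -> 1ℤ) ≡ + (2 ^ n)
 haon zero = refl
 haon (suc n) = tr (cg2 Z._+_ (haon n) (haon n)) (tr (sy (pos-+ _ _)) (cg (\ z -> + (2 ^ n + z)) (sy (+-identityʳ _))))
 waon : (ts : Vec ℕ n) -> walk ts (\ _ -> 1ℤ) ≡ + vo ts
 waon Vec.[] = refl
 waon (t Vec.∷ ts) = tr (Additive.congruent (ha (t + t)) (\ _ -> tr (waon ts) (sy (Z.*-identityʳ _))))
  (tr (Additive.homogeneous (ha (t + t)) (+ vo ts) (\ _ -> 1ℤ)) (tr (cg (+ vo ts Z.*_) (haon (t + t)))
   (tr (sy (pos-* (vo ts) (2 ^ (t + t)))) (cg +_ (tr (*-comm (vo ts) _) (cg (_* vo ts) (tr (^-distribˡ-+-* 2 t t) (sy (^-distrib-* 2 2 t)))))))))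
 vol : (ts : Vec ℕ n) -> NonZero (vo ts)
 vol Vec.[] = _
 vol (t Vec.∷ ts) = m*n≢0 (4 ^ t) (vo ts) {{m^n≢0 4 t}} {{vol ts}}
 poma : ∀ e A H T -> .{{NonZero A}} -> A ≤ T -> suc A ^ e * H ≤ A ^ e * suc H -> suc T ^ e * H ≤ T ^ e * suc H
 poma e A H T A≤T margin = *-cancelʳ-≤ _ _ (A ^ e) {{m^n≢0 A e}} (begin
  suc T ^ e * H * A ^ e ≡⟨ tr (sl (suc T ^ e) H (A ^ e)) (cg (_* H) (sy (^-distrib-* (suc T) A e))) ⟩
  (suc T * A) ^ e * H ≤⟨ *-monoˡ-≤ H (^-monoˡ-≤ e sT) ⟩
  (T * suc A) ^ e * H ≡⟨ tr (cg (_* H) (^-distrib-* T (suc A) e)) (*-assoc (T ^ e) _ H) ⟩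
  T ^ e * (suc A ^ e * H) ≤⟨ *-monoʳ-≤ (T ^ e) margin ⟩
  T ^ e * (A ^ e * suc H) ≡⟨ shuffle (T ^ e) (A ^ e) (suc H) ⟩
  T ^ e * suc H * A ^ e ∎)
  where
  sl : ∀ x y z -> x * y * z ≡ x * z * y
  sl = sv
  shuffle : ∀ x y z -> x * (y * z) ≡ x * z * y
  shuffle = sv
  sT : suc T * A ≤ T * suc A
  sT = ≤-trans (+-monoˡ-≤ (T * A) A≤T) (≤-reflexive (sy (*-suc T A)))
 -- Stated for variables, like `vr`, `scro` and `conclude` below, so that the enormous constants of
 -- the certificate are never expanded.
 cala : ∀ f l L h K c S p r -> f * l ≡ L -> .{{NonZero (L * h)}} -> (L * h) * p ≤ (f * K) * S -> S ≤ c * l * h -> c * K ≤ r -> p ≤ r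
 cala f l L h K c S p r refl Lhp S≤ cK≤r = ≤-trans (*-cancelˡ-≤ (f * l * h) (begin
  (f * l * h) * p ≤⟨ Lhp ⟩
  (f * K) * S ≤⟨ *-monoʳ-≤ (f * K) S≤ ⟩
  (f * K) * (c * l * h) ≡⟨ shuffle f K c l h ⟩
  (f * l * h) * (c * K) ∎)) cK≤r
  where
  shuffle : ∀ f K c L h -> (f * K) * (c * L * h) ≡ (f * L * h) * (c * K)
  shuffle = sv
 vr : ∀ M f t P d w V ff tt dd ww -> ff ≡ f * f -> tt ≡ t * t * (P * P) -> dd ≡ d * d -> ww ≡ w * w ->
  M * M * (ff * tt) * dd ≤ ww * (V * V) -> M * f * t * P * d ≤ w * V
 vr M f t P d w V _ _ _ _ refl refl refl refl le = square-cancel-≤ (sb2 _≤_ (left M f t P d) (right w V) le)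
  where
  left : ∀ M f t P d -> M * M * (f * f * (t * t * (P * P))) * (d * d) ≡ M * f * t * P * d * (M * f * t * P * d)
  left = sv
  right : ∀ w V -> w * w * (V * V) ≡ w * V * (w * V)
  right = sv
 scro : ∀ i g t P C f M d w gw V -> i ≡ g * t * P -> C ≡ f * M -> gw ≡ g * w -> M * f * t * P * d ≤ w * V -> i * C * d ≤ gw * V
 scro _ g t P _ f M d w _ V refl refl refl le = sb2 _≤_ (left g M f t P d) (sy (*-assoc g w V)) (*-monoʳ-≤ g le)
  where
  left : ∀ g M f t P d -> g * (M * f * t * P * d) ≡ g * t * P * (f * M) * d
  left = sv
 po24 : ∀ N T -> N * N ≡ 18 * T -> N ^ 24 ≡ 18 ^ 12 * T ^ 12
 po24 N T e = tr (sy (^-*-assoc N 2 12)) (tr (cg (_^ 12) (tr (cg (N *_) (*-identityʳ N)) e)) (^-distrib-* 18 T 12))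
 dopo : ∀ x e -> x ^ (e + e) ≡ x ^ e * x ^ e
 dopo x e = ^-distribˡ-+-* x e e
 pipo : ∀ {n} (c : Ch n) -> 0 < piv c
 pipo done = s≤s z≤n
 pipo (step p b c) = ≤-trans (pipo c) (m≤m+n _ _)
 opaque
  wi : ℕ -> ℕ -> ℕ -> ℕ
  wi n N P = N ^ n * P
  wi2 : ∀ N T P -> N * N ≡ 18 * T -> wi 24 N P ≡ 18 ^ 12 * T ^ 12 * P
  wi2 N T P e = cg (_* P) (po24 N T e)
  wein : ∀ n N P -> .{{NonZero N}} -> .{{NonZero P}} -> 0 < wi n N P
  wein n N P = >-nonZero⁻¹ (N ^ n * P) {{m*n≢0 (N ^ n) P {{m^n≢0 N n}}}}
  iw : ∀ N (c : Ch n) T -> WalkOn.index N c T ≡ + wi n (suc N) (piv c)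
  iw N c T = refl
 conclude : ∀ K R V i C S μ w w₀ d G -> .{{NonZero V}} -> K * (R * V) ≤ i * (C * (S + μ * w)) -> i * C * d ≤ G * V -> G * (S + μ * w₀) < K * R * d -> w₀ < w
 conclude K R V i C S μ w w₀ d G combined volume-bound final = ≰⇒> \ w≤w₀ -> <-irrefl refl (begin-strict
  G * (S + μ * w₀) * V <⟨ *-monoˡ-< V final ⟩
  K * R * d * V ≡⟨ shuf K R d V ⟩
  K * (R * V) * d ≤⟨ *-monoˡ-≤ d combined ⟩
  i * (C * (S + μ * w)) * d ≡⟨ shu i C (S + μ * w) d ⟩
  i * C * d * (S + μ * w) ≤⟨ *-mono-≤ volume-bound (+-monoʳ-≤ S (*-monoʳ-≤ μ w≤w₀)) ⟩
  G * V * (S + μ * w₀) ≡⟨ shuffle₃ G V (S + μ * w₀) ⟩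
  G * (S + μ * w₀) * V ∎)
  where
  shuf : ∀ K R d V -> K * R * d * V ≡ K * (R * V) * d
  shuf = sv
  shu : ∀ i C X d -> i * (C * X) * d ≡ i * C * d * X
  shu = sv
  shuffle₃ : ∀ G V X -> G * V * X ≡ G * X * V
  shuffle₃ = sv
 module _ (M : Mat 24) (completed : Completion M) (unimodular : det 24 M ≡ 1ℤ)
  (hn : Vec ℤ 24 -> ℕ) (hns : ∀ x -> form M (lk x) (lk x) ≡ + (2 * hn x)) (nr : ∀ x -> hn x ≢ 1) (hnz : ∀ x -> hn x ≡ 0 -> x ≡ 𝟎)
  (short : List (Vec ℤ 24)) (shco : ∀ x -> 1 ≤ hn x -> hn x ≤ 4 -> x ∈ short) where
  open Completion completed renaming (chain to c)
  -- `λ₀` bounds the unscaled walk coordinates of all vectors of norm at most 32. The mesh is chosen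
  -- after it, because lower kernel estimates need displacements that are small against `T`.
  module Scaled (λ₀ : ℕ) (bounded : ∀ x -> hn x ≤ 16 -> All (\ y -> ∣ y ∣ ≤ λ₀) (lattice 1ℤ c x))
   (Q T N₀ q a : ℕ) (vast≤Q : vast ≤ Q) (vast≤T : vast ≤ T) (N² : suc N₀ * suc N₀ ≡ 18 * T) (a≡ : suc a ≡ 2 * q) (Vs : suc Q * (suc N₀ * λ₀) ≤ T)
   .{{_ : NonZero Q}} .{{_ : NonZero T}} .{{_ : NonZero q}} .{{_ : NonZero a}}
   (m∣ : ∀ j P -> .{{NonZero j}} -> .{{NonZero P}} -> j ≤ 15 -> P ≤ piv c -> Q * (j * (T * P) * odd (j * (T * P))) ∣ q)
   (eb : base a ↑ q ≼ e₁) (e₀bo : e₀ ≼ base a ↑ q) where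
   N : ℕ
   N = suc N₀
   open Context c a T N q a≡ N² hiding (ss)
   ss : Vec ℕ 24
   ss = times T c
   o∣ : ∀ j -> .{{NonZero j}} -> j ≤ 15 -> Od j
   o∣ j j≤ P P≤ = sb (odd (j * (T * P)) ∣_) (sy a≡) (∣-trans (∣-trans (n∣m*n (j * (T * P))) (n∣m*n Q)) (∣-trans (m∣ j P j≤ P≤) (n∣m*n 2)))
   t∣ : ∀ j -> .{{NonZero j}} -> j ≤ 15 -> Ti e₀ e₀bo Q j
   t∣ j j≤ P P≤ = ∣-trans (*-monoʳ-∣ Q (m∣m*n (odd (j * (T * P))))) (m∣ j P j≤ P≤)
   -- The kernel at time `j`, padded with mass to the common time 15.
   X : ℕ -> Vec ℤ 24 -> ℕ
   X j y = vo ss ^ (15 ∸ j) * ke (sc j ss) y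
   M₀ : ℕ
   M₀ = ke (sc 15 ss) 𝟎
   opaque
    -- The common yardstick: in the limit of a fine mesh, `X j` at half norm k is this divided by
    -- j^12, times exp(-36k/j).
    C : ℕ
    C = 15 ^ 12 * M₀
    Cd : C ≡ 15 ^ 12 * M₀
    Cd = refl
   Alss : ∀ (G : ℕ -> Set) -> (∀ P -> .{{NonZero P}} -> P ≤ piv c -> G (T * P)) -> All G ss
   Alss G good = sb (\ S -> All G (times S c)) (*-identityʳ T) (Products.Alti a T (piv c) 0 0 (\ _ -> 0) G good c 1 one≤)
   ss≢ : All NonZero ss
   ss≢ = Alss NonZero (\ P _ -> m*n≢0 T P)
   ss≥ : All (T ≤_) ss
   ss≥ = Alss (T ≤_) (\ P _ -> m≤m*n T P)
   r2 : ∀ A B x y -> A * A * x ^ 24 ≤ B * B * y ^ 24 -> A * x ^ 12 ≤ B * y ^ 12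
   r2 A B x y le = square-cancel-≤ (sb2 _≤_ (sy (lemma A x)) (sy (lemma B y)) le)
    where
    lemma : ∀ A x -> A * x ^ 12 * (A * x ^ 12) ≡ A * A * x ^ 24
    lemma A x = tr (*i A (x ^ 12) A (x ^ 12)) (cg (A * A *_) (sy (^-distribˡ-+-* x 12 12)))
   cur : ∀ j d J -> j + d ≡ J -> vo ss ^ d * ke (sc j ss) 𝟎 * j ^ 12 ≤ ke (sc J ss) 𝟎 * J ^ 12
   cur j d J refl = r2 (vo ss ^ d * ke (sc j ss) 𝟎) (ke (sc (j + d) ss) 𝟎) j (j + d) (CentralProducts.ceup j d ss ss≢)
   clr : ∀ j d J -> .{{NonZero j}} -> j + d ≡ J -> ke (sc J ss) 𝟎 * (J * T) ^ 12 ≤ vo ss ^ d * ke (sc j ss) 𝟎 * (j * suc T) ^ 12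
   clr j d J refl = r2 (ke (sc (j + d) ss) 𝟎) (vo ss ^ d * ke (sc j ss) 𝟎) ((j + d) * T) (j * suc T) (CentralProducts.celo j d T ss ss≢ ss≥)
   centre-≤ : ∀ j d -> j + d ≡ 15 -> vo ss ^ d * ke (sc j ss) 𝟎 * j ^ 12 ≤ M₀ * 15 ^ 12
   centre-≤ j d = cur j d 15
   c≥ : ∀ j d -> .{{NonZero j}} -> j + d ≡ 15 -> M₀ * (15 * T) ^ 12 ≤ vo ss ^ d * ke (sc j ss) 𝟎 * (j * suc T) ^ 12
   c≥ j d = clr j d 15
   Tma : suc T ^ 12 * H ≤ T ^ 12 * suc H
   Tma = poma 12 1000000000000 H T (≤-trans vas vast≤T) Hm
   module AtVector (x : Vec ℤ 24) where
    v : Vec ℤ 24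
    v = lattice (+ N) c x
    k : ℕ
    k = hn x
    norm : Ha v k
    norm = ZP.+-injective (tr (sy (wewe c v)) (tr (wl (+ N) x) (tr (cg2 Z._*_ (sy (pos-* N N)) (tr (Z.mc (hns x)) (sy (pos-* (piv c) _)))) (sy (pos-* (N * N) _)))))
    xbo : ∀ j d -> .{{NonZero j}} -> j + d ≡ 15 -> Mar j ->
     vo ss ^ d * ke (sc j ss) v * (j ^ 12 * D ^ k) ≤ C * ν j ^ k
    xbo j d eq (margin , size) = begin
     V * K * (j ^ 12 * D ^ k) ≡⟨ shuffle V K (j ^ 12) (D ^ k) ⟩
     V * j ^ 12 * (K * D ^ k) ≤⟨ *-monoʳ-≤ (V * j ^ 12) (kebo e₁ eb j (o∣ j j≤1) (ν j ∕ D) γ margin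
       (lapo (2 * T) (≤-trans vast≤T (m≤n*m T 2)) ((ν j ∕ D) ↑ j) size) v k norm) ⟩
     V * j ^ 12 * (K₀ * ν j ^ k) ≡⟨ shuffle V K₀ (j ^ 12) (ν j ^ k) ⟨
     V * K₀ * (j ^ 12 * ν j ^ k) ≡⟨ *-assoc (V * K₀) (j ^ 12) (ν j ^ k) ⟨
     V * K₀ * j ^ 12 * ν j ^ k ≤⟨ *-monoˡ-≤ (ν j ^ k) (≤-trans (centre-≤ j d eq) (≤-reflexive (tr (*-comm M₀ (15 ^ 12)) (sy Cd)))) ⟩
     C * ν j ^ k ∎
     where
     V = vo ss ^ d
     K = ke (sc j ss) v
     K₀ = ke (sc j ss) 𝟎
     j≤1 : j ≤ 15
     j≤1 = sb (j ≤_) eq (m≤m+n j d)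
     shuffle : ∀ V K j D -> V * K * (j * D) ≡ V * j * (K * D)
     shuffle = sv
    -- A lower estimate, needed where the certificate is negative. It is valid only for half norm up
    -- to 16, and its loss ((T+1)/T)^12 from comparing peaks is covered by `Tma`.
    xb : ∀ j d -> .{{NonZero j}} -> j + d ≡ 15 -> Ma j -> k ≤ 16 ->
     C * (ν j ^ k * H) ≤ vo ss ^ d * ke (sc j ss) v * (j ^ 12 * D ^ k * suc H)
    xb j d eq margin k≤16 = *-cancelʳ-≤ _ _ (T ^ 12) {{m^n≢0 T 12}} (begin
     C * (ν j ^ k * H) * T ^ 12 ≡⟨ tr (cg (\ z -> z * (ν j ^ k * H) * T ^ 12) Cd) (shuf (15 ^ 12) M₀ (ν j ^ k) H (T ^ 12)) ⟩
     M₀ * (15 ^ 12 * T ^ 12) * (ν j ^ k * H) ≡⟨ cg (\ z -> M₀ * z * (ν j ^ k * H)) (sy (^-distrib-* 15 T 12)) ⟩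
     M₀ * (15 * T) ^ 12 * (ν j ^ k * H) ≤⟨ *-monoˡ-≤ (ν j ^ k * H) (c≥ j d eq) ⟩
     V * K₀ * (j * suc T) ^ 12 * (ν j ^ k * H) ≡⟨ tr (cg (\ z -> V * K₀ * z * (ν j ^ k * H)) (^-distrib-* j (suc T) 12)) (shu V K₀ (j ^ 12) (suc T ^ 12) (ν j ^ k) H) ⟩
     V * j ^ 12 * (K₀ * ν j ^ k) * (suc T ^ 12 * H) ≤⟨ *-mono-≤ (*-monoʳ-≤ (V * j ^ 12) (kb e₀ e₀bo Q j (t∣ j j≤1) (N * λ₀) Vs (ν j ∕ D) γ margin
       (lapo Q vast≤Q (e₀ ↑ 36) e₀si) v k (labo N c x λ₀ (bounded x k≤16)) norm)) Tma ⟩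
     V * j ^ 12 * (K * D ^ k) * (T ^ 12 * suc H) ≡⟨ shuffle₃ V (j ^ 12) K (D ^ k) (T ^ 12) (suc H) ⟩
     V * K * (j ^ 12 * D ^ k * suc H) * T ^ 12 ∎)
     where
     V = vo ss ^ d
     K = ke (sc j ss) v
     K₀ = ke (sc j ss) 𝟎
     j≤1 : j ≤ 15
     j≤1 = sb (j ≤_) eq (m≤m+n j d)
     shuf : ∀ f M n H T -> f * M * (n * H) * T ≡ M * (f * T) * (n * H)
     shuf = sv
     shu : ∀ V K j S n H -> V * K * (j * S) * (n * H) ≡ V * j * (K * n) * (S * H)
     shu = sv
     shuffle₃ : ∀ V j K D T H -> V * j * (K * D) * (T * H) ≡ V * K * (j * D * H) * T
     shuffle₃ = sv
    xt : ∀ j d -> .{{NonZero j}} -> j + d ≡ 15 -> j ≤ 15 -> Marginᵗ j ->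
     vo ss ^ d * ke (sc j ss) v * (j ^ 12 * 100 ^ k) ≤ 15 ^ 12 * ke (sc 15 ss) v * τ j ^ k
    xt j d eq j≤1 (mar margin) = *-cancelʳ-≤ _ _ M₀ {{k𝟎p 15 ss}} (begin
     V * K * (j ^ 12 * 100 ^ k) * M₀ ≡⟨ shuf V K (j ^ 12) (100 ^ k) M₀ ⟩
     V * j ^ 12 * (K * M₀ * 100 ^ k) ≤⟨ *-monoʳ-≤ (V * j ^ 12) (kt (37 ∕ 100) (≼t eb ec) j 15 j≤1 (o∣ j j≤1) (o∣ 15 ≤-refl) Tl (τ j ∕ 100) margin v k norm) ⟩
     V * j ^ 12 * (K₀ * K₁₅ * τ j ^ k) ≡⟨ shu V (j ^ 12) K₀ K₁₅ (τ j ^ k) ⟩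
     V * K₀ * j ^ 12 * (K₁₅ * τ j ^ k) ≤⟨ *-monoˡ-≤ (K₁₅ * τ j ^ k) (centre-≤ j d eq) ⟩
     M₀ * 15 ^ 12 * (K₁₅ * τ j ^ k) ≡⟨ shuffle₃ M₀ (15 ^ 12) K₁₅ (τ j ^ k) ⟩
     15 ^ 12 * K₁₅ * τ j ^ k * M₀ ∎)
     where
     V = vo ss ^ d
     K = ke (sc j ss) v
     K₀ = ke (sc j ss) 𝟎
     K₁₅ = ke (sc 15 ss) v
     shuf : ∀ V K j h M -> V * K * (j * h) * M ≡ V * j * (K * M * h)
     shuf = sv
     shu : ∀ V j K L t -> V * j * (K * L * t) ≡ V * K * j * (L * t)
     shu = sv
     shuffle₃ : ∀ M f L t -> M * f * (L * t) ≡ f * L * t * M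
     shuffle₃ = sv
     Tl : suc (2 * T) * suc (2 * T) * 100 ≤ 101 * (4 * (T * T))
     Tl = begin
      suc (2 * T) * suc (2 * T) * 100 ≡⟨ expand T ⟩
      400 * (T * T) + (400 * T + 100) ≤⟨ +-monoʳ-≤ (400 * (T * T)) (begin
       400 * T + 100 ≤⟨ +-monoʳ-≤ (400 * T) (*-monoʳ-≤ 100 (>-nonZero⁻¹ T)) ⟩
       400 * T + 100 * T ≡⟨ co T ⟩
       4 * (125 * T) ≤⟨ *-monoʳ-≤ 4 (*-monoˡ-≤ T (≤-trans (≤-trans (≤ᵇ⇒≤ 125 1000000000000 tt) vas) vast≤T)) ⟩
       4 * (T * T) ∎) ⟩
      400 * (T * T) + 4 * (T * T) ≡⟨ te (T * T) ⟩
      101 * (4 * (T * T)) ∎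
      where
      expand : ∀ T -> suc (2 * T) * suc (2 * T) * 100 ≡ 400 * (T * T) + (400 * T + 100)
      expand = sv
      co : ∀ T -> 400 * T + 100 * T ≡ 4 * (125 * T)
      co = sv
      te : ∀ S -> 400 * S + 4 * S ≡ 101 * (4 * S)
      te = sv
    pos neg : ℕ
    pos = total pt (\ j -> X j v)
    neg = total nete (\ j -> X j v)
    ut : (Λ * suc H * D ^ k) * pos ≤ C * upsu k
    ut = sb2 _≤_ (t* pt (Λ * suc H * D ^ k) (\ j -> X j v)) (t* pt C (\ j -> Λ/ j * (ν j ^ k * suc H)))
     (tomo pt {\ j -> (Λ * suc H * D ^ k) * X j v} {\ j -> C * (Λ/ j * (ν j ^ k * suc H))}
      (zip margin⁺ Λp))
     where
     one : ∀ j d -> .{{NonZero j}} -> j + d ≡ 15 -> Mar j -> Λd j ->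
      (Λ * suc H * D ^ k) * (vo ss ^ d * ke (sc j ss) v) ≤ C * (Λ/ j * (ν j ^ k * suc H))
     one j d eq mg Λ≡ = begin
      (Λ * suc H * D ^ k) * Y ≡⟨ cg (\ z -> (z * suc H * D ^ k) * Y) (sy Λ≡) ⟩
      (j ^ 12 * Λ/ j * suc H * D ^ k) * Y ≡⟨ shuf (j ^ 12) (Λ/ j) (suc H) (D ^ k) Y ⟩
      Y * (j ^ 12 * D ^ k) * (Λ/ j * suc H) ≤⟨ *-monoˡ-≤ (Λ/ j * suc H) (xbo j d eq mg) ⟩
      C * ν j ^ k * (Λ/ j * suc H) ≡⟨ shu C (ν j ^ k) (Λ/ j) (suc H) ⟩
      C * (Λ/ j * (ν j ^ k * suc H)) ∎
      where
      Y = vo ss ^ d * ke (sc j ss) v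
      shuf : ∀ j L H D Y -> (j * L * H * D) * Y ≡ Y * (j * D) * (L * H)
      shuf = sv
      shu : ∀ C n L H -> C * n * (L * H) ≡ C * (L * (n * H))
      shu = sv
     zip : Allₗ.All (\ t -> Mar (p1 t)) pt -> Allₗ.All (\ t -> Λd (p1 t)) pt ->
      Allₗ.All (\ t -> (Λ * suc H * D ^ k) * X (p1 t) v ≤ C * (Λ/ (p1 t) * (ν (p1 t) ^ k * suc H))) pt
     zip (a ∷ b ∷ c ∷ d ∷ e ∷ f ∷ []) (a′ ∷ b′ ∷ c′ ∷ d′ ∷ e′ ∷ f′ ∷ []) =
      one 4 11 refl a a′ ∷ one 6 9 refl b b′ ∷ one 8 7 refl c c′ ∷ one 10 5 refl d d′ ∷ one 12 3 refl e e′ ∷ one 14 1 refl f f′ ∷ []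
    loto : k ≤ 16 -> C * losu k ≤ (Λ * suc H * D ^ k) * neg
    loto k≤16 = sb2 _≤_ (t* nete C (\ j -> Λ/ j * (ν j ^ k * H))) (t* nete (Λ * suc H * D ^ k) (\ j -> X j v))
     (tomo nete {\ j -> C * (Λ/ j * (ν j ^ k * H))} {\ j -> (Λ * suc H * D ^ k) * X j v} (zip margin⁻ Λn))
     where
     one : ∀ j d -> .{{NonZero j}} -> j + d ≡ 15 -> Ma j -> Λd j ->
      C * (Λ/ j * (ν j ^ k * H)) ≤ (Λ * suc H * D ^ k) * (vo ss ^ d * ke (sc j ss) v)
     one j d eq mg Λ≡ = begin
      C * (Λ/ j * (ν j ^ k * H)) ≡⟨ shu C (Λ/ j) (ν j ^ k * H) ⟩
      C * (ν j ^ k * H) * Λ/ j ≤⟨ *-monoˡ-≤ (Λ/ j) (xb j d eq mg k≤16) ⟩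
      Y * (j ^ 12 * D ^ k * suc H) * Λ/ j ≡⟨ shuf (j ^ 12) (Λ/ j) (suc H) (D ^ k) Y ⟩
      (j ^ 12 * Λ/ j * suc H * D ^ k) * Y ≡⟨ cg (\ z -> (z * suc H * D ^ k) * Y) Λ≡ ⟩
      (Λ * suc H * D ^ k) * Y ∎
      where
      Y = vo ss ^ d * ke (sc j ss) v
      shuf : ∀ j L H D Y -> Y * (j * D * H) * L ≡ (j * L * H * D) * Y
      shuf = sv
      shu : ∀ C L n -> C * (L * n) ≡ C * n * L
      shu = sv
     zip : Allₗ.All (\ t -> Ma (p1 t)) nete -> Allₗ.All (\ t -> Λd (p1 t)) nete ->
      Allₗ.All (\ t -> C * (Λ/ (p1 t) * (ν (p1 t) ^ k * H)) ≤ (Λ * suc H * D ^ k) * X (p1 t) v) nete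
     zip (a ∷ b ∷ c ∷ d ∷ e ∷ f ∷ []) (a′ ∷ b′ ∷ c′ ∷ d′ ∷ e′ ∷ f′ ∷ []) =
      one 5 10 refl a a′ ∷ one 7 8 refl b b′ ∷ one 9 6 refl c c′ ∷ one 11 4 refl d d′ ∷ one 13 2 refl e e′ ∷ one 15 0 refl f f′ ∷ []
    ft : k ≤ 16 -> Fits k -> Λ * suc H * pos ≤ Λ * suc H * neg + C * bu k
    ft k≤16 fits = *-cancelʳ-≤ _ _ (D ^ k) {{m^n≢0 D k}} (begin
     Λ * suc H * pos * D ^ k ≡⟨ sl (Λ * suc H) pos (D ^ k) ⟩
     Λ * suc H * D ^ k * pos ≤⟨ ut ⟩
     C * upsu k ≤⟨ *-monoʳ-≤ C (fit k fits) ⟩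
     C * (losu k + bu k * D ^ k) ≡⟨ *-distribˡ-+ C (losu k) _ ⟩
     C * losu k + C * (bu k * D ^ k) ≤⟨ +-monoˡ-≤ _ (loto k≤16) ⟩
     Λ * suc H * D ^ k * neg + C * (bu k * D ^ k) ≡⟨ co (Λ * suc H) (D ^ k) neg C (bu k) ⟩
     (Λ * suc H * neg + C * bu k) * D ^ k ∎)
     where
     sl : ∀ x y z -> x * y * z ≡ x * z * y
     sl = sv
     co : ∀ x d n C b -> x * d * n + C * (b * d) ≡ (x * n + C * b) * d
     co = sv
    -- For norm at least 34 the negative term at time 15 alone outweighs all positive terms, by the
    -- direct comparison of kernels, so no lower Gaussian estimate is needed far out.
    tato : ∀ e -> k ≡ e + 17 -> pos ≤ neg
    tato e k≡ = cala (15 ^ 12) (Λ/ 15) Λ (100 ^ k) K₁₅ 52272900000000000000000 (total pt (\ j -> Λ/ j * τ j ^ k)) pos neg Λ1 {{m*n≢0 Λ (100 ^ k) {{Λ≢}} {{m^n≢0 100 k}}}}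
     each easu late
     where
     K₁₅ = ke (sc 15 ss) v
     X-15 : X 15 v ≡ K₁₅
     X-15 = *-identityˡ K₁₅
     late : 52272900000000000000000 * K₁₅ ≤ neg
     late = coerce 52272900000000000000000 (t∈ nete (\ j -> X j v) (there (there (there (there (there (here refl)))))))
      where
      coerce : ∀ c -> c * X 15 v ≤ neg -> c * K₁₅ ≤ neg
      coerce c = sb (\ z -> c * z ≤ neg) X-15
     one : ∀ j d -> .{{NonZero j}} -> j + d ≡ 15 -> j ≤ 15 -> Marginᵗ j -> Λd j ->
      (Λ * 100 ^ k) * (vo ss ^ d * ke (sc j ss) v) ≤ (15 ^ 12 * K₁₅) * (Λ/ j * τ j ^ k)
     one j d eq j≤ mg Λ≡ = begin
      (Λ * 100 ^ k) * Y ≡⟨ cg (\ z -> (z * 100 ^ k) * Y) (sy Λ≡) ⟩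
      (j ^ 12 * Λ/ j * 100 ^ k) * Y ≡⟨ shuf (j ^ 12) (Λ/ j) (100 ^ k) Y ⟩
      Y * (j ^ 12 * 100 ^ k) * Λ/ j ≤⟨ *-monoˡ-≤ (Λ/ j) (xt j d eq j≤ mg) ⟩
      15 ^ 12 * K₁₅ * τ j ^ k * Λ/ j ≡⟨ shu (15 ^ 12 * K₁₅) (τ j ^ k) (Λ/ j) ⟩
      (15 ^ 12 * K₁₅) * (Λ/ j * τ j ^ k) ∎
      where
      Y = vo ss ^ d * ke (sc j ss) v
      shuf : ∀ j L h Y -> (j * L * h) * Y ≡ Y * (j * h) * L
      shuf = sv
      shu : ∀ x t L -> x * t * L ≡ x * (L * t)
      shu = sv
     zip : Allₗ.All (\ t -> Marginᵗ (p1 t)) pt -> Allₗ.All (\ t -> Λd (p1 t)) pt ->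
      Allₗ.All (\ t -> (Λ * 100 ^ k) * X (p1 t) v ≤ (15 ^ 12 * K₁₅) * (Λ/ (p1 t) * τ (p1 t) ^ k)) pt
     zip (a ∷ b ∷ c ∷ d ∷ e ∷ f ∷ []) (a′ ∷ b′ ∷ c′ ∷ d′ ∷ e′ ∷ f′ ∷ []) =
      one 4 11 refl (lt 4 11) a a′ ∷ one 6 9 refl (lt 6 9) b b′ ∷ one 8 7 refl (lt 8 7) c c′ ∷ one 10 5 refl (lt 10 5) d d′ ∷ one 12 3 refl (lt 12 3) e e′ ∷ one 14 1 refl (lt 14 1) f f′ ∷ []
      where
      lt : ∀ j d -> j ≤ j + d
      lt = m≤m+n
     each : (Λ * 100 ^ k) * pos ≤ (15 ^ 12 * K₁₅) * total pt (\ j -> Λ/ j * τ j ^ k)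
     each = sb2 _≤_ (t* pt (Λ * 100 ^ k) (\ j -> X j v)) (t* pt (15 ^ 12 * K₁₅) (\ j -> Λ/ j * τ j ^ k))
      (tomo pt {\ j -> (Λ * 100 ^ k) * X j v} {\ j -> (15 ^ 12 * K₁₅) * (Λ/ j * τ j ^ k)} (zip marginᵗ Λp))
     easu : total pt (\ j -> Λ/ j * τ j ^ k) ≤ 52272900000000000000000 * Λ/ 15 * 100 ^ k
     easu = tasu k e k≡
    sibo : Λ * suc H * pos ≤ Λ * suc H * neg + C * bu k
    sibo = cases k refl
     where
     small : k ≤ 16 -> Fits k -> Λ * suc H * pos ≤ Λ * suc H * neg + C * bu k
     small = ft
     large : ∀ e -> k ≡ e + 17 -> Λ * suc H * pos ≤ Λ * suc H * neg + C * bu k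
     large e k≡ = ≤-trans (*-monoʳ-≤ (Λ * suc H) (tato e k≡)) (m≤m+n (Λ * suc H * neg) (C * bu k))
     rearrange : ∀ e -> 2 + (e + 15) ≡ e + 17
     rearrange = sv
     split : ∀ k₀ -> k ≡ 2 + k₀ -> k₀ ≤ 14 ⊎ 15 ≤ k₀ -> Λ * suc H * pos ≤ Λ * suc H * neg + C * bu k
     split k₀ k≡ (n1 le) = small (≤-trans (≤-reflexive k≡) (+-monoʳ-≤ 2 le)) (sb Fits (sy k≡) (f2 k₀ le))
     split k₀ k≡ (n2 gt) = large (k₀ ∸ 15) (tr k≡ (tr (cg (\ z -> 2 + z) (sy (m∸n+n≡m gt))) (rearrange (k₀ ∸ 15))))
     cases : ∀ k₀ -> k ≡ k₀ -> Λ * suc H * pos ≤ Λ * suc H * neg + C * bu k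
     cases zero k≡ = small (≤-trans (≤-reflexive k≡) z≤n) (sb Fits (sy k≡) f0)
     cases (suc zero) k≡ = cx k≡ (nr x)
     cases (suc (suc k₀)) k≡ = split k₀ k≡ (≤-<-connex k₀ 14)
   B : ℕ
   B = 15 * (T * piv c)
   scti : ∀ {n} t S (c : Ch n) -> sc t (times S c) ≡ times (t * S) c
   scti t S done = refl
   scti t S (step p b c) = cg2 Vec._∷_ (sy (*-assoc t S (suc p))) (tr (scti t (S * suc p) c) (cg (\ z -> times z c) (sy (*-assoc t S (suc p)))))
   open WalkOn N₀ c T using (Δ; return; mass; index) renaming (_^_ to _^ᶻ_)
   scal : ∀ t -> t ≤ 15 -> All (_≤ B) (sc t ss)
   scal t t≤ = AP.map⁺ (All.map (\ s≤ -> *-mono-≤ t≤ s≤) (Alss (_≤ T * piv c) (\ P P≤ -> *-monoʳ-≤ T P≤)))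
   opaque
    toov : (Vec ℤ 24 -> ℤ) -> ℤ
    toov = ran B
    toa : Additive toov
    toa = ra 24 B
    toovpo : ∀ u -> toov (\ y -> indi (y ≟ᵥ u)) ℤ.≤ 1ℤ
    toovpo = rapo 24 B
    wto : ∀ (ts : Vec ℕ 24) -> All (_≤ B) ts -> ∀ g -> walk ts g ≡ toov (\ y -> + ke ts y Z.* g y)
    wto = wake B
   rera : ∀ t -> t ≤ 15 -> return t ≡ toov (\ y -> + ke (sc t ss) y Z.* Δ y)
   rera t t≤ = tr (cg (\ ts -> walk ts Δ) (sy (scti t T c))) (wto (sc t ss) (scal t t≤) Δ)
   mv : mass ≡ + vo ss
   mv = tr (cg (\ S -> walk (times S c) (\ _ -> 1ℤ)) (*-identityˡ T)) (waon ss)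
   mapo : ∀ k -> mass ^ᶻ k ≡ + (vo ss ^ k)
   mapo zero = refl
   mapo (suc k) = tr (cg2 Z._*_ mv (mapo k)) (sy (pos-* (vo ss) (vo ss ^ k)))
   Y : ℕ -> ℤ
   Y t = mass ^ᶻ (15 ∸ t) Z.* return t
   opaque
    -- The auxiliary function of the linear programming bound, at a grid point.
    F : Vec ℤ 24 -> ℤ
    F y = ev R (\ t -> + X t y)
    Fd : ∀ y -> ev R (\ t -> + X t y) ≡ F y
    Fd y = refl
    Fs : ∀ y -> F y Z.+ + total nete (\ t -> X t y) ≡ + total pt (\ t -> X t y)
    Fs y = sb2 (\ ts us -> ev R (\ t -> + X t y) Z.+ + total ts (\ t -> X t y) ≡ + total us (\ t -> X t y)) nR pR (spsi 0 R (\ t -> X t y))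
   ev-Y : ev R Y ≡ toov (\ y -> F y Z.* Δ y)
   ev-Y = tr (ec< R each) (tr (ef toa R (\ t y -> + X t y Z.* Δ y)) (A.congruent puou))
    where
    module A = Additive toa
    puou : ∀ y -> ev R (\ t -> + X t y Z.* Δ y) ≡ F y Z.* Δ y
    puou y = tr (evco R (\ t -> Z.*-comm (+ X t y) (Δ y))) (tr (ev-* R (Δ y) (\ t -> + X t y)) (tr (Z.*-comm (Δ y) (ev R (\ t -> + X t y))) (Z.mr (Fd y))))
    each : ∀ t -> t < Data.List.length R -> Y t ≡ toov (\ y -> + X t y Z.* Δ y)
    each t t< = tr (cg2 Z._*_ (mapo (15 ∸ t)) (rera t (≤-pred t<))) (tr (sy (A.homogeneous (+ (vo ss ^ (15 ∸ t))) (\ y -> + ke (sc t ss) y Z.* Δ y)))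
     (A.congruent (\ y -> tr (sy (Z.*-assoc (+ (vo ss ^ (15 ∸ t))) (+ ke (sc t ss) y) (Δ y))) (Z.mr (sy (pos-* (vo ss ^ (15 ∸ t)) (ke (sc t ss) y)))))))
   at : Vec ℤ 24 -> Vec ℤ 24 -> ℤ
   at x y = indi (y ≟ᵥ lattice (+ N) c x)
   listed : List (Vec ℤ 24) -> Vec ℤ 24 -> ℤ
   listed [] y = 0ℤ
   listed (x ∷ xs) y = + (μ * wo (hn x)) Z.* at x y Z.+ listed xs y
   -- A majorant supported on the origin and the listed short vectors; elsewhere the auxiliary
   -- function is at most zero on the lattice.
   W : Vec ℤ 24 -> ℤ
   W y = + S₀ Z.* at 𝟎 y Z.+ listed short y
   atno : ∀ x y -> 0ℤ ℤ.≤ at x y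
   atno x y = inbi (y ≟ᵥ lattice (+ N) c x)
    where
    inbi : ∀ {A : Set} (d : Relation.Nullary.Dec A) -> 0ℤ ℤ.≤ indi d
    inbi (yes a) = sb (0ℤ ℤ.≤_) (sy (inye (yes a) a)) (ℤ.+≤+ z≤n)
    inbi (no ¬a) = ZP.≤-reflexive (sy (inno (no ¬a) ¬a))
   atse : ∀ x -> at x (lattice (+ N) c x) ≡ 1ℤ
   atse x = inye (lattice (+ N) c x ≟ᵥ lattice (+ N) c x) refl
   tn : ∀ m x y -> 0ℤ ℤ.≤ + m Z.* at x y
   tn m x y = Z.*n {+ m} (ℤ.+≤+ z≤n) (atno x y)
   ln : ∀ xs y -> 0ℤ ℤ.≤ listed xs y
   ln [] y = ZP.≤-refl
   ln (x ∷ xs) y = Z.+no (tn _ x y) (ln xs y)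
   Wn : ∀ y -> 0ℤ ℤ.≤ W y
   Wn y = Z.+no (tn S₀ 𝟎 y) (ln short y)
   l∈ : ∀ {x} xs -> x ∈ xs -> + (μ * wo (hn x)) ℤ.≤ listed xs (lattice (+ N) c x)
   l∈ {x} (x ∷ xs) (here refl) = sb (ℤ._≤ listed (x ∷ xs) (lattice (+ N) c x)) (tr (Z.+-identityʳ _) (tr (Z.mc (atse x)) (Z.*-identityʳ _)))
    (Z.+-mono-≤ {+ (μ * wo (hn x)) Z.* at x (lattice (+ N) c x)} ZP.≤-refl (ln xs _))
   l∈ {x} (x′ ∷ xs) (there x∈) = sb (ℤ._≤ listed (x′ ∷ xs) (lattice (+ N) c x)) (Z.+-identityˡ _) (Z.+-mono-≤ (tn _ x′ _) (l∈ xs x∈))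
   bW : ∀ x k -> hn x ≡ k -> + bu k ℤ.≤ W (AtVector.v x)
   bW x zero e = sb (ℤ._≤ W (lattice (+ N) c x)) (tr (Z.+-identityʳ _) (tr (Z.mc (tr (cg (\ z -> at z (lattice (+ N) c x)) (sy (hnz x e))) (atse x))) (Z.*-identityʳ _)))
    (Z.+-mono-≤ {+ S₀ Z.* at 𝟎 (lattice (+ N) c x)} ZP.≤-refl (ln short _))
   bW x (suc k) e = sb (ℤ._≤ W (lattice (+ N) c x)) (Z.+-identityˡ _) (Z.+-mono-≤ (tn S₀ 𝟎 _) (bysiz k e))
    where
    small : ∀ k -> hn x ≡ suc k -> suc k ≤ 4 -> + bu (suc k) ℤ.≤ listed short (lattice (+ N) c x)
    small k e le = sb (\ h -> + (μ * wo h) ℤ.≤ listed short (lattice (+ N) c x)) e (l∈ short (shco x (sb (1 ≤_) (sy e) (s≤s z≤n)) (sb (_≤ 4) (sy e) le)))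
    bysiz : ∀ k -> hn x ≡ suc k -> + bu (suc k) ℤ.≤ listed short (lattice (+ N) c x)
    bysiz 0 e = small 0 e (s≤s z≤n)
    bysiz 1 e = small 1 e (s≤s (s≤s z≤n))
    bysiz 2 e = small 2 e (s≤s (s≤s (s≤s z≤n)))
    bysiz 3 e = small 3 e (s≤s (s≤s (s≤s (s≤s z≤n))))
    bysiz (suc (suc (suc (suc k)))) e = sb (ℤ._≤ listed short (lattice (+ N) c x)) (cg +_ (sy (*-zeroʳ μ))) (ln short _)
   F-at : ∀ x -> + (Λ * suc H) Z.* F (AtVector.v x) ℤ.≤ + C Z.* W (AtVector.v x)
   F-at x = ZP.≤-trans (cancel (+ neg) (sb2 ℤ._≤_ left right (ℤ.+≤+ sibo))) (Z.*-monoˡ-≤ {c = + C} (ℤ.+≤+ z≤n) (bW x k refl))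
    where
    open AtVector x
    left : + (Λ * suc H * pos) ≡ + (Λ * suc H) Z.* F v Z.+ + (Λ * suc H) Z.* + neg
    left = tr (pos-* (Λ * suc H) pos) (tr (Z.mc (sy (Fs v))) (Z.*-distribˡ-+ (+ (Λ * suc H)) (F v) (+ neg)))
    right : + (Λ * suc H * neg + C * bu k) ≡ + C Z.* + bu k Z.+ + (Λ * suc H) Z.* + neg
    right = tr (pos-+ (Λ * suc H * neg) (C * bu k)) (tr (cg2 Z._+_ (pos-* (Λ * suc H) neg) (pos-* C (bu k))) (Z.+-comm (+ (Λ * suc H) Z.* + neg) (+ C Z.* + bu k)))
    cancel : ∀ z {a b} -> a Z.+ + (Λ * suc H) Z.* z ℤ.≤ b Z.+ + (Λ * suc H) Z.* z -> a ℤ.≤ b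
    cancel z {a} {b} le = sb2 ℤ._≤_ (+cn a (+ (Λ * suc H) Z.* z)) (+cn b (+ (Λ * suc H) Z.* z)) (Z.+-mono-≤ le ZP.≤-refl)
   pointwise : ∀ y -> + (Λ * suc H) Z.* (F y Z.* Δ y) ℤ.≤ + C Z.* W y
   pointwise y with me N₀ c y
   ... | yes (x , refl) = sb (\ z -> + (Λ * suc H) Z.* z ℤ.≤ + C Z.* W y) (sy (tr (Z.mc (inye (yes (x , refl)) (x , refl))) (Z.*-identityʳ _))) (F-at x)
   ... | no ¬m = sb (ℤ._≤ + C Z.* W y) (sy (tr (Z.mc (tr (Z.mc (inno (no ¬m) ¬m)) (Z.*-zeroʳ _))) (Z.*-zeroʳ _))) (Z.*n {+ C} (ℤ.+≤+ z≤n) (Wn y))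
   sw : ℕ
   sw = su short (\ x -> wo (hn x))
   rW : toov W ℤ.≤ + (S₀ + μ * sw)
   rW = sb (ℤ._≤ + (S₀ + μ * sw)) (sy (A.additive (\ y -> + S₀ Z.* at 𝟎 y) (listed short))) (sb (toov (\ y -> + S₀ Z.* at 𝟎 y) Z.+ toov (listed short) ℤ.≤_) (sy (pos-+ S₀ _))
     (Z.+-mono-≤ (term S₀ 𝟎) (libo short)))
    where
    module A = Additive (toa)
    term : ∀ m x -> toov (\ y -> + m Z.* at x y) ℤ.≤ + m
    term m x = sb2 ℤ._≤_ (sy (A.homogeneous (+ m) (at x))) (Z.*-identityʳ _) (Z.*-monoˡ-≤ {c = + m} (ℤ.+≤+ z≤n) (toovpo (lattice (+ N) c x)))
    libo : ∀ xs -> toov (listed xs) ℤ.≤ + (μ * su xs (\ x -> wo (hn x)))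
    libo [] = ZP.≤-reflexive (tr (A.congruent {listed []} {\ _ -> 0ℤ Z.* 0ℤ} (\ y -> sy (Z.*-zeroˡ 0ℤ))) (tr (A.homogeneous 0ℤ (\ _ -> 0ℤ)) (tr (Z.*-zeroˡ _) (cg +_ (sy (*-zeroʳ μ))))))
    libo (x ∷ xs) = sb2 ℤ._≤_ (sy (A.additive (\ y -> + (μ * wo (hn x)) Z.* at x y) (listed xs))) (tr (sy (pos-+ _ _)) (cg +_ (sy (*-distribˡ-+ μ _ _)))) (Z.+-mono-≤ (term (μ * wo (hn x)) x) (libo xs))
   opaque
    unfolding Z._+_ Z._*_ Z.-_ sum R[1]
    Rd : R ≡ add (square-terms u₁) (square-terms u₂)
    Rd = refl
    sums : + 480 Z.* (sum 8 (lk u₁) Z.* sum 8 (lk u₁)) Z.+ + 480 Z.* (sum 8 (lk u₂) Z.* sum 8 (lk u₂)) ≡ + R[1]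
    sums = refl
    gn : 0ℤ ℤ.≤ + 1480 Z.- + 480
    gn = ℤ.+≤+ z≤n
    sqte : ∀ u -> wesq (+ 1480) (Z.- (+ 1480 Z.- + 480)) (Vec.toList u) ≡ square-terms u
    sqte u = refl
   idx : ℕ
   idx = wi 24 (suc N₀) (piv c)
   index≡ : index ≡ + idx
   index≡ = iw N₀ c T
   ip : idx ≡ 18 ^ 12 * T ^ 12 * piv c
   ip = wi2 (suc N₀) T (piv c) N²
   inde : 0ℤ ℤ.< index
   inde = sb (0ℤ ℤ.<_) (sy index≡) (ℤ.+<+ (wein 24 (suc N₀) (piv c) {{_}} {{>-nonZero (pipo c)}}))
   mass≥0 : 0ℤ ℤ.≤ mass
   mass≥0 = sb (0ℤ ℤ.≤_) (sy mv) (ℤ.+≤+ z≤n)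
   sqlo : ∀ u -> Data.List.length (mul (Vec.toList u) (Vec.toList u)) ≡ 15 -> + 480 Z.* (sum 8 (lk u) Z.* sum 8 (lk u) Z.* mass ^ᶻ 15) ℤ.≤ index Z.* ev (square-terms u) Y
   sqlo u len = sb (\ us -> + 480 Z.* (sum 8 (lk u) Z.* sum 8 (lk u) Z.* mass ^ᶻ 15) ℤ.≤ index Z.* ev us Y) (sqte u)
    (LowerBound.Square.lobo N₀ c T 7 u (+ 480) (+ 1480) inde mass≥0 (ℤ.+≤+ z≤n) gn len)
   Rl : + R[1] Z.* mass ^ᶻ 15 ℤ.≤ index Z.* ev R Y
   Rl = sb2 ℤ._≤_ (tr (factor (+ 480) _ _ (mass ^ᶻ 15)) (Z.mr sums)) (tr (sy (Z.*-distribˡ-+ index _ _)) (Z.mc (tr (sy (ea (square-terms u₁) (square-terms u₂) Y)) (cg (\ r -> ev r Y) (sy Rd)))))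
     (Z.+-mono-≤ (sqlo u₁ refl) (sqlo u₂ refl))
    where
    opaque
     unfolding Z._+_ Z._*_ Z.-_
     factor : ∀ k a b m -> k Z.* (a Z.* m) Z.+ k Z.* (b Z.* m) ≡ (k Z.* a Z.+ k Z.* b) Z.* m
     factor = riso
      where
      open import Tactic.RingSolver using () renaming (solve-∀ to svZ)
      riso : ∀ k a b m -> k Z.* (a Z.* m) Z.+ k Z.* (b Z.* m) ≡ (k Z.* a Z.+ k Z.* b) Z.* m
      riso = svZ Z.ring
   raup : + (Λ * suc H) Z.* ev R Y ℤ.≤ + C Z.* + (S₀ + μ * sw)
   raup = ZP.≤-trans (sb2 ℤ._≤_ (tr (A.homogeneous (+ (Λ * suc H)) (\ y -> F y Z.* Δ y)) (Z.mc (sy ev-Y))) (A.homogeneous (+ C) W) (A.monotone pointwise)) (Z.*-monoˡ-≤ {c = + C} (ℤ.+≤+ z≤n) rW)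
    where
    module A = Additive (toa)
   -- Joins the two evaluations of the certificate: positivity bounds its lattice sum from below,
   -- the majorant `W` from above.
   combined : (Λ * suc H) * (R[1] * vo ss ^ 15) ≤ idx * (C * (S₀ + μ * sw))
   combined = ZP.drop‿+≤+ (sb2 ℤ._≤_ (tr (Z.mc (tr (Z.mc (mapo 15)) (sy (pos-* R[1] (vo ss ^ 15))))) (sy (pos-* (Λ * suc H) (R[1] * vo ss ^ 15))))
     (tr (cg2 Z._*_ index≡ (sy (pos-* C (S₀ + μ * sw)))) (sy (pos-* idx (C * (S₀ + μ * sw)))))
     (ZP.≤-trans (Z.*-monoˡ-≤ {c = + (Λ * suc H)} (ℤ.+≤+ z≤n) Rl) (sb (ℤ._≤ index Z.* (+ C Z.* + (S₀ + μ * sw))) (Z.*s index (+ (Λ * suc H)) (ev R Y)) (Z.*-monoˡ-≤ (ZP.<⇒≤ inde) raup))))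
   pisq : pipr c ≡ piv c * piv c
   pisq = ZP.+-injective (tr (sy (Z.*-identityʳ _)) (tr (Z.mc (sy unimodular)) (tr depi (sy (pos-* (piv c) (piv c))))))
   -- The peak is about (15 pi T)^(-12) / piv relative to mass: the product of all walking times is
   -- T^24 times the square of `piv`, by unimodularity.
   cv : M₀ * 15 ^ 12 * T ^ 12 * piv c * wd ^ 12 ≤ wn ^ 12 * vo ss ^ 15
   cv = vr M₀ (15 ^ 12) (T ^ 12) (piv c) (wd ^ 12) (wn ^ 12) (vo ss ^ 15) (15 ^ 24) (tipr ss) (wd ^ 24) (wn ^ 24)
    (^-distribˡ-+-* 15 12 12) (tr (tpc T c) (cg2 _*_ (^-distribˡ-+-* T 12 12) pisq)) (^-distribˡ-+-* wd 12 12) (^-distribˡ-+-* wn 12 12)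
    (CentralLimit.celi 100 wn wd c1 15 ss (All.map (\ {s} T≤s -> ≤-trans (≤-trans (≤ᵇ⇒≤ 100 1000000000000 tt) vas) (≤-trans vast≤T (≤-trans T≤s (m≤n*m s 15)))) ss≥))
   iv : idx * C * wd ^ 12 ≤ (18 * wn) ^ 12 * vo ss ^ 15
   iv = scro idx (18 ^ 12) (T ^ 12) (piv c) C (15 ^ 12) M₀ (wd ^ 12) (wn ^ 12) ((18 * wn) ^ 12) (vo ss ^ 15)
    ip Cd (^-distrib-* 18 wn 12) cv
   mansho : 46 * 2 ^ 24 < sw
   mansho = conclude (Λ * suc H) R[1] (vo ss ^ 15) idx C S₀ μ sw (46 * 2 ^ 24) (wd ^ 12) ((18 * wn) ^ 12) {{m^n≢0 (vo ss) 15 {{vol ss}}}} combined iv fich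

-- Choice of the mesh and of the base of the powers.

module Scales where
 open Certificate hiding (wesq)
 open Fractions hiding (num; den)
 open Forms using (Ch; piv)
 open ShortVectors using (prto; pt∣; pt≢)
 open Estimates using (odd)
 open import Data.Nat
 open import Data.Nat.Properties
 open import Data.Nat.Divisibility using (_∣_; ∣-trans; m∣m*n; *-monoʳ-∣)
 open import Data.Nat.Tactic.RingSolver using () renaming (solve-∀ to sv)
 record Scale {n} (c : Ch n) (λ₀ : ℕ) : Set where
  field
   Q T N₀ q a : ℕ
   vast≤Q : vast ≤ Q
   vast≤T : vast ≤ T
   N² : suc N₀ * suc N₀ ≡ 18 * T
   a≡ : suc a ≡ 2 * q
   Vs : suc Q * (suc N₀ * λ₀) ≤ T
   Q≢ : NonZero Q
   T≢ : NonZero T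
   q≢ : NonZero q
   a≢ : NonZero a
   m∣ : ∀ j P -> .{{NonZero j}} -> .{{NonZero P}} -> j ≤ 15 -> P ≤ piv c -> Q * (j * (T * P) * odd (j * (T * P))) ∣ q
   eb : base a ↑ q ≼ e₁
   e₀bo : e₀ ≼ base a ↑ q
 module _ {n} (c : Ch n) (λ₀ : ℕ) where
  private
   m′ : ℕ
   m′ = vast + suc vast * λ₀
   m T : ℕ
   m = suc m′
   -- With mesh factor 18m this makes `N * N ≡ 18 * T`, and a large `m` makes `T` exceed any given
   -- multiple of `N`.
   T = 18 * (m * m)
   instance
    vast≢0 : NonZero vast
    vast≢0 = >-nonZero (≤-trans (s≤s z≤n) vas)
    T≢ : NonZero T
    T≢ = m*n≢0 18 (m * m)
   mu : ℕ -> ℕ -> ℕ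
   mu j P = j * (T * P) * odd (j * (T * P))
   products : ℕ
   products = prto (\ j -> prto (mu j) (piv c)) 15
   instance
    products≢0 : NonZero products
    products≢0 = pt≢ (\ j -> prto (mu j) (piv c)) 15 (\ j -> pt≢ (mu (suc j)) (piv c) (\ P -> m*n≢0 (suc j * (T * suc P)) (odd (suc j * (T * suc P))) {{m*n≢0 (suc j) (T * suc P) {{_}} {{m*n≢0 T (suc P)}}}}))
   multiple : ∀ j P -> .{{NonZero j}} -> .{{NonZero P}} -> j ≤ 15 -> P ≤ piv c -> mu j P ∣ products
   multiple j P j≤ P≤ = ∣-trans (pt∣ (mu j) (piv c) P P≤) (pt∣ (\ j -> prto (mu j) (piv c)) 15 j j≤)
   build : ∀ M -> M ≡ vast * products -> .{{NonZero M}} -> ∀ s -> s ≡ 16383 -> Scale c λ₀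
   build M refl s refl = record
    { Q = vast ; T = T ; N₀ = 17 + 18 * m′ ; q = suc l * suc 16383 ; a = pred (2 * (suc l * suc 16383))
    ; vast≤Q = ≤-refl
    ; vast≤T = ≤-trans (≤-trans (m≤m+n vast _) (n≤1+n m′)) (≤-trans (m≤m*n m m) (m≤n*m (m * m) 18))
    ; N² = square m′
    ; a≡ = a-eq
    ; Vs = ≤-trans (≤-reflexive (ar (suc vast) m′ λ₀)) (*-monoʳ-≤ 18 (*-monoʳ-≤ m (≤-trans (m≤n+m (suc vast * λ₀) vast) (n≤1+n m′))))
    ; Q≢ = vast≢0 ; T≢ = T≢
    ; q≢ = m*n≢0 (suc l) (suc 16383)
    ; a≢ = >-nonZero (≤-pred (≤-trans (≤-trans (s≤s (s≤s z≤n)) (*-monoʳ-≤ 2 (m≤n*m (suc 16383) (suc l)))) (≤-reflexive (sy a-eq))))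
    ; m∣ = \ j P j≤ P≤ -> ∣-trans (*-monoʳ-∣ vast (multiple j P j≤ P≤)) (sb (_∣ suc l * suc 16383) (suc-pred (vast * products)) (m∣m*n (suc 16383)))
    ; eb = ≼t (baup (pred (2 * (suc l * suc 16383))) l 16383 a-eq) e₁ch
    ; e₀bo = ≼t e₀ch (bl (pred (2 * (suc l * suc 16383))) l 16383 a-eq) }
    where
    -- `q` is this plus one, times 16384. The first factor carries all required divisibilities, and
    -- 16384 is the order of the approximations to 1/e in `e₁ch` and `e₀ch`.
    l : ℕ
    l = pred (vast * products)
    a-eq : suc (pred (2 * (suc l * suc 16383))) ≡ 2 * (suc l * suc 16383)
    a-eq = suc-pred (2 * (suc l * suc 16383)) {{m*n≢0 2 (suc l * suc 16383) {{_}} {{m*n≢0 (suc l) (suc 16383)}}}}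
    square : ∀ m -> suc (17 + 18 * m) * suc (17 + 18 * m) ≡ 18 * (18 * (suc m * suc m))
    square = sv
    ar : ∀ Q m l -> Q * (suc (17 + 18 * m) * l) ≡ 18 * (suc m * (Q * l))
    ar = sv
  sca : Scale c λ₀
  sca = build (vast * products) refl {{m*n≢0 vast products}} 16383 refl

-- Coordinates with respect to an orthogonal frame.

module Coordinates where
 open import Defs using (Mat)
 open Z
 open Forms
 open Walks
 open Leech
 open Determinants using (det)
 open import Data.Nat as ℕ using (ℕ; zero; suc)
 open import Data.Integer as ℤ using (ℤ; +_; 0ℤ; 1ℤ)
 open import Data.Fin using (Fin; zero; suc; punchIn)
 open import Data.Vec using (Vec; lookup)
 open import Tactic.RingSolver using () renaming (solve-∀ to sv)
 private variable n : ℕ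
 Σp : ∀ n (p : Fin (suc n)) (f : Fin (suc n) -> ℤ) -> sum (suc n) f ≡ f p + sum n (\ j -> f (punchIn p j))
 Σp n zero f = susu n f
 Σp (suc n) (suc p) f = tr (susu (suc n) f) (tr (ac (Σp n p (\ i -> f (suc i)))) (tr (exc (f zero) (f (suc p)) _) (ac (sy (susu n _)))))
  where
  opaque
   unfolding _+_ _*_ -_
   exc : ∀ a b c -> a + (b + c) ≡ b + (a + c)
   exc = sv ring
 -- Fraction-free elimination: pivot on a nonzero entry of the first column, recurse, and let the
 -- coefficient of the pivot vector clear that column.
 relation : ∀ n (w : Fin (suc n) -> Fin n -> ℤ) -> Σ (Fin (suc n) -> ℤ) \ a -> (∃ \ i -> a i ≢ 0ℤ) × (∀ k -> sum (suc n) (\ i -> a i * w i k) ≡ 0ℤ)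
 relation zero w = (\ _ -> 1ℤ) , (zero , \ ()) , \ ()
 relation (suc n) w with FP.any? (\ i -> ¬? (w i zero ZP.≟ 0ℤ))
 ... | no none = a , (suc (p1 (p1 (p2 IH))) , p2 (p1 (p2 IH))) , va
  where
  IH = relation n (\ i k -> w (suc i) (suc k))
  a : Fin (suc (suc n)) -> ℤ
  a zero = 0ℤ
  a (suc i) = p1 IH i
  first : ∀ i -> w i zero ≡ 0ℤ
  first i = decidable-stable (w i zero ZP.≟ 0ℤ) (\ ne -> none (i , ne))
  va : ∀ k -> sum (suc (suc n)) (\ i -> a i * w i k) ≡ 0ℤ
  va zero = Σz \ i -> tr (mc (first i)) (*-zeroʳ _)
  va (suc k) = tr (susu (suc n) _) (tr (cg2 _+_ (*-zeroˡ _) (p2 (p2 IH) k)) (+-identityʳ _))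
 ... | yes (p , q≢) = a , nonzero , va
  where
  q = w p zero
  w₁ : Fin (suc n) -> Fin (suc n) -> ℤ
  w₁ j = w (punchIn p j)
  IH = relation n (\ j k -> q * w₁ j (suc k) - w₁ j zero * w p (suc k))
  a′ = p1 IH
  s = sum (suc n) (\ j -> a′ j * w₁ j zero)
  a : Fin (suc (suc n)) -> ℤ
  a = F.insertAt (\ j -> q * a′ j) p (- s)
  nonzero : ∃ \ i -> a i ≢ 0ℤ
  nonzero with p1 (p2 IH)
  ... | j , a′≢0 = punchIn p j , \ e -> byfa (*≡0 q (a′ j) (tr (sy (FF.insertAt-punchIn (\ j -> q * a′ j) p (- s) j)) e))
   where
   byfa : q ≡ 0ℤ ⊎ a′ j ≡ 0ℤ -> _
   byfa (n1 e) = q≢ e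
   byfa (n2 e) = a′≢0 e
  opaque
   unfolding _+_ _*_ -_
   cancel : ∀ s q -> (- s) * q + q * s ≡ 0ℤ
   cancel = sv ring
   term : ∀ q a w -> (q * a) * w ≡ q * (a * w)
   term = sv ring
   expand : ∀ a q x y z -> (q * a) * x ≡ a * (q * x - y * z) + (a * y) * z
   expand = sv ring
   close : ∀ s z t -> t ≡ 0ℤ -> (- s) * z + (t + s * z) ≡ 0ℤ
   close s z _ refl = clo s z
    where
    clo : ∀ s z -> (- s) * z + (0ℤ + s * z) ≡ 0ℤ
    clo = sv ring
  split : ∀ k -> sum (suc (suc n)) (\ i -> a i * w i k) ≡ (- s) * w p k + sum (suc n) (\ j -> (q * a′ j) * w₁ j k)
  split k = tr (Σp (suc n) p _) (cg2 _+_ (mr (FF.insertAt-lookup (\ j -> q * a′ j) p (- s))) (Sc \ j -> mr (FF.insertAt-punchIn (\ j -> q * a′ j) p (- s) j)))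
  va : ∀ k -> sum (suc (suc n)) (\ i -> a i * w i k) ≡ 0ℤ
  va zero = tr (split zero) (tr (ac (tr (Sc \ j -> term q (a′ j) (w₁ j zero)) (Σ* (suc n) q _))) (cancel s q))
  va (suc k) = tr (split (suc k)) (tr (ac (tr (Sc \ j -> expand (a′ j) q (w₁ j (suc k)) (w₁ j zero) (w p (suc k))) (tr (Σ-+ (suc n) _ _) (ac (Σ*ʳ (suc n) (w p (suc k)) _)))))
   (close s (w p (suc k)) _ (p2 (p2 IH) k)))
 opaque
  lin : ∀ {m} -> (Fin m -> ℤ) -> (Fin m -> Vec ℤ n) -> Vec ℤ n
  lin {m = zero} a w = 𝟎
  lin {m = suc m} a w = a zero · w zero ⊕ lin (\ i -> a (suc i)) (\ i -> w (suc i))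
  ll : ∀ {m} (a : Fin m -> ℤ) (w : Fin m -> Vec ℤ n) k -> lk (lin a w) k ≡ sum m (\ i -> a i * lk (w i) k)
  ll {m = zero} a w k = tr (l𝟎 k) (sy (se _))
  ll {m = suc m} a w k = tr (l⊕ (a zero · w zero) (lin (\ i -> a (suc i)) (\ i -> w (suc i))) k) (tr (cg2 _+_ (l· (a zero) (w zero) k) (ll (\ i -> a (suc i)) (\ i -> w (suc i)) k)) (sy (susu m _)))
 module FrameCoordinates (L : Mat n) (symmetric : ∀ i j -> L i j ≡ L j i)
  (v : Fin n -> Vec ℤ n) (norms : ∀ i j -> Lattice.⟨_,_⟩ L symmetric (v i) (v j) ≡ + 8 * δ i j) where
  open Lattice L symmetric
  opaque
   unfolding lin
   ⟨l : ∀ {m} (a : Fin m -> ℤ) (w : Fin m -> Vec ℤ n) y -> ⟨ lin a w , y ⟩ ≡ sum m (\ i -> a i * ⟨ w i , y ⟩)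
   ⟨l {zero} a w y = tr (⟨𝟎 y) (sy (se _))
   ⟨l {suc m} a w y = tr (⟨⊕ _ _ y) (tr (cg2 _+_ (⟨· (a zero) (w zero) y) (⟨l (\ i -> a (suc i)) (\ i -> w (suc i)) y)) (sy (susu m _)))
  c : Vec ℤ n -> Fin n -> ℤ
  c x i = ⟨ x , v i ⟩
  cfr : (a : Fin n -> ℤ) -> ∀ k -> c (lin a v) k ≡ + 8 * a k
  cfr a k = tr (⟨l a v (v k)) (tr (Sc \ i -> tr (mc (norms i k)) (*s (a i) (+ 8) (δ i k))) (tr (Σ* n (+ 8) _) (mc (Σδʳ n k a))))
  opaque
   unfolding lin
   lisu : ∀ {m} (a : Fin (suc m) -> ℤ) (w : Fin (suc m) -> Vec ℤ n) -> lin a w ≡ a zero · w zero ⊕ lin (\ i -> a (suc i)) (\ i -> w (suc i))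
   lisu a w = refl
  -- Together with the 24 frame vectors `z` satisfies an integer relation. Pairing it with the frame
  -- kills the frame coefficients, so that of `z` is nonzero and `z` vanishes.
  oz : ∀ z -> (∀ j -> c z j ≡ 0ℤ) -> z ≡ 𝟎
  oz z perp = lookup-injective \ k -> tr (zz k) (sy (l𝟎 k))
   where
   w : Fin (suc n) -> Vec ℤ n
   w zero = z
   w (suc i) = v i
   R = relation n (\ i -> lk (w i))
   a = p1 R
   u≡𝟎 : lin a w ≡ 𝟎
   u≡𝟎 = lookup-injective \ k -> tr (ll a w k) (tr (p2 (p2 R) k) (sy (l𝟎 k)))
   taze : ∀ k -> a (suc k) ≡ 0ℤ
   taze k = *-cancelˡ-≡ (+ 8) (\ ()) (tr (sy (cfr (\ i -> a (suc i)) k)) (tr (sy (+-identityˡ _)) (tr (cg (\ t -> t + c (lin (\ i -> a (suc i)) v) k) (sy (tr (⟨· (a zero) z (v k)) (tr (mc (perp k)) (*-zeroʳ _)))))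
    (tr (sy (⟨⊕ (a zero · z) (lin (\ i -> a (suc i)) v) (v k))) (tr (cg (\ t -> ⟨ t , v k ⟩) (tr (sy (lisu a w)) u≡𝟎)) (tr (⟨𝟎 (v k)) (sy (*-zeroʳ _))))))))
   hea : a zero ≢ 0ℤ
   hea with p1 (p2 R)
   ... | zero , ne = ne
   ... | suc k , ne = cx (taze k) ne
   zz : ∀ k -> lk z k ≡ 0ℤ
   zz k = *-cancelˡ-≡ (a zero) hea (tr (sy (+-identityʳ _)) (tr (ac (sy (Σz \ i -> tr (mr (taze i)) (*-zeroˡ _)))) (tr (sy (susu n (\ i -> a i * lk (w i) k))) (tr (p2 (p2 R) k) (sy (*-zeroʳ _))))))
  -- The frame vectors have norm 8; the difference of the two sides is orthogonal to all of them.
  eifo : ∀ x -> + 8 · x ≡ lin (c x) v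
  eifo x = tr (sy (⊕-identityʳ _)) (tr (cg (+ 8 · x ⊕_) (sy zd)) (tr (sy (⊕-assoc _ _ _)) (tr (cg (_⊕ lin (c x) v) (tr (cg (+ 8 · x ⊕_) (neg≡ _)) dz)) (⊕-identityˡ _))))
   where
   zd : neg (lin (c x) v) ⊕ lin (c x) v ≡ 𝟎
   zd = tr (⊕-comm _ _) (⊕-inverse _)
   opaque
    unfolding _+_ _*_ -_
    cancel : ∀ a -> a + (- 1ℤ) * a ≡ 0ℤ
    cancel = sv ring
   dz : + 8 · x ⊕ (- 1ℤ) · lin (c x) v ≡ 𝟎
   dz = oz _ \ j -> tr (⟨⊕ _ _ (v j)) (tr (cg2 _+_ (⟨· (+ 8) x (v j)) (tr (⟨· (- 1ℤ) _ (v j)) (mc (cfr (c x) j)))) (cancel _))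
  parseval : ∀ x y -> + 8 * ⟨ x , y ⟩ ≡ sum n (\ i -> c x i * c y i)
  parseval x y = tr (sy (⟨· (+ 8) x y)) (tr (cg (\ z -> ⟨ z , y ⟩) (eifo x)) (tr (⟨l (c x) v y) (Sc \ i -> mc (⟨s (v i) y))))
  cin : ∀ x y -> (∀ i -> c x i ≡ c y i) -> x ≡ y
  cin x y e = tr (sy (⊕-identityʳ x)) (tr (cg (x ⊕_) (tr (sy (⊕-inverse y)) (⊕-comm y (neg y)))) (tr (sy (⊕-assoc x (neg y) y)) (tr (cg (_⊕ y) difference) (⊕-identityˡ y))))
   where
   opaque
    unfolding _+_ _*_ -_
    cancel : ∀ a -> a + (- 1ℤ) * a ≡ 0ℤ
    cancel = sv ring
   difference : x ⊕ neg y ≡ 𝟎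
   difference = tr (cg (x ⊕_) (neg≡ y)) (oz _ \ j -> tr (⟨⊕ x _ (v j)) (tr (cg2 _+_ (e j) (⟨· (- 1ℤ) y (v j))) (cancel _)))
  module Represent (positive : ∀ x -> x ≢ 𝟎 -> 0ℤ ℤ.< ⟨ x , x ⟩) (unimodular : det n L ≡ 1ℤ) where
   open Definite positive
   open Unimodular unimodular
   -- The divisibility says that pairing with y/8 is an integral functional, and unimodularity
   -- represents it by a lattice vector. This is how lattice vectors are produced from their
   -- coordinates.
   rea : (y : Fin n -> ℤ) -> (∀ x -> Σ ℤ \ q -> sum n (\ i -> y i * c x i) ≡ + 8 * q) -> Σ (Vec ℤ n) \ x -> ∀ i -> c x i ≡ y i
   rea y di = x , \ k -> *-cancelˡ-≡ (+ 8) (\ ()) (tr (mc (⟨s x (v k))) (tr (pairing (v k))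
     (tr (Sc \ i -> tr (mc (norms k i)) (tr (*s (y i) (+ 8) (δ k i)) (mc (mc (δs k i))))) (tr (Σ* n (+ 8) _) (mc (Σδʳ n k y))))))
    where
    basis : Fin n -> Vec ℤ n
    basis j = Data.Vec.tabulate (\ i -> δ i j)
    expansion : ∀ x -> x ≡ lin (lk x) basis
    expansion x = lookup-injective \ k -> sy (tr (ll (lk x) basis k) (tr (Sc \ i -> mc (tr (Data.Vec.Properties.lookup∘tabulate (\ m -> δ m i) k) (δs k i))) (Σδʳ n k (lk x))))
     where import Data.Vec.Properties
    u : Fin n -> ℤ
    u j = p1 (di (basis j))
    x = p1 (represent u)
    pairing : ∀ x′ -> + 8 * ⟨ x′ , x ⟩ ≡ sum n (\ i -> y i * c x′ i)
    pairing x′ = tr (mc (p2 (represent u) x′)) (tr (sy (Σ* n (+ 8) _)) (tr (Sc \ j -> tr (*s (+ 8) (lk x′ j) (u j)) (tr (mc (sy (p2 (di (basis j))))) (sy (Σ* n (lk x′ j) _))))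
     (tr (Σs n n _) (Sc \ i -> tr (Sc \ j -> *s (lk x′ j) (y i) (c (basis j) i)) (tr (Σ* n (y i) _) (mc (tr (sy (⟨l (lk x′) basis (v i))) (cg (\ z -> ⟨ z , v i ⟩) (sy (expansion x′))))))))))

-- Binary words and linear algebra over two elements.

module Bits where
 open import Data.Bool using (Bool; true; false; _xor_; _∧_; not)
 open import Data.Nat using (ℕ; zero; suc)
 open import Data.Fin using (zero; suc)
 open import Data.Vec using (Vec; []; _∷_; zipWith; replicate)
 open import Relation.Unary using (Decidable)
 private variable n : ℕ
 Word : ℕ -> Set
 Word n = Vec Bool n
 infixl 6 _⊞_
 _⊞_ : Word n -> Word n -> Word n
 _⊞_ = zipWith _xor_
 𝟘 : Word n
 𝟘 = replicate _ false
 infixl 7 _∙_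
 _∙_ : Word n -> Word n -> Bool
 [] ∙ [] = false
 (a ∷ u) ∙ (b ∷ v) = (a ∧ b) xor (u ∙ v)
 wei : Word n -> ℕ
 wei [] = 0
 wei (true ∷ u) = suc (wei u)
 wei (false ∷ u) = wei u
 ⊞a : (u v w : Word n) -> (u ⊞ v) ⊞ w ≡ u ⊞ (v ⊞ w)
 ⊞a = VP.zipWith-assoc BP.xor-assoc
 ⊞c : (u v : Word n) -> u ⊞ v ≡ v ⊞ u
 ⊞c = VP.zipWith-comm BP.xor-comm
 ⊞i : (u : Word n) -> 𝟘 ⊞ u ≡ u
 ⊞i = VP.zipWith-identityˡ \ _ -> refl
 ⊞s : (u : Word n) -> u ⊞ u ≡ 𝟘
 ⊞s [] = refl
 ⊞s (a ∷ u) = cg2 _∷_ (BP.xor-same a) (⊞s u)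
 ⊞ca : (u v : Word n) -> u ⊞ (u ⊞ v) ≡ v
 ⊞ca u v = tr (sy (⊞a u u v)) (tr (cg (_⊞ v) (⊞s u)) (⊞i v))
 xi : ∀ a b c d -> (a xor b) xor (c xor d) ≡ (a xor c) xor (b xor d)
 xi false b c d = tr (sy (BP.xor-assoc b c d)) (tr (cg (_xor d) (BP.xor-comm b c)) (BP.xor-assoc c b d))
 xi true b c d = tr (xono (not b) b c d refl) refl
  where
  xono : ∀ nb b c d -> nb ≡ not b -> nb xor (c xor d) ≡ (not c) xor (b xor d)
  xono _ true true true refl = refl
  xono _ true true false refl = refl
  xono _ true false true refl = refl
  xono _ true false false refl = refl
  xono _ false true true refl = refl
  xono _ false true false refl = refl
  xono _ false false true refl = refl
  xono _ false false false refl = refl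
 ∙⊞ʳ : (u v w : Word n) -> u ∙ (v ⊞ w) ≡ (u ∙ v) xor (u ∙ w)
 ∙⊞ʳ [] [] [] = refl
 ∙⊞ʳ (a ∷ u) (b ∷ v) (c ∷ w) = tr (cg2 _xor_ (BP.∧-distribˡ-xor a b c) (∙⊞ʳ u v w)) (xi (a ∧ b) (a ∧ c) (u ∙ v) (u ∙ w))
 ∙-comm : (u v : Word n) -> u ∙ v ≡ v ∙ u
 ∙-comm [] [] = refl
 ∙-comm (a ∷ u) (b ∷ v) = cg2 _xor_ (BP.∧-comm a b) (∙-comm u v)
 ∙𝟘 : (u : Word n) -> 𝟘 ∙ u ≡ false
 ∙𝟘 [] = refl
 ∙𝟘 (b ∷ u) = ∙𝟘 u
 opaque
  search : ∀ n {P : Word n -> Set} -> Decidable P -> Dec (∃ P)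
  search zero P? = map′ (\ p -> [] , p) (\ { ([] , p) -> p }) (P? [])
  search (suc n) {P} P? with search n (\ u -> P? (true ∷ u)) | search n (\ u -> P? (false ∷ u))
  ... | yes (u , p) | _ = yes (true ∷ u , p)
  ... | no _ | yes (u , p) = yes (false ∷ u , p)
  ... | no ¬t | no ¬f = no \ { (true ∷ u , p) -> ¬t (u , p) ; (false ∷ u , p) -> ¬f (u , p) }
 record Subspace (V : Word n -> Set) : Set where
  field
   decide : Decidable V
   zi : V 𝟘
   plin : ∀ {u v} -> V u -> V v -> V (u ⊞ v)
 -- Induction on length. If some member of `V` starts with `true`, it serves as pivot and fixes the
 -- first entry of the functional; otherwise the first entry is free.
 separate : ∀ n {V : Word n -> Set} -> Subspace V -> ∀ t -> ¬ V t -> Σ (Word n) \ w -> (∀ u -> V u -> w ∙ u ≡ false) × w ∙ t ≡ true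
 separate zero S [] t∉ = cx (Subspace.zi S) t∉
 separate (suc n) {V} S (τ ∷ t) t∉ = bypi (search n (\ a -> decide (true ∷ a)))
  where
  open Subspace S
  S₀ : Subspace (\ u -> V (false ∷ u))
  S₀ = record { decide = \ u -> decide (false ∷ u) ; zi = zi ; plin = plin }
  Goal = Σ (Word (suc n)) \ w -> (∀ u -> V u -> w ∙ u ≡ false) × w ∙ (τ ∷ t) ≡ true
  xf : ∀ {a b} -> a xor b ≡ false -> a ≡ b
  xf {false} e = sy e
  xf {true} {true} e = refl
  without : ∀ τ -> ¬ V (τ ∷ t) -> ¬ (∃ \ a -> V (true ∷ a)) -> Σ (Word (suc n)) \ w -> (∀ u -> V u -> w ∙ u ≡ false) × w ∙ (τ ∷ t) ≡ true
  without true _ none = true ∷ 𝟘 , (\ { (true ∷ u) u∈ -> cx (u , u∈) none ; (false ∷ u) _ -> ∙𝟘 u }) , tr (cg (true xor_) (∙𝟘 t)) refl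
  without false t∉ none with separate n S₀ t t∉
  ... | w , perp , hit = false ∷ w , (\ { (true ∷ u) u∈ -> cx (u , u∈) none ; (false ∷ u) u∈ -> perp u u∈ }) , hit
  wipi : ∀ τ a -> V (true ∷ a) -> ¬ V (τ ∷ t) -> Σ (Word (suc n)) \ w -> (∀ u -> V u -> w ∙ u ≡ false) × w ∙ (τ ∷ t) ≡ true
  wipi false a a∈ t∉ with separate n S₀ t t∉
  ... | w , perp , hit = (w ∙ a) ∷ w , va , tr (cg (_xor (w ∙ t)) (BP.∧-zeroʳ (w ∙ a))) hit
   where
   va : ∀ u -> V u -> ((w ∙ a) ∷ w) ∙ u ≡ false
   va (false ∷ u) u∈ = tr (cg (_xor (w ∙ u)) (BP.∧-zeroʳ (w ∙ a))) (perp u u∈)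
   va (true ∷ u) u∈ = tr (cg (_xor (w ∙ u)) (BP.∧-identityʳ (w ∙ a))) (tr (sy (∙⊞ʳ w a u)) (perp (a ⊞ u) (plin a∈ u∈)))
  wipi true a a∈ t∉ with separate n S₀ (a ⊞ t) (\ at∈ -> t∉ (sb (\ z -> V (true ∷ z)) (⊞ca a t) (plin a∈ at∈)))
  ... | w , perp , hit = (w ∙ a) ∷ w , va , tr (cg (_xor (w ∙ t)) (BP.∧-identityʳ (w ∙ a))) (tr (sy (∙⊞ʳ w a t)) hit)
   where
   va : ∀ u -> V u -> ((w ∙ a) ∷ w) ∙ u ≡ false
   va (false ∷ u) u∈ = tr (cg (_xor (w ∙ u)) (BP.∧-zeroʳ (w ∙ a))) (perp u u∈)
   va (true ∷ u) u∈ = tr (cg (_xor (w ∙ u)) (BP.∧-identityʳ (w ∙ a))) (tr (sy (∙⊞ʳ w a u)) (perp (a ⊞ u) (plin a∈ u∈)))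
  bypi : Dec (∃ \ a -> V (true ∷ a)) -> Goal
  bypi (yes (a , a∈)) = wipi τ a a∈ t∉
  bypi (no none) = without τ t∉ none
 -- Excluded middle holds under a double negation for each word, and there are finitely many words.
 ¬¬de : ∀ n (P : Word n -> Set) -> ¬ ¬ (∀ u -> Dec (P u))
 ¬¬de zero P k = k \ { [] -> no \ p -> k \ { [] -> yes p } }
 ¬¬de (suc n) P k = ¬¬de n (\ u -> P (true ∷ u)) \ t -> ¬¬de n (\ u -> P (false ∷ u)) \ f -> k \ { (true ∷ u) -> t u ; (false ∷ u) -> f u }

-- The binary code of the lattice in frame coordinates.

module Code where
 open Z
 open Bits hiding (wei)
 open import Data.Nat as ℕ using (ℕ; zero; suc; z≤n; s≤s)
 open import Data.Bool using (Bool; true; false; _xor_; _∧_)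
 open import Data.Integer as ℤ using (ℤ; +_; -[1+_]; 0ℤ; 1ℤ)
 open import Data.Fin using (Fin; zero; suc)
 open import Data.Vec using (Vec; []; _∷_; lookup; tabulate; replicate)
 open Frames using (paha; Hal)
 open import Tactic.RingSolver using () renaming (solve-∀ to sv)
 private variable n : ℕ
 bit : Bool -> ℤ
 bit true = 1ℤ
 bit false = 0ℤ
 bi : ∀ b -> bit b * bit b ≡ bit b
 bi true = *-identityˡ 1ℤ
 bi false = *-zeroˡ 0ℤ
 opaque
  unfolding _+_ _*_ -_
  bx : ∀ a b -> bit a + bit b ≡ bit (a xor b) + (bit (a ∧ b) + bit (a ∧ b))
  bx true true = refl
  bx true false = refl
  bx false true = refl
  bx false false = refl
  b∧ : ∀ a b -> bit (a ∧ b) ≡ bit a * bit b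
  b∧ true true = refl
  b∧ true false = refl
  b∧ false true = refl
  b∧ false false = refl
 wesu : (u : Word n) -> sum n (\ i -> bit (lk u i)) ≡ + Bits.wei u
 wesu [] = se _
 wesu (true ∷ u) = tr (susu _ _) (tr (ac (wesu u)) (sy (pos-+ 1 (Bits.wei u))))
 wesu (false ∷ u) = tr (susu _ _) (tr (+-identityˡ _) (wesu u))
 dosu : (u v : Word n) -> Σ ℤ \ t -> sum n (\ i -> bit (lk u i) * bit (lk v i)) ≡ bit (u ∙ v) + (t + t)
 dosu [] [] = 0ℤ , tr (se _) (sy (tr (+-identityˡ _) (+-identityˡ _)))
 dosu (a ∷ u) (b ∷ v) with dosu u v
 ... | t , e = bit ((a ∧ b) ∧ (u ∙ v)) + t , tr (susu _ _) (tr (cg2 _+_ (sy (b∧ a b)) e) (tr (sy (+-assoc _ _ _)) (tr (cg (\ z -> z + (t + t)) (bx (a ∧ b) (u ∙ v))) (co _ _ t))))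
  where
  opaque
   unfolding _+_ _*_ -_
   co : ∀ x y t -> (x + (y + y)) + (t + t) ≡ x + ((y + t) + (y + t))
   co = sv ring
 lookup-⊞ : (u v : Word n) (i : Fin n) -> lk (u ⊞ v) i ≡ lk u i xor lk v i
 lookup-⊞ u v i = VP.lookup-zipWith _xor_ i u v
 Co : Set
 Co = Fin 24 -> ℤ
 dot₂ : Co -> Co -> ℤ
 dot₂ y z = sum 24 (\ i -> y i * z i)
 o₀ : Fin 24
 o₀ = zero
 twice : Word 24 -> Co
 twice d i = + 2 * bit (lk d i)
 -- The lattice seen through its frame coordinates, where 8 in one place is a frame vector and
 -- `dot₂` is eight times the inner product. The number `h` is half the norm, and `ov` is an odd
 -- vector with all entries 1 modulo 4.
 record Construction (M : Co -> Set) : Set where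
  field
   resp : ∀ {y z} -> (∀ i -> y i ≡ z i) -> M y -> M z
   plus : ∀ {y z} -> M y -> M z -> M (\ i -> y i + z i)
   times : ∀ k {y} -> M y -> M (\ i -> k * y i)
   norm : ∀ {y} -> M y -> Σ ℕ \ h -> dot₂ y y ≡ + 16 * + h × h ≢ 1 × (h ≡ 0 -> ∀ i -> y i ≡ 0ℤ)
   pairing : ∀ {y z} -> M y -> M z -> Σ ℤ \ q -> dot₂ y z ≡ + 8 * q
   realised : ∀ y -> (∀ z -> M z -> Σ ℤ \ q -> dot₂ y z ≡ + 8 * q) -> M y
   differences : ∀ i -> M (\ k -> + 4 * (δ i k - δ o₀ k))
   eig : ∀ i -> M (\ k -> + 8 * δ i k)
   combination : ∀ (t : Co) (w : Fin 24 -> Co) -> (∀ i -> M (w i)) -> M (\ k -> sum 24 (\ i -> t i * w i k))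
   unif : ∀ {y} -> M y -> (∀ i -> Σ ℤ \ t -> y i ≡ t + t) ⊎ (∀ i -> Σ ℤ \ t -> y i ≡ t + t + 1ℤ)
   r : Co
   ov : M (\ i -> 1ℤ + + 4 * r i)
 module _ {M : Co -> Set} (K : Construction M) where
  open Construction K
  opaque
   unfolding _+_ _*_ -_
   private
    cate : ∀ b t d s -> (b + + 4 * t) + (- 1ℤ) * (+ 4 * t - d * s) ≡ b + d * s
    cate = sv ring
    reg : ∀ t x y -> t * (+ 4 * (x - y)) ≡ + 4 * (t * x) - (+ 4 * y) * t
    reg = sv ring
    drei : ∀ b d s x -> (b + (+ 4 * d) * (s + s + x)) + (- s) * (+ 8 * d) ≡ b + (+ 4 * d) * x
    drei = sv ring
  -- The differences 4(e_i - e_0) gather all multiples of 4 in the place `o₀`, and there 8 is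
  -- available, so only the parity of their sum matters.
  reduce : ∀ (b t : Co) -> M (\ i -> b i + + 4 * t i) -> M b ⊎ M (\ i -> b i + + 4 * δ o₀ i)
  reduce b t y∈ = fi (paha τ)
   where
   τ = sum 24 t
   shi : M (\ k -> b k + (+ 4 * δ o₀ k) * τ)
   shi = resp (\ k -> tr (cg (\ z -> (b k + + 4 * t k) + (- 1ℤ) * z) (total k)) (cate (b k) (t k) (+ 4 * δ o₀ k) τ))
    (plus y∈ (times (- 1ℤ) (combination t (\ i k -> + 4 * (δ i k - δ o₀ k)) differences)))
    where
    total : ∀ k -> sum 24 (\ i -> t i * (+ 4 * (δ i k - δ o₀ k))) ≡ + 4 * t k - (+ 4 * δ o₀ k) * τ
    total k = tr (Sc \ i -> tr (reg (t i) (δ i k) (δ o₀ k)) (cg (\ z -> + 4 * (t i * δ i k) + z) (nele (+ 4 * δ o₀ k) (t i))))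
     (tr (Σ-+ 24 _ _) (cg2 _+_ (tr (Σ* 24 (+ 4) _) (mc (Σδʳ 24 k t))) (tr (Σ* 24 (- (+ 4 * δ o₀ k)) t) (nl (+ 4 * δ o₀ k) τ))))
     where
     opaque
      unfolding _+_ _*_ -_
      nele : ∀ a t -> - (a * t) ≡ (- a) * t
      nele = sv ring
      nl : ∀ a t -> (- a) * t ≡ - (a * t)
      nl = sv ring
   fi : Hal _ τ -> _
   fi (s , n1 (_ , e)) = n1 (resp (\ k -> tr (drei (b k) (δ o₀ k) s 0ℤ) (tr (ac (*-zeroʳ _)) (+-identityʳ _)))
    (plus (resp (\ k -> ac (mc (tr e (sy (+-identityʳ _))))) shi) (times (- s) (eig o₀))))
   fi (s , n2 (_ , e)) = n2 (resp (\ k -> tr (drei (b k) (δ o₀ k) s 1ℤ) (ac (*-identityʳ _)))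
    (plus (resp (\ k -> ac (mc e)) shi) (times (- s) (eig o₀))))
  C : Word 24 -> Set
  C d = M (twice d)
  2-bits : ∀ (d : Word 24) -> sum 24 (\ i -> bit (lk d i)) ≡ + Bits.wei d
  2-bits = wesu
  opaque
   unfolding _+_ _*_ -_
   private
    even≢odd : ∀ x y -> (+ 2 * x) ≢ (+ 2 * y) + 1ℤ
    even≢odd x y e = pacl (x - y) (tr (difference x y) (tr (cg (\ z -> z - + 2 * y) e) (cancel (+ 2 * y))))
     where
     difference : ∀ x y -> + 2 * (x - y) ≡ + 2 * x - + 2 * y
     difference = sv ring
     cancel : ∀ a -> (a + 1ℤ) - a ≡ 1ℤ
     cancel = sv ring
     pacl : ∀ z -> + 2 * z ≢ 1ℤ
     pacl (+ zero) ()
     pacl (+ suc zero) ()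
     pacl (+ suc (suc n)) e with tr (sy (cg (\ z -> + suc (suc z)) (tr (NP.+-suc n _) (cg suc (NP.+-suc n _))))) e
     ... | ()
     pacl -[1+ n ] ()
    ni : ∀ b d -> (+ 2 * b + + 4 * d) * (+ 2 * b + + 4 * d) ≡ + 4 * (b * b) + (+ 16 * (d * (b + d)))
    ni = sv ring
    paid : ∀ b d r -> (+ 2 * b + + 4 * d) * (1ℤ + + 4 * r) ≡ + 2 * b + (+ 8 * (b * r) + (+ 4 * d + + 16 * (d * r)))
    paid = sv ring
  -- The norm forces the weight of `d` to be 0 modulo 4, the pairing with the odd vector forces 2
  -- modulo 4.
  noof : ∀ (d : Word 24) -> ¬ M (\ i -> twice d i + + 4 * δ o₀ i)
  noof d y∈ with norm y∈ | pairing y∈ ov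
  ... | h , eh , _ | q , eq = even≢odd _ _ (d4 D (x₀ + 1ℤ) (+ h) R (r o₀) q (tr (sy noto) eh) (tr (sy pato) eq))
   where
   D x₀ R : ℤ
   D = sum 24 (\ i -> bit (lk d i))
   x₀ = bit (lk d o₀)
   R = sum 24 (\ i -> bit (lk d i) * r i)
   noto : dot₂ (\ i -> twice d i + + 4 * δ o₀ i) (\ i -> twice d i + + 4 * δ o₀ i) ≡ + 4 * D + + 16 * (x₀ + 1ℤ)
   noto = tr (Sc \ i -> tr (ni (bit (lk d i)) (δ o₀ i)) (cg (\ z -> + 4 * z + + 16 * (δ o₀ i * (bit (lk d i) + δ o₀ i))) (bi (lk d i))))
    (tr (Σ-+ 24 _ _) (cg2 _+_ (Σ* 24 (+ 4) _) (tr (Σ* 24 (+ 16) _) (mc (Σδ 24 o₀ (\ i -> bit (lk d i) + δ o₀ i))))))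
   pato : dot₂ (\ i -> twice d i + + 4 * δ o₀ i) (\ i -> 1ℤ + + 4 * r i) ≡ + 2 * D + (+ 8 * R + (+ 4 * 1ℤ + + 16 * r o₀))
   pato = tr (Sc \ i -> paid (bit (lk d i)) (δ o₀ i) (r i))
    (tr (Σ-+ 24 _ _) (cg2 _+_ (Σ* 24 (+ 2) _) (tr (Σ-+ 24 _ _) (cg2 _+_ (Σ* 24 (+ 8) _) (tr (Σ-+ 24 _ _)
     (cg2 _+_ (tr (Σ* 24 (+ 4) _) (mc δt)) (tr (Σ* 24 (+ 16) _) (mc (Σδ 24 o₀ r)))))))))
    where
    δt : sum 24 (δ o₀) ≡ 1ℤ
    δt = tr (Sc \ i -> sy (*-identityʳ (δ o₀ i))) (Σδ 24 o₀ (\ _ -> 1ℤ))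
   opaque
    unfolding _+_ _*_ -_
    d4 : ∀ D x h R r q -> + 4 * D + + 16 * x ≡ + 16 * h -> + 2 * D + (+ 8 * R + (+ 4 * 1ℤ + + 16 * r)) ≡ + 8 * q -> + 2 * (q - R - + 2 * r) ≡ + 2 * (h - x) + 1ℤ
    d4 D x h R r q e₁ e₂ = *-cancelˡ-≡ (+ 8) (\ ()) (tr (left q R r) (tr (cg (\ z -> + 2 * z - + 16 * R - + 32 * r) (sy e₂)) (tr (middle D R r) (tr (cg (\ z -> z + + 8) (four D x)) (tr (cg (\ z -> (z - + 16 * x) + + 8) e₁) (right h x))))))
     where
     left : ∀ q R r -> + 8 * (+ 2 * (q - R - + 2 * r)) ≡ + 2 * (+ 8 * q) - + 16 * R - + 32 * r
     left = sv ring
     middle : ∀ D R r -> + 2 * (+ 2 * D + (+ 8 * R + (+ 4 * 1ℤ + + 16 * r))) - + 16 * R - + 32 * r ≡ + 4 * D + + 8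
     middle = sv ring
     four : ∀ D x -> + 4 * D ≡ (+ 4 * D + + 16 * x) - + 16 * x
     four = sv ring
     right : ∀ h x -> (+ 16 * h - + 16 * x) + + 8 ≡ + 8 * (+ 2 * (h - x) + 1ℤ)
     right = sv ring
  reev : ∀ (d : Word 24) (t : Co) -> M (\ i -> twice d i + + 4 * t i) -> C d
  reev d t y∈ with reduce (twice d) t y∈
  ... | n1 d∈ = d∈
  ... | n2 y∈′ = cx y∈′ (noof d)
  Cp : ∀ {u v} -> C u -> C v -> C (u ⊞ v)
  Cp {u} {v} u∈ v∈ = reev (u ⊞ v) (\ i -> bit (lk u i ∧ lk v i)) (resp each (plus u∈ v∈))
   where
   opaque
    unfolding _+_ _*_ -_
    double : ∀ a b x y -> a + b ≡ x + (y + y) -> + 2 * a + + 2 * b ≡ + 2 * x + + 4 * y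
    double a b x y e = tr (sy (distrib a b)) (tr (cg (+ 2 *_) e) (spr x y))
     where
     distrib : ∀ a b -> + 2 * (a + b) ≡ + 2 * a + + 2 * b
     distrib = sv ring
     spr : ∀ x y -> + 2 * (x + (y + y)) ≡ + 2 * x + + 4 * y
     spr = sv ring
   each : ∀ i -> twice u i + twice v i ≡ twice (u ⊞ v) i + + 4 * bit (lk u i ∧ lk v i)
   each i = tr (double _ _ _ _ (bx (lk u i) (lk v i))) (cg (\ b -> + 2 * bit b + + 4 * bit (lk u i ∧ lk v i)) (sy (lookup-⊞ u v i)))
  𝟙 : Word 24
  𝟙 = replicate 24 true
  Con : C 𝟙
  Con = reev 𝟙 (\ i -> + 2 * r i) (resp (\ i -> tr (double (r i)) (cg (\ b -> + 2 * bit b + + 4 * (+ 2 * r i)) (sy (VP.lookup-replicate i true)))) (times (+ 2) ov))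
   where
   opaque
    unfolding _+_ _*_ -_
    double : ∀ r -> + 2 * (1ℤ + + 4 * r) ≡ + 2 * 1ℤ + + 4 * (+ 2 * r)
    double = sv ring
  Cz : C 𝟘
  Cz = resp (\ i -> tr (*-zeroˡ _) (sy (tr (cg (\ b -> + 2 * bit b) (VP.lookup-replicate i false)) (*-zeroʳ _)))) (times 0ℤ ov)
  Cw : ∀ {u} -> C u -> Σ ℕ \ h -> Bits.wei u ≡ 4 ℕ.* h × h ≢ 1 × (h ≡ 0 -> u ≡ 𝟘)
  Cw {u} u∈ with norm u∈
  ... | h , e , h≢1 , va = h , NP.*-cancelˡ-≡ _ _ 4 (ZP.+-injective (tr (pos-* 4 (Bits.wei u)) (tr (mc (sy (wesu u))) (tr (sy total) (tr e (tr (sy (pos-* 16 h)) (cg +_ (NP.*-assoc 4 4 h)))))))) , h≢1 ,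
    \ h≡0 -> tr (sy (VP.tabulate∘lookup u)) (tr (VP.tabulate-cong (\ i -> tr (zb (lk u i) (va h≡0 i)) (sy (VP.lookup-replicate i false)))) (VP.tabulate∘lookup 𝟘))
   where
   opaque
    unfolding _+_ _*_ -_
    square : ∀ b -> (+ 2 * b) * (+ 2 * b) ≡ + 4 * (b * b)
    square = sv ring
    zb : ∀ b -> + 2 * bit b ≡ 0ℤ -> b ≡ false
    zb false _ = refl
    zb true ()
   total : dot₂ (twice u) (twice u) ≡ + 4 * sum 24 (\ i -> bit (lk u i))
   total = tr (Sc \ i -> tr (square _) (mc (bi (lk u i)))) (Σ* 24 (+ 4) _)
  opaque
   unfolding _+_ _*_ -_
   private
    fodo : ∀ a b -> (+ 2 * a) * (+ 2 * b) ≡ + 4 * (a * b)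
    fodo = sv ring
    oddo : ∀ t q -> + 4 * (1ℤ + (t + t)) ≢ + 8 * q
    oddo t q e = even≢odd q t (sy (*-cancelˡ-≡ (+ 4) {+ 2 * t + 1ℤ} {+ 2 * q} (\ ()) (tr (left t) (tr e (right q)))))
     where
     left : ∀ t -> + 4 * (+ 2 * t + 1ℤ) ≡ + 4 * (1ℤ + (t + t))
     left = sv ring
     right : ∀ q -> + 8 * q ≡ + 4 * (+ 2 * q)
     right = sv ring
  Cor : ∀ {u v} -> C u -> C v -> u ∙ v ≡ false
  Cor {u} {v} u∈ v∈ with u ∙ v | dosu u v | pairing u∈ v∈
  ... | false | _ | _ = refl
  ... | true | t , e | q , e′ = cx (tr (mc (sy e)) (tr (sy (tr (Sc \ i -> fodo (bit (lk u i)) (bit (lk v i))) (Σ* 24 (+ 4) _))) e′)) (oddo t q)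
  -- The candidate 2t + 4s e_0 lies in the self-dual lattice once its pairings are divisible by 8.
  -- For even vectors this is orthogonality to the code; odd ones differ from `ov` by an even one;
  -- and `s` is chosen to suit `ov` itself.
  Csd : ∀ t -> (∀ u -> C u -> u ∙ t ≡ false) -> C t
  Csd t perp = bw (dosu 𝟙 t)
   where
   ones : sum 24 (\ i -> bit (lk 𝟙 i) * bit (lk t i)) ≡ sum 24 (\ i -> bit (lk t i))
   ones = Sc \ i -> tr (cg (\ b -> bit b * bit (lk t i)) (VP.lookup-replicate i true)) (*-identityˡ _)
   W = sum 24 (\ i -> bit (lk t i))
   y : ℤ -> Co
   y s i = twice t i + + 4 * (s * δ o₀ i)
   opaque
    unfolding _+_ _*_ -_
    evte : ∀ b s d β ρ -> (+ 2 * b + + 4 * (s * d)) * (+ 2 * β + + 4 * ρ) ≡ + 4 * (b * β) + (+ 8 * (b * ρ) + + 8 * (d * (s * (β + + 2 * ρ))))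
    evte = sv ring
    odte : ∀ b s d ρ -> (+ 2 * b + + 4 * (s * d)) * (1ℤ + + 4 * ρ) ≡ + 2 * b + (+ 8 * (b * ρ) + + 4 * (d * (s * (1ℤ + + 4 * ρ))))
    odte = sv ring
    et : ∀ t x z -> + 4 * (0ℤ + (t + t)) + (+ 8 * x + + 8 * z) ≡ + 8 * (t + x + z)
    et = sv ring
    ot : ∀ k s x ρ m -> k + s ≡ m + m -> + 2 * (0ℤ + (k + k)) + (+ 8 * x + + 4 * (s * (1ℤ + + 4 * ρ))) ≡ + 8 * (m + x + + 2 * (s * ρ))
    ot k s x ρ m e = tr (first k s x ρ) (tr (cg (\ z -> + 4 * z + (+ 8 * x + + 16 * (s * ρ))) e) (second m x (s * ρ)))
     where
     first : ∀ k s x ρ -> + 2 * (0ℤ + (k + k)) + (+ 8 * x + + 4 * (s * (1ℤ + + 4 * ρ))) ≡ + 4 * (k + s) + (+ 8 * x + + 16 * (s * ρ))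
     first = sv ring
     second : ∀ m x w -> + 4 * (m + m) + (+ 8 * x + + 16 * w) ≡ + 8 * (m + x + + 2 * w)
     second = sv ring
    subtract : ∀ q p -> + 8 * q + (- 1ℤ) * (+ 8 * p) ≡ + 8 * (q - p)
    subtract = sv ring
    pull : ∀ a z w -> a * (z + (- 1ℤ) * w) ≡ a * z + (- 1ℤ) * (a * w)
    pull = sv ring
    restore : ∀ z w -> (z + (- 1ℤ) * w) + w ≡ z
    restore = sv ring
    om : ∀ s r -> (s + s + 1ℤ) + (- 1ℤ) * (1ℤ + + 4 * r) ≡ (s - + 2 * r) + (s - + 2 * r)
    om = sv ring
    qua : ∀ a s β -> a ≡ s + s -> Σ ℤ (\ m -> (β ≡ 0ℤ × s ≡ m + m) ⊎ (β ≡ 1ℤ × s ≡ m + m + 1ℤ)) -> Σ ℤ \ ρ -> a ≡ + 2 * β + + 4 * ρ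
    qua _ _ _ refl (m , n1 (refl , refl)) = m , q₀ m
     where
     q₀ : ∀ m -> (m + m) + (m + m) ≡ + 2 * 0ℤ + + 4 * m
     q₀ = sv ring
    qua _ _ _ refl (m , n2 (refl , refl)) = m , q₁ m
     where
     q₁ : ∀ m -> (m + m + 1ℤ) + (m + m + 1ℤ) ≡ + 2 * 1ℤ + + 4 * m
     q₁ = sv ring
   evca : ∀ s z -> M z -> (∀ i -> Σ ℤ \ a -> z i ≡ a + a) -> Σ ℤ \ q -> dot₂ (y s) z ≡ + 8 * q
   evca s z z∈ halves = bd (u ∙ t) refl
    where
    hb : Fin 24 -> Bool
    hb i with paha (p1 (halves i))
    ... | _ , n1 _ = false
    ... | _ , n2 _ = true
    decompose : ∀ i -> Σ ℤ \ ρ -> z i ≡ + 2 * bit (hb i) + + 4 * ρ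
    decompose i with paha (p1 (halves i))
    ... | m , n1 (_ , e) = qua (z i) (p1 (halves i)) 0ℤ (p2 (halves i)) (m , n1 (refl , e))
    ... | m , n2 (_ , e) = qua (z i) (p1 (halves i)) 1ℤ (p2 (halves i)) (m , n2 (refl , e))
    u : Word 24
    u = tabulate hb
    ρ : Co
    ρ i = p1 (decompose i)
    z≡ : ∀ i -> z i ≡ twice u i + + 4 * ρ i
    z≡ i = tr (p2 (decompose i)) (cg (\ b -> + 2 * bit b + + 4 * ρ i) (sy (VP.lookup∘tabulate hb i)))
    u∈ : C u
    u∈ = reev u ρ (resp z≡ z∈)
    β : Co
    β i = bit (lk u i)
    X = sum 24 (\ i -> bit (lk t i) * ρ i)
    total : dot₂ (y s) z ≡ + 4 * sum 24 (\ i -> bit (lk t i) * β i) + (+ 8 * X + + 8 * (s * (β o₀ + + 2 * ρ o₀)))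
    total = tr (Sc \ i -> tr (mc (z≡ i)) (evte (bit (lk t i)) s (δ o₀ i) (β i) (ρ i)))
     (tr (Σ-+ 24 _ _) (cg2 _+_ (Σ* 24 (+ 4) _) (tr (Σ-+ 24 _ _) (cg2 _+_ (Σ* 24 (+ 8) _) (tr (Σ* 24 (+ 8) _) (mc (Σδ 24 o₀ (\ i -> s * (β i + + 2 * ρ i)))))))))
    bd : ∀ b -> u ∙ t ≡ b -> _
    bd true e = cx (tr (sy e) (perp u u∈)) \ ()
    bd false e with dosu t u
    ... | τ , e′ = _ , tr total (tr (cg (\ w -> + 4 * w + (+ 8 * X + + 8 * (s * (β o₀ + + 2 * ρ o₀)))) (tr e′ (cg (\ b -> bit b + (τ + τ)) (tr (∙-comm t u) e)))) (et τ X _))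
   odt : ∀ s -> dot₂ (y s) (\ i -> 1ℤ + + 4 * r i) ≡ + 2 * W + (+ 8 * sum 24 (\ i -> bit (lk t i) * r i) + + 4 * (s * (1ℤ + + 4 * r o₀)))
   odt s = tr (Sc \ i -> odte (bit (lk t i)) s (δ o₀ i) (r i))
    (tr (Σ-+ 24 _ _) (cg2 _+_ (Σ* 24 (+ 2) _) (tr (Σ-+ 24 _ _) (cg2 _+_ (Σ* 24 (+ 8) _) (tr (Σ* 24 (+ 4) _) (mc (Σδ 24 o₀ (\ i -> s * (1ℤ + + 4 * r i)))))))))
   inla : ∀ k s m -> W ≡ 0ℤ + (k + k) -> k + s ≡ m + m -> M (y s)
   inla k s m W≡ ks = realised (y s) \ z z∈ -> every z z∈ (unif z∈)
    where
    odpa : Σ ℤ \ q -> dot₂ (y s) (\ i -> 1ℤ + + 4 * r i) ≡ + 8 * q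
    odpa = _ , tr (odt s) (tr (cg (\ w -> + 2 * w + (+ 8 * sum 24 (\ i -> bit (lk t i) * r i) + + 4 * (s * (1ℤ + + 4 * r o₀)))) W≡) (ot k s (sum 24 (\ i -> bit (lk t i) * r i)) (r o₀) m ks))
    every : ∀ z -> M z -> _ -> Σ ℤ \ q -> dot₂ (y s) z ≡ + 8 * q
    every z z∈ (n1 halves) = evca s z z∈ halves
    every z z∈ (n2 halves) with odpa | evca s (\ i -> z i + (- 1ℤ) * (1ℤ + + 4 * r i)) (plus z∈ (times (- 1ℤ) ov))
      (\ i -> _ , tr (cg (\ w -> w + (- 1ℤ) * (1ℤ + + 4 * r i)) (p2 (halves i))) (om (p1 (halves i)) (r i)))
    ... | p , ep | q , eq = q + p , tr (sy (restore (dot₂ (y s) z) (dot₂ (y s) (\ i -> 1ℤ + + 4 * r i)))) (tr (cg2 _+_ (tr (sy split) eq) ep) (sy (*-distribˡ-+ (+ 8) q p)))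
     where
     split : dot₂ (y s) (\ i -> z i + (- 1ℤ) * (1ℤ + + 4 * r i)) ≡ dot₂ (y s) z + (- 1ℤ) * dot₂ (y s) (\ i -> 1ℤ + + 4 * r i)
     split = tr (Sc \ i -> pull (y s i) (z i) (1ℤ + + 4 * r i)) (tr (Σ-+ 24 _ _) (ac (Σ* 24 (- 1ℤ) _)))
   bw : (Σ ℤ \ k -> sum 24 (\ i -> bit (lk 𝟙 i) * bit (lk t i)) ≡ bit (𝟙 ∙ t) + (k + k)) -> C t
   bw (k , e) = bp (paha k)
    where
    W≡ : W ≡ 0ℤ + (k + k)
    W≡ = tr (sy ones) (tr e (cg (\ b -> bit b + (k + k)) (perp 𝟙 Con)))
    opaque
     unfolding _+_ _*_ -_
     bump : ∀ m -> (m + m + 1ℤ) + 1ℤ ≡ (m + 1ℤ) + (m + 1ℤ)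
     bump = sv ring
    bp : Hal _ k -> C t
    -- Half the weight of `t` plus `s` must be even, which selects 0 or 1.
    bp (m , n1 (_ , e′)) = reev t (\ i -> 0ℤ * δ o₀ i) (inla k 0ℤ m W≡ (tr (+-identityʳ k) e′))
    bp (m , n2 (_ , e′)) = reev t (\ i -> 1ℤ * δ o₀ i) (inla k 1ℤ (m + 1ℤ) W≡ (tr (cg (\ z -> z + 1ℤ) e′) (bump m)))
  -- The vector (-3, 1, ..., 1) of the standard construction. The all-one vector is excluded because
  -- 24 is not a multiple of 16.
  glue : M (\ i -> 1ℤ + (- + 4) * δ o₀ i)
  glue with reduce (\ _ -> 1ℤ) r ov
  ... | n1 ones∈ = cx (p1 (p2 (norm ones∈))) (no24 (p1 (norm ones∈)))
   where
   opaque
    unfolding _+_ _*_ -_ sum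
    no24 : ∀ h -> dot₂ (\ _ -> 1ℤ) (\ _ -> 1ℤ) ≢ + 16 * + h
    no24 0 ()
    no24 1 ()
    no24 (suc (suc h)) e with tr e (sy (ZP.pos-* 16 (suc (suc h))))
    ... | e′ with ZP.+-injective e′
    ...   | e″ = NP.<⇒≢ (NP.<-≤-trans {24} {32} (NP.≤ᵇ⇒≤ 25 32 _) (NP.*-monoʳ-≤ 16 (s≤s (s≤s (z≤n {h}))))) e″
  ... | n2 y∈ = resp (\ i -> shift (δ o₀ i)) (plus y∈ (times (- 1ℤ) (eig o₀)))
   where
   opaque
    unfolding _+_ _*_ -_
    shift : ∀ d -> (1ℤ + + 4 * d) + (- 1ℤ) * (+ 8 * d) ≡ 1ℤ + (- + 4) * d
    shift = sv ring

-- Cutting coordinates into equal cells by balanced words.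

module Balanced where
 open Z
 open Bits hiding (wei)
 open Code using (bit; lookup-⊞)
 open import Data.Nat as ℕ using (ℕ; suc; z≤n; s≤s)
 open import Data.Bool using (Bool; true; false; _xor_)
 open import Data.Integer as ℤ using (ℤ; +_; 0ℤ; 1ℤ; _≤_; _<_; +≤+)
 open import Data.Fin using (Fin; suc)
 open import Data.Vec using (Vec; []; _∷_; lookup; replicate)
 open import Data.Vec.Relation.Unary.All using (All; []; _∷_)
 open import Tactic.RingSolver using () renaming (solve-∀ to sv)
 sign : Bool -> ℤ
 sign true = - 1ℤ
 sign false = 1ℤ
 opaque
  unfolding _+_ _*_ -_
  sx : ∀ a b -> sign (a xor b) ≡ sign a * sign b
  sx true true = refl
  sx true false = refl
  sx false true = refl
  sx false false = refl
  fasa : ∀ a -> 1ℤ + sign (a xor a) ≡ + 2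
  fasa true = refl
  fasa false = refl
  fd : ∀ a b -> a ≢ b -> 1ℤ + sign (a xor b) ≡ 0ℤ
  fd true true ne = cx refl ne
  fd true false ne = refl
  fd false true ne = refl
  fd false false ne = cx refl ne
  spte : ∀ g s β ω c -> (g * s) * ((1ℤ + β * ω) * c) ≡ (g * s) * c + β * ((g * (s * ω)) * c)
  spte = sv ring
 module _ {n} (g : Fin n -> Bool) where
  mass : ℤ
  mass = sum n (\ p -> bit (g p))
  χ : Word n -> ℤ
  χ u = sum n (\ p -> bit (g p) * sign (lk u p))
  -- 2^k times the indicator of the points where the words `ws` take the values `bs`, as a product
  -- that expands into characters.
  cell : ∀ {k} -> Vec Bool k -> Vec (Word n) k -> Fin n -> ℤ
  cell [] [] p = 1ℤ
  cell (b ∷ bs) (w ∷ ws) p = (1ℤ + sign (b xor lk w p)) * cell bs ws p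
  InC : ∀ {k} -> Vec Bool k -> Vec (Word n) k -> Fin n -> Set
  InC [] [] p = ⊤
  InC (b ∷ bs) (w ∷ ws) p = b ≡ lk w p × InC bs ws p
  inC : ∀ {k} (bs : Vec Bool k) ws p -> Dec (InC bs ws p)
  inC [] [] p = yes tt
  inC (b ∷ bs) (w ∷ ws) p = (b BP.≟ lk w p) ×-dec inC bs ws p
  cein : ∀ {k} (bs : Vec Bool k) ws p -> InC bs ws p -> cell bs ws p ≡ + (2 ℕ.^ k)
  cein [] [] p _ = refl
  cein {suc k} (b ∷ bs) (w ∷ ws) p (refl , r) = tr (cg2 _*_ (fasa b) (cein bs ws p r)) (sy (pos-* 2 (2 ℕ.^ k)))
  ceou : ∀ {k} (bs : Vec Bool k) ws p -> ¬ InC bs ws p -> cell bs ws p ≡ 0ℤ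
  ceou [] [] p out = cx tt out
  ceou (b ∷ bs) (w ∷ ws) p out with b BP.≟ lk w p
  ... | yes e = tr (mc (ceou bs ws p (\ r -> out (e , r)))) (*-zeroʳ _)
  ... | no ne = tr (mr (fd b (lk w p) ne)) (*-zeroˡ _)
  S : ∀ {k} -> Vec Bool k -> Vec (Word n) k -> Word n -> ℤ
  S bs ws u = sum n (\ p -> (bit (g p) * sign (lk u p)) * cell bs ws p)
  S∷ : ∀ {k} b w (bs : Vec Bool k) ws u -> S (b ∷ bs) (w ∷ ws) u ≡ S bs ws u + sign b * S bs ws (u ⊞ w)
  S∷ b w bs ws u = tr (Sc \ p -> tr (cg (\ z -> (bit (g p) * sign (lk u p)) * ((1ℤ + z) * cell bs ws p)) (sx b (lk w p)))
    (tr (spte (bit (g p)) (sign (lk u p)) (sign b) (sign (lk w p)) (cell bs ws p))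
     (cg (\ z -> (bit (g p) * sign (lk u p)) * cell bs ws p + sign b * ((bit (g p) * z) * cell bs ws p)) (tr (sy (sx (lk u p) (lk w p))) (cg sign (sy (lookup-⊞ u w p)))))))
   (tr (Σ-+ n _ _) (ac (Σ* n (sign b) _)))
  data Com : ∀ {k} -> Vec (Word n) k -> Word n -> Set where
   empty : Com [] 𝟘
   skip : ∀ {k w c} {ws : Vec (Word n) k} -> Com ws c -> Com (w ∷ ws) c
   take : ∀ {k w c} {ws : Vec (Word n) k} -> Com ws c -> Com (w ∷ ws) (w ⊞ c)
  -- Every nonempty sum of the words has character sum zero; hence all 2^k cells contain equally
  -- many points of `g`.
  Inde : ∀ {k} -> Vec (Word n) k -> Set
  Inde [] = ⊤
  Inde (w ∷ ws) = (∀ {c} -> Com ws c -> χ (w ⊞ c) ≡ 0ℤ) × Inde ws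
  Sz : ∀ {k} (bs : Vec Bool k) ws u -> (∀ {c} -> Com ws c -> χ (u ⊞ c) ≡ 0ℤ) -> S bs ws u ≡ 0ℤ
  Sz [] [] u balanced = tr (Sc \ p -> *-identityʳ _) (tr (cg χ (sy (tr (⊞c u 𝟘) (⊞i u)))) (balanced empty))
  Sz (b ∷ bs) (w ∷ ws) u balanced = tr (S∷ b w bs ws u) (tr (cg2 _+_ (Sz bs ws u (\ c -> balanced (skip c)))
   (tr (mc (Sz bs ws (u ⊞ w) (\ {c} c∈ -> tr (cg χ (⊞a u w c)) (balanced (take c∈))))) (*-zeroʳ _))) (+-identityʳ _))
  Sm : ∀ {k} (bs : Vec Bool k) ws -> Inde ws -> S bs ws 𝟘 ≡ mass
  Sm [] [] _ = Sc \ p -> tr (*-identityʳ _) (tr (mc (cg sign (VP.lookup-replicate p false))) (*-identityʳ _))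
  Sm (b ∷ bs) (w ∷ ws) (new , old) = tr (S∷ b w bs ws 𝟘) (tr (cg2 _+_ (Sm bs ws old)
   (tr (mc (tr (cg (S bs ws) (⊞i w)) (Sz bs ws w new))) (*-zeroʳ _))) (+-identityʳ _))
  ct : ∀ {k} (bs : Vec Bool k) ws -> Inde ws -> sum n (\ p -> bit (g p) * cell bs ws p) ≡ mass
  ct bs ws ind = tr (Sc \ p -> mr (sy (tr (mc (cg sign (VP.lookup-replicate p false))) (*-identityʳ _)))) (Sm bs ws ind)
  Ins : ∀ {k} -> Vec Bool k -> Vec (Word n) k -> Fin n -> Set
  Ins bs ws p = g p ≡ true × InC bs ws p
  ins : ∀ {k} (bs : Vec Bool k) ws p -> Dec (Ins bs ws p)
  ins bs ws p = (g p BP.≟ true) ×-dec inC bs ws p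
  teou : ∀ {k} (bs : Vec Bool k) ws p -> ¬ Ins bs ws p -> bit (g p) * cell bs ws p ≡ 0ℤ
  teou bs ws p out with g p
  ... | false = *-zeroˡ _
  ... | true = tr (mc (ceou bs ws p (\ r -> out (refl , r)))) (*-zeroʳ _)
  ti : ∀ {k} (bs : Vec Bool k) ws p -> Ins bs ws p -> bit (g p) * cell bs ws p ≡ + (2 ℕ.^ k)
  ti bs ws p (gp , r) = tr (cg2 (\ b z -> bit b * z) gp (cein bs ws p r)) (*-identityˡ _)
  temu : ∀ {k} (bs : Vec Bool k) ws p -> bit (g p) * cell bs ws p ≡ + (2 ℕ.^ k) * bit (does (ins bs ws p))
  temu {k} bs ws p = bc (ins bs ws p)
   where
   bc : (d : Dec (Ins bs ws p)) -> bit (g p) * cell bs ws p ≡ + (2 ℕ.^ k) * bit (does d)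
   bc (yes r) = tr (ti bs ws p r) (sy (*-identityʳ _))
   bc (no ¬r) = tr (teou bs ws p ¬r) (sy (*-zeroʳ _))
  tn : ∀ {k} (bs : Vec Bool k) ws p -> 0ℤ ≤ bit (g p) * cell bs ws p
  tn bs ws p with ins bs ws p
  ... | yes r = sb (0ℤ ≤_) (sy (ti bs ws p r)) (+≤+ z≤n)
  ... | no ¬r = ZP.≤-reflexive (sy (teou bs ws p ¬r))
  opaque
   fipo : ∀ {k} (bs : Vec Bool k) ws -> Inde ws -> mass ≢ 0ℤ -> ∃ (Ins bs ws)
   fipo bs ws ind m≢0 with FP.any? (ins bs ws)
   ... | yes found = found
   ... | no none = cx (tr (sy (ct bs ws ind)) (Σz \ p -> teou bs ws p (\ r -> none (p , r)))) m≢0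
   fintwo : ∀ {k} (bs : Vec Bool k) ws -> Inde ws -> mass ≢ 0ℤ -> mass ≢ + (2 ℕ.^ k) -> ∃₂ \ p q -> p ≢ q × Ins bs ws p × Ins bs ws q
   fintwo {k} bs ws ind m≢0 m≢1 with fipo bs ws ind m≢0
   ... | p , pin with FP.any? (\ q -> ¬? (p FP.≟ q) ×-dec ins bs ws q)
   ...   | yes (q , p≢q , qin) = p , q , p≢q , pin , qin
   ...   | no none = cx (tr (sy (ct bs ws ind)) (tr (Sc only) (Σδ n p (\ _ -> + (2 ℕ.^ k))))) m≢1
    where
    only : ∀ q -> bit (g q) * cell bs ws q ≡ δ p q * + (2 ℕ.^ k)
    only q with p FP.≟ q
    ... | yes refl = tr (ti bs ws p pin) (sy (tr (mr (δr p)) (*-identityˡ _)))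
    ... | no p≢q = tr (teou bs ws q (\ r -> none (q , p≢q , r))) (sy (tr (mr (δ≢ p q p≢q)) (*-zeroˡ _)))
   amo : ∀ {k} (bs : Vec Bool k) ws -> Inde ws -> mass ≡ + (2 ℕ.^ k) -> ∀ p q -> Ins bs ws p -> Ins bs ws q -> p ≡ q
   amo {k} bs ws ind m≡ p q pin qin with p FP.≟ q
   ... | yes e = e
   ... | no p≢q = cx (ZP.drop‿+≤+ (sb2 _≤_ two (tr (ct bs ws ind) m≡) (Σm bound))) (NP.<⇒≱ (NP.m<m+n (2 ℕ.^ k) (NP.m^n>0 2 k)))
    where
    K : ℤ
    K = + (2 ℕ.^ k)
    two : sum n (\ i -> δ p i * K + δ q i * K) ≡ + (2 ℕ.^ k ℕ.+ 2 ℕ.^ k)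
    two = tr (Σ-+ n _ _) (tr (cg2 _+_ (Σδ n p (\ _ -> K)) (Σδ n q (\ _ -> K))) (sy (pos-+ (2 ℕ.^ k) (2 ℕ.^ k))))
    bound : ∀ i -> δ p i * K + δ q i * K ≤ bit (g i) * cell bs ws i
    bound i with p FP.≟ i | q FP.≟ i
    ... | yes refl | yes refl = cx refl p≢q
    ... | yes refl | no q≢i = ZP.≤-reflexive (tr (cg2 _+_ (tr (mr (δr p)) (*-identityˡ _)) (tr (mr (δ≢ q p q≢i)) (*-zeroˡ _))) (tr (+-identityʳ _) (sy (ti bs ws p pin))))
    ... | no p≢i | yes refl = ZP.≤-reflexive (tr (cg2 _+_ (tr (mr (δ≢ p q p≢i)) (*-zeroˡ _)) (tr (mr (δr q)) (*-identityˡ _))) (tr (+-identityˡ _) (sy (ti bs ws q qin))))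
    ... | no p≢i | no q≢i = sb (_≤ bit (g i) * cell bs ws i) (sy (tr (cg2 _+_ (tr (mr (δ≢ p i p≢i)) (*-zeroˡ _)) (tr (mr (δ≢ q i q≢i)) (*-zeroˡ _))) (+-identityʳ 0ℤ))) (tn bs ws i)
  record BalancedClass (K : Word n -> Set) : Set where
   field
    zi : K 𝟘
    plin : ∀ {u v} -> K u -> K v -> K (u ⊞ v)
    balanced : ∀ {u} -> K u -> (∀ p q -> g p ≡ true -> g q ≡ true -> lk u p ≡ lk u q) ⊎ χ u ≡ 0ℤ
    sepa : ∀ p q -> p ≢ q -> g p ≡ true -> g q ≡ true -> ∃ \ u -> K u × lk u p ≢ lk u q
  module _ {K : Word n -> Set} (B : BalancedClass K) where
   open BalancedClass B
   combin : ∀ {k} {ws : Vec (Word n) k} -> All K ws -> ∀ {c} -> Com ws c -> K c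
   combin [] empty = zi
   combin (w∈ ∷ ws∈) (skip c∈) = combin ws∈ c∈
   combin (w∈ ∷ ws∈) (take c∈) = plin w∈ (combin ws∈ c∈)
   coco : ∀ {k} {bs : Vec Bool k} {ws} p q -> InC bs ws p -> InC bs ws q -> ∀ {c} -> Com ws c -> lk c p ≡ lk c q
   coco {bs = []} p q _ _ empty = tr (VP.lookup-replicate p false) (sy (VP.lookup-replicate q false))
   coco {bs = b ∷ bs} p q (_ , r) (_ , s) (skip c∈) = coco {bs = bs} p q r s c∈
   coco {bs = b ∷ bs} p q (e , r) (e′ , s) (take {w = w} {c = c} c∈) = tr (lookup-⊞ w c p) (tr (cg2 _xor_ (tr (sy e) e′) (coco {bs = bs} p q r s c∈)) (sy (lookup-⊞ w c q)))
   opaque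
    -- While a cell still holds two points, a word that separates them is new: sums of the old words
    -- are constant on the cell, so adding one never gives a constant word, and nonconstant words
    -- are balanced.
    extend : ∀ {k} (ws : Vec (Word n) k) -> All K ws -> Inde ws -> mass ≢ 0ℤ -> mass ≢ + (2 ℕ.^ k) -> ∃ \ u -> K u × Inde (u ∷ ws)
    extend {k} ws ws∈ ind m≢0 m≢1 with fintwo (replicate k false) ws ind m≢0 m≢1
    ... | p , q , p≢q , (gp , pin) , (gq , qin) with sepa p q p≢q gp gq
    ...   | u , u∈ , up≢uq = u , u∈ , new , ind
     where
     new : ∀ {c} -> Com ws c -> χ (u ⊞ c) ≡ 0ℤ
     new {c} c∈ with balanced (plin u∈ (combin ws∈ c∈))
     ... | n2 z = z
     ... | n1 constant = cx (xc (lk c p) _ _ (tr (sy (lookup-⊞ u c p)) (tr (constant p q gp gq) (tr (lookup-⊞ u c q) (cg (lk u q xor_) (sy (coco {bs = replicate k false} p q pin qin c∈))))))) up≢uq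
      where
      xc : ∀ c a b -> a xor c ≡ b xor c -> a ≡ b
      xc true true true _ = refl
      xc true false false _ = refl
      xc false true true _ = refl
      xc false false false _ = refl
    four : mass ≢ 0ℤ -> (∀ k -> k ℕ.< 4 -> mass ≢ + (2 ℕ.^ k)) -> Σ (Vec (Word n) 4) \ ws -> All K ws × Inde ws
    four m≢0 m≢ with extend [] [] tt m≢0 (m≢ 0 (s≤s z≤n))
    ... | u₁ , k₁ , i₁ with extend (u₁ ∷ []) (k₁ ∷ []) i₁ m≢0 (m≢ 1 (s≤s (s≤s z≤n)))
    ...   | u₂ , k₂ , i₂ with extend (u₂ ∷ u₁ ∷ []) (k₂ ∷ k₁ ∷ []) i₂ m≢0 (m≢ 2 (s≤s (s≤s (s≤s z≤n))))
    ...     | u₃ , k₃ , i₃ with extend (u₃ ∷ u₂ ∷ u₁ ∷ []) (k₃ ∷ k₂ ∷ k₁ ∷ []) i₃ m≢0 (m≢ 3 (s≤s (s≤s (s≤s (s≤s z≤n)))))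
    ...       | u₄ , k₄ , i₄ = (u₄ ∷ u₃ ∷ u₂ ∷ u₁ ∷ []) , (k₄ ∷ k₃ ∷ k₂ ∷ k₁ ∷ []) , i₄

-- An octad and the affine space on its complement.

module Octad where
 open Z hiding (+-identityʳ; +-identityˡ; *-identityʳ; *-identityˡ; +d; *d)
 open Bits
 open Code using (bit; wesu; b∧; lookup-⊞)
 open Balanced
 open import Data.Nat as ℕ using (ℕ; zero; suc; z≤n; s≤s)
 open import Data.Nat.Tactic.RingSolver using () renaming (solve-∀ to svN)
 open import Data.Bool using (Bool; true; false; _xor_; _∧_; not)
 open import Data.Integer as ℤ using (+_; -[1+_]; 0ℤ; 1ℤ)
 open import Data.Fin using (Fin; zero; suc)
 open import Data.Vec using (Vec; []; _∷_; lookup; replicate; zipWith; map)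
 open import Data.Vec.Relation.Unary.All using (All; []; _∷_)
 open import Tactic.RingSolver using () renaming (solve-∀ to sv)
 open import Relation.Unary using (Decidable)
 private variable n : ℕ
 _≟ʷ_ : (u v : Word n) -> Dec (u ≡ v)
 _≟ʷ_ = VP.≡-dec BP._≟_
 outside : Word n -> Word n -> Word n
 outside = zipWith (\ o a -> a ∧ not o)
 w⊞o : (o u : Word n) -> wei u ℕ.+ wei (u ⊞ o) ≡ wei o ℕ.+ 2 ℕ.* wei (outside o u)
 w⊞o [] [] = refl
 w⊞o (true ∷ o) (true ∷ u) = cg suc (w⊞o o u)
 w⊞o (true ∷ o) (false ∷ u) = tr (NP.+-suc _ _) (cg suc (w⊞o o u))
 w⊞o (false ∷ o) (true ∷ u) = tr (cg suc (NP.+-suc _ _)) (tr (cg (\ z -> 2 ℕ.+ z) (w⊞o o u)) (shift (wei o) (wei (outside o u))))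
  where
  shift : ∀ a b -> 2 ℕ.+ (a ℕ.+ 2 ℕ.* b) ≡ a ℕ.+ 2 ℕ.* suc b
  shift = svN
 w⊞o (false ∷ o) (false ∷ u) = w⊞o o u
 weight-⊞-≤ : (u v : Word n) -> wei (u ⊞ v) ℕ.≤ wei u ℕ.+ wei v
 weight-⊞-≤ [] [] = z≤n
 weight-⊞-≤ (true ∷ u) (true ∷ v) = NP.≤-trans (weight-⊞-≤ u v) (NP.+-mono-≤ (NP.n≤1+n _) (NP.n≤1+n _))
 weight-⊞-≤ (true ∷ u) (false ∷ v) = s≤s (weight-⊞-≤ u v)
 weight-⊞-≤ (false ∷ u) (true ∷ v) = NP.≤-trans (s≤s (weight-⊞-≤ u v)) (NP.≤-reflexive (sy (NP.+-suc _ _)))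
 weight-⊞-≤ (false ∷ u) (false ∷ v) = weight-⊞-≤ u v
 weight-outside-≤ : (o u : Word n) -> wei (outside o u) ℕ.≤ wei u
 weight-outside-≤ [] [] = z≤n
 weight-outside-≤ (true ∷ o) (true ∷ u) = NP.≤-trans (weight-outside-≤ o u) (NP.n≤1+n _)
 weight-outside-≤ (true ∷ o) (false ∷ u) = weight-outside-≤ o u
 weight-outside-≤ (false ∷ o) (true ∷ u) = s≤s (weight-outside-≤ o u)
 weight-outside-≤ (false ∷ o) (false ∷ u) = weight-outside-≤ o u
 wc : (u : Word n) -> wei u ℕ.+ wei (u ⊞ replicate n true) ≡ n
 wc [] = refl
 wc (true ∷ u) = cg suc (wc u)
 wc (false ∷ u) = tr (NP.+-suc _ _) (cg suc (wc u))
 w𝟘 : ∀ n -> wei (𝟘 {n}) ≡ 0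
 w𝟘 zero = refl
 w𝟘 (suc n) = w𝟘 n
 unit : Fin n -> Word n
 unit zero = true ∷ 𝟘
 unit (suc i) = false ∷ unit i
 wu : (i : Fin n) -> wei (unit i) ≡ 1
 wu {suc n} zero = cg suc (w𝟘 n)
 wu (suc i) = wu i
 lu : (i : Fin n) -> lk (unit i) i ≡ true
 lu zero = refl
 lu (suc i) = lu i
 lu≢ : (i j : Fin n) -> i ≢ j -> lk (unit i) j ≡ false
 lu≢ zero zero ne = cx refl ne
 lu≢ zero (suc j) ne = VP.lookup-replicate j false
 lu≢ (suc i) zero ne = refl
 lu≢ (suc i) (suc j) ne = lu≢ i j (\ e -> ne (cg suc e))
 ∙u : (u : Word n) (i : Fin n) -> u ∙ unit i ≡ lk u i
 ∙u (a ∷ u) zero = tr (cg2 _xor_ (BP.∧-identityʳ a) (tr (∙-comm u 𝟘) (∙𝟘 u))) (BP.xor-identityʳ a)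
 ∙u (a ∷ u) (suc i) = tr (cg (_xor (u ∙ unit i)) (BP.∧-zeroʳ a)) (∙u u i)
 pair : Fin n -> Fin n -> Word n
 pair p q = unit p ⊞ unit q
 ∙p : (u : Word n) (p q : Fin n) -> u ∙ pair p q ≡ lk u p xor lk u q
 ∙p u p q = tr (∙⊞ʳ u (unit p) (unit q)) (cg2 _xor_ (∙u u p) (∙u u q))
 wepa : (p q : Fin n) -> wei (pair p q) ℕ.≤ 2
 wepa p q = NP.≤-trans (weight-⊞-≤ (unit p) (unit q)) (NP.≤-reflexive (cg2 ℕ._+_ (wu p) (wu q)))
 xor-≡ : ∀ a b -> a xor b ≡ false -> a ≡ b
 xor-≡ true true _ = refl
 xor-≡ false false _ = refl
 x≢ : ∀ a b -> a xor b ≡ true -> a ≢ b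
 x≢ true true ()
 x≢ true false _ ()
 x≢ false true _ ()
 x≢ false false ()
 paat : (p q : Fin n) -> p ≢ q -> lk (pair p q) p ≡ true
 paat p q ne = tr (lookup-⊞ (unit p) (unit q) p) (cg2 _xor_ (lu p) (lu≢ q p (\ e -> ne (sy e))))
 loex : {u v : Word n} -> (∀ i -> lk u i ≡ lk v i) -> u ≡ v
 loex {u = u} {v} e = tr (sy (VP.tabulate∘lookup u)) (tr (VP.tabulate-cong e) (VP.tabulate∘lookup v))
 ⊞𝟘 : (u v : Word n) -> u ⊞ v ≡ 𝟘 -> u ≡ v
 ⊞𝟘 u v e = tr (sy (⊞ca v u)) (tr (cg (v ⊞_) (tr (⊞c v u) e)) (tr (⊞c v 𝟘) (⊞i v)))
 record GolayLike (C : Word 24 -> Set) : Set where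
  field
   decide : Decidable C
   zi : C 𝟘
   oi : C (replicate 24 true)
   plin : ∀ {u v} -> C u -> C v -> C (u ⊞ v)
   sedu : ∀ t -> (∀ u -> C u -> u ∙ t ≡ false) -> C t
   weights : ∀ {u} -> C u -> Σ ℕ \ h -> wei u ≡ 4 ℕ.* h × h ≢ 1 × (h ≡ 0 -> u ≡ 𝟘)
  he : ∀ {u} -> C u -> u ≢ 𝟘 -> 8 ℕ.≤ wei u
  he u∈ u≢0 with weights u∈
  ... | zero , _ , _ , z = cx (z refl) u≢0
  ... | suc zero , _ , ne , _ = cx refl ne
  ... | suc (suc h) , e , _ , _ = NP.≤-trans (NP.*-monoʳ-≤ 4 (s≤s (s≤s (z≤n {h})))) (NP.≤-reflexive (sy e))
 opaque
  unfolding _+_ _*_ -_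
  sibi : ∀ g b -> (g ≡ false -> b ≡ false) -> bit g * sign b ≡ bit g + (- + 2) * bit b
  sibi true true _ = refl
  sibi true false _ = refl
  sibi false true f = cx (f refl) \ ()
  sibi false false _ = refl
 χw : (g : Fin n -> Bool) (u : Word n) -> (∀ p -> g p ≡ false -> lk u p ≡ false) -> χ g u ≡ mass g + (- + 2) * + wei u
 χw {n} g u inside = tr (Sc \ p -> sibi (g p) (lk u p) (inside p)) (tr (Σ-+ n _ _) (ac (tr (Σ* n (- + 2) _) (mc (wesu u)))))
 module _ {C : Word 24 -> Set} (G : GolayLike C) where
  open GolayLike G
  𝟙 : Word 24
  𝟙 = replicate 24 true
  ⊞𝟙𝟘 : ∀ u -> wei (u ⊞ 𝟙) ≡ 0 -> C u -> u ≡ 𝟙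
  ⊞𝟙𝟘 u e u∈ with weights (plin u∈ oi)
  ... | zero , _ , _ , z = ⊞𝟘 u 𝟙 (z refl)
  ... | suc h , e′ , _ , _ = cx (tr (sy e) e′) \ ()
  module _ (no-octad : ∀ u -> C u -> wei u ≢ 8) where
   eve : Fin 24 -> Bool
   eve _ = true
   opaque
    unfolding _+_ _*_ -_ sum
    m2 : mass eve ≡ + 24
    m2 = refl
    ma≢ : ∀ k -> k ℕ.< 4 -> + 24 ≢ + (2 ℕ.^ k)
    ma≢ 0 _ ()
    ma≢ 1 _ ()
    ma≢ 2 _ ()
    ma≢ 3 _ ()
    ma≢ (suc (suc (suc (suc k)))) (s≤s (s≤s (s≤s (s≤s ()))))
    twe : + 24 + (- + 2) * + 12 ≡ 0ℤ
    twe = refl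
    nomu : ∀ x -> + 16 * x ≢ + 24
    nomu (+ zero) ()
    nomu (+ suc zero) ()
    nomu (+ suc (suc m)) e with ZP.+-injective (tr (ZP.pos-* 16 (suc (suc m))) e)
    ... | e′ = NP.<⇒≢ (NP.<-≤-trans {24} {32} (NP.≤ᵇ⇒≤ 25 32 _) (NP.*-monoʳ-≤ 16 (s≤s (s≤s (z≤n {m}))))) (sy e′)
    nomu -[1+ m ] ()
   class : BalancedClass eve C
   class = record { zi = zi ; plin = plin ; balanced = balanced ; sepa = \ p q ne _ _ -> sepa p q ne }
    where
    balanced : ∀ {u} -> C u -> (∀ p q -> true ≡ true -> true ≡ true -> lk u p ≡ lk u q) ⊎ χ eve u ≡ 0ℤ
    balanced {u} u∈ = bw (weights u∈)
     where
     constant : ∀ b -> u ≡ replicate 24 b -> ∀ p q -> true ≡ true -> true ≡ true -> lk u p ≡ lk u q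
     constant b e p q _ _ = tr (cg (\ w -> lk w p) e) (tr (VP.lookup-replicate p b) (tr (sy (VP.lookup-replicate q b)) (cg (\ w -> lk w q) (sy e))))
     complement : ∀ w -> wei u ≡ w -> w ℕ.+ wei (u ⊞ 𝟙) ≡ 24
     complement w e = tr (cg (ℕ._+ wei (u ⊞ 𝟙)) (sy e)) (wc u)
     bw : (Σ ℕ \ h -> wei u ≡ 4 ℕ.* h × h ≢ 1 × (h ≡ 0 -> u ≡ 𝟘)) -> _
     bw (0 , e , _ , z) = n1 (constant false (z refl))
     bw (1 , e , ne , _) = cx refl ne
     bw (2 , e , _ , _) = cx e (no-octad u u∈)
     bw (3 , e , _ , _) = n2 (tr (χw eve u (\ _ ())) (tr (cg2 (\ m w -> m + (- + 2) * + w) m2 e) twe))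
     bw (4 , e , _ , _) = cx (NP.+-cancelˡ-≡ 16 _ 8 (complement 16 e)) (no-octad (u ⊞ 𝟙) (plin u∈ oi))
     bw (5 , e , _ , _) with weights (plin u∈ oi)
     ... | h , e′ , ne , _ = cx (NP.*-cancelˡ-≡ h 1 4 (tr (sy e′) (NP.+-cancelˡ-≡ 20 _ 4 (complement 20 e)))) ne
     bw (6 , e , _ , _) = n1 (constant true (⊞𝟙𝟘 u (NP.+-cancelˡ-≡ 24 _ 0 (complement 24 e)) u∈))
     bw (suc (suc (suc (suc (suc (suc (suc h)))))) , e , _ , _) = cx (NP.≤-trans (NP.m≤m+n (wei u) _) (NP.≤-reflexive (wc u)))
      (NP.<⇒≱ (NP.<-≤-trans {24} {28} (NP.≤ᵇ⇒≤ 25 28 _) (NP.≤-trans (NP.*-monoʳ-≤ 4 {7} {7 ℕ.+ h} (NP.m≤m+n 7 h)) (NP.≤-reflexive (sy e)))))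
    sepa : ∀ p q -> p ≢ q -> ∃ \ u -> C u × lk u p ≢ lk u q
    sepa p q p≢q with search 24 (\ u -> decide u ×-dec ¬? (lk u p BP.≟ lk u q))
    ... | yes found = found
    ... | no none = cx (he (sedu (pair p q) same) nonzero) (NP.<⇒≱ (NP.≤-<-trans (wepa p q) (NP.≤ᵇ⇒≤ 3 8 _)))
     where
     same : ∀ u -> C u -> u ∙ pair p q ≡ false
     same u u∈ = tr (∙p u p q) (tr (cg (_xor lk u q) (decidable-stable (lk u p BP.≟ lk u q) (\ ne -> none (u , u∈ , ne)))) (BP.xor-same (lk u q)))
     nonzero : pair p q ≢ 𝟘
     nonzero e = cx (tr (sy (paat p q p≢q)) (tr (cg (\ w -> lk w p) e) (VP.lookup-replicate p false))) \ ()
   -- Without words of weight 8 only 0, 12 and 24 remain, so every nonconstant word is balanced.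
   -- Four of them would cut 24 coordinates into 16 equal cells.
   contradictory : ∀ {A : Set} -> A
   contradictory with four eve class (\ e -> cx (tr (sy m2) e) \ ()) (\ k k< e -> ma≢ k k< (tr (sy m2) e))
   ... | ws , _ , ind = cx (tr (sy (Σ* 24 (+ 16) (\ p -> bit (does (ins eve bs ws p))))) (tr (Sc \ p -> sy (temu eve bs ws p)) (tr (ct eve bs ws ind) m2))) (nomu _)
    where
    bs = replicate 4 false
  opaque
   oct : ∃ \ u -> C u × wei u ≡ 8
   oct with search 24 (\ u -> decide u ×-dec (wei u ℕ.≟ 8))
   ... | yes found = found
   ... | no none = contradictory (\ u u∈ e -> none (u , u∈ , e))
  module WithOctad (O : Word 24) (O∈ : C O) (O-weight : wei O ≡ 8) where
   -- The weights of `u` and `u ⊞ O` are at least 8 each and add up to 8 plus twice the part of `u`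
   -- outside the octad, so that part has at least four points.
   sha : ∀ u -> C u -> u ≢ 𝟘 -> u ≢ O -> ¬ wei (outside O u) ℕ.≤ 2
   sha u u∈ u≢0 u≢O le = NP.<⇒≱ {12} {16} (NP.≤ᵇ⇒≤ 13 16 _) (NP.≤-trans (NP.+-mono-≤ (he u∈ u≢0) (he (plin u∈ O∈) (\ e -> u≢O (⊞𝟘 u O e))))
    (NP.≤-trans (NP.≤-reflexive (tr (w⊞o O u) (cg (ℕ._+ 2 ℕ.* wei (outside O u)) O-weight))) (NP.+-monoʳ-≤ 8 (NP.*-monoʳ-≤ 2 le))))
   differs : ∀ (u v : Word 24) (p q : Fin 24) -> lk u p ≢ lk u q -> lk v p ≡ lk v q -> u ≢ v
   differs u v p q ne e refl = ne e
   module Agreeing (mask : Fin 24 -> Bool) where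
    V : Word 24 -> Set
    V u = ∃ \ d -> C d × (∀ p -> mask p ≡ true -> lk d p ≡ lk u p)
    subs : Subspace V
    subs = record
     { decide = \ u -> search 24 (\ d -> decide d ×-dec FP.all? (\ p -> im (mask p) (lk d p BP.≟ lk u p)))
     ; zi = 𝟘 , zi , \ _ _ -> refl
     ; plin = \ { {u} {v} (d , d∈ , e) (d′ , d′∈ , e′) -> d ⊞ d′ , plin d∈ d′∈ , \ p m -> tr (lookup-⊞ d d′ p) (tr (cg2 _xor_ (e p m) (e′ p m)) (sy (lookup-⊞ u v p))) } }
     where
     im : ∀ b {A : Set} -> Dec A -> Dec (b ≡ true -> A)
     im true (yes a) = yes \ _ -> a
     im true (no ¬a) = no \ f -> ¬a (f refl)
     im false _ = yes \ ()
    -- Duality of puncturing and shortening: a functional vanishing on the restrictions of all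
    -- codewords to the mask is, by self-duality, itself a codeword, and it is supported in the
    -- mask.
    functional : ∀ t -> ¬ V t -> ∃ \ w -> C w × (∀ p -> mask p ≡ false -> lk w p ≡ false) × w ∙ t ≡ true
    functional t t∉ with separate 24 subs t t∉
    ... | w , perp , hit = w , sedu w (\ u u∈ -> tr (∙-comm u w) (perp u (u , u∈ , \ _ _ -> refl))) ,
     (\ p off -> tr (sy (∙u w p)) (perp (unit p) (𝟘 , zi , \ r on -> tr (VP.lookup-replicate r false) (sy (lu≢ p r (\ e -> cx (tr (sy on) (tr (cg mask (sy e)) off)) \ ())))))) , hit
   off : Fin 24 -> Bool
   off p = not (lk O p)
   oe : ∀ u v -> (∀ p -> off p ≡ true -> lk u p ≡ lk v p) -> outside O u ≡ outside O v
   oe u v e = loex \ p -> tr (VP.lookup-zipWith _ p O u) (tr (each (lk O p) (e p)) (sy (VP.lookup-zipWith _ p O v)))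
    where
    each : ∀ o {a b} -> (not o ≡ true -> a ≡ b) -> a ∧ not o ≡ b ∧ not o
    each true {a} {b} _ = tr (BP.∧-zeroʳ a) (sy (BP.∧-zeroʳ b))
    each false f = cg (_∧ true) (f refl)
   opaque
    -- If no such word existed, some codeword would agree with the pair outside the octad and have
    -- at most two points there, against `sha`.
    seof : ∀ p q -> p ≢ q -> off p ≡ true -> off q ≡ true -> ∃ \ u -> (C u × (∀ r -> off r ≡ false -> lk u r ≡ false)) × lk u p ≢ lk u q
    seof p q p≢q offp offq with Subspace.decide (Agreeing.subs off) (pair p q)
    ... | no t∉ with Agreeing.functional off (pair p q) t∉
    ...   | w , w∈ , va , hit = w , (w∈ , va) , x≢ _ _ (tr (sy (∙p w p q)) hit)
    seof p q p≢q offp offq | yes (d , d∈ , e) = cx (NP.≤-trans (NP.≤-reflexive (cg wei (oe d (pair p q) e))) (NP.≤-trans (weight-outside-≤ O (pair p q)) (wepa p q)))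
     (sha d d∈ (\ d≡ -> cx (tr (sy dap) (tr (cg (\ w -> lk w p) d≡) (VP.lookup-replicate p false))) \ ())
      (\ d≡ -> cx (tr (sy offp) (cg not (tr (cg (\ w -> lk w p) (sy d≡)) dap))) \ ()))
     where
     dap : lk d p ≡ true
     dap = tr (e p offp) (paat p q p≢q)
    -- Otherwise there would be a codeword inside the octad that separates two of its points, hence
    -- neither zero nor the octad.
    pawo : ∀ p q -> p ≢ q -> lk O p ≡ true -> lk O q ≡ true -> ∃ \ d -> C d × (∀ r -> lk O r ≡ true -> lk d r ≡ lk (pair p q) r)
    pawo p q p≢q Op Oq with Subspace.decide (Agreeing.subs (lk O)) (pair p q)
    ... | yes found = found
    ... | no t∉ with Agreeing.functional (lk O) (pair p q) t∉
    ...   | w , w∈ , va , hit = cx (NP.≤-trans (NP.≤-reflexive (tr (cg wei (oe w 𝟘 zo)) refl)) (NP.≤-trans (weight-outside-≤ O 𝟘) (NP.≤-trans (NP.≤-reflexive (w𝟘 24)) z≤n)))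
     (sha w w∈ (differs w 𝟘 p q wdi (tr (VP.lookup-replicate p false) (sy (VP.lookup-replicate q false)))) (differs w O p q wdi (tr Op (sy Oq))))
     where
     wdi : lk w p ≢ lk w q
     wdi = x≢ _ _ (tr (sy (∙p w p q)) hit)
     zo : ∀ r -> off r ≡ true -> lk w r ≡ lk 𝟘 r
     zo r offr = tr (va r (notr (lk O r) offr)) (sy (VP.lookup-replicate r false))
      where
      notr : ∀ b -> not b ≡ true -> b ≡ false
      notr false _ = refl
   K : Word 24 -> Set
   K u = C u × (∀ r -> off r ≡ false -> lk u r ≡ false)
   opaque
    unfolding _+_ _*_ -_
    bn : ∀ b -> bit (not b) ≡ 1ℤ + (- 1ℤ) * bit b
    bn true = refl
    bn false = refl
    si : + 24 + (- 1ℤ) * + 8 ≡ + 16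
    si = refl
    b8 : + 16 + (- + 2) * + 8 ≡ 0ℤ
    b8 = refl
   opaque
    unfolding sum
    c2 : sum 24 (\ _ -> 1ℤ) ≡ + 24
    c2 = refl
   opaque
    m1 : mass off ≡ + 16
    m1 = tr (Sc \ p -> bn (lk O p)) (tr (Σ-+ 24 _ _) (tr (cg2 _+_ c2 (tr (Σ* 24 (- 1ℤ) _) (mc (tr (wesu O) (cg +_ O-weight))))) si))
   -- Codewords disjoint from the octad have weight 0, 8 or 16. Weight 12 is impossible, since
   -- adding the octad and complementing would give weight 4.
   clof : BalancedClass off K
   clof = record
    { zi = zi , \ r _ -> VP.lookup-replicate r false
    ; plin = \ { {u} {v} (u∈ , u₀) (v∈ , v₀) -> plin u∈ v∈ , \ r o -> tr (lookup-⊞ u v r) (cg2 _xor_ (u₀ r o) (v₀ r o)) }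
    ; balanced = balanced ; sepa = seof }
    where
    oa : ∀ u -> (∀ r -> off r ≡ false -> lk u r ≡ false) -> outside O u ≡ u
    oa u va = loex \ p -> tr (VP.lookup-zipWith _ p O u) (each (lk O p) (lk u p) (va p))
     where
     each : ∀ o a -> (not o ≡ false -> a ≡ false) -> a ∧ not o ≡ a
     each true a f = tr (BP.∧-zeroʳ a) (sy (f refl))
     each false a f = BP.∧-identityʳ a
    balanced : ∀ {u} -> K u -> (∀ p q -> off p ≡ true -> off q ≡ true -> lk u p ≡ lk u q) ⊎ χ off u ≡ 0ℤ
    balanced {u} (u∈ , va) = bw (weights u∈)
     where
     rai : wei (u ⊞ O) ≡ 8 ℕ.+ wei u
     rai = NP.+-cancelˡ-≡ (wei u) _ _ (tr (w⊞o O u) (tr (cg2 (\ a b -> a ℕ.+ 2 ℕ.* wei b) O-weight (oa u va)) (rearrange (wei u))))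
      where
      rearrange : ∀ w -> 8 ℕ.+ 2 ℕ.* w ≡ w ℕ.+ (8 ℕ.+ w)
      rearrange = svN
     complement : ∀ w -> wei u ≡ w -> 8 ℕ.+ w ℕ.+ wei (u ⊞ O ⊞ 𝟙) ≡ 24
     complement w e = tr (cg (\ z -> z ℕ.+ wei (u ⊞ O ⊞ 𝟙)) (sy (tr rai (cg (8 ℕ.+_) e)))) (wc (u ⊞ O))
     bw : (Σ ℕ \ h -> wei u ≡ 4 ℕ.* h × h ≢ 1 × (h ≡ 0 -> u ≡ 𝟘)) -> _
     bw (0 , e , _ , z) = n1 \ p q _ _ -> tr (cg (\ w -> lk w p) (z refl)) (tr (VP.lookup-replicate p false) (sy (tr (cg (\ w -> lk w q) (z refl)) (VP.lookup-replicate q false))))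
     bw (1 , e , ne , _) = cx refl ne
     bw (2 , e , _ , _) = n2 (tr (χw off u va) (tr (cg2 (\ m w -> m + (- + 2) * + w) m1 e) b8))
     bw (3 , e , _ , _) with weights (plin (plin u∈ O∈) oi)
     ... | h , e′ , ne , _ = cx (NP.*-cancelˡ-≡ h 1 4 (tr (sy e′) (NP.+-cancelˡ-≡ 20 _ 4 (complement 12 e)))) ne
     bw (4 , e , _ , _) = n1 \ p q offp offq -> tr (on p offp) (sy (on q offq))
      where
      full : u ⊞ O ≡ 𝟙
      full = ⊞𝟙𝟘 (u ⊞ O) (NP.+-cancelˡ-≡ 24 _ 0 (complement 16 e)) (plin u∈ O∈)
      on : ∀ p -> off p ≡ true -> lk u p ≡ true
      on p offp = tr (tr (sy (BP.xor-identityʳ _)) (cg (lk u p xor_) (sy (notr (lk O p) offp)))) (tr (sy (lookup-⊞ u O p)) (tr (cg (\ w -> lk w p) full) (VP.lookup-replicate p true)))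
       where
       notr : ∀ b -> not b ≡ true -> b ≡ false
       notr false _ = refl
     bw (suc (suc (suc (suc (suc h)))) , e , _ , _) = cx (NP.≤-trans (NP.m≤m+n (8 ℕ.+ 4 ℕ.* (5 ℕ.+ h)) _) (NP.≤-reflexive (complement (4 ℕ.* (5 ℕ.+ h)) e)))
      (NP.<⇒≱ (NP.<-≤-trans {24} {28} (NP.≤ᵇ⇒≤ 25 28 _) (NP.+-monoʳ-≤ 8 (NP.*-monoʳ-≤ 4 {5} {5 ℕ.+ h} (NP.m≤m+n 5 h)))))
   opaque
    s≢ : ∀ k -> k ℕ.< 4 -> + 16 ≢ + (2 ℕ.^ k)
    s≢ 0 _ ()
    s≢ 1 _ ()
    s≢ 2 _ ()
    s≢ 3 _ ()
    s≢ (suc (suc (suc (suc k)))) (s≤s (s≤s (s≤s (s≤s ()))))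
   opaque
    axes : Σ (Vec (Word 24) 4) \ ws -> All K ws × Inde off ws
    axes = four off clof (\ e -> cx (tr (sy m1) e) \ ()) (\ k k< e -> s≢ k k< (tr (sy m1) e))
    point : Word 4 -> Fin 24
    point b = p1 (fipo off b (p1 axes) (p2 (p2 axes)) (\ e -> cx (tr (sy m1) e) \ ()))
    poispe : ∀ b -> Ins off b (p1 axes) (point b)
    poispe b = p2 (fipo off b (p1 axes) (p2 (p2 axes)) (\ e -> cx (tr (sy m1) e) \ ()))
   label : Fin 24 -> Word 4
   label p = map (\ w -> lk w p) (p1 axes)
   opaque
    unfolding point
    -- Sixteen points in sixteen equal cells: each cell is a single point, so the four words are
    -- affine coordinates on the complement of the octad.
    pola : ∀ p -> off p ≡ true -> point (label p) ≡ p
    pola p offp = amo off (label p) (p1 axes) (p2 (p2 axes)) m1 (point (label p)) p (poispe (label p)) (offp , own (p1 axes))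
     where
     own : ∀ {k} (ws : Vec (Word 24) k) -> InC off (map (\ w -> lk w p) ws) ws p
     own [] = _
     own (w ∷ ws) = refl , own ws

-- Tables for the uniqueness of the Golay code.

module GolayData where
 open Bits using (Word)
 open import Data.Fin using (Fin; #_)
 open import Data.Nat using (ℕ; zero; suc; _/_; _%_; _≡ᵇ_)
 open import Data.Vec using (Vec; []; _∷_; map)
 binary : ∀ n -> ℕ -> Word n
 binary zero N = []
 binary (suc n) N = (N % 2 ≡ᵇ 1) ∷ binary n (N / 2)
 -- Alternating forms on a binary space of dimension 4 with Pfaffian 1, six coefficients each. The
 -- 28 of them behave as the edges of the complete graph on 8 points: a sum of two has Pfaffian 1
 -- exactly when the edges meet. The rows are the 8 stars.
 sta : Vec (Vec (Word 6) 7) 8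
 sta = map (map (binary 6)) (
  (12 ∷ 26 ∷ 54 ∷ 57 ∷ 37 ∷ 43 ∷ 23 ∷ []) ∷
  (12 ∷ 58 ∷ 22 ∷ 41 ∷ 53 ∷ 27 ∷ 39 ∷ []) ∷
  (44 ∷ 26 ∷ 22 ∷ 49 ∷ 13 ∷ 35 ∷ 63 ∷ []) ∷
  (44 ∷ 58 ∷ 54 ∷ 33 ∷ 29 ∷ 19 ∷ 15 ∷ []) ∷
  (28 ∷ 18 ∷ 46 ∷ 57 ∷ 53 ∷ 35 ∷ 15 ∷ []) ∷
  (28 ∷ 50 ∷ 14 ∷ 41 ∷ 37 ∷ 19 ∷ 63 ∷ []) ∷
  (60 ∷ 18 ∷ 14 ∷ 49 ∷ 29 ∷ 43 ∷ 39 ∷ []) ∷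
  (60 ∷ 50 ∷ 46 ∷ 33 ∷ 13 ∷ 27 ∷ 23 ∷ []) ∷
  [])
 -- Row `s` permutes the coordinates so that the code built from star `s` becomes the one built from
 -- star 0; `coefficients` names the words that turn into the standard generators.
 rela : Vec (Vec (Fin 24) 24) 8
 rela =
  (# 0 ∷ # 1 ∷ # 2 ∷ # 3 ∷ # 4 ∷ # 5 ∷ # 6 ∷ # 7 ∷ # 8 ∷ # 9 ∷ # 10 ∷ # 11 ∷ # 12 ∷ # 13 ∷ # 14 ∷ # 15 ∷ # 16 ∷ # 17 ∷ # 18 ∷ # 19 ∷ # 20 ∷ # 21 ∷ # 22 ∷ # 23 ∷ []) ∷
  (# 0 ∷ # 1 ∷ # 6 ∷ # 3 ∷ # 4 ∷ # 7 ∷ # 2 ∷ # 5 ∷ # 8 ∷ # 17 ∷ # 12 ∷ # 21 ∷ # 10 ∷ # 19 ∷ # 14 ∷ # 23 ∷ # 9 ∷ # 16 ∷ # 13 ∷ # 20 ∷ # 11 ∷ # 18 ∷ # 15 ∷ # 22 ∷ []) ∷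
  (# 0 ∷ # 5 ∷ # 2 ∷ # 3 ∷ # 6 ∷ # 1 ∷ # 4 ∷ # 7 ∷ # 8 ∷ # 16 ∷ # 13 ∷ # 21 ∷ # 10 ∷ # 18 ∷ # 15 ∷ # 23 ∷ # 9 ∷ # 17 ∷ # 12 ∷ # 20 ∷ # 11 ∷ # 19 ∷ # 14 ∷ # 22 ∷ []) ∷
  (# 0 ∷ # 7 ∷ # 6 ∷ # 5 ∷ # 4 ∷ # 1 ∷ # 2 ∷ # 3 ∷ # 8 ∷ # 17 ∷ # 13 ∷ # 20 ∷ # 11 ∷ # 18 ∷ # 14 ∷ # 23 ∷ # 9 ∷ # 16 ∷ # 12 ∷ # 21 ∷ # 10 ∷ # 19 ∷ # 15 ∷ # 22 ∷ []) ∷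
  (# 0 ∷ # 7 ∷ # 2 ∷ # 1 ∷ # 6 ∷ # 3 ∷ # 4 ∷ # 5 ∷ # 8 ∷ # 16 ∷ # 13 ∷ # 21 ∷ # 11 ∷ # 19 ∷ # 14 ∷ # 22 ∷ # 9 ∷ # 17 ∷ # 12 ∷ # 20 ∷ # 10 ∷ # 18 ∷ # 15 ∷ # 23 ∷ []) ∷
  (# 0 ∷ # 3 ∷ # 6 ∷ # 1 ∷ # 4 ∷ # 5 ∷ # 2 ∷ # 7 ∷ # 8 ∷ # 17 ∷ # 12 ∷ # 21 ∷ # 11 ∷ # 18 ∷ # 15 ∷ # 22 ∷ # 9 ∷ # 16 ∷ # 13 ∷ # 20 ∷ # 10 ∷ # 19 ∷ # 14 ∷ # 23 ∷ []) ∷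
  (# 0 ∷ # 3 ∷ # 2 ∷ # 5 ∷ # 6 ∷ # 7 ∷ # 4 ∷ # 1 ∷ # 8 ∷ # 16 ∷ # 12 ∷ # 20 ∷ # 11 ∷ # 19 ∷ # 15 ∷ # 23 ∷ # 9 ∷ # 17 ∷ # 13 ∷ # 21 ∷ # 10 ∷ # 18 ∷ # 14 ∷ # 22 ∷ []) ∷
  (# 0 ∷ # 5 ∷ # 6 ∷ # 7 ∷ # 4 ∷ # 3 ∷ # 2 ∷ # 1 ∷ # 8 ∷ # 17 ∷ # 13 ∷ # 20 ∷ # 10 ∷ # 19 ∷ # 15 ∷ # 22 ∷ # 9 ∷ # 16 ∷ # 12 ∷ # 21 ∷ # 11 ∷ # 18 ∷ # 14 ∷ # 23 ∷ []) ∷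
  []
 coefficients : Vec (Vec (Word 12) 12) 8
 coefficients = map (map (binary 12)) (
  (1 ∷ 2 ∷ 4 ∷ 8 ∷ 16 ∷ 32 ∷ 64 ∷ 128 ∷ 256 ∷ 512 ∷ 1024 ∷ 2048 ∷ []) ∷
  (9 ∷ 4 ∷ 2 ∷ 1 ∷ 16 ∷ 33 ∷ 1024 ∷ 129 ∷ 256 ∷ 2049 ∷ 64 ∷ 513 ∷ []) ∷
  (10 ∷ 4 ∷ 2 ∷ 1 ∷ 16 ∷ 512 ∷ 66 ∷ 130 ∷ 1024 ∷ 32 ∷ 258 ∷ 2050 ∷ []) ∷
  (15 ∷ 4 ∷ 2 ∷ 1 ∷ 16 ∷ 2049 ∷ 1026 ∷ 515 ∷ 260 ∷ 37 ∷ 70 ∷ 135 ∷ []) ∷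
  (14 ∷ 4 ∷ 2 ∷ 1 ∷ 16 ∷ 2048 ∷ 66 ∷ 34 ∷ 1028 ∷ 132 ∷ 262 ∷ 518 ∷ []) ∷
  (13 ∷ 4 ∷ 2 ∷ 1 ∷ 16 ∷ 129 ∷ 1024 ∷ 33 ∷ 260 ∷ 517 ∷ 68 ∷ 2053 ∷ []) ∷
  (12 ∷ 4 ∷ 2 ∷ 1 ∷ 16 ∷ 128 ∷ 64 ∷ 512 ∷ 1028 ∷ 2052 ∷ 260 ∷ 36 ∷ []) ∷
  (11 ∷ 4 ∷ 2 ∷ 1 ∷ 16 ∷ 513 ∷ 1026 ∷ 2051 ∷ 256 ∷ 129 ∷ 66 ∷ 35 ∷ []) ∷
  [])

-- Bent functions of four variables and cliques of alternating forms.

module Golay where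
 open Bits
 open Code using (lookup-⊞)
 open Balanced using (Ins; InC)
 open Octad
 open GolayData
 open import Data.Nat as ℕ using (ℕ; zero; suc; z≤n; s≤s; _≤ᵇ_)
 open import Data.Bool using (Bool; true; false; _xor_; _∧_; _∨_; not; T; if_then_else_)
 open import Data.Fin using (Fin; zero; suc; punchOut; #_)
 open import Data.Vec using (Vec; []; _∷_; _++_; lookup; replicate; map)
 open import Data.Vec.Relation.Unary.All using (All; []; _∷_)
 import Data.Vec.Relation.Unary.All as All
 private variable n m : ℕ
 inje : ∀ {m} (f : Fin m -> Fin m) -> (∀ {i j} -> f i ≡ f j -> i ≡ j) -> ∀ k -> ∃ \ i -> f i ≡ k
 inje {suc m} f inj k with FP.any? (\ i -> f i FP.≟ k)
 ... | yes found = found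
 ... | no none with FP.pigeonhole (NP.n<1+n m) (\ i -> punchOut {i = k} {j = f i} (\ e -> none (i , sy e)))
 ...   | i , j , i<j , e = cx (inj (FP.punchOut-injective {i = k} (\ e -> none (i , sy e)) (\ e -> none (j , sy e)) e)) (FP.<⇒≢ i<j)
 sur : ∀ {m} (f : Fin m -> Fin m) -> (∀ k -> ∃ \ i -> f i ≡ k) -> ∀ {i j} -> f i ≡ f j -> i ≡ j
 sur f surj {i} {j} e with inje g g-inj i | inje g g-inj j
  where
  g = \ k -> p1 (surj k)
  g-inj : ∀ {k l} -> g k ≡ g l -> k ≡ l
  g-inj {k} {l} e = tr (sy (p2 (surj k))) (tr (cg f e) (p2 (surj l)))
 ... | p , refl | q , refl = cg (\ k -> p1 (surj k)) (tr (sy (p2 (surj p))) (tr e (p2 (surj q))))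
 positions : (u : Word n) -> Vec (Fin n) (wei u)
 positions [] = []
 positions (true ∷ u) = zero ∷ map suc (positions u)
 positions (false ∷ u) = map suc (positions u)
 potr : (u : Word n) (i : Fin (wei u)) -> lk u (lk (positions u) i) ≡ true
 potr (true ∷ u) zero = refl
 potr (true ∷ u) (suc i) = tr (cg (lk (true ∷ u)) (VP.lookup-map i suc (positions u))) (potr u i)
 potr (false ∷ u) i = tr (cg (lk (false ∷ u)) (VP.lookup-map i suc (positions u))) (potr u i)
 poin : (u : Word n) (i j : Fin (wei u)) -> lk (positions u) i ≡ lk (positions u) j -> i ≡ j
 poin (true ∷ u) zero zero _ = refl
 poin (true ∷ u) zero (suc j) e = cx (tr e (VP.lookup-map j suc (positions u))) \ ()
 poin (true ∷ u) (suc i) zero e = cx (tr (sy e) (VP.lookup-map i suc (positions u))) \ ()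
 poin (true ∷ u) (suc i) (suc j) e = cg suc (poin u i j (FP.suc-injective (tr (sy (VP.lookup-map i suc (positions u))) (tr e (VP.lookup-map j suc (positions u))))))
 poin (false ∷ u) i j e = poin u i j (FP.suc-injective (tr (sy (VP.lookup-map i suc (positions u))) (tr e (VP.lookup-map j suc (positions u)))))
 pc : (u : Word n) (p : Fin n) -> lk u p ≡ true -> ∃ \ i -> lk (positions u) i ≡ p
 pc (true ∷ u) zero _ = zero , refl
 pc (true ∷ u) (suc p) e with pc u p e
 ... | i , e′ = suc i , tr (VP.lookup-map i suc (positions u)) (cg suc e′)
 pc (false ∷ u) (suc p) e with pc u p e
 ... | i , e′ = i , tr (VP.lookup-map i suc (positions u)) (cg suc e′)
 wm : (u v : Word n) -> (∀ i -> lk u i ≡ true -> lk v i ≡ true) -> wei u ℕ.≤ wei v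
 wm [] [] f = z≤n
 wm (true ∷ u) (b ∷ v) f with f zero refl
 wm (true ∷ u) (.true ∷ v) f | refl = s≤s (wm u v (\ i -> f (suc i)))
 wm (false ∷ u) (true ∷ v) f = NP.≤-trans (wm u v (\ i -> f (suc i))) (NP.n≤1+n _)
 wm (false ∷ u) (false ∷ v) f = wm u v (\ i -> f (suc i))
 cowe : (φ : Vec (Fin n) m) (d : Word n) -> (∀ p -> lk d p ≡ true -> ∃ \ i -> lk φ i ≡ p) -> wei d ℕ.≤ wei (map (lk d) φ)
 cowe {n} [] d cov = NP.≤-trans (wm d 𝟘 (\ i e -> cx (p1 (cov i e)) \ ())) (NP.≤-reflexive (w𝟘 n))
 cowe (q ∷ φ) d cov with lk d q in dq
 ... | false = cowe φ d \ p e -> tail p e (cov p e)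
  where
  tail : ∀ p -> lk d p ≡ true -> (∃ \ i -> lk (q ∷ φ) i ≡ p) -> ∃ \ i -> lk φ i ≡ p
  tail p e (zero , refl) = cx (tr (sy dq) e) \ ()
  tail p e (suc i , e′) = i , e′
 ... | true = NP.≤-trans dron (s≤s (NP.≤-trans (cowe φ d′ (\ p e -> tail p e (cov p (smaller p e)))) (wm (map (lk d′) φ) (map (lk d) φ) \ i e -> tr (VP.lookup-map i (lk d) φ) (smaller _ (tr (sy (VP.lookup-map i (lk d′) φ)) e)))))
  where
  d′ = d ⊞ unit q
  dron : wei d ℕ.≤ suc (wei d′)
  dron = NP.≤-trans (NP.≤-reflexive (cg wei (sy (tr (cg (_⊞ unit q) (⊞c d (unit q))) (tr (⊞c _ (unit q)) (⊞ca (unit q) d))))))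
   (NP.≤-trans (weight-⊞-≤ d′ (unit q)) (NP.≤-reflexive (tr (cg (wei d′ ℕ.+_) (wu q)) (NP.+-comm _ 1))))
  oq : lk d′ q ≡ false
  oq = tr (lookup-⊞ d (unit q) q) (cg2 _xor_ dq (lu q))
  smaller : ∀ p -> lk d′ p ≡ true -> lk d p ≡ true
  smaller p e with q FP.≟ p
  ... | yes refl = dq
  ... | no ne = tr (sy (tr (lookup-⊞ d (unit q) p) (tr (cg (lk d p xor_) (lu≢ q p ne)) (BP.xor-identityʳ _)))) e
  tail : ∀ p -> lk d′ p ≡ true -> (∃ \ i -> lk (q ∷ φ) i ≡ p) -> ∃ \ i -> lk φ i ≡ p
  tail p e (zero , refl) = cx (tr (sy oq) e) \ ()
  tail p e (suc i , e′) = i , e′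
 ∧t : ∀ {a b} -> a ∧ b ≡ true -> a ≡ true × b ≡ true
 ∧t {true} {true} _ = refl , refl
 opaque
  aw : ∀ n -> (Word n -> Bool) -> Bool
  aw zero p = p []
  aw (suc n) p = aw n (\ u -> p (true ∷ u)) ∧ aw n (\ u -> p (false ∷ u))
  aws : ∀ n p -> aw n p ≡ true -> ∀ u -> p u ≡ true
  aws zero p e [] = e
  aws (suc n) p e (true ∷ u) = aws n _ (p1 (∧t e)) u
  aws (suc n) p e (false ∷ u) = aws n _ (p2 (∧t {aw n (\ u -> p (true ∷ u))} e)) u
  awc : ∀ n (p : Word n -> Bool) -> (∀ u -> p u ≡ true) -> aw n p ≡ true
  awc zero p f = f []
  awc (suc n) p f = cg2 _∧_ (awc n _ (\ u -> f (true ∷ u))) (awc n _ (\ u -> f (false ∷ u)))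
 points : Vec (Word 4) 16
 points = words 4
  where
  words : ∀ n -> Vec (Word n) (2 ℕ.^ n)
  words zero = [] ∷ []
  words (suc n) = sb (\ k -> Vec (Word (suc n)) (2 ℕ.^ n ℕ.+ k)) (sy (NP.+-identityʳ _)) (map (false ∷_) (words n) ++ map (true ∷_) (words n))
 axis : Fin 4 -> Word 16
 axis k = map (\ b -> lk b k) points
 _≡ʷ_ : Word n -> Word n -> Bool
 u ≡ʷ v = does (u ≟ʷ v)
 ≡s : (u v : Word n) -> u ≡ʷ v ≡ true -> u ≡ v
 ≡s u v e with u ≟ʷ v
 ... | yes eq = eq
 sca : Bool -> Word n -> Word n
 sca b u = if b then u else 𝟘
 axis₀ axis₁ axi ax : Word 16
 axis₀ = false ∷ false ∷ false ∷ false ∷ false ∷ false ∷ false ∷ false ∷ true ∷ true ∷ true ∷ true ∷ true ∷ true ∷ true ∷ true ∷ []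
 axis₁ = false ∷ false ∷ false ∷ false ∷ true ∷ true ∷ true ∷ true ∷ false ∷ false ∷ false ∷ false ∷ true ∷ true ∷ true ∷ true ∷ []
 axi = false ∷ false ∷ true ∷ true ∷ false ∷ false ∷ true ∷ true ∷ false ∷ false ∷ true ∷ true ∷ false ∷ false ∷ true ∷ true ∷ []
 ax = false ∷ true ∷ false ∷ true ∷ false ∷ true ∷ false ∷ true ∷ false ∷ true ∷ false ∷ true ∷ false ∷ true ∷ false ∷ true ∷ []
 af : Word 5 -> Word 16
 af (c ∷ c₀ ∷ c₁ ∷ c₂ ∷ c₃ ∷ []) = sca c (replicate 16 true) ⊞ (sca c₀ axis₀ ⊞ (sca c₁ axis₁ ⊞ (sca c₂ axi ⊞ sca c₃ ax)))
 -- Six is what minimum weight 8 leaves outside the octad for a word with two points inside; adding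
 -- any affine function keeps it in the code.
 Bent : Word 16 -> Set
 Bent f = ∀ a -> 6 ℕ.≤ wei (f ⊞ af a)
 ben : Word 16 -> Bool
 ben f = aw 5 (\ a -> 6 ≤ᵇ wei (f ⊞ af a))
 beco : ∀ f -> Bent f -> ben f ≡ true
 beco f bent = awc 5 (\ a -> 6 ≤ᵇ wei (f ⊞ af a)) (\ a -> T⇒ (NP.≤⇒≤ᵇ (bent a)))
  where
  T⇒ : ∀ {b} -> T b -> b ≡ true
  T⇒ {true} _ = refl
 qu : Word 6 -> Word 16
 qu (a ∷ b ∷ c ∷ d ∷ e ∷ f ∷ []) = map value points
  where
  value : Word 4 -> Bool
  value (x ∷ y ∷ z ∷ w ∷ []) = (a ∧ (x ∧ y)) xor ((b ∧ (x ∧ z)) xor ((c ∧ (x ∧ w)) xor ((d ∧ (y ∧ z)) xor ((e ∧ (y ∧ w)) xor (f ∧ (z ∧ w))))))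
 -- The Pfaffian of the polar form of the quadratic form `qu`.
 pfa : Word 6 -> Bool
 pfa (a ∷ b ∷ c ∷ d ∷ e ∷ f ∷ []) = (a ∧ f) xor ((b ∧ e) xor (c ∧ d))
 coof : Word 16 -> Word 6
 coof f = lk f (# 12) ∷ lk f (# 10) ∷ lk f (# 9) ∷ lk f (# 6) ∷ lk f (# 5) ∷ lk f (# 3) ∷ []
 coefficients-⊞ : ∀ f g -> coof (f ⊞ g) ≡ coof f ⊞ coof g
 coefficients-⊞ f g = cong₆ (lookup-⊞ f g (# 12)) (lookup-⊞ f g (# 10)) (lookup-⊞ f g (# 9)) (lookup-⊞ f g (# 6)) (lookup-⊞ f g (# 5)) (lookup-⊞ f g (# 3))
  where
  cong₆ : ∀ {a a′ b b′ c c′ d d′ e e′ h h′ : Bool} -> a ≡ a′ -> b ≡ b′ -> c ≡ c′ -> d ≡ d′ -> e ≡ e′ -> h ≡ h′ -> (a ∷ b ∷ c ∷ d ∷ e ∷ h ∷ []) ≡ (a′ ∷ b′ ∷ c′ ∷ d′ ∷ e′ ∷ h′ ∷ [])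
  cong₆ refl refl refl refl refl refl = refl
 -- Vanishing at the origin and at the four unit vectors removes the affine part; eleven free values
 -- remain.
 Normal : Word 16 -> Set
 Normal f = lk f (# 0) ≡ false × lk f (# 1) ≡ false × lk f (# 2) ≡ false × lk f (# 4) ≡ false × lk f (# 8) ≡ false
 normal-⊞ : ∀ {f g} -> Normal f -> Normal g -> Normal (f ⊞ g)
 normal-⊞ {f} {g} (a , b , c , d , e) (a′ , b′ , c′ , d′ , e′) = both (# 0) a a′ , both (# 1) b b′ , both (# 2) c c′ , both (# 4) d d′ , both (# 8) e e′
  where
  both : ∀ i -> lk f i ≡ false -> lk g i ≡ false -> lk (f ⊞ g) i ≡ false
  both i x y = tr (lookup-⊞ f g i) (cg2 _xor_ x y)
 wid : Word 11 -> Word 16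
 wid (a ∷ b ∷ c ∷ d ∷ e ∷ f ∷ g ∷ h ∷ i ∷ j ∷ k ∷ []) = false ∷ false ∷ false ∷ a ∷ false ∷ b ∷ c ∷ d ∷ false ∷ e ∷ f ∷ g ∷ h ∷ i ∷ j ∷ k ∷ []
 nw : ∀ f -> Normal f -> ∃ \ u -> f ≡ wid u
 nw (_ ∷ _ ∷ _ ∷ a ∷ _ ∷ b ∷ c ∷ d ∷ _ ∷ e ∷ f ∷ g ∷ h ∷ i ∷ j ∷ k ∷ []) (refl , refl , refl , refl , refl) = (a ∷ b ∷ c ∷ d ∷ e ∷ f ∷ g ∷ h ∷ i ∷ j ∷ k ∷ []) , refl
 implies : Bool -> Bool -> Bool
 implies a b = not a ∨ b
 modu : ∀ {a b} -> implies a b ≡ true -> a ≡ true -> b ≡ true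
 modu {true} {true} _ _ = refl
 opaque
  unfolding aw
  -- Exhaustion over the 2^11 normalised functions: each bent one is quadratic with nonsingular
  -- polar form.
  bqc : aw 11 (\ u -> implies (ben (wid u)) (pfa (coof (wid u)) ∧ (wid u ≡ʷ qu (coof (wid u))))) ≡ true
  bqc = refl
 bq : ∀ f -> Normal f -> Bent f -> pfa (coof f) ≡ true × f ≡ qu (coof f)
 bq f normal bent with nw f normal
 ... | u , refl with ∧t (modu (aws 11 _ bqc u) (beco (wid u) bent))
 ...   | p , q = p , ≡s (wid u) (qu (coof (wid u))) q
 index-of : Word 6 -> ∀ {k} -> Vec (Word 6) k -> Bool
 index-of a [] = false
 index-of a (b ∷ bs) = (a ≡ʷ b) ∨ index-of a bs
 ios : ∀ a {k} (bs : Vec (Word 6) k) -> index-of a bs ≡ true -> ∃ \ i -> a ≡ lk bs i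
 ios a (b ∷ bs) e with a ≟ʷ b
 ... | yes refl = zero , refl
 ... | no _ with ios a bs e
 ...   | i , e′ = suc i , e′
 st : Word 6 -> Word 6 -> ∀ {k} -> Vec (Vec (Word 6) 7) (suc k) -> Fin (suc k)
 st a b (s ∷ []) = zero
 st a b (s ∷ t ∷ ss) = if index-of a s ∧ index-of b s then zero else suc (st a b (t ∷ ss))
 star : Word 6 -> Word 6 -> Vec (Word 6) 7
 star a b = lk sta (st a b sta)
 opaque
  unfolding aw
  stch : aw 6 (\ a -> implies (pfa a) (aw 6 \ b -> implies (pfa b) (implies (pfa (a ⊞ b)) (index-of a (star a b) ∧ index-of b (star a b))))) ≡ true
  stch = refl
  -- In the edge picture three pairwise meeting edges outside a star form a triangle, and no fourth
  -- edge meets all three. So a clique of at least four forms lies in the star of any two of its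
  -- members.
  stache : aw 6 (\ a -> implies (pfa a) (aw 6 \ b -> implies (pfa b) (implies (pfa (a ⊞ b)) (aw 6 \ c -> implies (pfa c) (implies (pfa (a ⊞ c)) (implies (pfa (b ⊞ c))
   (index-of c (star a b) ∨ aw 6 \ d -> implies (pfa d) (implies (pfa (a ⊞ d)) (implies (pfa (b ⊞ d)) (not (pfa (c ⊞ d)))))))))))) ≡ true
  stache = refl
 orfa : ∀ {a b} -> a ∨ b ≡ true -> a ≡ false -> b ≡ true
 orfa {false} e _ = e
 comb : ∀ {k} -> Word k -> (Fin k -> Word 24) -> Word 24
 comb [] g = 𝟘
 comb (b ∷ bs) g = sca b (g zero) ⊞ comb bs (\ i -> g (suc i))
 comin : ∀ {P : Word 24 -> Set} -> P 𝟘 -> (∀ {u v} -> P u -> P v -> P (u ⊞ v)) -> ∀ {k} (bs : Word k) (g : Fin k -> Word 24) -> (∀ i -> P (g i)) -> P (comb bs g)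
 comin z p [] g g∈ = z
 comin {P} z p (true ∷ bs) g g∈ = p {g zero} {comb bs (\ i -> g (suc i))} (g∈ zero) (comin {P} z p bs (\ i -> g (suc i)) (\ i -> g∈ (suc i)))
 comin {P} z p (false ∷ bs) g g∈ = sb P (sy (⊞i (comb bs (\ i -> g (suc i))))) (comin {P} z p bs (\ i -> g (suc i)) (\ i -> g∈ (suc i)))

-- Uniqueness of the Golay code.

module GolayUnique where
 open Bits
 open Code using (lookup-⊞)
 open Balanced using (Ins; InC)
 open Octad
 open GolayData
 open Golay
 open import Data.Nat as ℕ using (ℕ; zero; suc)
 open import Data.Bool using (Bool; true; false; _xor_; _∧_; _∨_; not)
 import Data.Fin
 open import Data.Fin using (Fin; zero; suc; #_; _↑ˡ_; _↑ʳ_)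
 open import Data.Vec using (Vec; []; _∷_; _++_; lookup; replicate; map; allFin)
 open import Data.Vec.Relation.Unary.All using (All; []; _∷_)
 private variable n m : ℕ
 onoc oo : Word 24
 onoc = replicate 8 true ++ replicate 16 false
 oo = replicate 8 false ++ replicate 16 true
 cowo : Fin 4 -> Word 24
 cowo k = replicate 8 false ++ axis k
 opaque
  ph : Fin 7 -> Word 8
  ph j = pair zero (suc j)
  phd : ∀ j -> ph j ≡ pair zero (suc j)
  phd j = refl
 -- Octad coordinates come first. The first five words span the affine functions on the complement;
 -- the other seven join a pair of octad points to a quadratic form of the star.
 generator : Vec (Word 6) 7 -> Fin 12 -> Word 24
 generator s zero = cowo (# 0)
 generator s (suc zero) = cowo (# 1)
 generator s (suc (suc zero)) = cowo (# 2)
 generator s (suc (suc (suc zero))) = cowo (# 3)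
 generator s (suc (suc (suc (suc zero)))) = oo
 generator s (suc (suc (suc (suc (suc j))))) = ph j ++ qu (lk s j)
 w+ : (u : Word m) (v : Word n) -> wei (u ++ v) ≡ wei u ℕ.+ wei v
 w+ [] v = refl
 w+ (true ∷ u) v = cg suc (w+ u v)
 w+ (false ∷ u) v = w+ u v
 ⊞+ : (u u′ : Word m) (v v′ : Word n) -> (u ++ v) ⊞ (u′ ++ v′) ≡ (u ⊞ u′) ++ (v ⊞ v′)
 ⊞+ [] [] v v′ = refl
 ⊞+ (a ∷ u) (b ∷ u′) v v′ = cg (_ ∷_) (⊞+ u u′ v v′)
 maex : ∀ {A B : Set} {k} (f g : A -> B) (xs : Vec A k) -> (∀ i -> f (lk xs i) ≡ g (lk xs i)) -> map f xs ≡ map g xs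
 maex f g [] e = refl
 maex f g (x ∷ xs) e = cg2 _∷_ (e zero) (maex f g xs (\ i -> e (suc i)))
 map-const : ∀ {A : Set} {k} (f : A -> Bool) b (xs : Vec A k) -> (∀ i -> f (lk xs i) ≡ b) -> map f xs ≡ replicate k b
 map-const f b [] e = refl
 map-const f b (x ∷ xs) e = cg2 _∷_ (e zero) (map-const f b xs (\ i -> e (suc i)))
 il : ∀ {k} (g : Fin 24 -> Bool) (b : Vec Bool k) (ws : Vec (Word 24) k) p -> InC g b ws p -> ∀ i -> lk (lk ws i) p ≡ lk b i
 il g (b ∷ bs) (w ∷ ws) p (e , r) zero = sy e
 il g (b ∷ bs) (w ∷ ws) p (e , r) (suc i) = il g bs ws p r i
 allloo : ∀ {A : Set} {P : A -> Set} {k} {xs : Vec A k} -> All P xs -> ∀ i -> P (lk xs i)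
 allloo (p ∷ ps) zero = p
 allloo (p ∷ ps) (suc i) = allloo ps i
 opaque
  alpo : ∀ b -> ∃ \ i -> lk points i ≡ b
  alpo (false ∷ false ∷ false ∷ false ∷ []) = # 0 , refl
  alpo (false ∷ false ∷ false ∷ true ∷ []) = # 1 , refl
  alpo (false ∷ false ∷ true ∷ false ∷ []) = # 2 , refl
  alpo (false ∷ false ∷ true ∷ true ∷ []) = # 3 , refl
  alpo (false ∷ true ∷ false ∷ false ∷ []) = # 4 , refl
  alpo (false ∷ true ∷ false ∷ true ∷ []) = # 5 , refl
  alpo (false ∷ true ∷ true ∷ false ∷ []) = # 6 , refl
  alpo (false ∷ true ∷ true ∷ true ∷ []) = # 7 , refl
  alpo (true ∷ false ∷ false ∷ false ∷ []) = # 8 , refl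
  alpo (true ∷ false ∷ false ∷ true ∷ []) = # 9 , refl
  alpo (true ∷ false ∷ true ∷ false ∷ []) = # 10 , refl
  alpo (true ∷ false ∷ true ∷ true ∷ []) = # 11 , refl
  alpo (true ∷ true ∷ false ∷ false ∷ []) = # 12 , refl
  alpo (true ∷ true ∷ false ∷ true ∷ []) = # 13 , refl
  alpo (true ∷ true ∷ true ∷ false ∷ []) = # 14 , refl
  alpo (true ∷ true ∷ true ∷ true ∷ []) = # 15 , refl
 record Labelled (R : Word 24 -> Set) : Set where
  field
   plin : ∀ {u v} -> R u -> R v -> R (u ⊞ v)
   he : ∀ {u} -> R u -> u ≢ 𝟘 -> 8 ℕ.≤ wei u
   ai : ∀ k -> R (cowo k)
   ofin : R oo
   pain : ∀ j -> ∃ \ f -> R (ph j ++ f)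
 module FromOctad {C : Word 24 -> Set} (Cp : ∀ {u v} -> C u -> C v -> C (u ⊞ v)) (Con : C (replicate 24 true)) (C-heavy : ∀ {u} -> C u -> u ≢ 𝟘 -> 8 ℕ.≤ wei u)
  (O : Word 24) (O∈ : C O) (ei : Vec (Fin 24) 8) (eight-true : ∀ i -> lk O (lk ei i) ≡ true)
  (eight-injective : ∀ i j -> lk ei i ≡ lk ei j -> i ≡ j) (eight-cover : ∀ p -> lk O p ≡ true -> ∃ \ i -> lk ei i ≡ p)
  (point : Word 4 -> Fin 24) (off-point : ∀ b -> not (lk O (point b)) ≡ true) (label : Fin 24 -> Word 4) (pola : ∀ p -> not (lk O p) ≡ true -> point (label p) ≡ p)
  (ws : Vec (Word 24) 4) (ws∈ : ∀ k -> C (lk ws k) × (∀ r -> not (lk O r) ≡ false -> lk (lk ws k) r ≡ false)) (ws-point : ∀ b k -> lk (lk ws k) (point b) ≡ lk b k)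
  (pawo : ∀ p q -> p ≢ q -> lk O p ≡ true -> lk O q ≡ true -> ∃ \ d -> C d × (∀ r -> lk O r ≡ true -> lk d r ≡ lk (pair p q) r)) where
  table : Vec (Fin 24) 24
  table = ei ++ map point points
  tc : ∀ p -> ∃ \ i -> lk table i ≡ p
  tc p = bysi (lk O p) refl
   where
   bysi : ∀ b -> lk O p ≡ b -> ∃ \ i -> lk table i ≡ p
   bysi true e with eight-cover p e
   ... | i , e′ = i ↑ˡ 16 , tr (VP.lookup-++ˡ ei (map point points) i) e′
   bysi false e with alpo (label p)
   ... | i , e′ = 8 ↑ʳ i , tr (VP.lookup-++ʳ ei (map point points) i) (tr (VP.lookup-map i point points) (tr (cg point e′) (pola p (cg not e))))
  relabel : Word 24 -> Word 24
  relabel d = map (lk d) table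
  R : Word 24 -> Set
  R u = ∃ \ d -> C d × relabel d ≡ u
  r+ : ∀ d -> relabel d ≡ map (lk d) ei ++ map (\ b -> lk d (point b)) points
  r+ d = tr (VP.map-++ (lk d) ei (map point points)) (cg (map (lk d) ei ++_) (sy (VP.map-∘ (lk d) point points)))
  lab : Labelled R
  lab = record { plin = plus ; he = he ; ai = ai ; ofin = ofin ; pain = pain }
   where
   plus : ∀ {u v} -> R u -> R v -> R (u ⊞ v)
   plus (d , d∈ , refl) (d′ , d′∈ , refl) = d ⊞ d′ , Cp d∈ d′∈ , loex \ i -> tr (VP.lookup-map i (lk (d ⊞ d′)) table) (tr (lookup-⊞ d d′ (lk table i)) (sy (tr (lookup-⊞ (relabel d) (relabel d′) i) (cg2 _xor_ (VP.lookup-map i (lk d) table) (VP.lookup-map i (lk d′) table)))))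
   he : ∀ {u} -> R u -> u ≢ 𝟘 -> 8 ℕ.≤ wei u
   he (d , d∈ , refl) u≢0 = NP.≤-trans (C-heavy d∈ (\ e -> u≢0 (tr (cg relabel e) (map-const (lk 𝟘) false table (\ i -> VP.lookup-replicate (lk table i) false))))) (cowe table d (\ p _ -> tc p))
   ai : ∀ k -> R (cowo k)
   ai k = w , p1 (ws∈ k) , tr (r+ w) (cg2 _++_ (map-const (lk w) false ei (\ i -> p2 (ws∈ k) (lk ei i) (cg not (eight-true i))))
     (maex (\ b -> lk w (point b)) (\ b -> lk b k) points (\ i -> ws-point (lk points i) k)))
    where
    w : Word 24
    w = lk ws k
   ofin : R oo
   ofin = O ⊞ replicate 24 true , Cp (O∈) Con , tr (r+ (O ⊞ replicate 24 true)) (cg2 _++_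
     (map-const (lk (O ⊞ replicate 24 true)) false ei (\ i -> tr (flipped (lk ei i)) (cg not (eight-true i))))
     (map-const (\ b -> lk (O ⊞ replicate 24 true) (point b)) true points (\ i -> tr (flipped (point (lk points i))) (off-point (lk points i)))))
    where
    flipped : ∀ p -> lk (O ⊞ replicate 24 true) p ≡ not (lk O p)
    flipped p = tr (lookup-⊞ O (replicate 24 true) p) (tr (cg (lk O p xor_) (VP.lookup-replicate p true)) (tr (BP.xor-comm (lk O p) true) refl))
   pain : ∀ j -> ∃ \ f -> R (ph j ++ f)
   pain j = from (pawo (lk ei zero) (lk ei (suc j)) (\ e -> cx (eight-injective zero (suc j) e) \ ()) (eight-true zero) (eight-true (suc j)))
    where
    from : (∃ \ d -> C d × (∀ r -> lk O r ≡ true -> lk d r ≡ lk (pair (lk ei zero) (lk ei (suc j))) r)) -> ∃ \ f -> R (ph j ++ f)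
    from (d , d∈ , on) = map (\ b -> lk d (point b)) points , d , d∈ , tr (r+ d) (cg (_++ map (\ b -> lk d (point b)) points) (loex {u = map (lk d) ei} {v = ph j} \ i ->
      tr (VP.lookup-map i (lk d) ei) (tr (on (lk ei i) (eight-true i)) (tr (lookup-⊞ (unit (lk ei zero)) (unit (lk ei (suc j))) (lk ei i))
       (tr (cg2 _xor_ (tra zero i) (tra (suc j) i)) (tr (sy (lookup-⊞ (unit zero) (unit (suc j)) i)) (cg (\ u -> lk u i) (sy (phd j)))))))))
     where
     tra : ∀ a i -> lk (unit (lk ei a)) (lk ei i) ≡ lk (unit a) i
     tra a i with a FP.≟ i
     ... | yes refl = tr (lu (lk ei a)) (sy (lu a))
     ... | no ne = tr (lu≢ _ _ (\ e -> ne (eight-injective a i e))) (sy (lu≢ a i ne))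
 record Relabelling (C : Word 24 -> Set) : Set₁ where
  field
   table : Vec (Fin 24) 24
   cov : ∀ p -> ∃ \ i -> lk table i ≡ p
   R : Word 24 -> Set
   pull : ∀ {u} -> R u -> ∃ \ d -> C d × map (lk d) table ≡ u
   lab : Labelled R
 eisp : ∀ (O : Word 24) w (e : wei O ≡ w) -> let v = sb (Vec (Fin 24)) e (positions O) in
  (∀ i -> lk O (lk v i) ≡ true) × (∀ i j -> lk v i ≡ lk v j -> i ≡ j) × (∀ p -> lk O p ≡ true -> ∃ \ i -> lk v i ≡ p)
 eisp O _ refl = potr O , poin O , pc O
 opaque
  relabelling : ∀ {C : Word 24 -> Set} -> GolayLike C -> Relabelling C
  relabelling {C} G = fo (oct G)
   where
   open GolayLike G
   fo : (∃ \ u -> C u × wei u ≡ 8) -> Relabelling C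
   fo (O , O∈ , O-weight) = record { table = M.table ; cov = M.tc ; R = M.R ; pull = \ r -> r ; lab = M.lab }
    where
    module W = WithOctad G O O∈ O-weight
    module M = FromOctad {C} plin oi he O O∈ (sb (Vec (Fin 24)) O-weight (positions O)) (p1 (eisp O 8 O-weight)) (p1 (p2 (eisp O 8 O-weight))) (p2 (p2 (eisp O 8 O-weight)))
     W.point (\ b -> p1 (W.poispe b)) W.label W.pola (p1 W.axes) (\ k -> allloo (p1 (p2 W.axes)) k) (\ b k -> il W.off b (p1 W.axes) (W.point b) (p2 (W.poispe b)) k) W.pawo
 module _ {R : Word 24 -> Set} (L : Labelled R) where
  open Labelled L
  afin : ∀ a -> R (replicate 8 false ++ af a)
  afin (c ∷ c₀ ∷ c₁ ∷ c₂ ∷ c₃ ∷ []) = join (sc c ofin) (join (sc c₀ (ai (# 0))) (join (sc c₁ (ai (# 1))) (join (sc c₂ (ai (# 2))) (sc c₃ (ai (# 3))))))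
   where
   Z : Word 16 -> Set
   Z v = R (replicate 8 false ++ v)
   join : ∀ {u v} -> Z u -> Z v -> Z (u ⊞ v)
   join {u} {v} u∈ v∈ = sb R (⊞+ (replicate 8 false) (replicate 8 false) u v) (plin u∈ v∈)
   sc : ∀ b {u} -> Z u -> Z (sca b u)
   sc true u∈ = u∈
   sc false {u} u∈ = sb Z (⊞s u) (join u∈ u∈)
  shin : ∀ {h : Word 8} {f : Word 16} a -> R (h ++ f) -> R (h ++ (f ⊞ af a))
  shin {h} {f} a r = sb R (tr (⊞+ h (replicate 8 false) f (af a)) (cg (_++ (f ⊞ af a)) (tr (⊞c h (replicate 8 false)) (⊞i h)))) (plin r (afin a))
  -- Weight 2 on the octad leaves at least 6 of the minimum weight 8 for every affine translate.
  tb : ∀ {h : Word 8} {f : Word 16} -> wei h ≡ 2 -> R (h ++ f) -> Bent f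
  tb {h} {f} w r a = NP.+-cancelˡ-≤ 2 6 _ (NP.≤-trans (he (shin {h} {f} a r) nonzero) (NP.≤-reflexive (tr (w+ h (f ⊞ af a)) (cg (ℕ._+ wei (f ⊞ af a)) w))))
   where
   nonzero : h ++ (f ⊞ af a) ≢ 𝟘
   nonzero e = cx (tr (sy (tr (w+ h (f ⊞ af a)) (cg (ℕ._+ wei (f ⊞ af a)) w))) (tr (cg wei e) (w𝟘 24))) \ ()
  -- The affine function that interpolates the given one at the origin and the unit vectors.
  cor : Word 16 -> Word 5
  cor f = lk f (# 0) ∷ (lk f (# 8) xor lk f (# 0)) ∷ (lk f (# 4) xor lk f (# 0)) ∷ (lk f (# 2) xor lk f (# 0)) ∷ (lk f (# 1) xor lk f (# 0)) ∷ []
  cn : ∀ f -> Normal (f ⊞ af (cor f))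
  cn f = normal (lk f (# 0)) (lk f (# 1)) (lk f (# 2)) (lk f (# 4)) (lk f (# 8)) refl refl refl refl refl
   where
   opaque
    unfolding aw
    checked : aw 5 (\ { (x ∷ y ∷ z ∷ w ∷ v ∷ []) -> let a = af (x ∷ (v xor x) ∷ (w xor x) ∷ (z xor x) ∷ (y xor x) ∷ []) in
     not (x xor lk a (# 0)) ∧ (not (y xor lk a (# 1)) ∧ (not (z xor lk a (# 2)) ∧ (not (w xor lk a (# 4)) ∧ not (v xor lk a (# 8))))) }) ≡ true
    checked = refl
   nofa : ∀ {b} -> not b ≡ true -> b ≡ false
   nofa {false} _ = refl
   normal : ∀ x y z w v -> lk f (# 0) ≡ x -> lk f (# 1) ≡ y -> lk f (# 2) ≡ z -> lk f (# 4) ≡ w -> lk f (# 8) ≡ v -> Normal (f ⊞ af (cor f))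
   normal x y z w v refl refl refl refl refl with ∧t (aws 5 _ checked (x ∷ y ∷ z ∷ w ∷ v ∷ []))
   ... | e₀ , r₀ with ∧t r₀
   ...   | e₁ , r₁ with ∧t r₁
   ...     | e₂ , r₂ with ∧t r₂
   ...       | e₄ , e₈ = at (# 0) e₀ , at (# 1) e₁ , at (# 2) e₂ , at (# 4) e₄ , at (# 8) e₈
    where
    at : ∀ i -> not (lk f i xor lk (af (cor f)) i) ≡ true -> lk (f ⊞ af (cor f)) i ≡ false
    at i e = tr (lookup-⊞ f (af (cor f)) i) (nofa e)
  opaque
   f : Fin 7 -> Word 16
   f j = p1 (pain j) ⊞ af (cor (p1 (pain j)))
   f-in : ∀ j -> R (ph j ++ f j)
   f-in j = shin {ph j} {p1 (pain j)} (cor (p1 (pain j))) (p2 (pain j))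
   fn : ∀ j -> Normal (f j)
   fn j = cn (p1 (pain j))
  a : Fin 7 -> Word 6
  a j = coof (f j)
  opaque
   unfolding ph
   hw : ∀ j -> wei (ph j) ≡ 2
   hw zero = refl
   hw (suc zero) = refl
   hw (suc (suc zero)) = refl
   hw (suc (suc (suc zero))) = refl
   hw (suc (suc (suc (suc zero)))) = refl
   hw (suc (suc (suc (suc (suc zero))))) = refl
   hw (suc (suc (suc (suc (suc (suc zero)))))) = refl
  dw : ∀ i j -> i ≢ j -> wei (ph i ⊞ ph j) ≡ 2
  dw i j ne = tr (cg wei (tr (cg2 _⊞_ (phd i) (phd j)) (cancel (unit zero) (unit (suc i)) (unit (suc j))))) (two i j ne)
   where
   cancel : ∀ {n} (o u v : Word n) -> (o ⊞ u) ⊞ (o ⊞ v) ≡ u ⊞ v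
   cancel o u v = tr (cg (_⊞ (o ⊞ v)) (⊞c o u)) (tr (⊞a u o (o ⊞ v)) (cg (u ⊞_) (⊞ca o v)))
   two : ∀ {n} (i j : Fin n) -> i ≢ j -> wei (pair (suc i) (suc j)) ≡ 2
   two {n} i j ne = ≢⇒ i j ne
    where
    ≢⇒ : ∀ {n} (i j : Fin n) -> i ≢ j -> wei (pair i j) ≡ 2
    ≢⇒ zero zero ne = cx refl ne
    ≢⇒ zero (suc j) ne = cg suc (tr (cg wei (⊞i (unit j))) (wu j))
    ≢⇒ (suc i) zero ne = cg suc (tr (cg wei (tr (⊞c (unit i) 𝟘) (⊞i (unit i)))) (wu i))
    ≢⇒ (suc i) (suc j) ne = ≢⇒ i j (\ e -> ne (cg suc e))
  apf : ∀ j -> pfa (a j) ≡ true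
  apf j = p1 (bq (f j) (fn j) (tb {ph j} {f j} (hw j) (f-in j)))
  fq : ∀ j -> f j ≡ qu (a j)
  fq j = p2 (bq (f j) (fn j) (tb {ph j} {f j} (hw j) (f-in j)))
  -- The sum of two pair words again has two points in the octad, so the sum of their functions is
  -- bent as well: the seven forms are a clique.
  ad : ∀ i j -> i ≢ j -> pfa (a i ⊞ a j) ≡ true
  ad i j ne = sb (\ c -> pfa c ≡ true) (coefficients-⊞ (f i) (f j))
   (p1 (bq (f i ⊞ f j) (normal-⊞ {f i} {f j} (fn i) (fn j)) (tb {ph i ⊞ ph j} {f i ⊞ f j} (dw i j ne) (sb R (⊞+ (ph i) (ph j) (f i) (f j)) (plin (f-in i) (f-in j))))))
  opaque
   s : Fin 8
   s = st (a (# 0)) (a (# 1)) sta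
   stme : ∀ j -> index-of (a j) (lk sta s) ≡ true
   stme zero = p1 fitw
    where
    fitw : index-of (a (# 0)) (lk sta s) ≡ true × index-of (a (# 1)) (lk sta s) ≡ true
    fitw = ∧t (modu (modu (aws 6 _ (modu (aws 6 _ stch (a (# 0))) (apf (# 0))) (a (# 1))) (apf (# 1))) (ad (# 0) (# 1) \ ()))
   stme (suc zero) = p2 (∧t {index-of (a (# 0)) (lk sta s)} (modu (modu (aws 6 _ (modu (aws 6 _ stch (a (# 0))) (apf (# 0))) (a (# 1))) (apf (# 1))) (ad (# 0) (# 1) \ ())))
   stme (suc (suc j)) = wifo (fourth j)
    where
    -- A fourth member of the clique, which rules out the triangle.
    fourth : ∀ (j : Fin 5) -> ∃ \ (k : Fin 5) -> j ≢ k
    fourth zero = suc zero , \ ()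
    fourth (suc j) = zero , \ ()
    distinct : ∀ (k : Fin 5) -> (# 0) ≢ suc (suc k) × (# 1) ≢ suc (suc k)
    distinct k = (\ ()) , (\ ())
    wifo : (∃ \ k -> j ≢ k) -> index-of (a (suc (suc j))) (lk sta s) ≡ true
    wifo (k , j≢k) = byva (index-of (a (suc (suc j))) (lk sta s)) refl
     where
     byva : ∀ v -> index-of (a (suc (suc j))) (lk sta s) ≡ v -> index-of (a (suc (suc j))) (lk sta s) ≡ true
     byva true e = e
     byva false e = cx (tr (sy (cg not (ad (suc (suc j)) (suc (suc k)) \ e -> j≢k (FP.suc-injective (FP.suc-injective e)))))
      (modu (modu (modu (aws 6 _ (orfa lev e) (a (suc (suc k)))) (apf _)) (ad (# 0) (suc (suc k)) \ ())) (ad (# 1) (suc (suc k)) \ ()))) \ ()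
      where
      lev : index-of (a (suc (suc j))) (lk sta s) ∨ aw 6 (\ d -> implies (pfa d) (implies (pfa (a (# 0) ⊞ d)) (implies (pfa (a (# 1) ⊞ d)) (not (pfa (a (suc (suc j)) ⊞ d)))))) ≡ true
      lev = modu (modu (modu (aws 6 _ (modu (modu (aws 6 _ (modu (aws 6 _ stache (a (# 0))) (apf (# 0))) (a (# 1))) (apf (# 1))) (ad (# 0) (# 1) \ ())) (a (suc (suc j)))) (apf _)) (ad (# 0) (suc (suc j)) \ ())) (ad (# 1) (suc (suc j)) \ ())
  -- The position of each form in its star. Distinct indices have distinct forms, since the form
  -- zero has Pfaffian 0, so this is a permutation; `reo` sorts the octad by it.
  σ : Fin 7 -> Fin 7
  σ j = p1 (ios (a j) (lk sta s) (stme j))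
  σs : ∀ j -> a j ≡ lk (lk sta s) (σ j)
  σs j = p2 (ios (a j) (lk sta s) (stme j))
  σi : ∀ {i j} -> σ i ≡ σ j -> i ≡ j
  σi {i} {j} e with i FP.≟ j
  ... | yes i≡j = i≡j
  ... | no ne = cx (tr (sy (ad i j ne)) (tr (cg (\ c -> pfa (c ⊞ a j)) (tr (σs i) (tr (cg (lk (lk sta s)) e) (sy (σs j))))) (tr (cg pfa (⊞s (a j))) refl))) \ ()
  σ⁻ : Fin 7 -> Fin 7
  σ⁻ k = p1 (inje σ σi k)
  σσ : ∀ k -> σ (σ⁻ k) ≡ k
  σσ k = p2 (inje σ σi k)
  ordered : Fin 8 -> Fin 8
  ordered zero = zero
  ordered (suc k) = suc (σ⁻ k)
  opaque
   reo : Vec (Fin 24) 24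
   reo = map (\ i -> ordered i ↑ˡ 16) (allFin 8) ++ map (8 ↑ʳ_) (allFin 16)
  R′ : Word 24 -> Set
  R′ u = ∃ \ d -> R d × map (lk d) reo ≡ u
  opaque
   unfolding reo
   reordered : ∀ (h : Word 8) (v : Word 16) -> map (lk (h ++ v)) reo ≡ map (\ i -> lk h (ordered i)) (allFin 8) ++ v
   reordered h v = tr (VP.map-++ (lk (h ++ v)) (map (\ i -> ordered i ↑ˡ 16) (allFin 8)) (map (8 ↑ʳ_) (allFin 16))) (cg2 _++_
    (tr (sy (VP.map-∘ (lk (h ++ v)) (\ i -> ordered i ↑ˡ 16) (allFin 8))) (VP.map-cong (\ i -> VP.lookup-++ˡ h v (ordered i)) (allFin 8)))
    (tr (sy (VP.map-∘ (lk (h ++ v)) (8 ↑ʳ_) (allFin 16))) (tr (VP.map-cong (\ i -> VP.lookup-++ʳ h v i) (allFin 16)) (VP.map-lookup-allFin v))))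
  Rp : ∀ {u v} -> R′ u -> R′ v -> R′ (u ⊞ v)
  Rp (d , d∈ , refl) (d′ , d′∈ , refl) = d ⊞ d′ , plin d∈ d′∈ , loex \ i -> tr (VP.lookup-map i (lk (d ⊞ d′)) reo) (tr (lookup-⊞ d d′ (lk reo i)) (sy (tr (lookup-⊞ (map (lk d) reo) (map (lk d′) reo) i) (cg2 _xor_ (VP.lookup-map i (lk d) reo) (VP.lookup-map i (lk d′) reo)))))
  fixed : ∀ {v} -> R (replicate 8 false ++ v) -> R′ (replicate 8 false ++ v)
  fixed {v} r = replicate 8 false ++ v , r , tr (reordered (replicate 8 false) v) (cg (_++ v) (map-const (\ i -> lk (replicate 8 false) (ordered i)) false (allFin 8) (\ i -> VP.lookup-replicate (ordered (lk (allFin 8) i)) false)))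
  gi : ∀ k -> R′ (generator (lk sta s) k)
  gi zero = fixed {axis (# 0)} (ai (# 0))
  gi (suc zero) = fixed {axis (# 1)} (ai (# 1))
  gi (suc (suc zero)) = fixed {axis (# 2)} (ai (# 2))
  gi (suc (suc (suc zero))) = fixed {axis (# 3)} (ai (# 3))
  gi (suc (suc (suc (suc zero)))) = fixed {replicate 16 true} ofin
  gi (suc (suc (suc (suc (suc k))))) = ph (σ⁻ k) ++ f (σ⁻ k) , f-in (σ⁻ k) , tr (reordered (ph (σ⁻ k)) (f (σ⁻ k)))
    (cg2 _++_ (loex {u = map (\ i -> lk (ph (σ⁻ k)) (ordered i)) (allFin 8)} {v = ph k} \ i -> tr (VP.lookup-map i (\ i -> lk (ph (σ⁻ k)) (ordered i)) (allFin 8)) (tr (cg (\ i -> lk (ph (σ⁻ k)) (ordered i)) (VP.lookup-allFin i)) (heads i)))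
     (tr (fq (σ⁻ k)) (cg qu (tr (σs (σ⁻ k)) (cg (lk (lk sta s)) (σσ k))))))
   where
   tra : ∀ i -> lk (unit (suc (σ⁻ k))) (ordered i) ≡ lk (unit (suc k)) i
   tra zero = refl
   tra (suc i) with i FP.≟ k
   ... | yes refl = tr (lu (σ⁻ i)) (sy (lu i))
   ... | no ne = tr (lu≢ (σ⁻ k) (σ⁻ i) (\ e -> ne (tr (sy (σσ i)) (tr (cg σ (sy e)) (σσ k))))) (sy (lu≢ k i (\ e -> ne (sy e))))
   tran : ∀ i -> lk (unit {8} zero) (ordered i) ≡ lk (unit {8} zero) i
   tran zero = refl
   tran (suc i) = tr (VP.lookup-replicate (σ⁻ i) false) (sy (VP.lookup-replicate i false))
   heads : ∀ i -> lk (ph (σ⁻ k)) (ordered i) ≡ lk (ph k) i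
   heads i = tr (cg (\ u -> lk u (ordered i)) (phd (σ⁻ k))) (tr (lookup-⊞ (unit zero) (unit (suc (σ⁻ k))) (ordered i)) (tr (cg2 _xor_ (tran i) (tra i)) (tr (sy (lookup-⊞ (unit zero) (unit (suc k)) i)) (cg (\ u -> lk u i) (sy (phd k))))))
  opaque
   unfolding reo
   reco : ∀ p -> ∃ \ i -> lk reo i ≡ p
   reco p = bysi (Data.Fin.splitAt 8 p) refl
    where
    heads : Vec (Fin 24) 8
    heads = map (\ i -> ordered i ↑ˡ 16) (allFin 8)
    tails : Vec (Fin 24) 16
    tails = map (8 ↑ʳ_) (allFin 16)
    byor : ∀ i -> (∃ \ k -> ordered k ≡ i) -> Data.Fin.splitAt 8 p ≡ n1 i -> ∃ \ i -> lk (heads ++ tails) i ≡ p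
    byor i (k , e′) e = k ↑ˡ 16 , tr (VP.lookup-++ˡ heads tails k) (tr (VP.lookup-map k (\ i -> ordered i ↑ˡ 16) (allFin 8)) (tr (cg (\ i -> ordered i ↑ˡ 16) (VP.lookup-allFin k)) (tr (cg (_↑ˡ 16) e′) (FP.splitAt⁻¹-↑ˡ e))))
    os : ∀ i -> ∃ \ k -> ordered k ≡ i
    os zero = zero , refl
    os (suc j) = suc (σ j) , cg suc (σi (σσ (σ j)))
    bysi : ∀ side -> Data.Fin.splitAt 8 p ≡ side -> ∃ \ i -> lk (heads ++ tails) i ≡ p
    bysi (n1 i) e = byor i (os i) e
    bysi (n2 i) e = 8 ↑ʳ i , tr (VP.lookup-++ʳ heads tails i) (tr (VP.lookup-map i (8 ↑ʳ_) (allFin 16)) (tr (cg (8 ↑ʳ_) (VP.lookup-allFin i)) (FP.splitAt⁻¹-↑ʳ e)))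
 standard : Fin 12 -> Word 24
 standard = generator (lk sta zero)
 opaque
  unfolding ph
  relabelled : ∀ s k -> map (lk (comb (lk (lk coefficients s) k) (generator (lk sta s)))) (lk rela s) ≡ standard k
  relabelled = toWitness {a? = FP.all? \ s -> FP.all? \ k -> map (lk (comb (lk (lk coefficients s) k) (generator (lk sta s)))) (lk rela s) ≟ʷ standard k} _
  rc : ∀ s p -> ∃ \ i -> lk (lk rela s) i ≡ p
  rc = toWitness {a? = FP.all? \ s -> FP.all? \ p -> FP.any? \ i -> lk (lk rela s) i FP.≟ p} _
 -- Composes three relabellings: to octad and affine coordinates, to the tabulated order of the
 -- star, and from that star to the first one.
 gu : ∀ {C : Word 24 -> Set} -> GolayLike C -> Σ (Fin 24 -> Fin 24) \ π -> (∀ {i j} -> π i ≡ π j -> i ≡ j) × (∀ k -> ∃ \ d -> C d × (∀ i -> lk d (π i) ≡ lk (standard k) i))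
 gu {C} G = fr (relabelling G)
  where
  fr : Relabelling C -> Σ (Fin 24 -> Fin 24) \ π -> (∀ {i j} -> π i ≡ π j -> i ≡ j) × (∀ k -> ∃ \ d -> C d × (∀ i -> lk d (π i) ≡ lk (standard k) i))
  fr record { table = table ; cov = cov ; R = R ; pull = pull ; lab = L } = π , sur π πs , \ k -> trace k (member k)
   where
   t : Fin 8
   t = s L
   ρ : Fin 24 -> Fin 24
   ρ = lk (lk rela t)
   π : Fin 24 -> Fin 24
   π i = lk table (lk (reo L) (ρ i))
   πs : ∀ p -> ∃ \ i -> π i ≡ p
   πs p = step₁ (cov p)
    where
    ste : ∀ i j -> lk (reo L) j ≡ i -> lk table i ≡ p -> (∃ \ k -> ρ k ≡ j) -> ∃ \ i -> π i ≡ p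
    ste i j e e′ (k , e″) = k , tr (cg (\ z -> lk table (lk (reo L) z)) e″) (tr (cg (lk table) e) e′)
    step₂ : ∀ i -> lk table i ≡ p -> (∃ \ j -> lk (reo L) j ≡ i) -> ∃ \ i -> π i ≡ p
    step₂ i e′ (j , e) = ste i j e e′ (rc t j)
    step₁ : (∃ \ i -> lk table i ≡ p) -> ∃ \ i -> π i ≡ p
    step₁ (i , e) = step₂ i e (reco L i)
   word : Fin 12 -> Word 24
   word k = comb (lk (lk coefficients t) k) (generator (lk sta t))
   member : ∀ k -> R′ L (word k)
   member k = comin {R′ L} (sb (R′ L) (⊞s (generator (lk sta t) zero)) (Rp L (gi L zero) (gi L zero))) (\ {u} {v} -> Rp L {u} {v}) (lk (lk coefficients t) k) (generator (lk sta t)) (gi L)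
   trace : ∀ k -> R′ L (word k) -> ∃ \ d -> C d × (∀ i -> lk d (π i) ≡ lk (standard k) i)
   trace k (d′ , d′∈ , e) = fi (pull d′∈)
    where
    fi : (∃ \ d -> C d × map (lk d) table ≡ d′) -> ∃ \ d -> C d × (∀ i -> lk d (π i) ≡ lk (standard k) i)
    fi (d , d∈ , e′) = d , d∈ , \ i -> tr (sy (VP.lookup-map (lk (reo L) (ρ i)) (lk d) table))
     (tr (cg (\ u -> lk u (lk (reo L) (ρ i))) e′) (tr (sy (VP.lookup-map (ρ i) (lk d′) (reo L))) (tr (cg (\ u -> lk u (ρ i)) e)
      (tr (sy (VP.lookup-map i (lk (word k)) (lk rela t))) (cg (\ u -> lk u i) (relabelled t k))))))

-- Tables for the standard Leech lattice and its symmetry of order 13.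

module StandardData where
 open Bits using (Word)
 open GolayData using (binary)
 open import Data.Nat using (ℕ; zero; suc; _/_; _%_; NonZero)
 open import Data.Integer using (ℤ; _⊖_)
 open import Data.Vec using (Vec; []; _∷_; map)
 decode : ∀ n b -> .{{NonZero b}} -> ℕ -> ℕ -> Vec ℤ n
 decode zero b k N = []
 decode (suc n) b k N = (N % b ⊖ k) ∷ decode n b k (N / b)
 -- A basis in frame coordinates, read digit by digit from the low end with 3 subtracted. Rows 0 to
 -- 11 and rows 12 to 23 are each successive images under the symmetry.
 br : Vec (Vec ℤ 24) 24
 br = map (decode 24 10 3) (
  333333333333333337333337 ∷
  402244444422222222424424 ∷
  422444042244242422442222 ∷
  242222242022222444222244 ∷
  533333535113313333335331 ∷
  242442244426444422244222 ∷
  153153331333335333313353 ∷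
  535333333531333335335351 ∷
  224222244644422242242222 ∷
  244224422244442222420442 ∷
  333513513331353335333133 ∷
  222422424442224240244424 ∷
  333333333333333333333377 ∷
  533335333511313333533313 ∷
  333331133355131313333313 ∷
  224242442022442442422244 ∷
  442424444222224224464242 ∷
  242222244424244442224402 ∷
  335353333155335333313353 ∷
  333533353511533335333353 ∷
  331133333553313133333311 ∷
  424222222244462422222442 ∷
  224424422222424244242044 ∷
  242424424422222222244622 ∷
  [])
 -- The inverse of the Gram matrix of this basis, integral because the determinant is 1.
 ig : Vec (Vec ℤ 24) 24
 ig = map (decode 24 1000 59) (
  39039056026065019072012078009075019310084272132218189160246106294068319 ∷
  39056043052045052045051048045055039084046094040097039096042090052077068 ∷
  56043069032078025084021084025075039272094228145173201118252074287052294 ∷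
  26052032048034047037040047028058022132040145033147035140048121074090106 ∷
  65045078034086030086033080041071052218097173147121197076235048252042246 ∷
  19052025047030040040027054015062013189039201035197047177076140118096160 ∷
  72045084037086040080047074052069059160096118140076177047197035201039189 ∷
  12051021040033027047014058006062006246042252048235076197121147173097218 ∷
  78048084047080054074058072059069066106090074121048140035147033145040132 ∷
  9045025028041015052006059000063000294052287074252118201173145228094272 ∷
  75055075058071062069062069063066069068077052090042096039097040094046084 ∷
  19039039022052013059006066000069003319068294106246160189218132272084310 ∷
  85068075076072074076072073080063089003069000066006059013052022039039019 ∷
  68058066063061065063060068058067063069066063069062069062071058075055075 ∷
  75066070069069069068072063079058080000063000059006052015041028025045009 ∷
  76063069070066067073060077063068073066069059072058074054080047084048078 ∷
  72061069066063071060073060072060072006062006058014047027033040021051012 ∷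
  74065069067071062077060073068063076059069052074047080040086037084045072 ∷
  76063068073060077062071067069065074013062015054027040040030047025052019 ∷
  72060072060073060071063066069061072052071041080033086030086034078045065 ∷
  73068063077060073067066070069063076022058028047040037047034048032052026 ∷
  80058079063072068069069069070066075039075025084021084025078032069043056 ∷
  63067058068060063065061063066058068039055045048051045052045052043056039 ∷
  89063080073072076074072076075068085019075009078012072019065026056039039 ∷
  [])
 -- Two companion blocks of 1 + x + ... + x^12: the lattice is treated as a module of rank 2 over
 -- the integers of the 13th cyclotomic field.
 shirow : Vec (Vec ℤ 24) 24
 shirow = map (decode 24 10 1) (
  111111111111111111111121 ∷
  111111111111111111111211 ∷
  111111111111111111112111 ∷
  111111111111111111121111 ∷
  111111111111111111211111 ∷
  111111111111111112111111 ∷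
  111111111111111121111111 ∷
  111111111111111211111111 ∷
  111111111111112111111111 ∷
  111111111111121111111111 ∷
  111111111111211111111111 ∷
  111111111111000000000000 ∷
  111111111121111111111111 ∷
  111111111211111111111111 ∷
  111111112111111111111111 ∷
  111111121111111111111111 ∷
  111111211111111111111111 ∷
  111112111111111111111111 ∷
  111121111111111111111111 ∷
  111211111111111111111111 ∷
  112111111111111111111111 ∷
  121111111111111111111111 ∷
  211111111111111111111111 ∷
  111111111111 ∷
  [])
 sbr : Vec (Vec ℤ 24) 24
 sbr = map (decode 24 10 3) (
  402244444422222222424424 ∷
  422444042244242422442222 ∷
  242222242022222444222244 ∷
  533333535113313333335331 ∷
  242442244426444422244222 ∷
  153153331333335333313353 ∷
  535333333531333335335351 ∷
  224222244644422242242222 ∷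
  244224422244442222420442 ∷
  333513513331353335333133 ∷
  222422424442224240244424 ∷
  444444222244444442442624 ∷
  533335333511313333533313 ∷
  333331133355131313333313 ∷
  224242442022442442422244 ∷
  442424444222224224464242 ∷
  242222244424244442224402 ∷
  335353333155335333313353 ∷
  333533353511533335333353 ∷
  331133333553313133333311 ∷
  424222222244462422222442 ∷
  224424422222424244242044 ∷
  242424424422222222244622 ∷
  333353313355353553333313 ∷
  [])
 eigr : Vec (Vec ℤ 24) 24
 eigr = map (decode 24 100 16) (
  82408082416081616161632082408081616080824081648 ∷
  240808241608161616163216240808161608082408164816 ∷
  80824160816161616321608080816160808240816481608 ∷
  82416081616161632160824081616080824081648160824 ∷
  241608161616163216082408161608082408164816082408 ∷
  160816161616321608240808160808240816481608240808 ∷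
  81616161632160824080824080824081648160824080816 ∷
  161616163216082408082416082408164816082408081616 ∷
  161616321608240808241608240816481608240808161608 ∷
  161632160824080824160816081648160824080816160808 ∷
  163216082408082416081616164816082408081616080824 ∷
  321608240808241608161616481608240808161608082408 ∷
  82416002424001624080848161616081624080824081632 ∷
  241600242400162408084808161608162408082408163216 ∷
  160024240016240808480808160816240808240816321616 ∷
  2424001624080848080824081624080824081632161616 ∷
  242400162408084808082416162408082408163216161616 ∷
  240016240808480808241600240808240816321616161608 ∷
  1624080848080824160024080824081632161616160816 ∷
  162408084808082416002424082408163216161616081624 ∷
  240808480808241600242400240816321616161608162408 ∷
  80848080824160024240016081632161616160816240808 ∷
  84808082416002424001624163216161616081624080824 ∷
  480808241600242400162408321616161608162408082408 ∷
  [])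
 dr : Vec (Vec ℤ 24) 24
 dr = map (decode 24 100 19) (
  416160620121022182222260824381426382028242414 ∷
  191719191721252315212121171719251719171919191919 ∷
  10515170919070725171921251123311725391927232513 ∷
  171719191323272513212521191319331519171921191919 ∷
  50715171315070527171521231323251925371923232513 ∷
  131519190925272511212723231119371319211927191919 ∷
  81016161814080628181418201624221824322018222414 ∷
  91119190525252309212725230919391521271931212117 ∷
  121418162016101030181616201822201822262016202216 ∷
  50717190323231911212527230721411523331929232315 ∷
  161818182018141426181816202020181820221818182018 ∷
  20416180420181416202424240624421424362028242414 ∷
  212319192119131723171717212317092117191721171921 ∷
  182020181820161822182016221820201618201820181820 ∷
  222220202216161820181618182218102018181818181820 ∷
  162020181820141822162016242018161818221824181820 ∷
  222220182218182022181816182220141818162016181820 ∷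
  171919191719131721171719212119132119231723191919 ∷
  212321192121172123172115212119151717151719171721 ∷
  181818202016141622181618202020142020221818202018 ∷
  212319191921172119172117232117131917171723171721 ∷
  191919172117131525171715212121151719191917191919 ∷
  202020201820182016181820202018142018181822181820 ∷
  182220182220121626161814222218121818181820181820 ∷
  [])
 glpa : Vec ℕ 24
 glpa = 0 ∷ 1 ∷ 1 ∷ 1 ∷ 0 ∷ 1 ∷ 0 ∷ 0 ∷ 1 ∷ 1 ∷ 0 ∷ 1 ∷ 0 ∷ 0 ∷ 0 ∷ 1 ∷ 1 ∷ 1 ∷ 0 ∷ 0 ∷ 0 ∷ 1 ∷ 1 ∷ 1 ∷ []
 wp : Vec (Word 12) 24
 wp = map (binary 12) (0 ∷ 3377 ∷ 3304 ∷ 974 ∷ 132 ∷ 3682 ∷ 296 ∷ 1186 ∷ 1779 ∷ 3350 ∷ 1095 ∷ 568 ∷ 0 ∷ 550 ∷ 2090 ∷ 1482 ∷ 2393 ∷ 1792 ∷ 298 ∷ 1059 ∷ 59 ∷ 3981 ∷ 664 ∷ 3696 ∷ [])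
 dp : Vec (Vec ℤ 24) 24
 dp = map (decode 24 10 1) (
  111111111111111112111112 ∷
  100011111100000000101102 ∷
  100111010011010100110001 ∷
  10000010000000111000012 ∷
  111111111001101111111110 ∷
  10110011101111100011001 ∷
  11011110111111111101111 ∷
  111111111110111111111110 ∷
  1000011111100010010001 ∷
  11001100011110000100111 ∷
  111101101110111111111011 ∷
  100101110001010011102 ∷
  111111111111111111111122 ∷
  111111111100101111111101 ∷
  111110011111010101111101 ∷
  1010110000110110100012 ∷
  110101111000001001111011 ∷
  10000011101011110001101 ∷
  111111111011111111101111 ∷
  111111111100111111111111 ∷
  110011111111101011111100 ∷
  101000000011110100000111 ∷
  1101100000101011010012 ∷
  10101101100000000011101 ∷
  [])
 eipa : Vec ℤ 24
 eipa = map (_⊖ 9) (10 ∷ 3 ∷ 3 ∷ 1 ∷ 7 ∷ 4 ∷ 7 ∷ 8 ∷ 2 ∷ 3 ∷ 7 ∷ 3 ∷ 10 ∷ 7 ∷ 6 ∷ 3 ∷ 4 ∷ 3 ∷ 8 ∷ 8 ∷ 6 ∷ 2 ∷ 3 ∷ 2 ∷ [])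

-- The symmetry of order 13.

module Standard where
 open import Defs using (Mat)
 open Z
 open Forms
 open Walks
 open Leech
 open Coordinates
 open Orbits using (iterate)
 open StandardData
 open import Data.Nat as ℕ using (ℕ; zero; suc)
 open import Data.Integer as ℤ using (ℤ; +_; 0ℤ; 1ℤ)
 open import Data.Fin using (Fin; zero; suc)
 open import Data.Vec as Vec using (Vec; lookup; tabulate)
 open import Tactic.RingSolver using () renaming (solve-∀ to sv)
 private variable n : ℕ
 row sr : Fin 24 -> Vec ℤ 24
 row k = lk br k
 sr k = lk shirow k
 inv : Fin 24 -> Fin 24 -> ℤ
 inv k l = lk (lk ig k) l
 opaque
  unitᶻ : Fin 24 -> Vec ℤ 24
  unitᶻ i = tabulate (δ i)
  loun : ∀ i j -> lk (unitᶻ i) j ≡ δ i j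
  loun i j = VP.lookup∘tabulate (δ i) j
 combine : ∀ {m} -> Vec ℤ m -> (Fin m -> Vec ℤ n) -> Vec ℤ n
 combine v w = lin (lk v) w
 loco : ∀ {m} (v : Vec ℤ m) (w : Fin m -> Vec ℤ n) k -> lk (combine v w) k ≡ sum m (\ i -> lk v i * lk (w i) k)
 loco v w k = ll (lk v) w k
 comcom : ∀ {m k} (v : Vec ℤ m) (p : Fin m -> Vec ℤ k) (b : Fin k -> Vec ℤ n) -> combine v (\ i -> combine (p i) b) ≡ combine (combine v p) b
 comcom {m = m} {k} v p b = lookup-injective \ j -> tr (loco v (\ i -> combine (p i) b) j) (tr (Sc \ i -> tr (mc (loco (p i) b j)) (sy (Σ* k (lk v i) _)))
  (tr (Σs m k _) (tr (Sc \ l -> tr (Sc \ i -> sy (*-assoc (lk v i) (lk (p i) l) (lk (b l) j))) (tr (Σ*ʳ m (lk (b l) j) _) (mr (sy (loco v p l))))) (sy (loco (combine v p) b j)))))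
 co⊕ : ∀ {m} (v : Vec ℤ m) (p q : Fin m -> Vec ℤ n) -> combine v (\ i -> p i ⊕ q i) ≡ combine v p ⊕ combine v q
 co⊕ {m = m} v p q = lookup-injective \ j -> tr (loco v (\ i -> p i ⊕ q i) j) (tr (Sc \ i -> tr (mc (l⊕ (p i) (q i) j)) (*-distribˡ-+ (lk v i) _ _))
  (tr (Σ-+ m _ _) (sy (tr (l⊕ (combine v p) (combine v q) j) (cg2 _+_ (loco v p j) (loco v q j))))))
 c⊕ : ∀ {m} (u v : Vec ℤ m) (p : Fin m -> Vec ℤ n) -> combine (u ⊕ v) p ≡ combine u p ⊕ combine v p
 c⊕ {m = m} u v p = lookup-injective \ j -> tr (loco (u ⊕ v) p j) (tr (Sc \ i -> tr (mr (l⊕ u v i)) (tr (*-comm _ _) (tr (*-distribˡ-+ (lk (p i) j) _ _) (cg2 _+_ (*-comm _ _) (*-comm _ _)))))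
  (tr (Σ-+ m _ _) (sy (tr (l⊕ (combine u p) (combine v p) j) (cg2 _+_ (loco u p j) (loco v p j))))))
 coun : (v : Vec ℤ 24) -> combine v unitᶻ ≡ v
 coun v = lookup-injective \ j -> tr (loco v unitᶻ j) (tr (Sc \ i -> mc (loun i j)) (Σδʳ 24 j (lk v)))
 c𝟎 : ∀ {m} (v : Vec ℤ m) (p : Fin m -> Vec ℤ n) -> (∀ i -> p i ≡ 𝟎) -> combine v p ≡ 𝟎
 c𝟎 v p e = lookup-injective \ j -> tr (loco v p j) (tr (Σz \ i -> tr (mc (tr (cg (\ u -> lk u j) (e i)) (l𝟎 j))) (*-zeroʳ _)) (sy (l𝟎 j)))
 c0 : ∀ {m} (p : Fin m -> Vec ℤ n) -> combine 𝟎 p ≡ 𝟎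
 c0 {m = m} p = lookup-injective \ j -> tr (loco 𝟎 p j) (tr (Σz \ i -> tr (mr (l𝟎 i)) (*-zeroˡ _)) (sy (l𝟎 j)))
 comcon : ∀ {m} (v : Vec ℤ m) {p q : Fin m -> Vec ℤ n} -> (∀ i -> p i ≡ q i) -> combine v p ≡ combine v q
 comcon v {p} {q} e = lookup-injective \ j -> tr (loco v p j) (tr (Sc \ i -> mc (cg (\ u -> lk u j) (e i))) (sy (loco v q j)))
 shift : Vec ℤ 24 -> Vec ℤ 24
 shift v = combine v sr
 -- Horner's scheme for 1 + S + ... + S^(k-1) with S the shift. For `k = 13` it vanishes: comparing
 -- its two recursions gives S^13 = 1, and a fixed vector v satisfies 13 v = 0.
 ho : ℕ -> Vec ℤ 24 -> Vec ℤ 24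
 ho zero v = 𝟎
 ho (suc k) v = v ⊕ shift (ho k v)
 hoco : ∀ k v -> ho k v ≡ combine v (\ i -> ho k (unitᶻ i))
 hoco zero v = sy (c𝟎 v _ (\ _ -> refl))
 hoco (suc k) v = tr (cg2 _⊕_ (sy (coun v)) (tr (cg shift (hoco k v)) (sy (comcom v (\ i -> ho k (unitᶻ i)) sr)))) (sy (co⊕ v unitᶻ (\ i -> shift (ho k (unitᶻ i)))))
 hl : ∀ k v -> ho (suc k) v ≡ ho k v ⊕ iterate shift k v
 hl zero v = tr (cg (v ⊕_) (c0 sr)) (⊕-comm v 𝟎)
 hl (suc k) v = tr (cg (\ z -> v ⊕ shift z) (hl k v)) (tr (cg (v ⊕_) (c⊕ (ho k v) (iterate shift k v) sr)) (sy (⊕-assoc v _ _)))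
 dotᵥ : Vec ℤ n -> Vec ℤ n -> ℤ
 dotᵥ Vec.[] Vec.[] = 0ℤ
 dotᵥ (a Vec.∷ u) (b Vec.∷ v) = a * b + dotᵥ u v
 sd : (u v : Vec ℤ n) -> sum n (\ i -> lk u i * lk v i) ≡ dotᵥ u v
 sd Vec.[] Vec.[] = se _
 sd (a Vec.∷ u) (b Vec.∷ v) = tr (susu _ _) (ac (sd u v))
 column : Fin 24 -> Vec ℤ 24
 column i = tabulate (\ k -> lk (row k) i)
 opaque
  unfolding _+_ _*_ -_ sum lin unitᶻ
  tu : ∀ i -> ho 13 (unitᶻ i) ≡ 𝟎
  tu = toWitness {a? = FP.all? \ i -> VP.≡-dec ZP._≟_ (ho 13 (unitᶻ i)) 𝟎} _
  shro : ∀ k -> combine (sr k) row ≡ lk sbr k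
  shro = toWitness {a? = FP.all? \ k -> VP.≡-dec ZP._≟_ (combine (sr k) row) (lk sbr k)} _
  grch : ∀ k l -> dotᵥ (row k) (row l) ≡ lk (lk eigr k) l
  grch = toWitness {a? = FP.all? \ k -> FP.all? \ l -> dotᵥ (row k) (row l) ZP.≟ lk (lk eigr k) l} _
  sgc : ∀ k l -> dotᵥ (lk sbr k) (lk sbr l) ≡ lk (lk eigr k) l
  sgc = toWitness {a? = FP.all? \ k -> FP.all? \ l -> dotᵥ (lk sbr k) (lk sbr l) ZP.≟ lk (lk eigr k) l} _
  igc : ∀ k -> combine (lk ig k) (lk eigr) ≡ tabulate (\ j -> + 8 * δ k j)
  igc = toWitness {a? = FP.all? \ k -> VP.≡-dec ZP._≟_ (combine (lk ig k) (lk eigr)) (tabulate (\ j -> + 8 * δ k j))} _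
  duch : ∀ k -> combine (lk ig k) row ≡ lk dr k
  duch = toWitness {a? = FP.all? \ k -> VP.≡-dec ZP._≟_ (combine (lk ig k) row) (lk dr k)} _
  dpc : ∀ i -> combine (column i) (lk dr) ≡ tabulate (\ j -> + 8 * δ i j)
  dpc = toWitness {a? = FP.all? \ i -> VP.≡-dec ZP._≟_ (combine (column i) (lk dr)) (tabulate (\ j -> + 8 * δ i j))} _
 gren : ∀ k l -> sum 24 (\ i -> lk (row k) i * lk (row l) i) ≡ lk (lk eigr k) l
 gren k l = tr (sd (row k) (row l)) (grch k l)
 sge : ∀ k l -> sum 24 (\ i -> lk (lk sbr k) i * lk (lk sbr l) i) ≡ lk (lk eigr k) l
 sge k l = tr (sd (lk sbr k) (lk sbr l)) (sgc k l)
 ige : ∀ k j -> sum 24 (\ l -> inv k l * lk (lk eigr l) j) ≡ + 8 * δ k j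
 ige k j = tr (sy (loco (lk ig k) (lk eigr) j)) (tr (cg (\ u -> lk u j) (igc k)) (VP.lookup∘tabulate (\ j -> + 8 * δ k j) j))
 duen : ∀ k j -> sum 24 (\ l -> inv k l * lk (row l) j) ≡ lk (lk dr k) j
 duen k j = tr (sy (loco (lk ig k) row j)) (cg (\ u -> lk u j) (duch k))
 dupr : ∀ i j -> sum 24 (\ k -> lk (row k) i * lk (lk dr k) j) ≡ + 8 * δ i j
 dupr i j = tr (Sc \ k -> mr (sy (VP.lookup∘tabulate (\ k -> lk (row k) i) k))) (tr (sy (loco (column i) (lk dr) j)) (tr (cg (\ u -> lk u j) (dpc i)) (VP.lookup∘tabulate (\ j -> + 8 * δ i j) j)))
 shgr : ∀ k l -> sum 24 (\ i -> lk (combine (sr k) row) i * lk (combine (sr l) row) i) ≡ sum 24 (\ i -> lk (row k) i * lk (row l) i)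
 shgr k l = tr (cg2 (\ u w -> sum 24 (\ i -> lk u i * lk w i)) (shro k) (shro l)) (tr (sge k l) (sy (gren k l)))
 inle : ∀ k j -> sum 24 (\ l -> inv k l * sum 24 (\ i -> lk (row l) i * lk (row j) i)) ≡ + 8 * δ k j
 inle k j = tr (Sc \ l -> mc (gren l j)) (ige k j)
 inri : ∀ i j -> sum 24 (\ k -> lk (row k) i * sum 24 (\ l -> inv k l * lk (row l) j)) ≡ + 8 * δ i j
 inri i j = tr (Sc \ k -> mc (duen k j)) (dupr i j)
 thi : ∀ v -> ho 13 v ≡ 𝟎
 thi v = tr (hoco 13 v) (c𝟎 v _ tu)
 shpe : ∀ v -> iterate shift 13 v ≡ v
 shpe v = tr (sy (⊕-identityˡ _)) (tr (cg (_⊕ iterate shift 13 v) (sy (thi v))) (tr (sy (hl 13 v)) (tr (cg (\ z -> v ⊕ shift z) (thi v)) (tr (cg (v ⊕_) (c0 sr)) (⊕-identityʳ v)))))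
 sf : ∀ v -> shift v ≡ v -> v ≡ 𝟎
 sf v fixed = lookup-injective \ j -> *-cancelˡ-≡ (+ 13) (\ ()) (tr (sy (multiple 13 j)) (tr (cg (\ u -> lk u j) (thi v)) (tr (l𝟎 j) (sy (tr (mc (l𝟎 j)) (*-zeroʳ _))))))
  where
  itfi : ∀ k -> iterate shift k v ≡ v
  itfi zero = refl
  itfi (suc k) = tr (cg shift (itfi k)) fixed
  multiple : ∀ k j -> lk (ho k v) j ≡ + k * lk v j
  multiple zero j = tr (l𝟎 j) (sy (*-zeroˡ _))
  multiple (suc k) j = tr (cg (\ u -> lk u j) (hl k v)) (tr (l⊕ (ho k v) _ j) (tr (cg2 _+_ (multiple k j) (cg (\ u -> lk u j) (itfi k))) (tr (co (+ k) (lk v j)) (mr (tr (sy (pos-+ k 1)) (cg +_ (ℕc k)))))))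
   where
   opaque
    unfolding _+_ _*_ -_
    co : ∀ k x -> k * x + x ≡ (k + 1ℤ) * x
    co = sv ring
   ℕc : ∀ k -> k ℕ.+ 1 ≡ suc k
   ℕc zero = refl
   ℕc (suc k) = cg suc (ℕc k)
 record Automorphism (⟨_,_⟩ : Vec ℤ 24 -> Vec ℤ 24 -> ℤ) : Set where
  field
   map : Vec ℤ 24 -> Vec ℤ 24
   iso : ∀ x y -> ⟨ map x , map y ⟩ ≡ ⟨ x , y ⟩
   peri : ∀ x -> iterate map 13 x ≡ x
   fixed : ∀ x -> map x ≡ x -> x ≡ 𝟎
 module FromBasis (L : Mat 24) (symmetric : ∀ i j -> L i j ≡ L j i)
  (v : Fin 24 -> Vec ℤ 24) (norms : ∀ i j -> Lattice.⟨_,_⟩ L symmetric (v i) (v j) ≡ + 8 * δ i j)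
  (b : Fin 24 -> Vec ℤ 24) (b-coordinates : ∀ k i -> Lattice.⟨_,_⟩ L symmetric (b k) (v i) ≡ lk (row k) i) where
  open Lattice L symmetric
  open FrameCoordinates L symmetric v norms
  β : Vec ℤ 24 -> Vec ℤ 24
  β u = combine u b
  c-β : ∀ u i -> c (β u) i ≡ lk (combine u row) i
  c-β u i = tr (⟨l (lk u) b (v i)) (tr (Sc \ k -> mc (b-coordinates k i)) (sy (loco u row i)))
  eigpai : ∀ x l -> + 8 * ⟨ x , b l ⟩ ≡ sum 24 (\ i -> c x i * lk (row l) i)
  eigpai x l = tr (parseval x (b l)) (Sc \ i -> mc (b-coordinates l i))
  -- Basis coordinates recovered from inner products by the inverse Gram matrix. That `b` spans the
  -- whole lattice follows from `βm`.
  m : Vec ℤ 24 -> Vec ℤ 24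
  m x = tabulate (\ k -> sum 24 (\ l -> inv k l * ⟨ x , b l ⟩))
  lom : ∀ x k -> lk (m x) k ≡ sum 24 (\ l -> inv k l * ⟨ x , b l ⟩)
  lom x k = VP.lookup∘tabulate (\ k -> sum 24 (\ l -> inv k l * ⟨ x , b l ⟩)) k
  eim : ∀ x k -> + 8 * lk (m x) k ≡ sum 24 (\ l -> inv k l * sum 24 (\ i -> c x i * lk (row l) i))
  eim x k = tr (mc (lom x k)) (tr (sy (Σ* 24 (+ 8) _)) (Sc \ l -> tr (*s (+ 8) (inv k l) _) (mc (eigpai x l))))
  βm : ∀ x -> β (m x) ≡ x
  βm x = cin (β (m x)) x \ i -> *-cancelˡ-≡ (+ 8) (\ ()) (tr (mc (tr (c-β (m x) i) (loco (m x) row i))) (tr (sy (Σ* 24 (+ 8) _))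
   (tr (Sc \ k -> tr (sy (*-assoc (+ 8) _ _)) (tr (mr (tr (eim x k) (inner k))) (tr (*-comm _ _) (tr (sy (Σ* 24 (lk (row k) i) _)) (Sc \ j -> *s (lk (row k) i) (c x j) _)))))
    (tr (Σs 24 24 _) (tr (Sc \ j -> tr (Σ* 24 (c x j) _) (tr (mc (inri i j)) (*s (c x j) (+ 8) (δ i j)))) (tr (Σ* 24 (+ 8) _) (mc (tr (Sc \ j -> *-comm (c x j) (δ i j)) (Σδ 24 i (c x))))))))))
   where
   inner : ∀ k -> sum 24 (\ l -> inv k l * sum 24 (\ i -> c x i * lk (row l) i)) ≡ sum 24 (\ j -> c x j * sum 24 (\ l -> inv k l * lk (row l) j))
   inner k = tr (Sc \ l -> tr (sy (Σ* 24 (inv k l) _)) (Sc \ j -> *s (inv k l) (c x j) _)) (tr (Σs 24 24 _) (Sc \ j -> Σ* 24 (c x j) _))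
  mβ : ∀ u -> m (β u) ≡ u
  mβ u = lookup-injective \ k -> *-cancelˡ-≡ (+ 8) (\ ()) (tr (eim (β u) k) (tr (Sc \ l -> mc (ropr l))
    (tr (Sc \ l -> tr (sy (Σ* 24 (inv k l) _)) (Sc \ j -> *s (inv k l) (lk u j) _)) (tr (Σs 24 24 _)
     (tr (Sc \ j -> tr (Σ* 24 (lk u j) _) (tr (mc (inle k j)) (*s (lk u j) (+ 8) (δ k j)))) (tr (Σ* 24 (+ 8) _) (mc (tr (Sc \ j -> *-comm (lk u j) (δ k j)) (Σδ 24 k (lk u))))))))))
   where
   ropr : ∀ l -> sum 24 (\ i -> c (β u) i * lk (row l) i) ≡ sum 24 (\ j -> lk u j * sum 24 (\ i -> lk (row l) i * lk (row j) i))
   ropr l = tr (Sc \ i -> tr (mr (tr (c-β u i) (loco u row i))) (tr (sy (Σ*ʳ 24 (lk (row l) i) _)) (Sc \ j -> tr (*-assoc _ _ _) (mc (*-comm (lk (row j) i) (lk (row l) i))))))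
    (tr (Σs 24 24 _) (Sc \ j -> Σ* 24 (lk u j) _))
  S : Vec ℤ 24 -> Vec ℤ 24
  S x = β (shift (m x))
  Se : ∀ x -> S x ≡ combine (m x) (\ k -> β (sr k))
  Se x = sy (comcom (m x) sr b)
  -- Inner products are determined by frame coordinates through `parseval`, so invariance on the
  -- basis is an identity between the tabulated matrices.
  sagr : ∀ k l -> ⟨ β (sr k) , β (sr l) ⟩ ≡ ⟨ b k , b l ⟩
  sagr k l = *-cancelˡ-≡ (+ 8) (\ ()) (tr (parseval (β (sr k)) (β (sr l))) (tr (Sc \ i -> cg2 _*_ (c-β (sr k) i) (c-β (sr l) i))
   (tr (shgr k l) (sy (tr (parseval (b k) (b l)) (Sc \ i -> cg2 _*_ (b-coordinates k i) (b-coordinates l i)))))))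
  bili : ∀ (u w : Vec ℤ 24) (p : Fin 24 -> Vec ℤ 24) -> ⟨ combine u p , combine w p ⟩ ≡ sum 24 (\ k -> lk u k * sum 24 (\ l -> lk w l * ⟨ p l , p k ⟩))
  bili u w p = tr (⟨l (lk u) p (combine w p)) (Sc \ k -> mc (tr (⟨s (p k) (combine w p)) (⟨l (lk w) p (p k))))
  Si : ∀ x y -> ⟨ S x , S y ⟩ ≡ ⟨ x , y ⟩
  Si x y = tr (cg2 ⟨_,_⟩ (Se x) (Se y)) (tr (bili (m x) (m y) (\ k -> β (sr k)))
   (tr (Sc \ k -> mc (Sc \ l -> mc (sagr l k))) (tr (sy (bili (m x) (m y) b)) (cg2 ⟨_,_⟩ (βm x) (βm y)))))
  iS : ∀ k x -> iterate S k x ≡ β (iterate shift k (m x))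
  iS zero x = sy (βm x)
  iS (suc k) x = tr (cg S (iS k x)) (cg (\ u -> β (shift u)) (mβ (iterate shift k (m x))))
  aut : Automorphism ⟨_,_⟩
  aut = record
   { map = S ; iso = Si
   ; peri = \ x -> tr (iS 13 x) (tr (cg β (shpe (m x))) (βm x))
   ; fixed = \ x e -> tr (sy (βm x)) (tr (cg β (sf (m x) (tr (sy (mβ (shift (m x)))) (cg m e)))) (c0 b)) }

-- The basis rows in terms of the code.

module Rows where
 open Z
 open Code
 open Golay using (comb)
 open GolayUnique using (standard; ph)
 open Standard using (row)
 open StandardData
 open import Data.Integer as ℤ using (+_; 1ℤ)
 open import Data.Fin using (Fin)
 open import Data.Vec using (lookup)
 opaque
  unfolding _+_ _*_ -_ sum ph
  -- Exhibits each row as a combination of (-3, 1, ..., 1), twice a codeword, the differences 4(e_i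
  -- - e_0) and 8 e_0, all of which lie in any lattice with the standard code.
  rd : ∀ k i -> (+ lk glpa k * (1ℤ + (- + 4) * δ o₀ i) + twice (comb (lk wp k) standard) i)
   + (sum 24 (\ j -> lk (lk dp k) j * (+ 4 * (δ j i - δ o₀ i))) + lk eipa k * (+ 8 * δ o₀ i)) ≡ lk (row k) i
  rd = toWitness {a? = FP.all? \ k -> FP.all? \ i -> ((+ lk glpa k * (1ℤ + (- + 4) * δ o₀ i) + twice (comb (lk wp k) standard) i)
   + (sum 24 (\ j -> lk (lk dp k) j * (+ 4 * (δ j i - δ o₀ i))) + lk eipa k * (+ 8 * δ o₀ i))) ZP.≟ lk (row k) i} _

-- From an orthogonal frame to the automorphism.

module Symmetry where
 open import Defs using (Mat)
 open Z
 open Forms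
 open Walks
 open Leech
 open Determinants using (det)
 open Coordinates
 open Frames
 open Bits using (Word; 𝟘; _⊞_; _∙_; ¬¬de; ∙-comm)
 open Code
 open Octad using (GolayLike)
 open Golay using (comb; comin)
 open GolayUnique using (gu; standard)
 open Standard
 open StandardData
 open Rows
 open import Data.Nat as ℕ using (ℕ; zero; suc)
 open import Data.Integer as ℤ using (ℤ; +_; -[1+_]; 0ℤ; 1ℤ)
 open import Data.Fin using (Fin; zero; suc)
 open import Data.Vec using (Vec; lookup)
 open import Tactic.RingSolver using () renaming (solve-∀ to sv)
 Even Odd : ℤ -> Set
 Even a = Σ ℤ \ t -> a ≡ t + t
 Odd a = Σ ℤ \ t -> a ≡ t + t + 1ℤ
 opaque
  unfolding _+_ _*_ -_
  scev : ∀ κ t -> (1ℤ + (κ + κ)) * (t + t) ≡ (t + (κ + κ) * t) + (t + (κ + κ) * t)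
  scev = sv ring
  scod : ∀ κ t -> (1ℤ + (κ + κ)) * (t + t + 1ℤ) ≡ (t + (κ + κ) * t + κ) + (t + (κ + κ) * t + κ) + 1ℤ
  scod = sv ring
  ed : ∀ t s -> ((t + t) + + 2 * s) ≡ (t + s) + (t + s)
  ed = sv ring
  odddif : ∀ t s -> ((t + t + 1ℤ) + + 2 * s) ≡ (t + s) + (t + s) + 1ℤ
  odddif = sv ring
  plon : ∀ m -> ((m + m) + (m + m)) + 1ℤ ≡ 1ℤ + + 4 * m
  plon = sv ring
  mt : ∀ m -> (- 1ℤ) * ((m + m + 1ℤ) + (m + m + 1ℤ) + 1ℤ) ≡ 1ℤ + + 4 * (- m - 1ℤ)
  mt = sv ring
  evga : ∀ a b -> + 4 * ((a + a) - (b + b)) ≡ + 8 * (a - b)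
  evga = sv ring
  og : ∀ a b -> + 4 * ((a + a + 1ℤ) - (b + b + 1ℤ)) ≡ + 8 * (a - b)
  og = sv ring
  gapr : ∀ x y z -> (+ 4 * (x - y)) * z ≡ + 4 * (x * z) + (- + 4) * (y * z)
  gapr = sv ring
  gaco : ∀ a b -> + 4 * a + (- + 4) * b ≡ + 4 * (a - b)
  gaco = sv ring
  fe : ∀ t -> + 4 * (t + t) ≡ + 8 * t
  fe = sv ring
  plsi : 1ℤ + (0ℤ + 0ℤ) ≡ 1ℤ
  plsi = refl
  misi : 1ℤ + ((- 1ℤ) + (- 1ℤ)) ≡ - 1ℤ
  misi = refl
  misq : (- 1ℤ) * (- 1ℤ) ≡ 1ℤ
  misq = refl
  recover : ∀ a b -> (a + (- 1ℤ) * b) + b ≡ a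
  recover = sv ring
 module _ (L : Mat 24) (symmetric : ∀ i j -> L i j ≡ L j i)
  (positive : ∀ x -> x ≢ 𝟎 -> 0ℤ ℤ.< Lattice.⟨_,_⟩ L symmetric x x) (unimodular : det 24 L ≡ 1ℤ)
  (hn : Vec ℤ 24 -> ℕ) (hns : ∀ x -> Lattice.⟨_,_⟩ L symmetric x x ≡ + (2 ℕ.* hn x))
  (hnz : ∀ x -> hn x ≡ 0 -> x ≡ 𝟎) (nr : ∀ x -> hn x ≢ 1) where
  open Lattice L symmetric
  six : ∀ x -> + 8 * ⟨ x , x ⟩ ≡ + 16 * + hn x
  six x = tr (mc (hns x)) (tr (sy (pos-* 8 _)) (tr (cg +_ (sy (NP.*-assoc 8 2 (hn x)))) (pos-* 16 (hn x))))
  module Normalised (v : Fin 24 -> Vec ℤ 24) (norms : ∀ i j -> ⟨ v i , v j ⟩ ≡ + 8 * δ i j)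
   (unif : ∀ x -> (∀ i -> Even ⟨ x , v i ⟩) ⊎ (∀ i -> Odd ⟨ x , v i ⟩)) (x₁ : Vec ℤ 24) (ρ : Fin 24 -> ℤ) (odd : ∀ i -> ⟨ x₁ , v i ⟩ ≡ 1ℤ + + 4 * ρ i) where
   open FrameCoordinates L symmetric v norms
   open Represent positive unimodular
   M : Co -> Set
   M y = Σ (Vec ℤ 24) \ x -> ∀ i -> c x i ≡ y i
   pe : ∀ {y z x x′} -> (∀ i -> c x i ≡ y i) -> (∀ i -> c x′ i ≡ z i) -> dot₂ y z ≡ + 8 * ⟨ x , x′ ⟩
   pe {x = x} {x′} e e′ = tr (Sc \ i -> cg2 _*_ (sy (e i)) (sy (e′ i))) (sy (parseval x x′))
   construction : Construction M
   construction = record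
    { resp = \ { eq (x , e) -> x , \ i -> tr (e i) (eq i) }
    ; plus = \ { (x , e) (x′ , e′) -> x ⊕ x′ , \ i -> tr (⟨⊕ x x′ (v i)) (cg2 _+_ (e i) (e′ i)) }
    ; times = \ { k (x , e) -> k · x , \ i -> tr (⟨· k x (v i)) (mc (e i)) }
    ; norm = \ { {y} (x , e) -> hn x , tr (pe {x = x} {x} e e) (six x) , nr x ,
      \ z i -> tr (sy (e i)) (tr (cg (\ u -> c u i) (hnz x z)) (⟨𝟎 (v i))) }
    ; pairing = \ { (x , e) (x′ , e′) -> ⟨ x , x′ ⟩ , pe {x = x} {x′} e e′ }
    ; realised = \ y di -> rea y (\ x -> di (c x) (x , \ _ -> refl))
    ; differences = \ i -> rea _ (\ x -> gap i x (unif x))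
    ; eig = \ i -> v i , \ k -> norms i k
    ; combination = \ t w w∈ -> lin t (\ i -> p1 (w∈ i)) , \ k -> tr (⟨l t (\ i -> p1 (w∈ i)) (v k)) (Sc \ i -> mc (p2 (w∈ i) k))
    ; unif = \ { {y} (x , e) -> transport x {y} e (unif x) }
    ; r = ρ
    ; ov = x₁ , odd }
    where
    transport : ∀ x {y} -> (∀ i -> c x i ≡ y i) -> (∀ i -> Even (c x i)) ⊎ (∀ i -> Odd (c x i)) -> (∀ i -> Even (y i)) ⊎ (∀ i -> Odd (y i))
    transport x e (n1 ev) = n1 \ i -> p1 (ev i) , tr (sy (e i)) (p2 (ev i))
    transport x e (n2 od) = n2 \ i -> p1 (od i) , tr (sy (e i)) (p2 (od i))
    -- All coordinates of a lattice vector have the same parity, so four times a difference of two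
    -- of them is divisible by 8.
    gap : ∀ i x -> (∀ i -> Even (c x i)) ⊎ (∀ i -> Odd (c x i)) -> Σ ℤ \ q -> sum 24 (\ k -> (+ 4 * (δ i k - δ o₀ k)) * c x k) ≡ + 8 * q
    gap i x parity = p1 (quotient parity) , tr total (p2 (quotient parity))
     where
     total : sum 24 (\ k -> (+ 4 * (δ i k - δ o₀ k)) * c x k) ≡ + 4 * (c x i - c x o₀)
     total = tr (Sc \ k -> gapr (δ i k) (δ o₀ k) (c x k)) (tr (Σ-+ 24 _ _) (tr (cg2 _+_ (tr (Σ* 24 (+ 4) _) (mc (Σδ 24 i (c x)))) (tr (Σ* 24 (- + 4) _) (mc (Σδ 24 o₀ (c x))))) (gaco _ _)))
     quotient : (∀ i -> Even (c x i)) ⊎ (∀ i -> Odd (c x i)) -> Σ ℤ \ q -> + 4 * (c x i - c x o₀) ≡ + 8 * q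
     quotient (n1 ev) = _ , tr (cg2 (\ a b -> + 4 * (a - b)) (p2 (ev i)) (p2 (ev o₀))) (evga (p1 (ev i)) (p1 (ev o₀)))
     quotient (n2 od) = _ , tr (cg2 (\ a b -> + 4 * (a - b)) (p2 (od i)) (p2 (od o₀))) (og (p1 (od i)) (p1 (od o₀)))
   gl : (∀ d -> Dec (C construction d)) -> GolayLike (C construction)
   gl decide = record { decide = decide ; zi = Cz construction ; oi = Con construction ; plin = \ {u} {v} -> Cp construction {u} {v}
    ; sedu = Csd construction ; weights = \ {u} -> Cw construction {u} }
   aufr : (∀ k -> C construction (standard k)) -> Automorphism ⟨_,_⟩
   aufr standard∈ = FromBasis.aut L symmetric v norms (\ k -> p1 (row∈ k)) (\ k -> p2 (row∈ k))
    where
    open Construction construction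
    row∈ : ∀ k -> M (lk (row k))
    row∈ k = resp (rd k) (plus (plus (times (+ lk glpa k) (glue construction)) (comin {C construction} (Cz construction) (\ {u} {v} -> Cp construction {u} {v}) (lk wp k) standard standard∈))
     (plus (combination (lk (lk dp k)) (\ i m -> + 4 * (δ i m - δ o₀ m)) differences) (times (lk eipa k) (eig o₀))))
  module Permuted (v : Fin 24 -> Vec ℤ 24) (norms : ∀ i j -> ⟨ v i , v j ⟩ ≡ + 8 * δ i j)
   (unif : ∀ x -> (∀ i -> Even ⟨ x , v i ⟩) ⊎ (∀ i -> Odd ⟨ x , v i ⟩)) (x₁ : Vec ℤ 24) (ρ : Fin 24 -> ℤ) (odd : ∀ i -> ⟨ x₁ , v i ⟩ ≡ 1ℤ + + 4 * ρ i) where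
   open FrameCoordinates L symmetric v norms
   module N = Normalised v norms unif x₁ ρ odd
   symmetry : (∀ d -> Dec (C N.construction d)) -> Automorphism ⟨_,_⟩
   symmetry decide = frpe (gu (N.gl decide))
    where
    frpe : (Σ (Fin 24 -> Fin 24) \ π -> (∀ {i j} -> π i ≡ π j -> i ≡ j) × (∀ k -> ∃ \ d -> C N.construction d × (∀ i -> lk d (π i) ≡ lk (standard k) i))) -> Automorphism ⟨_,_⟩
    frpe (π , π-injective , member) = P.aufr \ k -> p1 (p1 (p2 (member k))) ,
      \ i -> tr (p2 (p1 (p2 (member k))) (π i)) (cg (\ b -> + 2 * bit b) (p2 (p2 (member k)) i))
     where
     δπ : ∀ i j -> δ (π i) (π j) ≡ δ i j
     δπ i j with i FP.≟ j
     ... | yes refl = tr (δr (π i)) (sy (δr i))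
     ... | no ne = tr (δ≢ (π i) (π j) (\ e -> ne (π-injective e))) (sy (δ≢ i j ne))
     uniform′ : ∀ x -> (∀ i -> Even ⟨ x , v (π i) ⟩) ⊎ (∀ i -> Odd ⟨ x , v (π i) ⟩)
     uniform′ x with unif x
     ... | n1 ev = n1 \ i -> ev (π i)
     ... | n2 od = n2 \ i -> od (π i)
     module P = Normalised (\ i -> v (π i)) (\ i j -> tr (norms (π i) (π j)) (mc (δπ i j))) uniform′ x₁ (\ i -> ρ (π i)) (\ i -> odd (π i))
  module Signed (F : OrthogonalFrame L symmetric hn hns hnz nr 24) where
   open OrthogonalFrame F
   norms₀ : ∀ i j -> ⟨ vector i , vector j ⟩ ≡ + 8 * δ i j
   norms₀ i j with i FP.≟ j
   ... | yes refl = tr (hns (vector i)) (tr (cg (\ h -> + (2 ℕ.* h)) (norm i)) (sy (tr (mc (δr i)) (*-identityʳ _))))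
   ... | no ne = tr (ort i j ne) (sy (tr (mc (δ≢ i j ne)) (*-zeroʳ _)))
   open FrameCoordinates L symmetric vector norms₀ using () renaming (c to c₀; ⟨l to ⟨⟩-lin₀; parseval to parseval₀; module Represent to Represent₀)
   -- Frame vectors are congruent modulo 2L, so their difference is twice a lattice vector.
   cc : ∀ x i -> Σ ℤ \ s -> c₀ x i ≡ c₀ x o₀ + + 2 * s
   cc x i with hadi (vector i) (vector o₀) (congruent i o₀)
   ... | p , e = ⟨ x , p ⟩ , tr (sy (recover (c₀ x i) (c₀ x o₀))) (tr (+-comm _ _) (ac (tr (sy (tr (⟨⟩⊕ʳ x (vector i) _) (ac (tr (cg (\ z -> ⟨ x , z ⟩) (neg≡ (vector o₀))) (⟨⟩·ʳ (- 1ℤ) x (vector o₀))))))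
     (tr (cg (\ z -> ⟨ x , z ⟩) e) (tr (⟨⟩⊕ʳ x p p) (tw ⟨ x , p ⟩))))))
    where
    opaque
     unfolding _+_ _*_ -_
     tw : ∀ a -> a + a ≡ + 2 * a
     tw = sv ring
   uniform₀ : ∀ x -> (∀ i -> Even (c₀ x i)) ⊎ (∀ i -> Odd (c₀ x i))
   uniform₀ x with paha (c₀ x o₀)
   ... | t , n1 (_ , e) = n1 \ i -> _ , tr (p2 (cc x i)) (tr (cg (\ z -> z + + 2 * p1 (cc x i)) e) (ed t (p1 (cc x i))))
   ... | t , n2 (_ , e) = n2 \ i -> _ , tr (p2 (cc x i)) (tr (cg (\ z -> z + + 2 * p1 (cc x i)) e) (odddif t (p1 (cc x i))))
   even? : ∀ a -> Dec (Even a)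
   even? a with paha a
   ... | t , n1 (_ , e) = yes (t , e)
   ... | t , n2 (_ , e) = no \ { (s , e′) -> cla s t (tr (sy e′) e) }
    where
    opaque
     unfolding _+_ _*_ -_
     cla : ∀ s t -> s + s ≢ t + t + 1ℤ
     cla s t e = onod (s - t) (tr (reg s t) (tr (cg (\ z -> z - (t + t)) e) (cancel (t + t))))
      where
      reg : ∀ s t -> (s - t) + (s - t) ≡ (s + s) - (t + t)
      reg = sv ring
      cancel : ∀ a -> (a + 1ℤ) - a ≡ 1ℤ
      cancel = sv ring
      onod : ∀ a -> a + a ≢ 1ℤ
      onod (+ zero) ()
      onod (+ suc n) e with tr (sy (cg (\ m -> + suc m) (NP.+-suc n n))) e
      ... | ()
      onod -[1+ n ] ()
   -- Were all coordinates even, 4 e_0 would pair integrally with everything and hence lie in the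
   -- lattice, with norm 2. It is enough to test the 24 basis vectors at one place.
   odex : Σ (Vec ℤ 24) \ x -> ∀ i -> Odd (c₀ x i)
   odex = bc (FP.all? (\ j -> even? (c₀ (unitᶻ j) o₀)))
    where
    odat : ∀ x -> ¬ Even (c₀ x o₀) -> (∀ i -> Even (c₀ x i)) ⊎ (∀ i -> Odd (c₀ x i)) -> Σ (Vec ℤ 24) \ x -> ∀ i -> Odd (c₀ x i)
    odat x not-even (n1 ev) = cx (ev o₀) not-even
    odat x not-even (n2 od) = x , od
    bc : Dec (∀ j -> Even (c₀ (unitᶻ j) o₀)) -> Σ (Vec ℤ 24) \ x -> ∀ i -> Odd (c₀ x i)
    bc (no some) = odat (unitᶻ j) not-even (uniform₀ (unitᶻ j))
     where
     exception = FP.¬∀⟶∃¬ 24 (\ j -> Even (c₀ (unitᶻ j) o₀)) (\ j -> even? (c₀ (unitᶻ j) o₀)) some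
     j = p1 exception
     not-even = p2 exception
    bc (yes all-even) = cx hio (nr z)
     where
     open Represent₀ positive unimodular
     even₀ : ∀ x -> Even (c₀ x o₀)
     even₀ x = _ , tr (cg (\ u -> c₀ u o₀) (sy (coun x))) (tr (⟨⟩-lin₀ (lk x) unitᶻ (vector o₀)) (tr (Sc \ j -> tr (mc (p2 (all-even j))) (*-distribˡ-+ (lk x j) _ _)) (Σ-+ 24 _ _)))
     found = rea (\ i -> + 4 * δ o₀ i) (\ x -> _ , tr (Sc \ i -> *-assoc (+ 4) (δ o₀ i) (c₀ x i)) (tr (Σ* 24 (+ 4) _) (tr (mc (tr (Σδ 24 o₀ (c₀ x)) (p2 (even₀ x)))) (fe (p1 (even₀ x))))))
     z = p1 found
     hio : hn z ≡ 1
     hio = ZP.+-injective (*-cancelˡ-≡ (+ 16) (\ ()) (tr (sy (six z)) (tr (parseval₀ z z) (tr (Sc \ i -> cg2 _*_ (p2 found i) (p2 found i)) (tr (Sc \ i -> *-assoc (+ 4) (δ o₀ i) (+ 4 * δ o₀ i)) (tr (Σ* 24 (+ 4) _) (tr (mc (Σδ 24 o₀ (\ i -> + 4 * δ o₀ i))) si)))))))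
      where
      opaque
       unfolding _*_
       si : + 4 * (+ 4 * δ o₀ o₀) ≡ + 16 * + 1
       si = refl
   x₁ : Vec ℤ 24
   x₁ = p1 odex
   -- The sign is written as 1 + 2κ, which makes plain that it preserves parity; it brings an odd
   -- coordinate to 1 modulo 4.
   record Sign (a : ℤ) : Set where
    field
     κ ρ : ℤ
     unsq : (1ℤ + (κ + κ)) * (1ℤ + (κ + κ)) ≡ 1ℤ
     normal : (1ℤ + (κ + κ)) * a ≡ 1ℤ + + 4 * ρ
   chsi : ∀ a -> Odd a -> Sign a
   chsi a (t , e) with paha t
   ... | m , n1 (_ , e′) = record { κ = 0ℤ ; ρ = m ; unsq = tr (cg (\ z -> z * z) plsi) (*-identityˡ _)
    ; normal = tr (cg2 _*_ plsi (tr e (cg (\ z -> z + z + 1ℤ) e′))) (tr (*-identityˡ _) (plon m)) }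
   ... | m , n2 (_ , e′) = record { κ = - 1ℤ ; ρ = - m - 1ℤ ; unsq = tr (cg (\ z -> z * z) misi) misq
    ; normal = tr (cg2 _*_ misi (tr e (cg (\ z -> z + z + 1ℤ) e′))) (mt m) }
   signs : ∀ i -> Sign (c₀ x₁ i)
   signs i = chsi (c₀ x₁ i) (p2 odex i)
   κ : Fin 24 -> ℤ
   κ i = Sign.κ (signs i)
   v : Fin 24 -> Vec ℤ 24
   v i = (1ℤ + (κ i + κ i)) · vector i
   norms : ∀ i j -> ⟨ v i , v j ⟩ ≡ + 8 * δ i j
   norms i j = tr (⟨· _ (vector i) (v j)) (tr (mc (tr (⟨⟩·ʳ _ (vector i) (vector j)) (mc (norms₀ i j)))) (casi (i FP.≟ j)))
    where
    opaque
     unfolding _+_ _*_ -_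
     reg : ∀ a b d -> a * (b * (+ 8 * d)) ≡ + 8 * ((a * b) * d)
     reg = sv ring
    casi : Dec (i ≡ j) -> (1ℤ + (κ i + κ i)) * ((1ℤ + (κ j + κ j)) * (+ 8 * δ i j)) ≡ + 8 * δ i j
    casi (yes refl) = tr (reg _ _ (δ i i)) (mc (tr (mr (Sign.unsq (signs i))) (*-identityˡ _)))
    casi (no ne) = tr (reg _ _ (δ i j)) (mc (tr (mc (δ≢ i j ne)) (tr (*-zeroʳ _) (sy (δ≢ i j ne)))))
   signed : ∀ x i -> ⟨ x , v i ⟩ ≡ (1ℤ + (κ i + κ i)) * c₀ x i
   signed x i = ⟨⟩·ʳ _ x (vector i)
   unif : ∀ x -> (∀ i -> Even ⟨ x , v i ⟩) ⊎ (∀ i -> Odd ⟨ x , v i ⟩)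
   unif x with uniform₀ x
   ... | n1 ev = n1 \ i -> _ , tr (signed x i) (tr (mc (p2 (ev i))) (scev (κ i) (p1 (ev i))))
   ... | n2 od = n2 \ i -> _ , tr (signed x i) (tr (mc (p2 (od i))) (scod (κ i) (p1 (od i))))
   module P = Permuted v norms unif x₁ (\ i -> Sign.ρ (signs i)) (\ i -> tr (signed x₁ i) (Sign.normal (signs i)))
   ¬¬s : ¬ ¬ Automorphism ⟨_,_⟩
   ¬¬s k = ¬¬de 24 (C P.N.construction) (\ decide -> k (P.symmetry decide))

-- Counting representations and dividing by 13.

module FourierCoefficients where
 open import Defs hiding (det)
 import Defs
 open Z hiding (_+_; _*_; -_; _-_)
 open Forms
 open Walks hiding (box)
 open Leech
 open Determinants using (det; dede)
 open Kernel using (_≟ᵥ_)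
 open ShortVectors using (module Scaled)
 open Scales
 open Frames hiding (remove)
 open Certificate using (wo)
 open Orbits using (iterate; 13∣length)
 open Standard using (Automorphism)
 open Symmetry using (module Signed)
 open import Data.Nat as ℕ using (ℕ; zero; suc; z≤n)
 open import Data.Nat.Divisibility using (_∣_; _∣?_)
 open import Data.Integer as ℤ using (ℤ; +_; -[1+_]; 0ℤ; 1ℤ; ∣_∣)
 open import Data.Fin using (Fin; zero; suc)
 open import Data.List using (List; []; _∷_; length; filter; cartesianProduct; cartesianProductWith)
 open import Data.List.Membership.Propositional using (_∈_)
 open import Data.List.Membership.Propositional.Properties using (∈-filter⁺; ∈-filter⁻; ∈-cartesianProduct⁺; ∈-cartesianProductWith⁺)
 open import Data.List.Relation.Unary.Any using (here; there)
 open import Data.List.Relation.Unary.All as Allₗ using ([]; _∷_)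
 open import Data.List.Relation.Unary.AllPairs using ([]; _∷_)
 open import Data.List.Relation.Unary.Unique.Propositional using (Unique)
 open import Data.Vec as Vec using (Vec; lookup)
 open import Data.Vec.Relation.Unary.All as All using (All)
 open import Data.Product.Properties using (≡-dec)
 private variable n : ℕ
 integers : ℕ -> List ℤ
 integers zero = 0ℤ ∷ []
 integers (suc k) = + suc k ∷ -[1+ k ] ∷ integers k
 ib : ∀ k -> Allₗ.All (\ z -> ∣ z ∣ ℕ.≤ k) (integers k)
 ib zero = z≤n ∷ []
 ib (suc k) = NP.≤-refl ∷ NP.≤-refl ∷ Allₗ.map NP.m≤n⇒m≤1+n (ib k)
 iu : ∀ k -> Unique (integers k)
 iu zero = [] ∷ []
 iu (suc k) = ((\ ()) ∷ fresh (+ suc k) NP.≤-refl) ∷ fresh -[1+ k ] NP.≤-refl ∷ iu k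
  where
  fresh : ∀ a -> suc k ℕ.≤ ∣ a ∣ -> Allₗ.All (a ≢_) (integers k)
  fresh a big = Allₗ.map (\ small e -> NP.<⇒≱ (NP.≤-trans big (NP.≤-reflexive (cg ∣_∣ e))) small) (ib k)
 inco : ∀ k z -> ∣ z ∣ ℕ.≤ k -> z ∈ integers k
 inco zero (+ zero) _ = here refl
 inco (suc k) (+ m) le with m ℕ.≟ suc k
 ... | yes refl = here refl
 ... | no ne = there (there (inco k (+ m) (NP.≤-pred (NP.≤∧≢⇒< le ne))))
 inco (suc k) -[1+ m ] le with m ℕ.≟ k
 ... | yes refl = there (here refl)
 ... | no ne = there (there (inco k -[1+ m ] (NP.≤∧≢⇒< (NP.≤-pred le) ne)))
 box : ∀ n -> (Fin n -> ℕ) -> List (Vec ℤ n)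
 box zero k = Vec.[] ∷ []
 box (suc n) k = cartesianProductWith Vec._∷_ (integers (k zero)) (box n (\ i -> k (suc i)))
 boun : ∀ n k -> Unique (box n k)
 boun zero k = [] ∷ []
 boun (suc n) k = UP.cartesianProductWith⁺ Vec._∷_ VP.∷-injective (iu (k zero)) (boun n (\ i -> k (suc i)))
 boxcom : ∀ n k x -> (∀ i -> ∣ lk x i ∣ ℕ.≤ k i) -> x ∈ box n k
 boxcom zero k Vec.[] le = here refl
 boxcom (suc n) k (z Vec.∷ x) le = ∈-cartesianProductWith⁺ Vec._∷_ (inco (k zero) z (le zero)) (boxcom n (\ i -> k (suc i)) x (\ i -> le (suc i)))
 largest : Vec ℤ n -> ℕ
 largest Vec.[] = 0
 largest (a Vec.∷ u) = ∣ a ∣ ℕ.⊔ largest u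
 larbou : ∀ (u : Vec ℤ n) V -> largest u ℕ.≤ V -> All (\ y -> ∣ y ∣ ℕ.≤ V) u
 larbou Vec.[] V _ = All.[]
 larbou (a Vec.∷ u) V le = NP.≤-trans (NP.m≤m⊔n ∣ a ∣ (largest u)) le All.∷ larbou u V (NP.≤-trans (NP.m≤n⊔m ∣ a ∣ (largest u)) le)
 boal : ∀ {A : Set} (f : A -> Vec ℤ n) (xs : List A) -> ∃ \ V -> ∀ {x} -> x ∈ xs -> largest (f x) ℕ.≤ V
 boal f [] = 0 , \ ()
 boal f (x ∷ xs) with boal f xs
 ... | V , le = largest (f x) ℕ.⊔ V , \ { (here refl) -> NP.m≤m⊔n _ V ; (there x∈) -> NP.≤-trans (le x∈) (NP.m≤n⊔m (largest (f x)) V) }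
 module _ (L : Mat 24) (leech : IsLeechGram L) where
  symmetric : ∀ i j -> L i j ≡ L j i
  symmetric = p1 leech
  open Lattice L symmetric
  bil≡ : ∀ x y -> bil L x y ≡ ⟨ x , y ⟩
  bil≡ x y = tr (bide L x y) (sy (⟨⟩de x y))
  positive : ∀ x -> x ≢ 𝟎 -> 0ℤ ℤ.< ⟨ x , x ⟩
  positive x x≢0 = sb (0ℤ ℤ.<_) (bil≡ x x) (p1 (p2 (p2 leech)) x x≢0)
  unimodular : det 24 L ≡ 1ℤ
  unimodular = tr (sy (dede 24 L)) (p1 (p2 (p2 (p2 leech))))
  open Definite positive
  open Unimodular unimodular
  evdi : ∀ i -> Σ ℤ \ m -> L i i ≡ m Z.+ m
  evdi i with Signedᵈ.∣ᵤ⇒∣ (p1 (p2 leech) i)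
  ... | Signedᵈ.divides q e = q , tr e (tr (Z.*d q (+ 2)) (tw q))
   where
   opaque
    unfolding Z._+_ Z._*_ Z.-_
    tw : ∀ q -> q Z.* + 2 ≡ q Z.+ q
    tw q = tr (ZP.*-comm q (+ 2)) (tr (ZP.suc-* (+ 1) q) (cg (\ z -> q ℤ.+ z) (ZP.*-identityˡ q)))
  half : ∀ x -> Σ ℤ \ h -> ⟨ x , x ⟩ ≡ h Z.+ h
  half x = p1 fh , tr (⟨⟩de x x) (p2 fh)
   where
   fh : Σ ℤ \ h -> form L (lk x) (lk x) ≡ h Z.+ h
   fh = evfo 24 L symmetric evdi (lk x)
  opaque
   hn : Vec ℤ 24 -> ℕ
   hn x = ∣ p1 (half x) ∣
   hns : ∀ x -> ⟨ x , x ⟩ ≡ + (2 ℕ.* hn x)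
   hns x = from (half x) (nonNeg x)
    where
    opaque
     unfolding Z._+_
     from : (p : Σ ℤ \ h -> ⟨ x , x ⟩ ≡ h Z.+ h) -> 0ℤ ℤ.≤ ⟨ x , x ⟩ -> ⟨ x , x ⟩ ≡ + (2 ℕ.* ∣ p1 p ∣)
     from (+ m , e) _ = tr e (cg (\ k -> + (m ℕ.+ k)) (sy (NP.+-identityʳ m)))
     from (-[1+ m ] , e) nn = cx (sb (0ℤ ℤ.≤_) e nn) \ ()
  hnz : ∀ x -> hn x ≡ 0 -> x ≡ 𝟎
  hnz x e = null x (tr (hns x) (cg (\ h -> + (2 ℕ.* h)) e))
  nr : ∀ x -> hn x ≢ 1
  nr x e = p2 (p2 (p2 (p2 leech))) x (tr (bil≡ x x) (tr (hns x) (cg (\ h -> + (2 ℕ.* h)) e)))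
  bounds : ℕ -> Fin 24 -> ℕ
  bounds B i = B ℕ.* (2 ℕ.* hn (coo i))
  opaque
   ball : ℕ -> List (Vec ℤ 24)
   ball B = box 24 (bounds B)
   -- Each coordinate is at most its own square, which `enbo` bounds by the norm times that of the
   -- dual basis vector.
   baco : ∀ B x -> 2 ℕ.* hn x ℕ.≤ B -> x ∈ ball B
   baco B x le = boxcom 24 (bounds B) x \ i -> NP.≤-trans (sqbo ∣ lk x i ∣) (NP.≤-trans (ZP.drop‿+≤+ (sb2 ℤ._≤_ (square (lk x i))
     (tr (cg2 Z._*_ (hns x) (hns (coo i))) (sy (pos-* (2 ℕ.* hn x) (2 ℕ.* hn (coo i))))) (enbo i x)))
     (NP.*-monoˡ-≤ (2 ℕ.* hn (coo i)) le))
    where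
    sqbo : ∀ a -> a ℕ.≤ a ℕ.* a
    sqbo zero = z≤n
    sqbo (suc a) = NP.m≤m+n (suc a) _
    square : ∀ a -> a Z.* a ≡ + (∣ a ∣ ℕ.* ∣ a ∣)
    square a = tr (sy (Z.*d a a)) (sq a)
     where
     sq : ∀ a -> a ℤ.* a ≡ + (∣ a ∣ ℕ.* ∣ a ∣)
     sq (+ m) = sy (ZP.pos-* m m)
     sq -[1+ m ] = refl
   baun : ∀ B -> Unique (ball B)
   baun B = boun 24 (bounds B)
  sho : ∀ x -> Dec (1 ℕ.≤ hn x × hn x ℕ.≤ 4)
  sho x = (1 ℕ.≤? hn x) ×-dec (hn x ℕ.≤? 4)
  opaque
   short : List (Vec ℤ 24)
   short = filter sho (ball 8)
   shun : Unique short
   shun = UP.filter⁺ sho (baun 8)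
   shco : ∀ x -> 1 ℕ.≤ hn x -> hn x ℕ.≤ 4 -> x ∈ short
   shco x lo hi = ∈-filter⁺ sho (baco 8 x (NP.*-monoʳ-≤ 2 hi)) (lo , hi)
   shno : ∀ {x} -> x ∈ short -> hn x ℕ.≤ 4
   shno {x} x∈ = p2 (p2 (∈-filter⁻ sho {xs = ball 8} x∈))
   -- Supplies `λ₀`: 16 is the largest half norm at which the lower kernel estimate is applied.
   bob : (f : Vec ℤ 24 -> Vec ℤ 24) -> ∃ \ V -> ∀ x -> hn x ℕ.≤ 16 -> All (\ y -> ∣ y ∣ ℕ.≤ V) (f x)
   bob f with boal f (ball 32)
   ... | V , le = V , \ x h≤ -> larbou (f x) V (le (baco 32 x (NP.*-monoʳ-≤ 2 h≤)))
  msv : Completion L -> 46 ℕ.* 2 ℕ.^ 24 ℕ.< su short (\ x -> wo (hn x))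
  msv completed with bob (lattice 1ℤ (Completion.chain completed))
  ... | λ₀ , bounded = atsc (sca (Completion.chain completed) λ₀)
   where
   atsc : Scale (Completion.chain completed) λ₀ -> 46 ℕ.* 2 ℕ.^ 24 ℕ.< su short (\ x -> wo (hn x))
   atsc record { Q = Q ; T = T ; N₀ = N₀ ; q = q ; a = a ; vast≤Q = vast≤Q ; vast≤T = vast≤T ; N² = N² ; a≡ = a≡ ; Vs = Vs ; Q≢ = Q≢ ; T≢ = T≢ ; q≢ = q≢ ; a≢ = a≢ ; m∣ = m∣ ; eb = eb ; e₀bo = e₀bo } =
    Scaled.mansho L completed unimodular hn (\ x -> tr (sy (⟨⟩de x x)) (hns x)) nr hnz short shco λ₀ bounded
     Q T N₀ q a vast≤Q vast≤T N² a≡ Vs {{Q≢}} {{T≢}} {{q≢}} {{a≢}} m∣ eb e₀bo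
  symmetry : ¬ ¬ Automorphism ⟨_,_⟩
  symmetry = Signed.¬¬s L symmetric positive unimodular hn hns hnz nr
   (fra L symmetric hn hns hnz nr short shun shno (msv (com 24 L symmetric (\ x x≢0 -> sb (0ℤ ℤ.<_) (⟨⟩de x x) (positive x x≢0)))))
  Pair : Set
  Pair = Vec ℤ 24 × Vec ℤ 24
  rep : ∀ T X -> Dec (Represents L T X)
  rep T (x , y) = (bil L x x ZP.≟ + 2 ℤ.* t11 T) ×-dec ((bil L y y ZP.≟ + 2 ℤ.* t22 T) ×-dec (bil L x y ZP.≟ b T))
  representations : Sym2* -> List Pair
  representations T = filter (rep T) (cartesianProduct (ball ∣ + 2 ℤ.* t11 T ∣) (ball ∣ + 2 ℤ.* t22 T ∣))
  nobo : ∀ x a -> bil L x x ≡ a -> 2 ℕ.* hn x ℕ.≤ ∣ a ∣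
  nobo x a e = NP.≤-reflexive (cg ∣_∣ (tr (sy (hns x)) (tr (sy (bil≡ x x)) e)))
  repspe : ∀ T X -> (X ∈ representations T -> Represents L T X) × (Represents L T X -> X ∈ representations T)
  repspe T X@(x , y) = (\ X∈ -> p2 (∈-filter⁻ (rep T) {xs = cartesianProduct (ball ∣ + 2 ℤ.* t11 T ∣) (ball ∣ + 2 ℤ.* t22 T ∣)} X∈)) ,
   \ R -> ∈-filter⁺ (rep T) (∈-cartesianProduct⁺ (baco ∣ + 2 ℤ.* t11 T ∣ x (nobo x _ (p1 R))) (baco ∣ + 2 ℤ.* t22 T ∣ y (nobo y _ (p1 (p2 R))))) R
  reun : ∀ T -> Unique (representations T)
  reun T = UP.filter⁺ (rep T) (UP.cartesianProduct⁺ (baun ∣ + 2 ℤ.* t11 T ∣) (baun ∣ + 2 ℤ.* t22 T ∣))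
  coefficient : ∀ T -> FourierCoeff L T (length (representations T))
  coefficient T = representations T , reun T , repspe T , refl
  b𝟎 : ∀ y -> bil L 𝟎 y ≡ 0ℤ
  b𝟎 y = tr (bil≡ 𝟎 y) (⟨𝟎 y)
  cote : FourierCoeff L zeroSym 1
  cote = (𝟎 , 𝟎) ∷ [] , ([] ∷ []) , (\ X -> (\ { (here refl) -> b𝟎 𝟎 , b𝟎 𝟎 , b𝟎 𝟎 }) ,
    \ R -> here (cg2 _,_ (null (p1 X) (tr (sy (bil≡ (p1 X) (p1 X))) (p1 R))) (null (p2 X) (tr (sy (bil≡ (p2 X) (p2 X))) (p1 (p2 R)))))) , refl
  rbz : ∀ T -> Represents L T (𝟎 , 𝟎) -> T ≡ zeroSym
  rbz (sym2 t u s) (e , e′ , e″) = cong₃ sym2 (halv t (tr (sy e) (b𝟎 𝟎))) (halv u (tr (sy e′) (b𝟎 𝟎))) (tr (sy e″) (b𝟎 𝟎))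
   where
   cong₃ : ∀ (f : ℤ -> ℤ -> ℤ -> Sym2*) {a a′ b b′ c c′} -> a ≡ a′ -> b ≡ b′ -> c ≡ c′ -> f a b c ≡ f a′ b′ c′
   cong₃ f refl refl refl = refl
   halv : ∀ a -> + 2 ℤ.* a ≡ 0ℤ -> a ≡ 0ℤ
   halv a e = ZP.*-cancelˡ-≡ (+ 2) a 0ℤ e
  -- Divisibility is decidable, so the automorphism may be used although it is known only under a
  -- double negation. It acts on both columns at once; a fixed pair would be zero, forcing `T` to be
  -- zero.
  di : ∀ T -> T ≢ zeroSym -> 13 ∣ length (representations T)
  di T T≢ = decidable-stable (13 ∣? length (representations T)) \ ¬divides -> symmetry \ S -> ¬divides (orco S)
   where
   orco : Automorphism ⟨_,_⟩ -> 13 ∣ length (representations T)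
   orco S = 13∣length (≡-dec _≟ᵥ_ _≟ᵥ_) act acpe (length (representations T)) (representations T) NP.≤-refl (reun T) closed mov
    where
    module S = Automorphism S
    act : Pair -> Pair
    act (x , y) = S.map x , S.map y
    ia : ∀ k x y -> iterate act k (x , y) ≡ (iterate S.map k x , iterate S.map k y)
    ia zero x y = refl
    ia (suc k) x y = cg act (ia k x y)
    acpe : ∀ X -> iterate act 13 X ≡ X
    acpe (x , y) = tr (ia 13 x y) (cg2 _,_ (S.peri x) (S.peri y))
    iso : ∀ x y -> bil L (S.map x) (S.map y) ≡ bil L x y
    iso x y = tr (bil≡ (S.map x) (S.map y)) (tr (S.iso x y) (sy (bil≡ x y)))
    closed : ∀ {X} -> X ∈ representations T -> act X ∈ representations T
    closed {x , y} X∈ = p2 (repspe T (S.map x , S.map y)) (transport (p1 (repspe T (x , y)) X∈))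
     where
     transport : Represents L T (x , y) -> Represents L T (S.map x , S.map y)
     transport (e , e′ , e″) = tr (iso x x) e , tr (iso y y) e′ , tr (iso x y) e″
    mov : ∀ {X} -> X ∈ representations T -> act X ≢ X
    mov {x , y} X∈ e = T≢ (rbz T (sb (Represents L T) (cg2 _,_ (S.fixed x (cg p1 e)) (S.fixed y (cg p2 e))) (p1 (repspe T (x , y)) X∈)))
 congruence : (L : Mat 24) -> IsLeechGram L ->
  FourierCoeff L zeroSym 1 ×
  (∀ (T : Sym2*) -> PSD T -> T ≢ zeroSym ->
   Σ ℕ (\ n -> FourierCoeff L T n × 13 ∣ n))
 congruence L leech = cote L leech , \ T _ T≢ -> length (representations L leech T) , coefficient L leech T , di L leech T T≢

open import Defs
open import Data.Nat using (ℕ)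
open import Data.Nat.Divisibility using (_∣_)
open import Data.Product using (Σ; _×_)
open import Relation.Binary.PropositionalEquality using (_≢_)

theorem3p4 : (L : Mat 24) → IsLeechGram L →
    FourierCoeff L zeroSym 1 ×
    (∀ (T : Sym2*) → PSD T → T ≢ zeroSym →
      Σ ℕ (λ n → FourierCoeff L T n × 13 ∣ n))
theorem3p4 = FourierCoefficients.congruence
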